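{- Let $D>1$ be squarefree and $F=\mathbb{Q}(\sqrt D)$. If there exists a universal ternary quadratic $\mathcal{O}_F$-lattice, then $D\in\{2,3,5,6,7,10,13,17,21,33,41,65,77\}$. Furthermore, for $D=10$ and $D=65$ there exists no free universal ternary quadratic $\mathcal{O}_F$-lattice.
   Context: $\mathcal{O}_F^+$ is the set of totally positive elements of $\mathcal{O}_F$. A quadratic $\mathcal{O}_F$-lattice is a finitely generated $\mathcal{O}_F$-submodule $L$ of a quadratic space $(V,Q)$ over $F$ with $Q(L)\subseteq\mathcal{O}_F$ (not necessarily classical); ternary means $\dim_F FL=3$; free means free as an $\mathcal{O}_F$-module. $L$ is universal if $Q(v)\in\mathcal{O}_F^+$ for all nonzero $v\in L$ and $Q(L\setminus\{0\})=\mathcal{O}_F^+$. -}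

module Defs where

open import Data.Nat as ℕ using (ℕ; zero; suc)
open import Data.Nat.DivMod using (_%_)
open import Data.Nat.Divisibility using (_∣_)
open import Data.Nat.Primality using (Prime)
open import Data.Integer as ℤ using (ℤ)
open import Data.Rational as ℚ using (ℚ; 0ℚ; ½; _<_; _≤_)
open import Data.Fin using (Fin; zero; suc)
open import Data.Bool using (if_then_else_)
open import Data.Product using (Σ; _×_; ∃; ∃-syntax)
open import Data.Sum using (_⊎_)
open import Relation.Nullary using (¬_)
open import Relation.Binary.PropositionalEquality using (_≡_)

Squarefree : ℕ → Set
Squarefree D = ∀ p → Prime p → ¬ (p ℕ.* p ∣ D)

record F : Set where
  constructor _+√_
  field
    re : ℚ
    im : ℚ
open F public

module Field (D : ℕ) where

  Dℚ : ℚ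
  Dℚ = (ℤ.+ D) ℚ./ 1

  0F : F
  0F = 0ℚ +√ 0ℚ

  _+F_ : F → F → F
  (a +√ b) +F (c +√ d) = (a ℚ.+ c) +√ (b ℚ.+ d)

  _*F_ : F → F → F
  (a +√ b) *F (c +√ d) = (a ℚ.* c ℚ.+ Dℚ ℚ.* (b ℚ.* d)) +√ (a ℚ.* d ℚ.+ b ℚ.* c)

  conj : F → F
  conj (a +√ b) = a +√ (ℚ.- b)

  -- a + b√D > 0 under the real embedding sending √D to the positive root of D
  Pos : F → Set
  Pos (a +√ b) =
      (0ℚ < a × 0ℚ ≤ b)
    ⊎ (0ℚ ≤ a × 0ℚ < b)
    ⊎ (0ℚ ≤ a × b < 0ℚ × Dℚ ℚ.* (b ℚ.* b) < a ℚ.* a)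
    ⊎ (a < 0ℚ × 0ℚ < b × a ℚ.* a < Dℚ ℚ.* (b ℚ.* b))

  TotPos : F → Set
  TotPos x = Pos x × Pos (conj x)

  -- the standard generator ω of O_F = ℤ[ω]
  ω : F
  ω = if D % 4 ℕ.≡ᵇ 1 then (½ +√ ½) else (0ℚ +√ ℚ.1ℚ)

  ofO : ℤ × ℤ → F
  ofO (m Data.Product., n) = ((m ℚ./ 1) +√ 0ℚ) +F (((n ℚ./ 1) +√ 0ℚ) *F ω)

  InO : F → Set
  InO x = ∃[ c ] ofO c ≡ x

  sumF : ∀ {n} → (Fin n → F) → F
  sumF {zero} f = 0F
  sumF {suc n} f = f zero +F sumF (λ i → f (suc i))

  V : Set
  V = Fin 3 → F

  _≈V_ : V → V → Set
  v ≈V w = ∀ i → v i ≡ w i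

  QForm : Set
  QForm = Fin 3 → Fin 3 → F

  evalQ : QForm → V → F
  evalQ a x = sumF (λ i → sumF (λ j → (a i j *F x i) *F x j))

  det3 : V → V → V → F
  det3 u v w =
    let m = λ x y → x *F y
        neg = λ (x : F) → (ℚ.- re x) +√ (ℚ.- im x)
    in  (m (u zero) (m (v (suc zero)) (w (suc (suc zero)))) +F neg (m (u zero) (m (v (suc (suc zero))) (w (suc zero)))))
     +F ((m (u (suc zero)) (m (v (suc (suc zero))) (w zero)) +F neg (m (u (suc zero)) (m (v zero) (w (suc (suc zero))))))
     +F (m (u (suc (suc zero))) (m (v zero) (w (suc zero))) +F neg (m (u (suc (suc zero))) (m (v (suc zero)) (w zero)))))

  combo : ∀ {m} → (Fin m → ℤ × ℤ) → (Fin m → V) → V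
  combo c g i = sumF (λ k → ofO (c k) *F g k i)

  InSpan : ∀ {m} → (Fin m → V) → V → Set
  InSpan {m} g v = ∃[ c ] combo {m} c g ≈V v

  record QLattice : Set where
    field
      form  : QForm
      ngens : ℕ
      gens  : Fin ngens → V

    Q : V → F
    Q = evalQ form

    _∈L : V → Set
    v ∈L = InSpan gens v

  open QLattice public

  IsQuadraticLattice : QLattice → Set
  IsQuadraticLattice L = ∀ v → _∈L L v → InO (Q L v)

  -- ternary: dim_F FL = 3 (L contains three F-linearly independent vectors of F³)
  Ternary : QLattice → Set
  Ternary L = ∃[ u ] ∃[ v ] ∃[ w ]
    (_∈L L u × _∈L L v × _∈L L w × ¬ (det3 u v w ≡ 0F))

  Free : QLattice → Set
  Free L = ∃[ e ]
      ((∀ i → _∈L L (e i))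
    × (∀ v → _∈L L v → InSpan {3} e v)
    × (∀ c → combo {3} c e ≈V (λ _ → 0F) → ∀ i → ofO (c i) ≡ 0F))

  Universal : QLattice → Set
  Universal L =
      (∀ v → _∈L L v → ¬ (v ≈V (λ _ → 0F)) → TotPos (Q L v))
    × (∀ α → InO α → TotPos α → ∃[ v ] (_∈L L v × ¬ (v ≈V (λ _ → 0F)) × Q L v ≡ α))

  UniversalTernaryLattice : QLattice → Set
  UniversalTernaryLattice L = IsQuadraticLattice L × Ternary L × Universal L

{-# OPTIONS --safe #-}
-- Let L be universal and ternary, v₁ ∈ L with Q(v₁) = 1, and let b be the polar form of Q.
-- If v₂ represents α, then 4α − b(v₁,v₂)² is totally nonnegative, so b(v₁,v₂) takes finitely many values;
-- likewise for v₃ representing β.  For v₄ representing γ there are again finitely many possible products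
-- with v₁, v₂, v₃, and since L has rank 3 the Gram determinant of v₁, …, v₄ vanishes.  For a good choice of
-- α, β, γ no possibility is left; all fields of discriminant Δ < 1849 outside the list are excluded this way.
--
-- If Δ ≥ 1849, vectors of norms 1, 2, 3, 5 have products in ℤ, so three of them are independent with Gram
-- determinant d ∈ ℤ.  A vector representing a totally positive a + ω of minimal trace also has products in ℤ
-- with them, and the ω-component of the vanishing 4 × 4 determinant is 2d, a contradiction.
--
-- If L is free and 5 divides Δ, norms from O_F are 0, ±1 mod 5.  The half discriminant of v₁, v₂, v₃ is that of L
-- times the square of an index c; if its norm has no divisor m² with m > 1, m ≢ ±2 mod 5, then c is a unit, and v₄
-- must be an integral combination of v₁, v₂, v₃.
module Submission where

open import Defs
open import Level using (0ℓ)
open import Algebra.Bundles using (CommutativeRing)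
open import Algebra.Structures using (IsCommutativeRing)
open import Algebra.Solver.Ring.AlmostCommutativeRing using (_-Raw-AlmostCommutative⟶_; fromCommutativeRing)
import Algebra.Solver.Ring
open import Data.Bool using (Bool; true; false; if_then_else_; T; _∧_; _∨_; not)
open import Data.Bool.ListAction using (all; any)
open import Data.Bool.Properties using (T-∧; T-∨)
open import Data.Empty using (⊥; ⊥-elim)
open import Data.Fin using (Fin; zero; suc)
open import Data.Fin.Properties using (all?)
open import Data.Integer as ℤ using (ℤ; +_; -[1+_])
import Data.Integer.Properties as ℤ
import Data.Integer.Solver as ℤS
open import Data.List using (List; []; _∷_; map; _++_; downFrom; filterᵇ; cartesianProduct)
open import Data.List.Membership.Propositional using (_∈_)
open import Data.List.Membership.Propositional.Properties using (∈-map⁺; ∈-++⁺ˡ; ∈-++⁺ʳ; ∈-downFrom⁺; ∈-filter⁺; ∈-cartesianProduct⁺)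
open import Data.List.Relation.Unary.All using (All; []; _∷_; lookupAny; lookup)
import Data.List.Relation.Unary.All as All
open import Data.List.Relation.Unary.All.Properties using (all⁺) renaming (++⁺ to infixr 5 _++ᴬ_)
open import Data.List.Relation.Unary.Any using (Any; here; there; satisfied)
import Data.List.Relation.Unary.Any as Any
open import Data.List.Relation.Unary.Any.Properties using (any⁻; map⁻)
import Data.Maybe
open import Data.Nat as ℕ using (ℕ; zero; suc; _<_)
open import Data.Nat.DivMod using (_%_; _/_; m≡m%n+[m/n]*n; m%n<n; m/n*n≤m; m*n/n≡m; m%n%n≡m%n; /-monoˡ-≤; %-distribˡ-*)
import Data.Nat.Divisibility as ℕ
open import Data.Nat.Induction using (<-rec)
open import Data.Nat.Primality using (Prime; prime?; euclidsLemma; prime⇒nonZero; prime⇒nonTrivial)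
open import Data.Nat.Primality.Factorisation using (factorise; PrimeFactorisation)
import Data.Nat.Properties as ℕ
import Data.Nat.Solver as ℕS
open import Data.Product using (_,_; _×_; proj₁; proj₂; ∃-syntax; Σ)
open import Data.Rational as ℚ using (ℚ; 0ℚ; 1ℚ; ½)
import Data.Rational.Properties as ℚ
import Data.Rational.Solver as ℚS
import Data.Rational.Unnormalised as ℚᵘ
import Data.Rational.Unnormalised.Properties as ℚᵘ
open import Data.Sum using (_⊎_; inj₁; inj₂; [_,_]; [_,_]′)
import Data.Sum as Sum
open import Data.Unit using (tt)
open import Function using (_∘_; id)
open import Function.Bundles using (module Equivalence)
open import Relation.Binary.Definitions using (tri<; tri≈; tri>)
open import Relation.Binary.PropositionalEquality hiding ([_])
open import Relation.Nullary using (¬_; Dec; yes; no; does)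
open import Relation.Nullary.Decidable using (T?; _×-dec_; map′; dec⇒maybe; dec-true; decidable-stable; toWitness; isYes)

-- The vector `v₁` is split off by the map x ↦ 2x - b(v₁,x)v₁, so the vanishing of a 4 × 4 Gram
-- determinant becomes the vanishing of the 3 × 3 determinant `symDet₃` of the form `h`. Everything
-- then happens with pairs of integers: an element of trace τ and ω-coordinate d is totally
-- nonnegative when 0 ≤ τ and Δd² ≤ τ², and its square has trace (τ² + Δd²)/2. The second fact makes
-- the range of every product finite, and forces a product into ℤ once Δ is large.
--
-- The norms 2, 3, 5 are explained over ℚ. Vectors of norms 1 and 2 span x² + axy + 2y² with |a| ≤
-- 2, of discriminant -4, -7 or -8; 3 is not a rational value for -4 or -7, nor 5 for -8, so no
-- plane contains all four vectors. The largest trace bound is 8 · 5 · s, for norm 5 and an element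
-- of trace s ≤ r + 2, where r is the integer part of √Δ; 40(r + 2) < r² holds for r ≥ 43, and 1849
-- = 43².
--
-- In the free case the index c enters only through the integer N(c)², which divides a computed
-- norm. Few square divisors are available, and the residues modulo 5 discard those whose root is
-- not a norm up to sign.

private
  module I = ℤS.+-*-Solver

-- The integers inside the rationals

/1-+ : ∀ i j → (i ℤ.+ j) ℚ./ 1 ≡ i ℚ./ 1 ℚ.+ j ℚ./ 1
/1-+ i j = ℚ.toℚᵘ-injective (begin-equality
  ℚ.toℚᵘ ((i ℤ.+ j) ℚ./ 1)                       ≃⟨ ℚ.toℚᵘ-fromℚᵘ ((i ℤ.+ j) ℚᵘ./ 1) ⟩
  (i ℤ.+ j) ℚᵘ./ 1                               ≃⟨ ℚᵘ.*≡* (cong (ℤ._* + 1) (cong₂ ℤ._+_ (sym (ℤ.*-identityʳ i)) (sym (ℤ.*-identityʳ j)))) ⟩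
  i ℚᵘ./ 1 ℚᵘ.+ j ℚᵘ./ 1                         ≃⟨ ℚᵘ.+-cong (ℚᵘ.≃-sym (ℚ.toℚᵘ-fromℚᵘ (i ℚᵘ./ 1))) (ℚᵘ.≃-sym (ℚ.toℚᵘ-fromℚᵘ (j ℚᵘ./ 1))) ⟩
  ℚ.toℚᵘ (i ℚ./ 1) ℚᵘ.+ ℚ.toℚᵘ (j ℚ./ 1)         ≃⟨ ℚᵘ.≃-sym (ℚ.toℚᵘ-homo-+ (i ℚ./ 1) (j ℚ./ 1)) ⟩
  ℚ.toℚᵘ (i ℚ./ 1 ℚ.+ j ℚ./ 1)                   ∎)
  where open ℚᵘ.≤-Reasoning

/1-* : ∀ i j → (i ℤ.* j) ℚ./ 1 ≡ (i ℚ./ 1) ℚ.* (j ℚ./ 1)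
/1-* i j = ℚ.toℚᵘ-injective (begin-equality
  ℚ.toℚᵘ ((i ℤ.* j) ℚ./ 1)                       ≃⟨ ℚ.toℚᵘ-fromℚᵘ ((i ℤ.* j) ℚᵘ./ 1) ⟩
  (i ℚᵘ./ 1) ℚᵘ.* (j ℚᵘ./ 1)                         ≃⟨ ℚᵘ.*-cong (ℚᵘ.≃-sym (ℚ.toℚᵘ-fromℚᵘ (i ℚᵘ./ 1))) (ℚᵘ.≃-sym (ℚ.toℚᵘ-fromℚᵘ (j ℚᵘ./ 1))) ⟩
  ℚ.toℚᵘ (i ℚ./ 1) ℚᵘ.* ℚ.toℚᵘ (j ℚ./ 1)         ≃⟨ ℚᵘ.≃-sym (ℚ.toℚᵘ-homo-* (i ℚ./ 1) (j ℚ./ 1)) ⟩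
  ℚ.toℚᵘ ((i ℚ./ 1) ℚ.* (j ℚ./ 1))                   ∎)
  where open ℚᵘ.≤-Reasoning

/1-< : ∀ {i j} → i ℤ.< j → i ℚ./ 1 ℚ.< j ℚ./ 1
/1-< {i} {j} p = ℚ.toℚᵘ-cancel-< (begin-strict
  ℚ.toℚᵘ (i ℚ./ 1)   ≃⟨ ℚ.toℚᵘ-fromℚᵘ (i ℚᵘ./ 1) ⟩
  i ℚᵘ./ 1           <⟨ ℚᵘ.*<* (ℤ.*-monoʳ-<-pos (+ 1) p) ⟩
  j ℚᵘ./ 1           ≃⟨ ℚᵘ.≃-sym (ℚ.toℚᵘ-fromℚᵘ (j ℚᵘ./ 1)) ⟩
  ℚ.toℚᵘ (j ℚ./ 1)   ∎)
  where open ℚᵘ.≤-Reasoning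

/1-cancel-< : ∀ {i j} → i ℚ./ 1 ℚ.< j ℚ./ 1 → i ℤ.< j
/1-cancel-< {i} {j} p with i ℤ.<? j
... | yes q = q
... | no ¬q with j ℤ.≟ i
...   | yes refl = ⊥-elim (ℚ.<-irrefl refl p)
...   | no j≢i = ⊥-elim (ℚ.<-asym p (/1-< (ℤ.≤∧≢⇒< (ℤ.≮⇒≥ ¬q) j≢i)))

/1-injective : ∀ {i j} → i ℚ./ 1 ≡ j ℚ./ 1 → i ≡ j
/1-injective {i} {j} e with ℤ.<-cmp i j
... | tri< a _ _ = ⊥-elim (ℚ.<-irrefl e (/1-< a))
... | tri≈ _ b _ = b
... | tri> _ _ c = ⊥-elim (ℚ.<-irrefl (sym e) (/1-< c))

/1-neg : ∀ i → (ℤ.- i) ℚ./ 1 ≡ ℚ.- (i ℚ./ 1)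
/1-neg (+ zero)    = refl
/1-neg (+ (suc n)) = refl
/1-neg -[1+ n ]    = sym (⁻¹-involutive _)
  where open import Algebra.Properties.Group ℚ.+-0-group using (⁻¹-involutive)

-- Polynomial identities with integer coefficients, and 3 × 3 determinants

module IntegerCoefficients (R : CommutativeRing 0ℓ 0ℓ)
  (hom : ℤ.+-*-rawRing -Raw-AlmostCommutative⟶ fromCommutativeRing R) where
  open Algebra.Solver.Ring ℤ.+-*-rawRing (fromCommutativeRing R) hom
    (λ i j → Data.Maybe.map (λ e → CommutativeRing.reflexive R (cong (_-Raw-AlmostCommutative⟶_.⟦_⟧ hom) e)) (dec⇒maybe (i ℤ.≟ j))) public

  module R = CommutativeRing R

  detR : (a b c d e f g h i : R.Carrier) → R.Carrier
  detR a b c d e f g h i = (a R.* (e R.* i) R.+ R.- (a R.* (f R.* h)))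
    R.+ ((b R.* (f R.* g) R.+ R.- (b R.* (d R.* i))) R.+ (c R.* (d R.* h) R.+ R.- (c R.* (e R.* g))))

  :det : ∀ {n} (a b c d e f g h i : Polynomial n) → Polynomial n
  :det a b c d e f g h i = (a :* (e :* i) :+ :- (a :* (f :* h)))
    :+ ((b :* (f :* g) :+ :- (b :* (d :* i))) :+ (c :* (d :* h) :+ :- (c :* (e :* g))))

  -- Stated over an arbitrary ring of this kind because it serves twice: over F for Gram matrices in
  -- coordinates, and over ℤ[ω] for a change of basis.
  detR-* : ∀ a b c d e f g h i a' b' c' d' e' f' g' h' i' →
    detR (a R.* a' R.+ (b R.* d' R.+ c R.* g')) (a R.* b' R.+ (b R.* e' R.+ c R.* h')) (a R.* c' R.+ (b R.* f' R.+ c R.* i'))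
         (d R.* a' R.+ (e R.* d' R.+ f R.* g')) (d R.* b' R.+ (e R.* e' R.+ f R.* h')) (d R.* c' R.+ (e R.* f' R.+ f R.* i'))
         (g R.* a' R.+ (h R.* d' R.+ i R.* g')) (g R.* b' R.+ (h R.* e' R.+ i R.* h')) (g R.* c' R.+ (h R.* f' R.+ i R.* i'))
    R.≈ detR a b c d e f g h i R.* detR a' b' c' d' e' f' g' h' i'
  detR-* = solve 18 (λ a b c d e f g h i a' b' c' d' e' f' g' h' i' →
    :det (a :* a' :+ (b :* d' :+ c :* g')) (a :* b' :+ (b :* e' :+ c :* h')) (a :* c' :+ (b :* f' :+ c :* i'))
         (d :* a' :+ (e :* d' :+ f :* g')) (d :* b' :+ (e :* e' :+ f :* h')) (d :* c' :+ (e :* f' :+ f :* i'))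
         (g :* a' :+ (h :* d' :+ i :* g')) (g :* b' :+ (h :* e' :+ i :* h')) (g :* c' :+ (h :* f' :+ i :* i'))
    := :det a b c d e f g h i :* :det a' b' c' d' e' f' g' h' i') R.refl

-- The ring of integers as pairs of integers

O : Set
O = ℤ × ℤ

-- Integer multiplication by cases, which the type checker evaluates faster than ℤ._*_.
infixl 7 _·_
_·_ : ℤ → ℤ → ℤ
+ i      · + j      = + (i ℕ.* j)
+ i      · -[1+ j ] = ℤ.- (+ (i ℕ.* suc j))
-[1+ i ] · + j      = ℤ.- (+ (suc i ℕ.* j))
-[1+ i ] · -[1+ j ] = + (suc i ℕ.* suc j)

·≡* : ∀ i j → i · j ≡ i ℤ.* j
·≡* (+ i)    (+ j)    = ℤ.pos-* i j
·≡* (+ i)    -[1+ j ] = trans (cong ℤ.-_ (ℤ.pos-* i (suc j))) (ℤ.neg-distribʳ-* (+ i) (+ suc j))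
·≡* -[1+ i ] (+ j)    = trans (cong ℤ.-_ (ℤ.pos-* (suc i) j)) (ℤ.neg-distribˡ-* (+ suc i) (+ j))
·≡* -[1+ i ] -[1+ j ] = refl

-- The order ℤ[ω] with ω² = tω + n

module Order (t n : ℤ) where
  infixl 6 _⊕_
  infixl 7 _⊗_
  infix 8 ⊖_

  _⊕_ _⊗_ : O → O → O
  (a , b) ⊕ (c , d) = a ℤ.+ c , b ℤ.+ d
  (a , b) ⊗ (c , d) = a · c ℤ.+ n · (b · d) , a · d ℤ.+ b · c ℤ.+ t · (b · d)

  ⊗-def : ∀ a b c d → (a , b) ⊗ (c , d)
        ≡ (a ℤ.* c ℤ.+ n ℤ.* (b ℤ.* d) , a ℤ.* d ℤ.+ b ℤ.* c ℤ.+ t ℤ.* (b ℤ.* d))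
  ⊗-def a b c d = cong₂ _,_
    (cong₂ ℤ._+_ (·≡* a c) (·³ n b d))
    (cong₂ ℤ._+_ (cong₂ ℤ._+_ (·≡* a d) (·≡* b c)) (·³ t b d))
    where
    ·³ : ∀ i j k → i · (j · k) ≡ i ℤ.* (j ℤ.* k)
    ·³ i j k = trans (·≡* i (j · k)) (cong (i ℤ.*_) (·≡* j k))

  ⊖_ : O → O
  ⊖ (a , b) = ℤ.- a , ℤ.- b

  int : ℤ → O
  int i = i , + 0

  -- The trace of a + bω.
  τ : O → ℤ
  τ (a , b) = + 2 ℤ.* a ℤ.+ t ℤ.* b

  Δ : ℤ
  Δ = t ℤ.* t ℤ.+ + 4 ℤ.* n

  private
    module S = ℤS.+-*-Solver
    open S using (_:+_; _:*_; :-_; _:=_; con)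

    -- The ring laws are proved for this product, whose integer operations the solver knows, and are
    -- carried over to `_⊗_` by `⊗≡⊛`.
    _⊛_ : O → O → O
    (a , b) ⊛ (c , d) = a ℤ.* c ℤ.+ n ℤ.* (b ℤ.* d) , a ℤ.* d ℤ.+ b ℤ.* c ℤ.+ t ℤ.* (b ℤ.* d)

    ⊗≡⊛ : ∀ x y → x ⊗ y ≡ x ⊛ y
    ⊗≡⊛ (a , b) (c , d) = ⊗-def a b c d

    isRing* : IsCommutativeRing _≡_ _⊕_ _⊛_ ⊖_ (int (+ 0)) (int (+ 1))
    isRing* = record
      { isRing = record
        { +-isAbelianGroup = record
          { isGroup = record
            { isMonoid = record
              { isSemigroup = record
                { isMagma = record { isEquivalence = isEquivalence ; ∙-cong = cong₂ _⊕_ }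
                ; assoc = λ { (a , b) (c , d) (e , f) → cong₂ _,_ (ℤ.+-assoc a c e) (ℤ.+-assoc b d f) } }
              ; identity = (λ { (a , b) → cong₂ _,_ (ℤ.+-identityˡ a) (ℤ.+-identityˡ b) })
                         , (λ { (a , b) → cong₂ _,_ (ℤ.+-identityʳ a) (ℤ.+-identityʳ b) }) }
            ; inverse = (λ { (a , b) → cong₂ _,_ (ℤ.+-inverseˡ a) (ℤ.+-inverseˡ b) })
                      , (λ { (a , b) → cong₂ _,_ (ℤ.+-inverseʳ a) (ℤ.+-inverseʳ b) })
            ; ⁻¹-cong = cong ⊖_ }
          ; comm = λ { (a , b) (c , d) → cong₂ _,_ (ℤ.+-comm a c) (ℤ.+-comm b d) } }
        ; *-cong = cong₂ _⊛_
        ; *-assoc = λ { (a , b) (c , d) (e , f) → cong₂ _,_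
            (S.solve 8 (λ t n a b c d e f → (a :* c :+ n :* (b :* d)) :* e :+ n :* ((a :* d :+ b :* c :+ t :* (b :* d)) :* f)
                      := a :* (c :* e :+ n :* (d :* f)) :+ n :* (b :* (c :* f :+ d :* e :+ t :* (d :* f)))) refl t n a b c d e f)
            (S.solve 8 (λ t n a b c d e f → (a :* c :+ n :* (b :* d)) :* f :+ (a :* d :+ b :* c :+ t :* (b :* d)) :* e
                        :+ t :* ((a :* d :+ b :* c :+ t :* (b :* d)) :* f)
                      := a :* (c :* f :+ d :* e :+ t :* (d :* f)) :+ b :* (c :* e :+ n :* (d :* f))
                        :+ t :* (b :* (c :* f :+ d :* e :+ t :* (d :* f)))) refl t n a b c d e f) }
        ; *-identity = (λ { (a , b) → cong₂ _,_
              (S.solve 3 (λ n a b → con (+ 1) :* a :+ n :* (con (+ 0) :* b) := a) refl n a b)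
              (S.solve 3 (λ t a b → con (+ 1) :* b :+ con (+ 0) :* a :+ t :* (con (+ 0) :* b) := b) refl t a b) })
          , (λ { (a , b) → cong₂ _,_
              (S.solve 3 (λ n a b → a :* con (+ 1) :+ n :* (b :* con (+ 0)) := a) refl n a b)
              (S.solve 3 (λ t a b → a :* con (+ 0) :+ b :* con (+ 1) :+ t :* (b :* con (+ 0)) := b) refl t a b) })
        ; distrib = (λ { (a , b) (c , d) (e , f) → cong₂ _,_
              (S.solve 7 (λ n a b c d e f → a :* (c :+ e) :+ n :* (b :* (d :+ f))
                  := (a :* c :+ n :* (b :* d)) :+ (a :* e :+ n :* (b :* f))) refl n a b c d e f)
              (S.solve 7 (λ t a b c d e f → a :* (d :+ f) :+ b :* (c :+ e) :+ t :* (b :* (d :+ f))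
                  := (a :* d :+ b :* c :+ t :* (b :* d)) :+ (a :* f :+ b :* e :+ t :* (b :* f))) refl t a b c d e f) })
          , (λ { (a , b) (c , d) (e , f) → cong₂ _,_
              (S.solve 7 (λ n a b c d e f → (c :+ e) :* a :+ n :* ((d :+ f) :* b)
                  := (c :* a :+ n :* (d :* b)) :+ (e :* a :+ n :* (f :* b))) refl n a b c d e f)
              (S.solve 7 (λ t a b c d e f → (c :+ e) :* b :+ (d :+ f) :* a :+ t :* ((d :+ f) :* b)
                  := (c :* b :+ d :* a :+ t :* (d :* b)) :+ (e :* b :+ f :* a :+ t :* (f :* b))) refl t a b c d e f) }) }
      ; *-comm = λ { (a , b) (c , d) → cong₂ _,_
            (S.solve 5 (λ n a b c d → a :* c :+ n :* (b :* d) := c :* a :+ n :* (d :* b)) refl n a b c d)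
            (S.solve 5 (λ t a b c d → a :* d :+ b :* c :+ t :* (b :* d) := c :* b :+ d :* a :+ t :* (d :* b)) refl t a b c d) } }

    module R* = IsCommutativeRing isRing*

    ⊗⊗≡ˡ : ∀ x y z → (x ⊗ y) ⊗ z ≡ (x ⊛ y) ⊛ z
    ⊗⊗≡ˡ x y z = trans (⊗≡⊛ (x ⊗ y) z) (cong (_⊛ z) (⊗≡⊛ x y))

    ⊗⊗≡ʳ : ∀ x y z → x ⊗ (y ⊗ z) ≡ x ⊛ (y ⊛ z)
    ⊗⊗≡ʳ x y z = trans (⊗≡⊛ x (y ⊗ z)) (cong (x ⊛_) (⊗≡⊛ y z))

    isRing : IsCommutativeRing _≡_ _⊕_ _⊗_ ⊖_ (int (+ 0)) (int (+ 1))
    isRing = record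
      { isRing = record
        { +-isAbelianGroup = R*.+-isAbelianGroup
        ; *-cong = cong₂ _⊗_
        ; *-assoc = λ x y z → trans (⊗⊗≡ˡ x y z) (trans (R*.*-assoc x y z) (sym (⊗⊗≡ʳ x y z)))
        ; *-identity = (λ x → trans (⊗≡⊛ (int (+ 1)) x) (R*.*-identityˡ x)) , (λ x → trans (⊗≡⊛ x (int (+ 1))) (R*.*-identityʳ x))
        ; distrib = (λ x y z → trans (⊗≡⊛ x (y ⊕ z)) (trans (R*.distribˡ x y z) (sym (cong₂ _⊕_ (⊗≡⊛ x y) (⊗≡⊛ x z)))))
                  , (λ x y z → trans (⊗≡⊛ (y ⊕ z) x) (trans (R*.distribʳ x y z) (sym (cong₂ _⊕_ (⊗≡⊛ y x) (⊗≡⊛ z x))))) }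
      ; *-comm = λ x y → trans (⊗≡⊛ x y) (trans (R*.*-comm x y) (sym (⊗≡⊛ y x))) }

  ringO : CommutativeRing 0ℓ 0ℓ
  ringO = record { isCommutativeRing = isRing }

  int-* : ∀ i j → int (i ℤ.* j) ≡ int i ⊗ int j
  int-* i j = trans (cong₂ _,_
    (S.solve 3 (λ n i j → i :* j := i :* j :+ n :* (con (+ 0) :* con (+ 0))) refl n i j)
    (S.solve 3 (λ t i j → con (+ 0) := i :* con (+ 0) :+ con (+ 0) :* j :+ t :* (con (+ 0) :* con (+ 0))) refl t i j))
    (sym (⊗-def i (+ 0) j (+ 0)))

  homO : ℤ.+-*-rawRing -Raw-AlmostCommutative⟶ fromCommutativeRing ringO
  homO = record
    { ⟦_⟧ = int ; +-homo = λ _ _ → refl ; *-homo = int-*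
    ; -‿homo = λ _ → refl ; 0-homo = refl ; 1-homo = refl }

module SolverO (t n : ℤ) = IntegerCoefficients (Order.ringO t n) (Order.homO t n)

-- The minimal polynomial of ω and the irrationality of √D

-- These are the coefficients of ω² = tω + n, so n is minus the norm of ω. The Boolean is a separate
-- argument so that a case split on it turns t into a numeral.
ωTrace ωNorm : Bool → ℕ → ℤ
ωTrace b D = if b then + 1 else + 0
ωNorm  b D = if b then + (D / 4) else + D

D≡4n+1 : ∀ D → (D % 4 ℕ.≡ᵇ 1) ≡ true → + D ≡ + 4 ℤ.* + (D / 4) ℤ.+ + 1
D≡4n+1 D e = trans (cong +_ (trans (m≡m%n+[m/n]*n D 4) (trans (cong (ℕ._+ D / 4 ℕ.* 4) (ℕ.≡ᵇ⇒≡ _ _ (subst T (sym e) _))) (ℕ.+-comm 1 (D / 4 ℕ.* 4)))))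
  (trans (ℤ.pos-+ (D / 4 ℕ.* 4) 1) (cong (ℤ._+ + 1) (trans (ℤ.pos-* (D / 4) 4) (ℤ.*-comm (+ (D / 4)) (+ 4)))))

primeDivisor : ∀ D → 1 ℕ.< D → ∃[ p ] (Prime p × p ℕ.∣ D)
primeDivisor D 1<D with factorise D {{ℕ.>-nonZero (ℕ.<-trans ℕ.z<s 1<D)}}
... | record { factors = [] ; isFactorisation = e } = ⊥-elim (ℕ.<-irrefl (sym e) 1<D)
... | record { factors = p ∷ ps ; isFactorisation = e ; factorsPrime = pr ∷ _ } =
  p , pr , subst (p ℕ.∣_) (sym e) (ℕ.m∣m*n _)

-- Infinite descent on b. A prime p dividing D = D'p divides a, hence D'b²; it does not divide D'
-- because D is squarefree, so it divides b, and p cancels from a and b.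
squarefree⇒nonsquare : ∀ {D} → 1 ℕ.< D → Squarefree D → ∀ b a → a ℕ.* a ≡ D ℕ.* (b ℕ.* b) → b ≡ 0
squarefree⇒nonsquare {D} 1<D sf with primeDivisor D 1<D
... | p , pr , ℕ.divides D' refl = <-rec _ step
  where
  open ℕS.+-*-Solver
  instance
    p≢0 : ℕ.NonZero p
    p≢0 = prime⇒nonZero pr
  E : ℕ
  E = D' ℕ.* p
  root : ∀ x → p ℕ.∣ x ℕ.* x → p ℕ.∣ x
  root x d = [ id , id ] (euclidsLemma x x pr d)
  p∣a : ∀ a b → a ℕ.* a ≡ E ℕ.* (b ℕ.* b) → p ℕ.∣ a
  p∣a a b e = root a (ℕ.divides (D' ℕ.* (b ℕ.* b))
    (trans e (solve 3 (λ d p b → d :* p :* b := d :* b :* p) refl D' p (b ℕ.* b))))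
  p∣b : ∀ a' b → a' ℕ.* p ℕ.* (a' ℕ.* p) ≡ E ℕ.* (b ℕ.* b) → p ℕ.∣ b
  p∣b a' b e = [ (λ p∣D' → ⊥-elim (sf p pr (ℕ.*-monoˡ-∣ p p∣D'))) , root b ]
    (euclidsLemma D' (b ℕ.* b) pr (ℕ.divides (a' ℕ.* a') (ℕ.*-cancelˡ-≡ _ _ p
      (trans (solve 3 (λ d p b → p :* (d :* b) := d :* p :* b) refl D' p (b ℕ.* b))
        (trans (sym e) (solve 2 (λ a p → a :* p :* (a :* p) := p :* (a :* a :* p)) refl a' p))))))
  descend : ∀ a' b' → a' ℕ.* p ℕ.* (a' ℕ.* p) ≡ E ℕ.* (b' ℕ.* p ℕ.* (b' ℕ.* p)) → a' ℕ.* a' ≡ E ℕ.* (b' ℕ.* b')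
  descend a' b' e = ℕ.*-cancelˡ-≡ _ _ (p ℕ.* p) {{ℕ.m*n≢0 p p}}
    (trans (solve 2 (λ a p → p :* p :* (a :* a) := a :* p :* (a :* p)) refl a' p)
      (trans e (solve 3 (λ d p b → d :* (b :* p :* (b :* p)) := p :* p :* (d :* (b :* b))) refl E p b')))
  step : ∀ b → (∀ {b'} → b' ℕ.< b → ∀ a → a ℕ.* a ≡ E ℕ.* (b' ℕ.* b') → b' ≡ 0)
       → ∀ a → a ℕ.* a ≡ E ℕ.* (b ℕ.* b) → b ≡ 0
  step b rec a e with p∣a a b e
  ... | ℕ.divides a' refl with p∣b a' b e
  ...   | ℕ.divides zero refl = refl
  ...   | ℕ.divides b'@(suc _) refl with () ← rec (ℕ.m<m*n b' p (ℕ.nonTrivial⇒n>1 p {{prime⇒nonTrivial pr}})) a' (descend a' b' e)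

-- Clearing denominators turns a² = Db² over ℚ into an equation of natural numbers, to which the
-- descent applies.
crossMultiply : ∀ D p q-1 r s-1 → let a = ℚᵘ.mkℚᵘ p q-1 ; b = ℚᵘ.mkℚᵘ r s-1 ; q = suc q-1 ; s = suc s-1 in
  a ℚᵘ.* a ℚᵘ.≃ ((+ D) ℚᵘ./ 1) ℚᵘ.* (b ℚᵘ.* b) →
  (ℤ.∣ p ∣ ℕ.* ℤ.∣ p ∣) ℕ.* (1 ℕ.* (s ℕ.* s)) ≡ (D ℕ.* (ℤ.∣ r ∣ ℕ.* ℤ.∣ r ∣)) ℕ.* (q ℕ.* q)
crossMultiply D p q-1 r s-1 (ℚᵘ.*≡* e) = begin
    (ℤ.∣ p ∣ ℕ.* ℤ.∣ p ∣) ℕ.* (1 ℕ.* (s ℕ.* s)) ≡⟨ cong (ℕ._* (1 ℕ.* (s ℕ.* s))) (ℤ.abs-* p p) ⟨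
    ℤ.∣ ℚᵘ.↥ A ∣ ℕ.* ℤ.∣ ℚᵘ.↧ X ∣               ≡⟨ ℤ.abs-* (ℚᵘ.↥ A) (ℚᵘ.↧ X) ⟨
    ℤ.∣ ℚᵘ.↥ A ℤ.* ℚᵘ.↧ X ∣                     ≡⟨ cong ℤ.∣_∣ e ⟩
    ℤ.∣ ℚᵘ.↥ X ℤ.* ℚᵘ.↧ A ∣                     ≡⟨ ℤ.abs-* (ℚᵘ.↥ X) (ℚᵘ.↧ A) ⟩
    ℤ.∣ ℚᵘ.↥ X ∣ ℕ.* ℤ.∣ ℚᵘ.↧ A ∣               ≡⟨ cong (ℕ._* (q ℕ.* q)) (trans (ℤ.abs-* (+ D) (r ℤ.* r)) (cong (D ℕ.*_) (ℤ.abs-* r r))) ⟩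
    (D ℕ.* (ℤ.∣ r ∣ ℕ.* ℤ.∣ r ∣)) ℕ.* (q ℕ.* q) ∎
  where
  open ≡-Reasoning
  q s : ℕ
  q = suc q-1
  s = suc s-1
  A X : ℚᵘ.ℚᵘ
  A = ℚᵘ.mkℚᵘ p q-1 ℚᵘ.* ℚᵘ.mkℚᵘ p q-1
  X = ((+ D) ℚᵘ./ 1) ℚᵘ.* (ℚᵘ.mkℚᵘ r s-1 ℚᵘ.* ℚᵘ.mkℚᵘ r s-1)

module ℚOrder where
  private
    module S = ℚS.+-*-Solver
    open S using (_:+_; _:*_; :-_; _:=_; con)

  square-nonneg : ∀ p → 0ℚ ℚ.≤ p ℚ.* p
  square-nonneg p with ℚ.≤-total 0ℚ p
  ... | inj₁ h = ℚ.nonNegative⁻¹ _ {{ℚ.nonNeg*nonNeg⇒nonNeg p {{ℚ.nonNegative h}} p {{ℚ.nonNegative h}}}}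
  ... | inj₂ h = subst (0ℚ ℚ.≤_) (S.solve 1 (λ p → (:- p) :* (:- p) := p :* p) refl p)
                  (ℚ.nonNegative⁻¹ _ {{ℚ.nonNeg*nonNeg⇒nonNeg (ℚ.- p) {{m}} (ℚ.- p) {{m}}}})
    where m = ℚ.nonNegative (ℚ.neg-antimono-≤ h)

open ℚOrder

ℚ-domain : ∀ p q → p ℚ.* q ≡ 0ℚ → ¬ (p ≡ 0ℚ) → q ≡ 0ℚ
ℚ-domain p q e p≢0 = begin
  q                      ≡⟨ ℚ.*-identityˡ q ⟨
  1ℚ ℚ.* q               ≡⟨ cong (ℚ._* q) (ℚ.*-inverseˡ p) ⟨
  ((ℚ.1/ p) ℚ.* p) ℚ.* q ≡⟨ ℚ.*-assoc (ℚ.1/ p) p q ⟩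
  (ℚ.1/ p) ℚ.* (p ℚ.* q) ≡⟨ cong ((ℚ.1/ p) ℚ.*_) e ⟩
  (ℚ.1/ p) ℚ.* 0ℚ        ≡⟨ ℚ.*-zeroʳ (ℚ.1/ p) ⟩
  0ℚ                     ∎
  where
  open ≡-Reasoning
  instance _ = ℚ.≢-nonZero p≢0

-- Quadratic spaces with values in ℤ[ω]

module Forms (t n : ℤ) where
  open Order t n public

  -- Total nonnegativity is expressed by the symmetric functions of the two conjugates: x + x̄ = τ
  -- and 4xx̄ = τ² - Δb², where b is the ω-coordinate.
  record Nonneg (x : O) : Set where
    constructor _,_
    field
      τ≥0    : + 0 ℤ.≤ τ x
      norm≥0 : Δ ℤ.* (proj₂ x ℤ.* proj₂ x) ℤ.≤ τ x ℤ.* τ x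

  record TotallyPositive (x : O) : Set where
    constructor _,_
    field
      τ>0    : + 0 ℤ.< τ x
      norm>0 : Δ ℤ.* (proj₂ x ℤ.* proj₂ x) ℤ.< τ x ℤ.* τ x

  0O 1O : O
  0O = int (+ 0)
  1O = int (+ 1)

  symDet₂ : (p q s : O) → O
  symDet₂ p q s = p ⊗ s ⊕ ⊖ (q ⊗ q)

  -- The determinant of the symmetric matrix with rows (p, q, r), (q, s, v), (r, v, u). The terms
  -- with v come last because v runs through the innermost loop of the checker.
  symDet₃ : (p q s r v u : O) → O
  symDet₃ p q s r v u = symDet₂ p q s ⊗ u ⊕ ⊖ (s ⊗ (r ⊗ r)) ⊕ ⊖ (v ⊗ (p ⊗ v ⊕ ⊖ (int (+ 2) ⊗ (q ⊗ r))))

  -- The interface between a universal ternary lattice and the integer computations. Linear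
  -- relations are visible only through `q` and `b`. In `rank` either x, y, z are dependent or w
  -- depends on them; as x has norm 1 and is orthogonal to the others, it drops out of both
  -- determinants.
  record Space : Set₁ where
    field
      X         : Set
      q         : X → O
      b         : X → X → O
      comb      : O → X → O → X → X
      q-comb    : ∀ α x β y → q (comb α x β y) ≡ α ⊗ α ⊗ q x ⊕ (α ⊗ β ⊗ b x y ⊕ β ⊗ β ⊗ q y)
      b-comb    : ∀ α x β y z → b (comb α x β y) z ≡ α ⊗ b x z ⊕ β ⊗ b y z
      b-sym     : ∀ x y → b x y ≡ b y x
      b-diag    : ∀ x → b x x ≡ q x ⊕ q x
      nonneg    : ∀ x → Nonneg (q x)
      universal : ∀ α → TotallyPositive α → ∃[ x ] q x ≡ α
      rank      : ∀ x y z w → q x ≡ 1O → b x y ≡ 0O → b x z ≡ 0O → b x w ≡ 0O →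
                  symDet₂ (b y y) (b y z) (b z z) ≡ 0O
                  ⊎ symDet₃ (b y y) (b y z) (b z z) (b y w) (b z w) (b w w) ≡ 0O
      domain    : ∀ x y → x ⊗ y ≡ 0O → ¬ (x ≡ 0O) → y ≡ 0O

-- The field F: ring structure, total positivity, and the embedding of ℤ[ω]

module FieldTheory (D : ℕ) where
  open Field D public

  module _ where
    private
      module S = ℚS.+-*-Solver
      open S using (_:+_; _:*_; :-_; _:=_; con)
    -F_ : F → F
    -F (a +√ b) = (ℚ.- a) +√ (ℚ.- b)

    1F : F
    1F = 1ℚ +√ 0ℚ

    ι : ℤ → F
    ι i = (i ℚ./ 1) +√ 0ℚ

    private
      isRing : IsCommutativeRing _≡_ _+F_ _*F_ -F_ 0F 1F
      isRing = record
        { isRing = record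
          { +-isAbelianGroup = record
            { isGroup = record
              { isMonoid = record
                { isSemigroup = record
                  { isMagma = record { isEquivalence = isEquivalence ; ∙-cong = cong₂ _+F_ }
                  ; assoc = λ x y z → cong₂ _+√_ (ℚ.+-assoc (re x) (re y) (re z)) (ℚ.+-assoc (im x) (im y) (im z)) }
                ; identity = (λ x → cong₂ _+√_ (ℚ.+-identityˡ (re x)) (ℚ.+-identityˡ (im x)))
                           , (λ x → cong₂ _+√_ (ℚ.+-identityʳ (re x)) (ℚ.+-identityʳ (im x))) }
              ; inverse = (λ x → cong₂ _+√_ (ℚ.+-inverseˡ (re x)) (ℚ.+-inverseˡ (im x)))
                        , (λ x → cong₂ _+√_ (ℚ.+-inverseʳ (re x)) (ℚ.+-inverseʳ (im x)))
              ; ⁻¹-cong = cong -F_ }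
            ; comm = λ x y → cong₂ _+√_ (ℚ.+-comm (re x) (re y)) (ℚ.+-comm (im x) (im y)) }
          ; *-cong = cong₂ _*F_
          ; *-assoc = λ { (a +√ b) (c +√ d) (e +√ f) → cong₂ _+√_
              (S.solve 7 (λ k a b c d e f → (a :* c :+ k :* (b :* d)) :* e :+ k :* ((a :* d :+ b :* c) :* f)
                        := a :* (c :* e :+ k :* (d :* f)) :+ k :* (b :* (c :* f :+ d :* e))) refl Dℚ a b c d e f)
              (S.solve 7 (λ k a b c d e f → (a :* c :+ k :* (b :* d)) :* f :+ (a :* d :+ b :* c) :* e
                        := a :* (c :* f :+ d :* e) :+ b :* (c :* e :+ k :* (d :* f))) refl Dℚ a b c d e f) }
          ; *-identity = (λ { (a +√ b) → cong₂ _+√_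
                (S.solve 3 (λ k a b → con 1ℚ :* a :+ k :* (con 0ℚ :* b) := a) refl Dℚ a b)
                (S.solve 2 (λ a b → con 1ℚ :* b :+ con 0ℚ :* a := b) refl a b) })
            , (λ { (a +√ b) → cong₂ _+√_
                (S.solve 3 (λ k a b → a :* con 1ℚ :+ k :* (b :* con 0ℚ) := a) refl Dℚ a b)
                (S.solve 2 (λ a b → a :* con 0ℚ :+ b :* con 1ℚ := b) refl a b) })
          ; distrib = (λ { (a +√ b) (c +√ d) (e +√ f) → cong₂ _+√_
                (S.solve 7 (λ k a b c d e f → a :* (c :+ e) :+ k :* (b :* (d :+ f))
                    := (a :* c :+ k :* (b :* d)) :+ (a :* e :+ k :* (b :* f))) refl Dℚ a b c d e f)
                (S.solve 6 (λ a b c d e f → a :* (d :+ f) :+ b :* (c :+ e)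
                    := (a :* d :+ b :* c) :+ (a :* f :+ b :* e)) refl a b c d e f) })
            , (λ { (a +√ b) (c +√ d) (e +√ f) → cong₂ _+√_
                (S.solve 7 (λ k a b c d e f → (c :+ e) :* a :+ k :* ((d :+ f) :* b)
                    := (c :* a :+ k :* (d :* b)) :+ (e :* a :+ k :* (f :* b))) refl Dℚ a b c d e f)
                (S.solve 6 (λ a b c d e f → (c :+ e) :* b :+ (d :+ f) :* a
                    := (c :* b :+ d :* a) :+ (e :* b :+ f :* a)) refl a b c d e f) }) }
        ; *-comm = λ { (a +√ b) (c +√ d) → cong₂ _+√_
              (S.solve 5 (λ k a b c d → a :* c :+ k :* (b :* d) := c :* a :+ k :* (d :* b)) refl Dℚ a b c d)
              (S.solve 4 (λ a b c d → a :* d :+ b :* c := c :* b :+ d :* a) refl a b c d) } }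

    ringF : CommutativeRing 0ℓ 0ℓ
    ringF = record { isCommutativeRing = isRing }

    ι-* : ∀ i j → ι (i ℤ.* j) ≡ ι i *F ι j
    ι-* i j = cong₂ _+√_
      (trans (/1-* i j) (S.solve 3 (λ k a b → a :* b := a :* b :+ k :* (con 0ℚ :* con 0ℚ)) refl Dℚ (i ℚ./ 1) (j ℚ./ 1)))
      (S.solve 2 (λ a b → con 0ℚ := a :* con 0ℚ :+ con 0ℚ :* b) refl (i ℚ./ 1) (j ℚ./ 1))

    ι-+ : ∀ i j → ι (i ℤ.+ j) ≡ ι i +F ι j
    ι-+ i j = cong (_+√ 0ℚ) (/1-+ i j)

    private
      homF : ℤ.+-*-rawRing -Raw-AlmostCommutative⟶ fromCommutativeRing ringF
      homF = record
        { ⟦_⟧ = ι ; +-homo = ι-+ ; *-homo = ι-*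
        ; -‿homo = λ i → cong (_+√ 0ℚ) (/1-neg i)
        ; 0-homo = refl ; 1-homo = refl }

    module SolverF = IntegerCoefficients ringF homF

  module _ where
    b₄ : Bool
    b₄ = D % 4 ℕ.≡ᵇ 1
    t n : ℤ
    t = ωTrace b₄ D
    n = ωNorm b₄ D
    open Order t n public
    private
      module S = ℚS.+-*-Solver
      open SolverF using (solve; con; _:+_; _:*_; :-_; _:=_)
      ωB : Bool → F
      ωB b = if b then (½ +√ ½) else (0ℚ +√ 1ℚ)

      ω²-case : ∀ b → b₄ ≡ b → ωB b *F ωB b ≡ (ι (ωTrace b D) *F ωB b) +F ι (ωNorm b D)
      ω²-case true e = cong₂ _+√_
        (trans (cong (λ d → ½ ℚ.* ½ ℚ.+ d ℚ.* (½ ℚ.* ½)) (trans (cong (ℚ._/ 1) (D≡4n+1 D e)) (trans (/1-+ (+ 4 ℤ.* + (D / 4)) (+ 1)) (cong (ℚ._+ 1ℚ) (/1-* (+ 4) (+ (D / 4)))))))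
          (S.solve 2 (λ k d → S.con ½ S.:* S.con ½ S.:+ (S.con (+ 4 ℚ./ 1) S.:* k S.:+ S.con 1ℚ) S.:* (S.con ½ S.:* S.con ½)
               S.:= S.con 1ℚ S.:* S.con ½ S.:+ d S.:* (S.con 0ℚ S.:* S.con ½) S.:+ k) refl (+ (D / 4) ℚ./ 1) Dℚ))
        refl
      ω²-case false e = cong₂ _+√_
        (S.solve 1 (λ d → S.con 0ℚ S.:* S.con 0ℚ S.:+ d S.:* (S.con 1ℚ S.:* S.con 1ℚ)
            S.:= S.con 0ℚ S.:* S.con 0ℚ S.:+ d S.:* (S.con 0ℚ S.:* S.con 1ℚ) S.:+ d) refl Dℚ)
        refl

    ω² : ω *F ω ≡ (ι t *F ω) +F ι n
    ω² = ω²-case b₄ refl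

    ofO-⊕ : ∀ x y → ofO (x ⊕ y) ≡ ofO x +F ofO y
    ofO-⊕ (a , b) (c , d) = trans (cong₂ (λ u v → u +F (v *F ω)) (ι-+ a c) (ι-+ b d))
      (solve 5 (λ w a b c d → (a :+ c) :+ ((b :+ d) :* w) := (a :+ b :* w) :+ (c :+ d :* w)) refl ω (ι a) (ι b) (ι c) (ι d))

    ofO-⊗ : ∀ x y → ofO (x ⊗ y) ≡ ofO x *F ofO y
    ofO-⊗ (a , b) (c , d) = begin
      ofO ((a , b) ⊗ (c , d)) ≡⟨ cong ofO (⊗-def a b c d) ⟩
      ι (a ℤ.* c ℤ.+ n ℤ.* (b ℤ.* d)) +F (ι (a ℤ.* d ℤ.+ b ℤ.* c ℤ.+ t ℤ.* (b ℤ.* d)) *F ω)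
        ≡⟨ cong₂ (λ u v → u +F (v *F ω))
            (trans (ι-+ (a ℤ.* c) (n ℤ.* (b ℤ.* d))) (cong₂ _+F_ (ι-* a c) (ι-*³ n b d)))
            (trans (ι-+ (a ℤ.* d ℤ.+ b ℤ.* c) (t ℤ.* (b ℤ.* d)))
              (cong₂ _+F_ (trans (ι-+ (a ℤ.* d) (b ℤ.* c)) (cong₂ _+F_ (ι-* a d) (ι-* b c))) (ι-*³ t b d))) ⟩
      ((ι a *F ι c) +F (ι n *F (ι b *F ι d))) +F ((((ι a *F ι d) +F (ι b *F ι c)) +F (ι t *F (ι b *F ι d))) *F ω)
        ≡⟨ solve 7 (λ t n w a b c d → a :* c :+ n :* (b :* d) :+ (a :* d :+ b :* c :+ t :* (b :* d)) :* w
              := a :* c :+ (a :* d :+ b :* c) :* w :+ b :* d :* (t :* w :+ n)) refl (ι t) (ι n) ω (ι a) (ι b) (ι c) (ι d) ⟩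
      ((ι a *F ι c) +F (((ι a *F ι d) +F (ι b *F ι c)) *F ω)) +F ((ι b *F ι d) *F ((ι t *F ω) +F ι n))
        ≡⟨ cong (λ u → ((ι a *F ι c) +F (((ι a *F ι d) +F (ι b *F ι c)) *F ω)) +F ((ι b *F ι d) *F u)) (sym ω²) ⟩
      ((ι a *F ι c) +F (((ι a *F ι d) +F (ι b *F ι c)) *F ω)) +F ((ι b *F ι d) *F (ω *F ω))
        ≡⟨ solve 5 (λ w a b c d → a :* c :+ (a :* d :+ b :* c) :* w :+ b :* d :* (w :* w) := (a :+ b :* w) :* (c :+ d :* w)) refl ω (ι a) (ι b) (ι c) (ι d) ⟩
      ofO (a , b) *F ofO (c , d) ∎
      where
      open ≡-Reasoning
      ι-*³ : ∀ i j k → ι (i ℤ.* (j ℤ.* k)) ≡ ι i *F (ι j *F ι k)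
      ι-*³ i j k = trans (ι-* i (j ℤ.* k)) (cong (ι i *F_) (ι-* j k))

    ofO-int : ∀ i → ofO (int i) ≡ ι i
    ofO-int i = solve 2 (λ w i → i :+ con (+ 0) :* w := i) refl ω (ι i)

    ofO-⊖ : ∀ x → ofO (⊖ x) ≡ -F ofO x
    ofO-⊖ (a , b) = trans (cong₂ (λ u v → u +F (v *F ω)) (cong (_+√ 0ℚ) (/1-neg a)) (cong (_+√ 0ℚ) (/1-neg b)))
      (solve 3 (λ w a b → (:- a) :+ (:- b) :* w := :- (a :+ b :* w)) refl ω (ι a) (ι b))

  module _ where
    private
      module OS = SolverO t n
      module S = ℚS.+-*-Solver
      open S using (_:+_; _:*_; :-_; _:=_; con)

    private
      0≤D : 0ℚ ℚ.≤ Dℚ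
      0≤D = ℚ.nonNegative⁻¹ Dℚ {{ℚ.normalize-nonNeg D 1}}

      0≤Db² : ∀ b → 0ℚ ℚ.≤ Dℚ ℚ.* (b ℚ.* b)
      0≤Db² b = ℚ.nonNegative⁻¹ _ {{ℚ.nonNeg*nonNeg⇒nonNeg Dℚ {{ℚ.nonNegative 0≤D}} _ {{ℚ.nonNegative (square-nonneg b)}}}}

      dropNeg : ∀ a b → Dℚ ℚ.* (ℚ.- b ℚ.* ℚ.- b) ℚ.< a → Dℚ ℚ.* (b ℚ.* b) ℚ.< a
      dropNeg a b = subst (ℚ._< a) (S.solve 2 (λ d b → d :* (:- b :* :- b) := d :* (b :* b)) refl Dℚ b)

      addNeg : ∀ a b → Dℚ ℚ.* (b ℚ.* b) ℚ.< a → Dℚ ℚ.* (ℚ.- b ℚ.* ℚ.- b) ℚ.< a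
      addNeg a b = subst (ℚ._< a) (S.solve 2 (λ d b → d :* (b :* b) := d :* (:- b :* :- b)) refl Dℚ b)

      positive : ∀ a b → 0ℚ ℚ.≤ a → Dℚ ℚ.* (b ℚ.* b) ℚ.< a ℚ.* a → 0ℚ ℚ.< a
      positive a b 0≤a h with 0ℚ ℚ.<? a
      ... | yes p = p
      ... | no ¬p with ℚ.≤-antisym (ℚ.≮⇒≥ ¬p) 0≤a
      ...   | refl = ⊥-elim (ℚ.<-irrefl refl (ℚ.<-≤-trans h (0≤Db² b)))

      ⊥-< : ∀ {p q} → p ℚ.< q → q ℚ.≤ p → ∀ {A : Set} → A
      ⊥-< h k = ⊥-elim (ℚ.<-irrefl refl (ℚ.<-≤-trans h k))

    private
      Pos-im<0 : ∀ a b → b ℚ.< 0ℚ → Pos (a +√ b) → 0ℚ ℚ.≤ a × Dℚ ℚ.* (b ℚ.* b) ℚ.< a ℚ.* a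
      Pos-im<0 a b b<0 (inj₁ (_ , 0≤b)) = ⊥-< b<0 0≤b
      Pos-im<0 a b b<0 (inj₂ (inj₁ (_ , 0<b))) = ⊥-< b<0 (ℚ.<⇒≤ 0<b)
      Pos-im<0 a b b<0 (inj₂ (inj₂ (inj₁ (0≤a , _ , h)))) = 0≤a , h
      Pos-im<0 a b b<0 (inj₂ (inj₂ (inj₂ (_ , 0<b , _)))) = ⊥-< b<0 (ℚ.<⇒≤ 0<b)

      Pos-im≡0 : ∀ a b → b ≡ 0ℚ → Pos (a +√ b) → 0ℚ ℚ.< a
      Pos-im≡0 a b e (inj₁ (0<a , _)) = 0<a
      Pos-im≡0 a b e (inj₂ (inj₁ (_ , h))) = ⊥-elim (ℚ.<-irrefl (sym e) h)
      Pos-im≡0 a b e (inj₂ (inj₂ (inj₁ (_ , h , _)))) = ⊥-elim (ℚ.<-irrefl e h)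
      Pos-im≡0 a b e (inj₂ (inj₂ (inj₂ (_ , h , _)))) = ⊥-elim (ℚ.<-irrefl (sym e) h)

    -- `Pos` is required with imaginary part b and with -b. Whichever of the two is negative
    -- supplies the inequality between the squares.
    TotPos⇒ : ∀ x → TotPos x → 0ℚ ℚ.< re x × Dℚ ℚ.* (im x ℚ.* im x) ℚ.< re x ℚ.* re x
    TotPos⇒ (a +√ b) (p , p′) with ℚ.<-cmp b 0ℚ
    ... | tri< b<0 _ _ with Pos-im<0 a b b<0 p
    ...   | 0≤a , h = positive a b 0≤a h , h
    TotPos⇒ (a +√ b) (p , p′) | tri> _ _ 0<b with Pos-im<0 a (ℚ.- b) (ℚ.neg-antimono-< 0<b) p′
    ...   | 0≤a , h = positive a (ℚ.- b) 0≤a h , dropNeg (a ℚ.* a) b h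
    TotPos⇒ (a +√ b) (p , p′) | tri≈ _ e _ = 0<a ,
      subst (λ b → Dℚ ℚ.* (b ℚ.* b) ℚ.< a ℚ.* a) (sym e)
        (subst (ℚ._< a ℚ.* a) (S.solve 1 (λ d → con 0ℚ := d :* (con 0ℚ :* con 0ℚ)) refl Dℚ)
          (ℚ.positive⁻¹ _ {{ℚ.pos*pos⇒pos a {{ℚ.positive 0<a}} a {{ℚ.positive 0<a}}}}))
      where
      0<a : 0ℚ ℚ.< a
      0<a = Pos-im≡0 a b e p

    ⇒TotPos : ∀ x → 0ℚ ℚ.< re x → Dℚ ℚ.* (im x ℚ.* im x) ℚ.< re x ℚ.* re x → TotPos x
    ⇒TotPos (a +√ b) 0<a h with ℚ.<-cmp 0ℚ b
    ... | tri< 0<b _ _ = inj₁ (0<a , ℚ.<⇒≤ 0<b) , inj₂ (inj₂ (inj₁ (ℚ.<⇒≤ 0<a , ℚ.neg-antimono-< 0<b , addNeg (a ℚ.* a) b h)))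
    ... | tri≈ _ refl _ = inj₁ (0<a , ℚ.≤-refl) , inj₁ (0<a , ℚ.≤-refl)
    ... | tri> _ _ b<0 = inj₂ (inj₂ (inj₁ (ℚ.<⇒≤ 0<a , b<0 , h))) , inj₁ (0<a , ℚ.<⇒≤ (ℚ.neg-antimono-< b<0))

    private
      ωB : Bool → F
      ωB b = if b then (½ +√ ½) else (0ℚ +√ 1ℚ)

      2re-case : ∀ b a c → let z = ι a +F (ι c *F ωB b) in
        re z ℚ.+ re z ≡ (+ 2 ℤ.* a ℤ.+ ωTrace b D ℤ.* c) ℚ./ 1
      2re-case true a c = sym (trans (/1-+ (+ 2 ℤ.* a) (+ 1 ℤ.* c)) (trans (cong₂ ℚ._+_ (/1-* (+ 2) a) (/1-* (+ 1) c))
        (S.solve 3 (λ a c d → con (+ 2 ℚ./ 1) :* a :+ con 1ℚ :* c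
           := (a :+ (c :* con ½ :+ d :* (con 0ℚ :* con ½))) :+ (a :+ (c :* con ½ :+ d :* (con 0ℚ :* con ½)))) refl (a ℚ./ 1) (c ℚ./ 1) Dℚ)))
      2re-case false a c = sym (trans (/1-+ (+ 2 ℤ.* a) (+ 0 ℤ.* c)) (trans (cong₂ ℚ._+_ (/1-* (+ 2) a) (/1-* (+ 0) c))
        (S.solve 3 (λ a c d → con (+ 2 ℚ./ 1) :* a :+ con 0ℚ :* c
           := (a :+ (c :* con 0ℚ :+ d :* (con 0ℚ :* con 1ℚ))) :+ (a :+ (c :* con 0ℚ :+ d :* (con 0ℚ :* con 1ℚ)))) refl (a ℚ./ 1) (c ℚ./ 1) Dℚ)))

      im-case : ∀ b a c → let z = ι a +F (ι c *F ωB b) in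
        im z ≡ (c ℚ./ 1) ℚ.* im (ωB b)
      im-case b a c = S.solve 3 (λ c w v → con 0ℚ :+ (c :* w :+ con 0ℚ :* v) := c :* w) refl (c ℚ./ 1) (im (ωB b)) (re (ωB b))

      4D-case : ∀ b → b₄ ≡ b → Dℚ ℚ.* ((im (ωB b) ℚ.+ im (ωB b)) ℚ.* (im (ωB b) ℚ.+ im (ωB b)))
              ≡ (ωTrace b D ℤ.* ωTrace b D ℤ.+ + 4 ℤ.* ωNorm b D) ℚ./ 1
      4D-case true e = trans (S.solve 1 (λ d → d :* con 1ℚ := d) refl Dℚ)
        (cong (ℚ._/ 1) (trans (D≡4n+1 D e) (ℤ.+-comm (+ 4 ℤ.* ωNorm true D) (+ 1))))
      4D-case false e = sym (trans (cong (ℚ._/ 1) (ℤ.+-identityˡ (+ 4 ℤ.* + D)))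
        (trans (/1-* (+ 4) (+ D)) (ℚ.*-comm (+ 4 ℚ./ 1) Dℚ)))

    2re-ofO : ∀ x → re (ofO x) ℚ.+ re (ofO x) ≡ τ x ℚ./ 1
    2re-ofO (a , c) = 2re-case b₄ a c

    D[2im]²-ofO : ∀ x → let y = im (ofO x) in Dℚ ℚ.* ((y ℚ.+ y) ℚ.* (y ℚ.+ y)) ≡ (Δ ℤ.* (proj₂ x ℤ.* proj₂ x)) ℚ./ 1
    D[2im]²-ofO (a , c) = trans (cong (λ y → Dℚ ℚ.* ((y ℚ.+ y) ℚ.* (y ℚ.+ y))) (im-case b₄ a c))
      (trans (S.solve 3 (λ d c w → d :* ((c :* w :+ c :* w) :* (c :* w :+ c :* w)) := (d :* ((w :+ w) :* (w :+ w))) :* (c :* c)) refl Dℚ (c ℚ./ 1) (im (ωB b₄)))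
        (trans (cong₂ ℚ._*_ (4D-case b₄ refl) (sym (/1-* c c))) (sym (/1-* Δ (c ℤ.* c)))))

    TotPosO : O → Set
    TotPosO x = + 0 ℤ.< τ x × Δ ℤ.* (proj₂ x ℤ.* proj₂ x) ℤ.< τ x ℤ.* τ x

    private
      4ℚ : ℚ
      4ℚ = + 4 ℚ./ 1
      ×4-D : ∀ y → 4ℚ ℚ.* (Dℚ ℚ.* (y ℚ.* y)) ≡ Dℚ ℚ.* ((y ℚ.+ y) ℚ.* (y ℚ.+ y))
      ×4-D y = S.solve 2 (λ d y → con 4ℚ :* (d :* (y :* y)) := d :* ((y :+ y) :* (y :+ y))) refl Dℚ y
      ×4-sq : ∀ a → 4ℚ ℚ.* (a ℚ.* a) ≡ (a ℚ.+ a) ℚ.* (a ℚ.+ a)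
      ×4-sq a = S.solve 1 (λ a → con 4ℚ :* (a :* a) := (a :+ a) :* (a :+ a)) refl a
      sq/1 : ∀ x → (re (ofO x) ℚ.+ re (ofO x)) ℚ.* (re (ofO x) ℚ.+ re (ofO x)) ≡ (τ x ℤ.* τ x) ℚ./ 1
      sq/1 x = trans (cong₂ ℚ._*_ (2re-ofO x) (2re-ofO x)) (sym (/1-* (τ x) (τ x)))

    -- Doubling removes the halves in ω: twice the real part is τ, and D times the square of twice
    -- the imaginary part is Δ times the square of the ω-coordinate.
    TotPos⇒TotPosO : ∀ x → TotPos (ofO x) → TotPosO x
    TotPos⇒TotPosO x h with TotPos⇒ (ofO x) h
    ... | p , q = /1-cancel-< (subst (0ℚ ℚ.<_) (2re-ofO x) (ℚ.+-mono-< p p))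
        , /1-cancel-< (subst₂ ℚ._<_ (trans (×4-D (im (ofO x))) (D[2im]²-ofO x)) (trans (×4-sq (re (ofO x))) (sq/1 x)) (ℚ.*-monoʳ-<-pos 4ℚ q))

    TotPosO⇒TotPos : ∀ x → TotPosO x → TotPos (ofO x)
    TotPosO⇒TotPos x (p , q) = ⇒TotPos (ofO x)
        (ℚ.*-cancelˡ-<-nonNeg (+ 2 ℚ./ 1) {0ℚ} {re (ofO x)} (subst (0ℚ ℚ.<_) (trans (sym (2re-ofO x)) (S.solve 1 (λ a → a :+ a := con (+ 2 ℚ./ 1) :* a) refl (re (ofO x)))) (/1-< p)))
        (ℚ.*-cancelˡ-<-nonNeg 4ℚ {Dℚ ℚ.* (im (ofO x) ℚ.* im (ofO x))} {re (ofO x) ℚ.* re (ofO x)} (subst₂ ℚ._<_ (sym (trans (×4-D (im (ofO x))) (D[2im]²-ofO x))) (sym (trans (×4-sq (re (ofO x))) (sq/1 x))) (/1-< q)))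

    private
      im-injective : ∀ b c → b₄ ≡ b → (c ℚ./ 1) ℚ.* im (ωB b) ≡ 0ℚ → c ≡ + 0
      im-injective true c e h = /1-injective {c} {+ 0} (trans (S.solve 1 (λ c → c := con (+ 2 ℚ./ 1) :* (c :* con ½)) refl (c ℚ./ 1)) (cong ((+ 2 ℚ./ 1) ℚ.*_) h))
      im-injective false c e h = /1-injective {c} {+ 0} (trans (sym (ℚ.*-identityʳ (c ℚ./ 1))) h)

    ofO-zero : ∀ x → ofO x ≡ 0F → x ≡ (+ 0 , + 0)
    ofO-zero (a , c) h = cong₂ _,_ a≡0 c≡0
      where
      c≡0 : c ≡ + 0
      c≡0 = im-injective b₄ c refl (trans (sym (im-case b₄ a c)) (cong im h))
      a≡0 : a ≡ + 0
      a≡0 = /1-injective {a} {+ 0} (trans (cong re (sym (ofO-int a)))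
        (trans (cong (λ c → re (ofO (a , c))) (sym c≡0)) (cong re h)))

    ofO-injective : ∀ x y → ofO x ≡ ofO y → x ≡ y
    ofO-injective x y h = begin
      x                      ≡⟨ OS.solve 2 (λ x y → x OS.:= (x OS.:+ OS.:- y) OS.:+ y) refl x y ⟩
      (x ⊕ ⊖ y) ⊕ y          ≡⟨ cong (_⊕ y) (ofO-zero (x ⊕ ⊖ y) (trans (ofO-⊕ x (⊖ y)) (trans (cong₂ _+F_ h (ofO-⊖ y))
                                 (SolverF.solve 1 (λ y → y SolverF.:+ SolverF.:- y SolverF.:= SolverF.con (+ 0)) refl (ofO y))))) ⟩
      int (+ 0) ⊕ y          ≡⟨ OS.solve 1 (λ y → OS.con (+ 0) OS.:+ y OS.:= y) refl y ⟩
      y                      ∎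
      where open ≡-Reasoning

    module Domain (1<D : 1 ℕ.< D) (sf : Squarefree D) where

      ↥≡0 : ∀ a b → a ℚᵘ.* a ℚᵘ.≃ ((+ D) ℚᵘ./ 1) ℚᵘ.* (b ℚᵘ.* b) → ℚᵘ.↥ b ≡ + 0
      ↥≡0 (ℚᵘ.mkℚᵘ p q-1) (ℚᵘ.mkℚᵘ r s-1) e = ℤ.∣i∣≡0⇒i≡0 ([ id , (λ ()) ] (ℕ.m*n≡0⇒m≡0∨n≡0 ℤ.∣ r ∣
          (squarefree⇒nonsquare 1<D sf (ℤ.∣ r ∣ ℕ.* suc q-1) (ℤ.∣ p ∣ ℕ.* suc s-1) (clear ℤ.∣ p ∣ (suc q-1) ℤ.∣ r ∣ (suc s-1) (crossMultiply D p q-1 r s-1 e)))))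
        where
        clear : ∀ p q r s → (p ℕ.* p) ℕ.* (1 ℕ.* (s ℕ.* s)) ≡ (D ℕ.* (r ℕ.* r)) ℕ.* (q ℕ.* q) →
          (p ℕ.* s) ℕ.* (p ℕ.* s) ≡ D ℕ.* ((r ℕ.* q) ℕ.* (r ℕ.* q))
        clear p q r s h = begin
          (p ℕ.* s) ℕ.* (p ℕ.* s)         ≡⟨ ℕ.[m*n]*[o*p]≡[m*o]*[n*p] p s p s ⟩
          (p ℕ.* p) ℕ.* (s ℕ.* s)         ≡⟨ cong (p ℕ.* p ℕ.*_) (ℕ.*-identityˡ (s ℕ.* s)) ⟨
          (p ℕ.* p) ℕ.* (1 ℕ.* (s ℕ.* s)) ≡⟨ h ⟩
          (D ℕ.* (r ℕ.* r)) ℕ.* (q ℕ.* q) ≡⟨ ℕ.*-assoc D (r ℕ.* r) (q ℕ.* q) ⟩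
          D ℕ.* ((r ℕ.* r) ℕ.* (q ℕ.* q)) ≡⟨ cong (D ℕ.*_) (ℕ.[m*n]*[o*p]≡[m*o]*[n*p] r r q q) ⟩
          D ℕ.* ((r ℕ.* q) ℕ.* (r ℕ.* q)) ∎
          where open ≡-Reasoning

      norm-zero : ∀ a b → a ℚ.* a ≡ Dℚ ℚ.* (b ℚ.* b) → b ≡ 0ℚ
      norm-zero a b e = ℚ.↥p≡0⇒p≡0 b (trans (sym (ℚ.↥ᵘ-toℚᵘ b)) (↥≡0 (ℚ.toℚᵘ a) (ℚ.toℚᵘ b) eᵘ))
        where
        eᵘ : ℚ.toℚᵘ a ℚᵘ.* ℚ.toℚᵘ a ℚᵘ.≃ ((+ D) ℚᵘ./ 1) ℚᵘ.* (ℚ.toℚᵘ b ℚᵘ.* ℚ.toℚᵘ b)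
        eᵘ = ℚᵘ.≃-trans (ℚᵘ.≃-sym (ℚ.toℚᵘ-homo-* a a)) (ℚᵘ.≃-trans (ℚᵘ.≃-reflexive (cong ℚ.toℚᵘ e))
               (ℚᵘ.≃-trans (ℚ.toℚᵘ-homo-* Dℚ (b ℚ.* b)) (ℚᵘ.*-cong (ℚ.toℚᵘ-fromℚᵘ ((+ D) ℚᵘ./ 1)) (ℚ.toℚᵘ-homo-* b b))))

      -- Multiplication by the conjugate replaces x by its norm a² - Db², which is nonzero for x ≠ 0
      -- because D is not a rational square.
      field-domain : ∀ x y → x *F y ≡ 0F → ¬ (x ≡ 0F) → y ≡ 0F
      field-domain x@(a +√ b) y@(c +√ d) h x≢0 = cong₂ _+√_ (kill c (trans (sym (eq c d)) (cong re z)))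
          (kill d (trans (sym (eq′ c d)) (cong im z)))
        where
        N : ℚ
        N = a ℚ.* a ℚ.+ ℚ.- (Dℚ ℚ.* (b ℚ.* b))
        z : conj x *F (x *F y) ≡ 0F
        z = trans (cong (conj x *F_) h) (SolverF.solve 1 (λ x → x SolverF.:* SolverF.con (+ 0) SolverF.:= SolverF.con (+ 0)) refl (conj x))
        eq : ∀ c d → re (conj x *F (x *F (c +√ d))) ≡ N ℚ.* c
        eq c d = S.solve 5 (λ k a b c d → a :* (a :* c :+ k :* (b :* d)) :+ k :* (:- b :* (a :* d :+ b :* c))
                   := (a :* a :+ :- (k :* (b :* b))) :* c) refl Dℚ a b c d
        eq′ : ∀ c d → im (conj x *F (x *F (c +√ d))) ≡ N ℚ.* d
        eq′ c d = S.solve 5 (λ k a b c d → a :* (a :* d :+ b :* c) :+ :- b :* (a :* c :+ k :* (b :* d))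
                   := (a :* a :+ :- (k :* (b :* b))) :* d) refl Dℚ a b c d
        N≢0 : ¬ (N ≡ 0ℚ)
        N≢0 e = x≢0 (cong₂ _+√_ a≡0 b≡0)
          where
          a²≡Db² : a ℚ.* a ≡ Dℚ ℚ.* (b ℚ.* b)
          a²≡Db² = trans (S.solve 2 (λ a k → a := (a :+ :- k) :+ k) refl (a ℚ.* a) (Dℚ ℚ.* (b ℚ.* b)))
            (trans (cong (ℚ._+ Dℚ ℚ.* (b ℚ.* b)) e) (ℚ.+-identityˡ (Dℚ ℚ.* (b ℚ.* b))))
          b≡0 : b ≡ 0ℚ
          b≡0 = norm-zero a b a²≡Db²
          a≡0 : a ≡ 0ℚ
          a≡0 = decidable-stable (a ℚ.≟ 0ℚ) (λ a≢0 → a≢0 (ℚ-domain a a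
            (trans a²≡Db² (trans (cong (λ b → Dℚ ℚ.* (b ℚ.* b)) b≡0) (ℚ.*-zeroʳ Dℚ))) a≢0))
        kill : ∀ c → N ℚ.* c ≡ 0ℚ → c ≡ 0ℚ
        kill c e = ℚ-domain N c e N≢0

  -- Polar forms, Cramer's rule and Gram determinants over F

  module _ where
    private
      module S = SolverF
      open S using (solve; con; _:+_; _:*_; :-_; _:=_)

    sumF-cong : ∀ {n} {f g : Fin n → F} → (∀ i → f i ≡ g i) → sumF f ≡ sumF g
    sumF-cong {zero}  h = refl
    sumF-cong {suc n} h = cong₂ _+F_ (h zero) (sumF-cong (λ i → h (suc i)))

    sumF-lin : ∀ {n} α β (f g : Fin n → F) →
      sumF (λ i → (α *F f i) +F (β *F g i)) ≡ (α *F sumF f) +F (β *F sumF g)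
    sumF-lin {zero}  α β f g = solve 2 (λ α β → con (+ 0) := α :* con (+ 0) :+ β :* con (+ 0)) refl α β
    sumF-lin {suc n} α β f g = trans (cong (((α *F f zero) +F (β *F g zero)) +F_) (sumF-lin α β (λ i → f (suc i)) (λ i → g (suc i))))
      (solve 6 (λ α β x y s t → α :* x :+ β :* y :+ (α :* s :+ β :* t) := α :* (x :+ s) :+ β :* (y :+ t)) refl
        α β (f zero) (g zero) (sumF (λ i → f (suc i))) (sumF (λ i → g (suc i))))

    lin : F → V → F → V → V
    lin α x β y i = (α *F x i) +F (β *F y i)

    e₀ e₁ e₂ : V
    e₀ zero = 1F
    e₀ (suc _) = 0F
    e₁ (suc zero) = 1F
    e₁ _ = 0F
    e₂ (suc (suc zero)) = 1F
    e₂ _ = 0F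

    expand : ∀ x → x ≈V lin (x zero) e₀ 1F (lin (x (suc zero)) e₁ (x (suc (suc zero))) e₂)
    expand x zero = solve 3 (λ x y z → x := x :* con (+ 1) :+ con (+ 1) :* (y :* con (+ 0) :+ z :* con (+ 0))) refl (x zero) (x (suc zero)) (x (suc (suc zero)))
    expand x (suc zero) = solve 3 (λ x y z → y := x :* con (+ 0) :+ con (+ 1) :* (y :* con (+ 1) :+ z :* con (+ 0))) refl (x zero) (x (suc zero)) (x (suc (suc zero)))
    expand x (suc (suc zero)) = solve 3 (λ x y z → z := x :* con (+ 0) :+ con (+ 1) :* (y :* con (+ 0) :+ z :* con (+ 1))) refl (x zero) (x (suc zero)) (x (suc (suc zero)))

    row : V → V → V → V → V
    row x y z w j = (w zero *F x j) +F ((w (suc zero) *F y j) +F (w (suc (suc zero)) *F z j))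

    det3-* : ∀ x y z u v w → det3 (row x y z u) (row x y z v) (row x y z w) ≡ det3 u v w *F det3 x y z
    det3-* x y z u v w = S.detR-*
      (u zero) (u (suc zero)) (u (suc (suc zero))) (v zero) (v (suc zero)) (v (suc (suc zero))) (w zero) (w (suc zero)) (w (suc (suc zero)))
      (x zero) (x (suc zero)) (x (suc (suc zero))) (y zero) (y (suc zero)) (y (suc (suc zero))) (z zero) (z (suc zero)) (z (suc (suc zero)))

    -- Cramer's rule without division. The summand with `0F` and the factor `1F` only bring both
    -- sides into the shape `lin`, on which the polar form is known to be linear.
    cramer : ∀ x y z w →
      lin (det3 x y z) w 0F w ≈V lin (det3 w y z) x 1F (lin (det3 x w z) y (det3 x y w) z)
    cramer x y z w i = aux i
      where
      x₀ = x zero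
      x₁ = x (suc zero)
      x₂ = x (suc (suc zero))
      y₀ = y zero
      y₁ = y (suc zero)
      y₂ = y (suc (suc zero))
      z₀ = z zero
      z₁ = z (suc zero)
      z₂ = z (suc (suc zero))
      w₀ = w zero
      w₁ = w (suc zero)
      w₂ = w (suc (suc zero))
      aux : lin (det3 x y z) w 0F w ≈V lin (det3 w y z) x 1F (lin (det3 x w z) y (det3 x y w) z)
      aux zero = solve 12 (λ a b c d e f g h i k l m → S.:det a b c d e f g h i :* k :+ con (+ 0) :* k
          := S.:det k l m d e f g h i :* a :+ con (+ 1) :* (S.:det a b c k l m g h i :* d :+ S.:det a b c d e f k l m :* g))
        refl x₀ x₁ x₂ y₀ y₁ y₂ z₀ z₁ z₂ w₀ w₁ w₂
      aux (suc zero) = solve 12 (λ a b c d e f g h i k l m → S.:det a b c d e f g h i :* l :+ con (+ 0) :* l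
          := S.:det k l m d e f g h i :* b :+ con (+ 1) :* (S.:det a b c k l m g h i :* e :+ S.:det a b c d e f k l m :* h))
        refl x₀ x₁ x₂ y₀ y₁ y₂ z₀ z₁ z₂ w₀ w₁ w₂
      aux (suc (suc zero)) = solve 12 (λ a b c d e f g h i k l m → S.:det a b c d e f g h i :* m :+ con (+ 0) :* m
          := S.:det k l m d e f g h i :* c :+ con (+ 1) :* (S.:det a b c k l m g h i :* f :+ S.:det a b c d e f k l m :* i))
        refl x₀ x₁ x₂ y₀ y₁ y₂ z₀ z₁ z₂ w₀ w₁ w₂

    module Polar (a : QForm) where

      B : V → V → F
      B x y = sumF (λ i → sumF (λ j → a i j *F ((x i *F y j) +F (y i *F x j))))

      sum₂-cong : ∀ {f g : Fin 3 → Fin 3 → F} → (∀ i j → f i j ≡ g i j) →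
        sumF (λ i → sumF (f i)) ≡ sumF (λ i → sumF (g i))
      sum₂-cong h = sumF-cong (λ i → sumF-cong (h i))

      sum₂-lin : ∀ α β (f g : Fin 3 → Fin 3 → F) →
        sumF (λ i → sumF (λ j → (α *F f i j) +F (β *F g i j)))
          ≡ (α *F sumF (λ i → sumF (f i))) +F (β *F sumF (λ i → sumF (g i)))
      sum₂-lin α β f g = trans (sumF-cong (λ i → sumF-lin α β (f i) (g i)))
        (sumF-lin α β (λ i → sumF (f i)) (λ i → sumF (g i)))

      evalQ-cong : ∀ x y → x ≈V y → evalQ a x ≡ evalQ a y
      evalQ-cong x y h = sum₂-cong (λ i j → cong₂ (λ u v → (a i j *F u) *F v) (h i) (h j))

      evalQ-zero : evalQ a (λ _ → 0F) ≡ 0F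
      evalQ-zero = sum₂-cong {g = λ _ _ → 0F} (λ i j → *0*0 (a i j))
        where
        *0*0 : ∀ c → (c *F 0F) *F 0F ≡ 0F
        *0*0 = solve 1 (λ c → c :* con (+ 0) :* con (+ 0) := con (+ 0)) refl

      B-cong : ∀ x y u v → x ≈V y → u ≈V v → B x u ≡ B y v
      B-cong x y u v h k = sum₂-cong (λ i j → cong (a i j *F_)
        (cong₂ _+F_ (cong₂ _*F_ (h i) (k j)) (cong₂ _*F_ (k i) (h j))))

      B-sym : ∀ x y → B x y ≡ B y x
      B-sym x y = sum₂-cong (λ i j → cong (a i j *F_)
        (solve 2 (λ u v → u :+ v := v :+ u) refl (x i *F y j) (y i *F x j)))

      B-lin : ∀ α x β y z → B (lin α x β y) z ≡ (α *F B x z) +F (β *F B y z)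
      B-lin α x β y z = trans
        (sum₂-cong (λ i j → solve 9 (λ α β c xi xj yi yj zi zj →
            c :* ((α :* xi :+ β :* yi) :* zj :+ zi :* (α :* xj :+ β :* yj))
              := α :* (c :* (xi :* zj :+ zi :* xj)) :+ β :* (c :* (yi :* zj :+ zi :* yj)))
            refl α β (a i j) (x i) (x j) (y i) (y j) (z i) (z j)))
        (sum₂-lin α β (λ i j → a i j *F ((x i *F z j) +F (z i *F x j))) (λ i j → a i j *F ((y i *F z j) +F (z i *F y j))))

      evalQ-lin : ∀ α x β y → evalQ a (lin α x β y)
        ≡ ((α *F α) *F evalQ a x) +F (1F *F (((α *F β) *F B x y) +F ((β *F β) *F evalQ a y)))
      evalQ-lin α x β y = trans
        (sum₂-cong (λ i j → solve 7 (λ α β c xi xj yi yj →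
            c :* (α :* xi :+ β :* yi) :* (α :* xj :+ β :* yj)
              := α :* α :* (c :* xi :* xj) :+ con (+ 1) :* (α :* β :* (c :* (xi :* yj :+ yi :* xj)) :+ β :* β :* (c :* yi :* yj)))
            refl α β (a i j) (x i) (x j) (y i) (y j)))
        (trans (sum₂-lin (α *F α) 1F (λ i j → (a i j *F x i) *F x j) (λ i j → ((α *F β) *F g i j) +F ((β *F β) *F h i j)))
          (cong (λ z → ((α *F α) *F evalQ a x) +F (1F *F z)) (sum₂-lin (α *F β) (β *F β) g h)))
        where
        g h : Fin 3 → Fin 3 → F
        g i j = a i j *F ((x i *F y j) +F (y i *F x j))
        h i j = (a i j *F y i) *F y j

      B-diag : ∀ x → B x x ≡ evalQ a x +F evalQ a x
      B-diag x = trans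
        (sum₂-cong (λ i j → solve 3 (λ c xi xj → c :* (xi :* xj :+ xi :* xj) := con (+ 1) :* (c :* xi :* xj) :+ con (+ 1) :* (c :* xi :* xj))
          refl (a i j) (x i) (x j)))
        (trans (sum₂-lin 1F 1F g g)
          (solve 1 (λ s → con (+ 1) :* s :+ con (+ 1) :* s := s :+ s) refl (evalQ a x)))
        where
        g : Fin 3 → Fin 3 → F
        g i j = (a i j *F x i) *F x j

      private
        +1* : ∀ u v → u +F (1F *F v) ≡ u +F v
        +1* = solve 2 (λ u v → u :+ con (+ 1) :* v := u :+ v) refl

      B-row : ∀ x y → B x y ≡ (x zero *F B e₀ y) +F ((x (suc zero) *F B e₁ y) +F (x (suc (suc zero)) *F B e₂ y))
      B-row x y = begin
        B x y ≡⟨ B-cong x (lin (x zero) e₀ 1F (lin (x (suc zero)) e₁ (x (suc (suc zero))) e₂)) y y (expand x) (λ i → refl) ⟩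
        B (lin (x zero) e₀ 1F (lin (x (suc zero)) e₁ (x (suc (suc zero))) e₂)) y ≡⟨ B-lin (x zero) e₀ 1F (lin (x (suc zero)) e₁ (x (suc (suc zero))) e₂) y ⟩
        (x zero *F B e₀ y) +F (1F *F B (lin (x (suc zero)) e₁ (x (suc (suc zero))) e₂) y)
          ≡⟨ cong (λ s → (x zero *F B e₀ y) +F (1F *F s)) (B-lin (x (suc zero)) e₁ (x (suc (suc zero))) e₂ y) ⟩
        (x zero *F B e₀ y) +F (1F *F ((x (suc zero) *F B e₁ y) +F (x (suc (suc zero)) *F B e₂ y)))
          ≡⟨ +1* (x zero *F B e₀ y) ((x (suc zero) *F B e₁ y) +F (x (suc (suc zero)) *F B e₂ y)) ⟩
        (x zero *F B e₀ y) +F ((x (suc zero) *F B e₁ y) +F (x (suc (suc zero)) *F B e₂ y)) ∎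
        where open ≡-Reasoning

      gramRow : V → V → V → V → V
      gramRow x y z u zero = B u x
      gramRow x y z u (suc zero) = B u y
      gramRow x y z u (suc (suc zero)) = B u z

      -- The Gram matrix is the coordinate matrix of x, y, z times the matrix of their products with
      -- the standard basis, so `det3 x y z` is a factor of its determinant.
      det-gram : ∀ x y z → det3 x y z ≡ 0F → det3 (gramRow x y z x) (gramRow x y z y) (gramRow x y z z) ≡ 0F
      det-gram x y z h = trans (det3-cong (g x) (g y) (g z) (g′ x) (g′ y) (g′ z) (r x) (r y) (r z)) (trans (det3-* (gramRow x y z e₀) (gramRow x y z e₁) (gramRow x y z e₂) x y z)
        (trans (cong (_*F det3 (gramRow x y z e₀) (gramRow x y z e₁) (gramRow x y z e₂)) h)
          (solve 1 (λ s → con (+ 0) :* s := con (+ 0)) refl (det3 (gramRow x y z e₀) (gramRow x y z e₁) (gramRow x y z e₂)))))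
        where
        g g′ : V → V
        g = gramRow x y z
        g′ = row (g e₀) (g e₁) (g e₂)
        r : ∀ u → g u ≈V g′ u
        r u zero = B-row u x
        r u (suc zero) = B-row u y
        r u (suc (suc zero)) = B-row u z
        det3-cong : ∀ u v w u' v' w' → u ≈V u' → v ≈V v' → w ≈V w' → det3 u v w ≡ det3 u' v' w'
        det3-cong u v w u' v' w' p q s = cong₂ _+F_
          (cong₂ _+F_ (triple (p zero) (q (suc zero)) (s (suc (suc zero)))) (cong -F_ (triple (p zero) (q (suc (suc zero))) (s (suc zero)))))
          (cong₂ _+F_
            (cong₂ _+F_ (triple (p (suc zero)) (q (suc (suc zero))) (s zero)) (cong -F_ (triple (p (suc zero)) (q zero) (s (suc (suc zero))))))
            (cong₂ _+F_ (triple (p (suc (suc zero))) (q zero) (s (suc zero))) (cong -F_ (triple (p (suc (suc zero))) (q (suc zero)) (s zero)))))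
          where
          triple : ∀ {a b c a' b' c'} → a ≡ a' → b ≡ b' → c ≡ c' → a *F (b *F c) ≡ a' *F (b' *F c')
          triple e f g = cong₂ _*F_ e (cong₂ _*F_ f g)

    _≟F_ : (x y : F) → Dec (x ≡ y)
    x ≟F y = map′ (λ (p , q) → cong₂ _+√_ p q) (λ e → cong re e , cong im e) (re x ℚ.≟ re y ×-dec im x ℚ.≟ im y)

    _≈V?_ : ∀ x y → Dec (x ≈V y)
    x ≈V? y = all? (λ i → x i ≟F y i)

  -- A universal lattice as a quadratic space over ℤ[ω]

  module LatticeSpace (1<D : 1 ℕ.< D) (sf : Squarefree D) (L : QLattice)
    (quadratic : IsQuadraticLattice L) (univ : Universal L) where
    open Domain 1<D sf
    open Polar (form L)
    open Forms t n using (Space; Nonneg; TotallyPositive; _,_; 0O; 1O; symDet₂; symDet₃)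
    private
      module S = SolverF
      open S using (solve; con; _:+_; _:*_; :-_; _:=_)

    O-domain : ∀ x y → x ⊗ y ≡ 0O → ¬ (x ≡ 0O) → y ≡ 0O
    O-domain x y h x≢0 = ofO-zero y (field-domain (ofO x) (ofO y) (trans (sym (ofO-⊗ x y)) (trans (cong ofO h) (ofO-int (+ 0))))
      (λ e → x≢0 (ofO-zero x e)))

    X : Set
    X = Σ V (_∈L L)

    ∈L-lin : ∀ α β {x y} → _∈L L x → _∈L L y → _∈L L (lin (ofO α) x (ofO β) y)
    ∈L-lin α β {x} {y} (c , c≡) (d , d≡) = (λ k → α ⊗ c k ⊕ β ⊗ d k) , λ i → begin
        sumF (λ k → ofO (α ⊗ c k ⊕ β ⊗ d k) *F gens L k i)
          ≡⟨ sumF-cong (λ k → trans (cong (_*F gens L k i) (trans (ofO-⊕ (α ⊗ c k) (β ⊗ d k)) (cong₂ _+F_ (ofO-⊗ α (c k)) (ofO-⊗ β (d k)))))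
               (regroup (ofO α) (ofO β) (ofO (c k)) (ofO (d k)) (gens L k i))) ⟩
        sumF (λ k → (ofO α *F (ofO (c k) *F gens L k i)) +F (ofO β *F (ofO (d k) *F gens L k i)))
          ≡⟨ sumF-lin (ofO α) (ofO β) (λ k → ofO (c k) *F gens L k i) (λ k → ofO (d k) *F gens L k i) ⟩
        (ofO α *F combo c (gens L) i) +F (ofO β *F combo d (gens L) i)
          ≡⟨ cong₂ (λ u v → (ofO α *F u) +F (ofO β *F v)) (c≡ i) (d≡ i) ⟩
        lin (ofO α) x (ofO β) y i ∎
      where
      open ≡-Reasoning
      regroup : ∀ α β c d g → ((α *F c) +F (β *F d)) *F g ≡ (α *F (c *F g)) +F (β *F (d *F g))
      regroup = solve 5 (λ α β c d g → (α :* c :+ β :* d) :* g := α :* (c :* g) :+ β :* (d :* g)) refl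

    comb : O → X → O → X → X
    comb α (x , x∈) β (y , y∈) = lin (ofO α) x (ofO β) y , ∈L-lin α β x∈ y∈

    q : X → O
    q (x , x∈) = proj₁ (quadratic x x∈)

    ofO-q : ∀ x → ofO (q x) ≡ Q L (proj₁ x)
    ofO-q (x , x∈) = proj₂ (quadratic x x∈)

    -- Defined by polarisation so that its values lie in ℤ[ω]: integrality is given only for `q`.
    b : X → X → O
    b x y = q (comb 1O x 1O y) ⊕ ⊖ (q x ⊕ q y)

    ofO-b : ∀ x y → ofO (b x y) ≡ B (proj₁ x) (proj₁ y)
    ofO-b x y = begin
      ofO (b x y)
        ≡⟨ ofO-⊕ (q (comb 1O x 1O y)) (⊖ (q x ⊕ q y)) ⟩
      ofO (q (comb 1O x 1O y)) +F ofO (⊖ (q x ⊕ q y))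
        ≡⟨ cong₂ _+F_ (trans (ofO-q (comb 1O x 1O y)) (evalQ-lin (ofO 1O) (proj₁ x) (ofO 1O) (proj₁ y)))
             (trans (ofO-⊖ (q x ⊕ q y)) (cong -F_ (trans (ofO-⊕ (q x) (q y)) (cong₂ _+F_ (ofO-q x) (ofO-q y))))) ⟩
      (((ofO 1O *F ofO 1O) *F Q L (proj₁ x)) +F (1F *F (((ofO 1O *F ofO 1O) *F B (proj₁ x) (proj₁ y)) +F ((ofO 1O *F ofO 1O) *F Q L (proj₁ y)))))
        +F (-F (Q L (proj₁ x) +F Q L (proj₁ y)))
        ≡⟨ cong (λ o → (((o *F o) *F Q L (proj₁ x)) +F (1F *F (((o *F o) *F B (proj₁ x) (proj₁ y)) +F ((o *F o) *F Q L (proj₁ y)))))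
        +F (-F (Q L (proj₁ x) +F Q L (proj₁ y)))) (ofO-int (+ 1)) ⟩
      (((1F *F 1F) *F Q L (proj₁ x)) +F (1F *F (((1F *F 1F) *F B (proj₁ x) (proj₁ y)) +F ((1F *F 1F) *F Q L (proj₁ y)))))
        +F (-F (Q L (proj₁ x) +F Q L (proj₁ y)))
        ≡⟨ polarise (Q L (proj₁ x)) (Q L (proj₁ y)) (B (proj₁ x) (proj₁ y)) ⟩
      B (proj₁ x) (proj₁ y) ∎
      where
      open ≡-Reasoning
      polarise : ∀ u v w → (((1F *F 1F) *F u) +F (1F *F (((1F *F 1F) *F w) +F ((1F *F 1F) *F v)))) +F (-F (u +F v)) ≡ w
      polarise = solve 3 (λ u v w → con (+ 1) :* con (+ 1) :* u :+ con (+ 1) :* (con (+ 1) :* con (+ 1) :* w :+ con (+ 1) :* con (+ 1) :* v) :+ :- (u :+ v) := w) refl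

    q-comb : ∀ α x β y → q (comb α x β y) ≡ α ⊗ α ⊗ q x ⊕ (α ⊗ β ⊗ b x y ⊕ β ⊗ β ⊗ q y)
    q-comb α x β y = ofO-injective _ _ (begin
      ofO (q (comb α x β y)) ≡⟨ trans (ofO-q (comb α x β y)) (evalQ-lin (ofO α) (proj₁ x) (ofO β) (proj₁ y)) ⟩
      ((ofO α *F ofO α) *F Q L (proj₁ x)) +F (1F *F (((ofO α *F ofO β) *F B (proj₁ x) (proj₁ y)) +F ((ofO β *F ofO β) *F Q L (proj₁ y))))
        ≡⟨ one* (((ofO α *F ofO α) *F Q L (proj₁ x))) (((ofO α *F ofO β) *F B (proj₁ x) (proj₁ y)) +F ((ofO β *F ofO β) *F Q L (proj₁ y))) ⟩
      ((ofO α *F ofO α) *F Q L (proj₁ x)) +F (((ofO α *F ofO β) *F B (proj₁ x) (proj₁ y)) +F ((ofO β *F ofO β) *F Q L (proj₁ y)))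
        ≡⟨ cong₂ _+F_ (m α α (q x) (ofO-q x)) (cong₂ _+F_ (m α β (b x y) (ofO-b x y)) (m β β (q y) (ofO-q y))) ⟩
      ofO (α ⊗ α ⊗ q x) +F (ofO (α ⊗ β ⊗ b x y) +F ofO (β ⊗ β ⊗ q y))
        ≡⟨ cong (ofO (α ⊗ α ⊗ q x) +F_) (ofO-⊕ (α ⊗ β ⊗ b x y) (β ⊗ β ⊗ q y)) ⟨
      ofO (α ⊗ α ⊗ q x) +F ofO (α ⊗ β ⊗ b x y ⊕ β ⊗ β ⊗ q y)
        ≡⟨ ofO-⊕ (α ⊗ α ⊗ q x) (α ⊗ β ⊗ b x y ⊕ β ⊗ β ⊗ q y) ⟨
      ofO (α ⊗ α ⊗ q x ⊕ (α ⊗ β ⊗ b x y ⊕ β ⊗ β ⊗ q y)) ∎)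
      where
      open ≡-Reasoning
      one* : ∀ u v → u +F (1F *F v) ≡ u +F v
      one* = solve 2 (λ u v → u :+ con (+ 1) :* v := u :+ v) refl
      m : ∀ α β γ {z} → ofO γ ≡ z → (ofO α *F ofO β) *F z ≡ ofO (α ⊗ β ⊗ γ)
      m α β γ refl = trans (cong (_*F ofO γ) (sym (ofO-⊗ α β))) (sym (ofO-⊗ (α ⊗ β) γ))

    b-comb : ∀ α x β y z → b (comb α x β y) z ≡ α ⊗ b x z ⊕ β ⊗ b y z
    b-comb α x β y z = ofO-injective _ _ (begin
      ofO (b (comb α x β y) z)    ≡⟨ trans (ofO-b (comb α x β y) z) (B-lin (ofO α) (proj₁ x) (ofO β) (proj₁ y) (proj₁ z)) ⟩
      (ofO α *F B (proj₁ x) (proj₁ z)) +F (ofO β *F B (proj₁ y) (proj₁ z))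
        ≡⟨ cong₂ _+F_ (m α (b x z) (ofO-b x z)) (m β (b y z) (ofO-b y z)) ⟩
      ofO (α ⊗ b x z) +F ofO (β ⊗ b y z) ≡⟨ ofO-⊕ (α ⊗ b x z) (β ⊗ b y z) ⟨
      ofO (α ⊗ b x z ⊕ β ⊗ b y z) ∎)
      where
      open ≡-Reasoning
      m : ∀ α γ {z} → ofO γ ≡ z → ofO α *F z ≡ ofO (α ⊗ γ)
      m α γ refl = sym (ofO-⊗ α γ)

    b-sym : ∀ x y → b x y ≡ b y x
    b-sym x y = ofO-injective _ _ (trans (ofO-b x y) (trans (B-sym (proj₁ x) (proj₁ y)) (sym (ofO-b y x))))

    b-diag : ∀ x → b x x ≡ q x ⊕ q x
    b-diag x = ofO-injective _ _ (trans (ofO-b x x) (trans (B-diag (proj₁ x))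
      (trans (sym (cong₂ _+F_ (ofO-q x) (ofO-q x))) (sym (ofO-⊕ (q x) (q x))))))

    -- Universality gives total positivity away from 0. The zero vector has value 0, hence the weak
    -- inequalities, and these hold for every combination formed later.
    nonneg : ∀ x → Nonneg (q x)
    nonneg x@(v , v∈) = cases (v ≈V? (λ _ → 0F))
      where
      τ0 : + 0 ≡ τ 0O
      τ0 = sym (trans (ℤ.+-identityˡ (t ℤ.* + 0)) (ℤ.*-zeroʳ t))
      Nonneg-0 : Nonneg 0O
      Nonneg-0 = ℤ.≤-reflexive τ0 , ℤ.≤-reflexive (trans (ℤ.*-zeroʳ Δ) (trans (sym (ℤ.*-zeroˡ (+ 0))) (cong₂ ℤ._*_ τ0 τ0)))
      weaken : TotPosO (q x) → Nonneg (q x)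
      weaken (0<τ , h) = ℤ.<⇒≤ 0<τ , ℤ.<⇒≤ h
      cases : Dec (v ≈V (λ _ → 0F)) → Nonneg (q x)
      cases (yes v≈0) = subst Nonneg (sym (ofO-zero (q x) (trans (ofO-q x) (trans (evalQ-cong v (λ _ → 0F) v≈0) evalQ-zero)))) Nonneg-0
      cases (no v≉0)  = weaken (TotPos⇒TotPosO (q x) (subst TotPos (sym (ofO-q x)) (proj₁ univ v v∈ v≉0)))

    universal : ∀ α → TotallyPositive α → ∃[ x ] q x ≡ α
    universal α (p , p′) = lift (proj₂ univ (ofO α) (α , refl) (TotPosO⇒TotPos α (p , p′)))
      where
      lift : ∃[ v ] (_∈L L v × ¬ (v ≈V (λ _ → 0F)) × Q L v ≡ ofO α) → ∃[ x ] q x ≡ α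
      lift (v , v∈ , _ , e) = (v , v∈) , ofO-injective _ _ (trans (ofO-q (v , v∈)) e)

    private
      symDet₂F : (p q s : F) → F
      symDet₂F p q s = (p *F s) +F (-F (q *F q))

      symDet₃F : (p q s r v u : F) → F
      symDet₃F p q s r v u = ((symDet₂F p q s *F u) +F (-F (s *F (r *F r)))) +F (-F (v *F ((p *F v) +F (-F (ι (+ 2) *F (q *F r))))))

      ofO-symDet₂ : ∀ p q s → ofO (symDet₂ p q s) ≡ symDet₂F (ofO p) (ofO q) (ofO s)
      ofO-symDet₂ p q s = trans (ofO-⊕ (p ⊗ s) (⊖ (q ⊗ q))) (cong₂ _+F_ (ofO-⊗ p s) (trans (ofO-⊖ (q ⊗ q)) (cong -F_ (ofO-⊗ q q))))

      ofO-symDet₃ : ∀ p q s r v u → ofO (symDet₃ p q s r v u) ≡ symDet₃F (ofO p) (ofO q) (ofO s) (ofO r) (ofO v) (ofO u)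
      ofO-symDet₃ p q s r v u = trans (ofO-⊕ (symDet₂ p q s ⊗ u ⊕ ⊖ (s ⊗ (r ⊗ r))) (⊖ (v ⊗ (p ⊗ v ⊕ ⊖ (int (+ 2) ⊗ (q ⊗ r))))))
        (cong₂ _+F_
          (trans (ofO-⊕ (symDet₂ p q s ⊗ u) (⊖ (s ⊗ (r ⊗ r)))) (cong₂ _+F_
            (trans (ofO-⊗ (symDet₂ p q s) u) (cong (_*F ofO u) (ofO-symDet₂ p q s)))
            (trans (ofO-⊖ (s ⊗ (r ⊗ r))) (cong -F_ (trans (ofO-⊗ s (r ⊗ r)) (cong (ofO s *F_) (ofO-⊗ r r)))))))
          (trans (ofO-⊖ (v ⊗ (p ⊗ v ⊕ ⊖ (int (+ 2) ⊗ (q ⊗ r))))) (cong -F_ (trans (ofO-⊗ v (p ⊗ v ⊕ ⊖ (int (+ 2) ⊗ (q ⊗ r)))) (cong (ofO v *F_)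
            (trans (ofO-⊕ (p ⊗ v) (⊖ (int (+ 2) ⊗ (q ⊗ r)))) (cong₂ _+F_ (ofO-⊗ p v)
              (trans (ofO-⊖ (int (+ 2) ⊗ (q ⊗ r))) (cong -F_ (trans (ofO-⊗ (int (+ 2)) (q ⊗ r)) (cong₂ _*F_ (ofO-int (+ 2)) (ofO-⊗ q r))))))))))))

      twice : ∀ s → ι (+ 2) *F s ≡ 0F → s ≡ 0F
      twice s h = field-domain (ι (+ 2)) s h (λ e → 2≢0 (ofO-zero (int (+ 2)) (trans (ofO-int (+ 2)) e)))
        where
        2≢0 : ¬ (int (+ 2) ≡ 0O)
        2≢0 ()

      -- The last column of the Gram matrix is a combination of the others.
      dependent : ∀ δ k₁ k₂ k₃ p q s r v u r' v' u' z₁ z₂ z₃ → z₁ ≡ 0F → z₂ ≡ 0F → z₃ ≡ 0F →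
        δ *F r' ≡ (k₁ *F z₁) +F ((k₂ *F p) +F (k₃ *F q)) →
        δ *F v' ≡ (k₁ *F z₂) +F ((k₂ *F q) +F (k₃ *F s)) →
        δ *F u' ≡ (k₁ *F z₃) +F ((k₂ *F r) +F (k₃ *F v)) →
        r ≡ r' → v ≡ v' → u ≡ u' →
        δ *F symDet₃F p q s r v u ≡ 0F
      dependent δ k₁ k₂ k₃ p q s r v u r' v' u' z₁ z₂ z₃ refl refl refl h₁ h₂ h₃ refl refl refl = begin
        δ *F symDet₃F p q s r v u
          ≡⟨ solve 7 (λ δ p q s r v u → δ :* ((p :* s :+ :- (q :* q)) :* u :+ :- (s :* (r :* r)) :+ :- (v :* (p :* v :+ :- (con (+ 2) :* (q :* r)))))
              := (p :* s :+ :- (q :* q)) :* (δ :* u) :+ (q :* v :+ :- (s :* r)) :* (δ :* r) :+ (q :* r :+ :- (p :* v)) :* (δ :* v))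
              refl δ p q s r v u ⟩
        (((symDet₂F p q s) *F (δ *F u)) +F (((q *F v) +F (-F (s *F r))) *F (δ *F r))) +F (((q *F r) +F (-F (p *F v))) *F (δ *F v))
          ≡⟨ cong₂ _+F_ (cong₂ _+F_ (cong (symDet₂F p q s *F_) h₃) (cong (((q *F v) +F (-F (s *F r))) *F_) h₁)) (cong (((q *F r) +F (-F (p *F v))) *F_) h₂) ⟩
        (((symDet₂F p q s) *F (k₁0 +F ((k₂ *F r) +F (k₃ *F v)))) +F (((q *F v) +F (-F (s *F r))) *F (k₁0 +F ((k₂ *F p) +F (k₃ *F q))))) +F (((q *F r) +F (-F (p *F v))) *F (k₁0 +F ((k₂ *F q) +F (k₃ *F s))))
          ≡⟨ solve 8 (λ k₁ k₂ k₃ p q s r v →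
               (p :* s :+ :- (q :* q)) :* (k₁ :* con (+ 0) :+ (k₂ :* r :+ k₃ :* v)) :+ (q :* v :+ :- (s :* r)) :* (k₁ :* con (+ 0) :+ (k₂ :* p :+ k₃ :* q))
               :+ (q :* r :+ :- (p :* v)) :* (k₁ :* con (+ 0) :+ (k₂ :* q :+ k₃ :* s)) := con (+ 0)) refl k₁ k₂ k₃ p q s r v ⟩
        0F ∎
        where
        open ≡-Reasoning
        k₁0 : F
        k₁0 = k₁ *F 0F

      blockDet : ∀ p q s c z₁ z₂ z₃ z₄ → c ≡ ι (+ 2) → z₁ ≡ 0F → z₂ ≡ 0F → z₃ ≡ 0F → z₄ ≡ 0F →
        S.detR c z₁ z₂ z₃ p q z₄ q s ≡ ι (+ 2) *F symDet₂F p q s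
      blockDet p q s _ _ _ _ _ refl refl refl refl refl = solve 3 (λ p q s → S.:det (con (+ 2)) (con (+ 0)) (con (+ 0)) (con (+ 0)) p q (con (+ 0)) q s
        := con (+ 2) :* (p :* s :+ :- (q :* q))) refl p q s

    -- If x, y, z are dependent, their Gram determinant vanishes, and it is twice `symDet₂` because
    -- x splits off with b(x,x) = 2. Otherwise Cramer's rule expresses a nonzero multiple of w by x,
    -- y, z, and the part along x contributes nothing to the products with y, z, w.
    rank : ∀ x y z w → q x ≡ 1O → b x y ≡ 0O → b x z ≡ 0O → b x w ≡ 0O →
           symDet₂ (b y y) (b y z) (b z z) ≡ 0O
           ⊎ symDet₃ (b y y) (b y z) (b z z) (b y w) (b z w) (b w w) ≡ 0O
    rank x@(x′ , _) y@(y′ , _) z@(z′ , _) w@(w′ , _) qx bxy bxz bxw = cases (det3 x′ y′ z′ ≟F 0F)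
      where
      z0 : ∀ u v → b u v ≡ 0O → B (proj₁ u) (proj₁ v) ≡ 0F
      z0 u v h = trans (sym (ofO-b u v)) (trans (cong ofO h) (ofO-int (+ 0)))
      z0′ : ∀ u v → b u v ≡ 0O → B (proj₁ v) (proj₁ u) ≡ 0F
      z0′ u v h = trans (B-sym (proj₁ v) (proj₁ u)) (z0 u v h)
      Bxx : B x′ x′ ≡ ι (+ 2)
      Bxx = trans (sym (ofO-b x x)) (trans (cong ofO (trans (b-diag x) (cong₂ _⊕_ qx qx))) (ofO-int (+ 2)))
      k₁ k₂ k₃ : F
      k₁ = det3 w′ y′ z′
      k₂ = det3 x′ w′ z′
      k₃ = det3 x′ y′ w′
      relation : ∀ v → det3 x′ y′ z′ *F B w′ v ≡ (k₁ *F B x′ v) +F ((k₂ *F B y′ v) +F (k₃ *F B z′ v))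
      relation v = begin
        det3 x′ y′ z′ *F B w′ v                              ≡⟨ +0* (det3 x′ y′ z′ *F B w′ v) (B w′ v) ⟨
        (det3 x′ y′ z′ *F B w′ v) +F (0F *F B w′ v)          ≡⟨ B-lin (det3 x′ y′ z′) w′ 0F w′ v ⟨
        B (lin (det3 x′ y′ z′) w′ 0F w′) v                   ≡⟨ B-cong (lin (det3 x′ y′ z′) w′ 0F w′) (lin k₁ x′ 1F (lin k₂ y′ k₃ z′)) v v (cramer x′ y′ z′ w′) (λ _ → refl) ⟩
        B (lin k₁ x′ 1F (lin k₂ y′ k₃ z′)) v                 ≡⟨ B-lin k₁ x′ 1F (lin k₂ y′ k₃ z′) v ⟩
        (k₁ *F B x′ v) +F (1F *F B (lin k₂ y′ k₃ z′) v)      ≡⟨ cong (λ s → (k₁ *F B x′ v) +F (1F *F s)) (B-lin k₂ y′ k₃ z′ v) ⟩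
        (k₁ *F B x′ v) +F (1F *F ((k₂ *F B y′ v) +F (k₃ *F B z′ v))) ≡⟨ +1* (k₁ *F B x′ v) ((k₂ *F B y′ v) +F (k₃ *F B z′ v)) ⟩
        (k₁ *F B x′ v) +F ((k₂ *F B y′ v) +F (k₃ *F B z′ v)) ∎
        where
        open ≡-Reasoning
        +0* : ∀ u v → u +F (0F *F v) ≡ u
        +0* = solve 2 (λ u v → u :+ con (+ 0) :* v := u) refl
        +1* : ∀ u v → u +F (1F *F v) ≡ u +F v
        +1* = solve 2 (λ u v → u :+ con (+ 1) :* v := u :+ v) refl
      cases : Dec (det3 x′ y′ z′ ≡ 0F) → symDet₂ (b y y) (b y z) (b z z) ≡ 0O
           ⊎ symDet₃ (b y y) (b y z) (b z z) (b y w) (b z w) (b w w) ≡ 0O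
      cases (yes δ≡0) = inj₁ (ofO-zero (symDet₂ (b y y) (b y z) (b z z)) (trans (ofO-symDet₂ (b y y) (b y z) (b z z))
        (trans (cong₃ (ofO-b y y) (ofO-b y z) (ofO-b z z))
          (twice (symDet₂F (B y′ y′) (B y′ z′) (B z′ z′)) (trans (sym (blockDet (B y′ y′) (B y′ z′) (B z′ z′) (B x′ x′) (B x′ y′) (B x′ z′) (B y′ x′) (B z′ x′) Bxx (z0 x y bxy) (z0 x z bxz) (z0′ x y bxy) (z0′ x z bxz)))
            (trans (cong (λ s → S.detR (B x′ x′) (B x′ y′) (B x′ z′) (B y′ x′) (B y′ y′) (B y′ z′) (B z′ x′) s (B z′ z′)) (B-sym y′ z′)) (det-gram x′ y′ z′ δ≡0)))))))
        where
        cong₃ : ∀ {a b c a' b' c'} → a ≡ a' → b ≡ b' → c ≡ c' → symDet₂F a b c ≡ symDet₂F a' b' c'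
        cong₃ refl refl refl = refl
      cases (no δ≢0) = inj₂ (ofO-zero (symDet₃ (b y y) (b y z) (b z z) (b y w) (b z w) (b w w)) (trans (ofO-symDet₃ (b y y) (b y z) (b z z) (b y w) (b z w) (b w w))
        (field-domain (det3 x′ y′ z′) (symDet₃F (ofO (b y y)) (ofO (b y z)) (ofO (b z z)) (ofO (b y w)) (ofO (b z w)) (ofO (b w w))) (dependent (det3 x′ y′ z′) k₁ k₂ k₃ (ofO (b y y)) (ofO (b y z)) (ofO (b z z)) (ofO (b y w)) (ofO (b z w)) (ofO (b w w))
          (B w′ y′) (B w′ z′) (B w′ w′) (B x′ y′) (B x′ z′) (B x′ w′) (z0 x y bxy) (z0 x z bxz) (z0 x w bxw)
          (trans (relation y′) (cong₂ (λ s t → (k₁ *F B x′ y′) +F ((k₂ *F s) +F (k₃ *F t))) (sym (ofO-b y y)) (sym (trans (ofO-b y z) (B-sym y′ z′)))))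
          (trans (relation z′) (cong₂ (λ s t → (k₁ *F B x′ z′) +F ((k₂ *F s) +F (k₃ *F t))) (sym (ofO-b y z)) (sym (ofO-b z z))))
          (trans (relation w′) (cong₂ (λ s t → (k₁ *F B x′ w′) +F ((k₂ *F s) +F (k₃ *F t))) (sym (ofO-b y w)) (sym (ofO-b z w))))
          (trans (ofO-b y w) (B-sym y′ w′)) (trans (ofO-b z w) (B-sym z′ w′)) (ofO-b w w)) δ≢0)))

    space : Space
    space = record { X = X ; q = q ; b = b ; comb = comb ; q-comb = q-comb ; b-comb = b-comb ; b-sym = b-sym ; b-diag = b-diag
      ; nonneg = nonneg ; universal = universal ; rank = rank ; domain = O-domain }

  -- Coordinates in a free lattice

  module FreeLattice (1<D : 1 ℕ.< D) (sf : Squarefree D) (L : QLattice)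
    (quadratic : IsQuadraticLattice L) (univ : Universal L) where
    open LatticeSpace 1<D sf L quadratic univ
    open Polar (form L)

    module _ (e : Fin 3 → V) (e∈ : ∀ i → _∈L L (e i)) (spans : ∀ v → _∈L L v → InSpan {3} e v) where

      e₀′ e₁′ e₂′ : X
      e₀′ = e zero , e∈ zero
      e₁′ = e (suc zero) , e∈ (suc zero)
      e₂′ = e (suc (suc zero)) , e∈ (suc (suc zero))

      -- Coordinates are recorded as an identity of linear functionals `b x`, since elements of `X`
      -- are functions paired with membership proofs and are not compared by equality.
      coordinates : ∀ x → ∃[ c ] ∃[ d ] ∃[ e ] (∀ y → b x y ≡ c ⊗ b e₀′ y ⊕ (d ⊗ b e₁′ y ⊕ e ⊗ b e₂′ y))
      coordinates (v , v∈) = expandBy (spans v v∈)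
        where
        expandBy : InSpan {3} e v → ∃[ c ] ∃[ d ] ∃[ f ] (∀ y → b (v , v∈) y ≡ c ⊗ b e₀′ y ⊕ (d ⊗ b e₁′ y ⊕ f ⊗ b e₂′ y))
        expandBy (k , k≡) = c , d , f , λ y → ofO-injective _ _ (begin
            ofO (b (v , v∈) y)
              ≡⟨ trans (ofO-b (v , v∈) y) (B-cong v w (proj₁ y) (proj₁ y) (λ i → trans (sym (k≡ i)) (regroup (ofO c *F e zero i) (ofO d *F e (suc zero) i) (ofO f *F e (suc (suc zero)) i))) (λ _ → refl)) ⟩
            B w (proj₁ y)
              ≡⟨ trans (B-lin (ofO c) (e zero) 1F w′ (proj₁ y)) (cong (λ s → (ofO c *F B (e zero) (proj₁ y)) +F (1F *F s)) (B-lin (ofO d) (e (suc zero)) (ofO f) (e (suc (suc zero))) (proj₁ y))) ⟩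
            (ofO c *F B (e zero) (proj₁ y)) +F (1F *F ((ofO d *F B (e (suc zero)) (proj₁ y)) +F (ofO f *F B (e (suc (suc zero))) (proj₁ y))))
              ≡⟨ cong₃ (m c (b e₀′ y) (ofO-b e₀′ y)) (m d (b e₁′ y) (ofO-b e₁′ y)) (m f (b e₂′ y) (ofO-b e₂′ y)) ⟩
            ofO (c ⊗ b e₀′ y) +F (1F *F (ofO (d ⊗ b e₁′ y) +F ofO (f ⊗ b e₂′ y)))
              ≡⟨ +1* (ofO (c ⊗ b e₀′ y)) (ofO (d ⊗ b e₁′ y) +F ofO (f ⊗ b e₂′ y)) ⟩
            ofO (c ⊗ b e₀′ y) +F (ofO (d ⊗ b e₁′ y) +F ofO (f ⊗ b e₂′ y))
              ≡⟨ trans (ofO-⊕ (c ⊗ b e₀′ y) (d ⊗ b e₁′ y ⊕ f ⊗ b e₂′ y)) (cong (ofO (c ⊗ b e₀′ y) +F_) (ofO-⊕ (d ⊗ b e₁′ y) (f ⊗ b e₂′ y))) ⟨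
            ofO (c ⊗ b e₀′ y ⊕ (d ⊗ b e₁′ y ⊕ f ⊗ b e₂′ y)) ∎)
          where
          open ≡-Reasoning
          c d f : O
          c = k zero
          d = k (suc zero)
          f = k (suc (suc zero))
          w w′ : V
          w′ = lin (ofO d) (e (suc zero)) (ofO f) (e (suc (suc zero)))
          w = lin (ofO c) (e zero) 1F w′
          cong₃ : ∀ {x y z x' y' z'} → x ≡ x' → y ≡ y' → z ≡ z' → x +F (1F *F (y +F z)) ≡ x' +F (1F *F (y' +F z'))
          cong₃ refl refl refl = refl
          m : ∀ α γ {z} → ofO γ ≡ z → ofO α *F z ≡ ofO (α ⊗ γ)
          m α γ refl = sym (ofO-⊗ α γ)
          +1* : ∀ u v → u +F (1F *F v) ≡ u +F v
          +1* = SolverF.solve 2 (λ u v → u SolverF.:+ SolverF.con (+ 1) SolverF.:* v SolverF.:= u SolverF.:+ v) refl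
          regroup : ∀ x y z → x +F (y +F (z +F 0F)) ≡ x +F (1F *F (y +F z))
          regroup = SolverF.solve 3 (λ x y z → x SolverF.:+ (y SolverF.:+ (z SolverF.:+ SolverF.con (+ 0))) SolverF.:= x SolverF.:+ SolverF.con (+ 1) SolverF.:* (y SolverF.:+ z)) refl

-- Inequalities between integers

module _ where
  open I using (_:+_; _:*_; :-_; _:-_; _:=_; con)

  0≤* : ∀ {i j} → + 0 ℤ.≤ i → + 0 ℤ.≤ j → + 0 ℤ.≤ i ℤ.* j
  0≤* {+ m} {+ k} _ _ = subst (+ 0 ℤ.≤_) (ℤ.pos-* m k) (ℤ.+≤+ ℕ.z≤n)

  0≤-cancel* : ∀ {i j} → + 0 ℤ.< i → + 0 ℤ.≤ i ℤ.* j → + 0 ℤ.≤ j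
  0≤-cancel* {+ suc m} {+ k} _ _ = ℤ.+≤+ ℕ.z≤n
  0≤-cancel* {+ zero}        (ℤ.+<+ ()) _
  0≤-cancel* {+ suc m} { -[1+ k ]} _ ()

  square≥0 : ∀ i → + 0 ℤ.≤ i ℤ.* i
  square≥0 (+ n)    = 0≤* {+ n} {+ n} (ℤ.+≤+ ℕ.z≤n) (ℤ.+≤+ ℕ.z≤n)
  square≥0 -[1+ n ] = ℤ.+≤+ ℕ.z≤n

  <⇒0< : ∀ {i j} → i ℤ.< j → + 0 ℤ.< j ℤ.- i
  <⇒0< {i} {j} h = subst (ℤ._< j ℤ.- i) (ℤ.+-inverseʳ i) (ℤ.+-monoˡ-< (ℤ.- i) h)

  0<⇒< : ∀ {i j} → + 0 ℤ.< j ℤ.- i → i ℤ.< j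
  0<⇒< {i} {j} h = subst₂ ℤ._<_ (ℤ.+-identityˡ i) (I.solve 2 (λ i j → (j :- i) :+ i := j) refl i j) (ℤ.+-monoˡ-< i h)

  0<* : ∀ {i j} → + 0 ℤ.< i → + 0 ℤ.< j → + 0 ℤ.< i ℤ.* j
  0<* {+ suc m} {+ suc k} _ _ = ℤ.+<+ ℕ.z<s
  0<* {+ zero} (ℤ.+<+ ()) _
  0<* {+ suc m} {+ zero} _ (ℤ.+<+ ())

  -- If q + p were negative, then q - p = 2q - (q + p) would be positive and the product q² - p²
  -- negative.
  sum-nonneg : ∀ p q → + 0 ℤ.≤ q → + 0 ℤ.≤ q ℤ.* q ℤ.- p ℤ.* p → + 0 ℤ.≤ q ℤ.+ p
  sum-nonneg p q 0≤q h with + 0 ℤ.≤? q ℤ.+ p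
  ... | yes k = k
  ... | no ¬k = ⊥-elim (ℤ.≤⇒≯ h′ (ℤ.neg-cancel-< (subst (+ 0 ℤ.<_) neg (0<* 0<a 0<b))))
    where
    a b : ℤ
    a = ℤ.- (q ℤ.+ p)
    b = q ℤ.- p
    0<a : + 0 ℤ.< a
    0<a = ℤ.neg-mono-< (ℤ.≰⇒> ¬k)
    0<b : + 0 ℤ.< b
    0<b = subst (+ 0 ℤ.<_) (I.solve 2 (λ q p → (:- (q :+ p)) :+ (q :+ q) := q :- p) refl q p)
            (ℤ.+-mono-<-≤ 0<a (ℤ.+-mono-≤ 0≤q 0≤q))
    h′ : + 0 ℤ.≤ (q ℤ.+ p) ℤ.* (q ℤ.- p)
    h′ = subst (+ 0 ℤ.≤_) (I.solve 2 (λ q p → q :* q :- p :* p := (q :+ p) :* (q :- p)) refl q p) h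
    neg : a ℤ.* b ≡ ℤ.- ((q ℤ.+ p) ℤ.* (q ℤ.- p))
    neg = I.solve 2 (λ q p → (:- (q :+ p)) :* (q :- p) := :- ((q :+ p) :* (q :- p))) refl q p

-- Finite enumerations and Boolean tests

-- `half` is nonnegativity in the lexicographic order of the coordinates, so every element or its
-- negative passes it.
isZero half : O → Bool
isZero (+ zero , + zero) = true
isZero _                 = false
half (+ suc _   , _)        = true
half (+ zero    , + _)      = true
half (+ zero    , -[1+ _ ]) = false
half (-[1+ _ ] , _)         = false

-- Of a pair (c , r) and its negative, at least one is canonical.
canon : O → O → Bool
canon c r = half c ∧ (if isZero c then half r else true)

-- The integer part of √(M/δ), by upward search. For δ ≥ 1 the fuel M is enough, because δ(k + 1)²
-- exceeds M once k = M.
root : ℕ → ℕ → ℕ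
root δ M = go M 0
  module Root where
  go : ℕ → ℕ → ℕ
  go zero       k = k
  go (suc fuel) k = if M ℕ.<ᵇ δ ℕ.* (suc k ℕ.* suc k) then k else go fuel (suc k)

-- The order m, ..., 0, -m, ..., -1 matters: the branches of a certificate are matched with an
-- enumeration position by position.
ints : ℕ → List ℤ
ints m = map +_ (downFrom (suc m)) ++ map -[1+_] (downFrom m)

T∧ : ∀ {x y} → T (x ∧ y) → T x × T y
T∧ = Equivalence.to T-∧

∧T : ∀ {x y} → T x → T y → T (x ∧ y)
∧T p q = Equivalence.from T-∧ (p , q)

T-not : ∀ {x} → T (not x) → ¬ T x
T-not {false} _ ()

T-not∨ : ∀ {x y} → T (not x ∨ y) → T x → T y
T-not∨ {true} h _ = h

root-> : ∀ δ M → .{{ℕ.NonZero δ}} → M ℕ.< δ ℕ.* (suc (root δ M) ℕ.* suc (root δ M))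
root-> δ M = bound M 0 (ℕ.≤-reflexive (sym (ℕ.+-identityʳ M)))
  where
  bound : ∀ fuel k → M ℕ.≤ fuel ℕ.+ k →
    M ℕ.< δ ℕ.* (suc (Root.go δ M fuel k) ℕ.* suc (Root.go δ M fuel k))
  bound zero k h = ℕ.≤-trans (ℕ.s≤s h) (ℕ.≤-trans (ℕ.m≤m*n (suc k) (suc k)) (ℕ.m≤n*m (suc k ℕ.* suc k) δ))
  bound (suc fuel) k h with M ℕ.<ᵇ δ ℕ.* (suc k ℕ.* suc k) in e
  ... | true  = ℕ.<ᵇ⇒< M _ (subst T (sym e) tt)
  ... | false = bound fuel (suc k) (ℕ.≤-trans h (ℕ.≤-reflexive (sym (ℕ.+-suc fuel k))))

root-≥ : ∀ δ M m → .{{ℕ.NonZero δ}} → δ ℕ.* (m ℕ.* m) ℕ.≤ M → m ℕ.≤ root δ M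
root-≥ δ M m h with m ℕ.≤? root δ M
... | yes p = p
... | no ¬p = ⊥-elim (ℕ.<-irrefl refl (ℕ.<-≤-trans (root-> δ M)
  (ℕ.≤-trans (ℕ.*-monoʳ-≤ δ (ℕ.*-mono-≤ (ℕ.≰⇒> ¬p) (ℕ.≰⇒> ¬p))) h)))

∈-ints : ∀ i m → ℤ.∣ i ∣ ℕ.≤ m → i ∈ ints m
∈-ints (+ k)    m h = ∈-++⁺ˡ (∈-map⁺ +_ (∈-downFrom⁺ (ℕ.s≤s h)))
∈-ints -[1+ k ] m h = ∈-++⁺ʳ (map +_ (downFrom (suc m))) (∈-map⁺ -[1+_] (∈-downFrom⁺ h))

-- Asymmetric by design: the check fails when the second list runs out first, so success provides a
-- partner for every element of the first list.
zipAll : {A B : Set} → (A → B → Bool) → List A → List B → Bool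
zipAll f []       _        = true
zipAll f (x ∷ xs) []       = false
zipAll f (x ∷ xs) (y ∷ ys) = f x y ∧ zipAll f xs ys

zipAll-sound : ∀ {A B : Set} (f : A → B → Bool) xs ys → T (zipAll f xs ys) → ∀ {x} → x ∈ xs → ∃[ y ] T (f x y)
zipAll-sound f (x ∷ xs) (y ∷ ys) h (here refl) = y , proj₁ (T∧ h)
zipAll-sound f (x ∷ xs) (y ∷ ys) h (there p)   = zipAll-sound f xs ys (proj₂ (T∧ {f x y} h)) p

all-sound : ∀ {A : Set} (f : A → Bool) xs → T (all f xs) → ∀ {x} → x ∈ xs → T (f x)
all-sound f xs h = lookup (all⁺ f xs h)

∈-filterᵇ : ∀ {A : Set} (f : A → Bool) {x xs} → x ∈ xs → T (f x) → x ∈ filterᵇ f xs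
∈-filterᵇ f = ∈-filter⁺ (T? ∘ f)

-- Necessary conditions for k to be a square (Euler's criterion).
eulerTest : (p : ℕ) .{{_ : ℕ.NonZero p}} → ℕ → ℕ → Bool
eulerTest p e k = (k % p) ℕ.^ e % p ℕ.≤ᵇ 1

isSquareMod16 : ℕ → Bool
isSquareMod16 r = (r ℕ.≡ᵇ 0) ∨ (r ℕ.≡ᵇ 1) ∨ (r ℕ.≡ᵇ 4) ∨ (r ℕ.≡ᵇ 9)

squareTest : ℕ → Bool
squareTest k = isSquareMod16 (k % 16) ∧ eulerTest 5 2 k ∧ eulerTest 7 3 k ∧ eulerTest 11 5 k ∧ eulerTest 13 6 k ∧ eulerTest 17 8 k

-- Each test depends only on a residue, so it is enough to run it on the squares of a complete
-- residue system.
squareTest-complete : ∀ m → T (squareTest (m ℕ.* m))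
squareTest-complete m = ∧T (residues 16 (λ k → isSquareMod16 (k % 16)) (λ k → cong isSquareMod16 (sym (m%n%n≡m%n k 16))) _)
  (∧T (euler 5 2 _) (∧T (euler 7 3 _) (∧T (euler 11 5 _) (∧T (euler 13 6 _) (euler 17 8 _)))))
  where
  residues : ∀ p .{{_ : ℕ.NonZero p}} (f : ℕ → Bool) → (∀ k → f k ≡ f (k % p)) →
    T (all (λ r → f (r ℕ.* r)) (downFrom p)) → T (f (m ℕ.* m))
  residues p f periodic h = subst T
    (trans (periodic (m % p ℕ.* (m % p))) (trans (cong f (sym (%-distribˡ-* m m p))) (sym (periodic (m ℕ.* m)))))
    (all-sound (λ r → f (r ℕ.* r)) (downFrom p) h (∈-downFrom⁺ (m%n<n m p)))
  euler : ∀ p e .{{_ : ℕ.NonZero p}} → T (all (λ r → eulerTest p e (r ℕ.* r)) (downFrom p)) → T (eulerTest p e (m ℕ.* m))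
  euler p e = residues p (eulerTest p e) (λ k → cong (λ r → r ℕ.^ e % p ℕ.≤ᵇ 1) (sym (m%n%n≡m%n k p)))

-- (α , (β , γs) ∷ …) says: take v₂ of norm α, split by b(v₁,v₂) ≥ 0 in the order of its enumeration,
-- in each branch take v₃ of norm β, and for each Gram matrix of v₁, v₂, v₃ some γ ∈ γs is not a norm.
Certificate : Set
Certificate = O × List (O × List O)

-- Numerical facts for large discriminants and for residues modulo 5

root-≤ : ∀ δ M → δ ℕ.* (root δ M ℕ.* root δ M) ℕ.≤ M
root-≤ δ M = bound M 0 (ℕ.≤-trans (ℕ.≤-reflexive (ℕ.*-zeroʳ δ)) ℕ.z≤n)
  where
  bound : ∀ fuel k → δ ℕ.* (k ℕ.* k) ℕ.≤ M → δ ℕ.* (Root.go δ M fuel k ℕ.* Root.go δ M fuel k) ℕ.≤ M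
  bound zero       k h = h
  bound (suc fuel) k h with M ℕ.<ᵇ δ ℕ.* (suc k ℕ.* suc k) in e
  ... | true  = h
  ... | false = bound fuel (suc k) (ℕ.≮⇒≥ (λ l → subst T e (ℕ.<⇒<ᵇ l)))

-- With r the integer part of √Δ, exactly one of r + 1 and r + 2 has the parity of t; it is the
-- least trace of a totally positive a + ω. The factor 40 is 8 · 5, from the trace bound for
-- products with a vector of norm 5.
minimalTrace : ∀ Δ t → t ℕ.≤ 1 → 1849 ℕ.≤ Δ →
  ∃[ a ] (let s = 2 ℕ.* a ℕ.+ t in Δ ℕ.< s ℕ.* s × 40 ℕ.* s ℕ.< Δ)
minimalTrace Δ t t≤1 1849≤Δ = a , lower , upper
  where
  r a s : ℕ
  r = root 1 Δ
  a = (r ℕ.+ 2 ℕ.∸ t) / 2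
  s = 2 ℕ.* a ℕ.+ t
  r≥43 : 43 ℕ.≤ r
  r≥43 = root-≥ 1 Δ 43 1849≤Δ
  t≤r+2 : t ℕ.≤ r ℕ.+ 2
  t≤r+2 = ℕ.≤-trans t≤1 (ℕ.≤-trans (ℕ.s≤s ℕ.z≤n) (ℕ.m≤n+m 2 r))
  s≤ : s ℕ.≤ r ℕ.+ 2
  s≤ = subst (s ℕ.≤_) (ℕ.m∸n+n≡m t≤r+2) (ℕ.+-monoˡ-≤ t (subst (ℕ._≤ r ℕ.+ 2 ℕ.∸ t) (ℕ.*-comm a 2) (m/n*n≤m (r ℕ.+ 2 ℕ.∸ t) 2)))
  s≥ : suc r ℕ.≤ s
  s≥ = ℕ.s≤s⁻¹ (begin
    suc (suc r)                          ≡⟨ ℕ.+-comm 2 r ⟩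
    r ℕ.+ 2                              ≡⟨ ℕ.m∸n+n≡m t≤r+2 ⟨
    r ℕ.+ 2 ℕ.∸ t ℕ.+ t                  ≡⟨ cong (ℕ._+ t) (m≡m%n+[m/n]*n (r ℕ.+ 2 ℕ.∸ t) 2) ⟩
    (r ℕ.+ 2 ℕ.∸ t) % 2 ℕ.+ a ℕ.* 2 ℕ.+ t ≤⟨ ℕ.+-monoˡ-≤ t (ℕ.+-mono-≤ (ℕ.s≤s⁻¹ (m%n<n (r ℕ.+ 2 ℕ.∸ t) 2)) (ℕ.≤-reflexive (ℕ.*-comm a 2))) ⟩
    suc s                                ∎)
    where open ℕ.≤-Reasoning
  lower : Δ ℕ.< s ℕ.* s
  lower = ℕ.<-≤-trans (root-> 1 Δ) (ℕ.≤-trans (ℕ.≤-reflexive (ℕ.*-identityˡ _)) (ℕ.*-mono-≤ s≥ s≥))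
  upper : 40 ℕ.* s ℕ.< Δ
  upper = begin-strict
    40 ℕ.* s                  ≤⟨ ℕ.*-monoʳ-≤ 40 s≤ ⟩
    40 ℕ.* (r ℕ.+ 2)          ≡⟨ solve 1 (λ r → con 40 :* (r :+ con 2) := con 40 :* r :+ con 80) refl r ⟩
    -- From r ≥ 43 follows 80 < 3r, which is why 43 = 40 + 3 suffices.
    40 ℕ.* r ℕ.+ 80           <⟨ ℕ.+-monoʳ-< (40 ℕ.* r) (ℕ.<-≤-trans (ℕ.≤ᵇ⇒≤ 81 129 tt) (ℕ.*-monoʳ-≤ 3 r≥43)) ⟩
    40 ℕ.* r ℕ.+ 3 ℕ.* r      ≡⟨ solve 1 (λ r → con 40 :* r :+ con 3 :* r := con 43 :* r) refl r ⟩
    43 ℕ.* r                  ≤⟨ ℕ.*-monoˡ-≤ r r≥43 ⟩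
    r ℕ.* r                   ≡⟨ ℕ.*-identityˡ (r ℕ.* r) ⟨
    1 ℕ.* (r ℕ.* r)           ≤⟨ root-≤ 1 Δ ⟩
    Δ                         ∎
    where
    open ℕ.≤-Reasoning
    open ℕS.+-*-Solver

-- For x₁, x₂, v of norms 1, 2, k / 4 with a = b(x₁,x₂), x = b(x₁,v), y = b(x₂,v): the Gram determinant vanishes.
degenerate : (k x y a : ℤ) → Bool
degenerate k x y a = does ((+ 8 ℤ.- a ℤ.* a) ℤ.* (k ℤ.- x ℤ.* x) ℤ.≟ (+ 2 ℤ.* y ℤ.- a ℤ.* x) ℤ.* (+ 2 ℤ.* y ℤ.- a ℤ.* x))

-- Hence x₁, x₂ and one of the vectors of norm 3 and 5 are linearly independent.
noPlane : T (all (λ a → all (λ b → all (λ g → not (degenerate (+ 12) b g a) ∨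
  all (λ c → all (λ e → not (degenerate (+ 20) c e a)) (ints 6)) (ints 4)) (ints 4)) (ints 3)) (ints 2))
noPlane = _

-- A fourth power is 0 or 1 modulo 5, whereas 2² and 3² are 4. The hypothesis concerns m² because m
-- will be the absolute value of a norm of either sign. All 25 pairs of residues are checked.
fourthPower-mod5 : ∀ m s k → + m ℤ.* + m ≡ (+ s ℤ.* + s) ℤ.* (+ s ℤ.* + s) ℤ.+ + 5 ℤ.* k →
  ¬ T ((m % 5 ℕ.≡ᵇ 2) ∨ (m % 5 ℕ.≡ᵇ 3))
fourthPower-mod5 m s k e bad = contradict (all-sound (test r) (downFrom 5)
    (all-sound (λ r → all (test r) (downFrom 5)) (downFrom 5) tt (∈-downFrom⁺ (m%n<n m 5))) (∈-downFrom⁺ (m%n<n s 5)))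
  where
  r r′ : ℕ
  r = m % 5
  r′ = s % 5
  residue : ℕ → ℕ → ℤ
  residue r r′ = + r ℤ.* + r ℤ.- (+ r′ ℤ.* + r′) ℤ.* (+ r′ ℤ.* + r′)
  test : ℕ → ℕ → Bool
  test r r′ = not (does (5 ℕ.∣? ℤ.∣ residue r r′ ∣)) ∨ not ((r ℕ.≡ᵇ 2) ∨ (r ℕ.≡ᵇ 3))
  decompose : ∀ k → + k ≡ + (k % 5) ℤ.+ + (k / 5) ℤ.* + 5
  decompose k = trans (cong +_ (m≡m%n+[m/n]*n k 5)) (trans (ℤ.pos-+ (k % 5) (k / 5 ℕ.* 5)) (cong (λ z → + (k % 5) ℤ.+ z) (ℤ.pos-* (k / 5) 5)))
  quotient : ∃[ z ] residue r r′ ≡ z ℤ.* + 5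
  quotient = residue≡ (+ r) (+ (m / 5)) (+ r′) (+ (s / 5)) k
      (subst₂ (λ x y → x ℤ.* x ≡ (y ℤ.* y) ℤ.* (y ℤ.* y) ℤ.+ + 5 ℤ.* k) (decompose m) (decompose s) e)
    where
    residue≡ : ∀ r w r′ v k → (r ℤ.+ w ℤ.* + 5) ℤ.* (r ℤ.+ w ℤ.* + 5)
        ≡ ((r′ ℤ.+ v ℤ.* + 5) ℤ.* (r′ ℤ.+ v ℤ.* + 5)) ℤ.* ((r′ ℤ.+ v ℤ.* + 5) ℤ.* (r′ ℤ.+ v ℤ.* + 5)) ℤ.+ + 5 ℤ.* k →
      ∃[ z ] r ℤ.* r ℤ.- (r′ ℤ.* r′) ℤ.* (r′ ℤ.* r′) ≡ z ℤ.* + 5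
    residue≡ r w r′ v k e = k ℤ.- + 2 ℤ.* r ℤ.* w ℤ.- + 5 ℤ.* w ℤ.* w ℤ.+ x ℤ.* (+ 2 ℤ.* r′ ℤ.* r′ ℤ.+ + 5 ℤ.* x) , trans
      (I.solve 4 (λ r w r′ v → let m = r I.:+ w I.:* I.con (+ 5) in
          r I.:* r I.:- (r′ I.:* r′) I.:* (r′ I.:* r′) I.:= m I.:* m I.:- (I.con (+ 2) I.:* r I.:* w I.:+ I.con (+ 5) I.:* w I.:* w) I.:* I.con (+ 5) I.:- (r′ I.:* r′) I.:* (r′ I.:* r′)) refl r w r′ v)
      (trans (cong (λ x → x ℤ.- (+ 2 ℤ.* r ℤ.* w ℤ.+ + 5 ℤ.* w ℤ.* w) ℤ.* + 5 ℤ.- (r′ ℤ.* r′) ℤ.* (r′ ℤ.* r′)) e)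
        (I.solve 5 (λ r w r′ v k → let s = r′ I.:+ v I.:* I.con (+ 5) ; x = I.con (+ 2) I.:* r′ I.:* v I.:+ I.con (+ 5) I.:* v I.:* v in
          (s I.:* s) I.:* (s I.:* s) I.:+ I.con (+ 5) I.:* k I.:- (I.con (+ 2) I.:* r I.:* w I.:+ I.con (+ 5) I.:* w I.:* w) I.:* I.con (+ 5) I.:- (r′ I.:* r′) I.:* (r′ I.:* r′)
          I.:= (k I.:- I.con (+ 2) I.:* r I.:* w I.:- I.con (+ 5) I.:* w I.:* w I.:+ x I.:* (I.con (+ 2) I.:* r′ I.:* r′ I.:+ I.con (+ 5) I.:* x)) I.:* I.con (+ 5)) refl r w r′ v k))
      where
      x : ℤ
      x = + 2 ℤ.* r′ ℤ.* v ℤ.+ + 5 ℤ.* v ℤ.* v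
  contradict : ¬ T (test r r′)
  contradict h = T-not (T-not∨ h (subst T (sym (dec-true (5 ℕ.∣? ℤ.∣ residue r r′ ∣)
      (ℕ.divides ℤ.∣ proj₁ quotient ∣ (trans (cong ℤ.∣_∣ (proj₂ quotient)) (ℤ.abs-* (proj₁ quotient) (+ 5)))))) tt)) bad

-- The certificate checker

module Quadratic (t n : ℤ) where
  open Forms t n
  private
    module SO = SolverO t n

  -- κ shears the box in which b(v₁,w) is searched; soundness needs (2κ + t)² ≤ Δ.
  module Check (κ : ℤ) where

    tr normO : O → ℤ
    tr (a , b) = a ℤ.+ a ℤ.+ t · b
    normO (a , b) = a · a ℤ.+ t · (a · b) ℤ.- n · (b · b)

    tnn totpos : O → Bool
    tnn x    = (+ 0 ℤ.≤ᵇ tr x) ∧ (+ 0 ℤ.≤ᵇ normO x)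
    totpos x = (+ 1 ℤ.≤ᵇ tr x) ∧ (+ 1 ℤ.≤ᵇ normO x)

    -- Here `z` is x̄y, so the quotient y/x = z/N(x) is integral when N(x) divides both coordinates
    -- of `z`.
    divides : O → O → Bool
    divides x y = does (ℤ.∣ normO x ∣ ℕ.∣? ℤ.∣ proj₁ z ∣) ∧ does (ℤ.∣ normO x ∣ ℕ.∣? ℤ.∣ proj₂ z ∣)
      where
      z : O
      z = (proj₁ x ℤ.+ t ℤ.* proj₂ x , ℤ.- proj₂ x) ⊗ y

    -- The norm of x / 4 has no square divisor m² with m > 1 and m ≢ ±2 mod 5.
    primitive5 : O → Bool
    primitive5 x = all (λ m → (m ℕ.<ᵇ 2) ∨ (m % 5 ℕ.≡ᵇ 2) ∨ (m % 5 ℕ.≡ᵇ 3) ∨ not (does (m ℕ.* m ℕ.∣? k))) (downFrom (suc (root 1 k)))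
      where
      k : ℕ
      k = ℤ.∣ normO x ∣ / 16

    -- All b for which P − b² is totally nonnegative.
    slope : ℤ → ℤ
    slope v = if + 0 ℤ.≤ᵇ v then κ else ℤ.- κ ℤ.- t

    bounded : O → List O
    bounded P = sheared (slope (proj₂ P))
      where
      sheared : ℤ → List O
      sheared k = filterᵇ (λ b → tnn (P ⊕ ⊖ (b ⊗ b))) (map (λ (d , y) → k · y ℤ.+ d , y)
        (cartesianProduct (ints (root 1 ℤ.∣ M ℤ.- (k ℤ.+ k ℤ.+ t) · (proj₂ P ℤ.+ proj₂ P) ∣ / 2)) (ints (root ℤ.∣ Δ ∣ ℤ.∣ M ∣))))
        where
        M : ℤ
        M = tr P ℤ.+ tr P

    -- The possible values of h(x,w), where a = b(v₁,x), k = h(x,x)h(w,w), c = b(v₁,w) and b(x,w) ∈ bs.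
    cross : (a k c : O) → List O → List O
    cross a k c bs = filterᵇ (λ r → tnn (k ⊕ ⊖ (r ⊗ r))) (shifts (⊖ (a ⊗ c)))
      where
      shifts : O → List O
      shifts m = map (λ e → e ⊕ e ⊕ m) bs

    tag : O → O → O × ℕ
    tag k r = r , ℤ.∣ normO (k ⊕ ⊖ (r ⊗ r)) ∣

    -- For a vector x with a = b(v₁,x) and p = h(x,x): the possible b(v₁,w), h(w,w) and h(x,w), up to the sign of w.
    -- Each r = h(x,w) is paired with |N(h(x,x)h(w,w) − r²)|.
    Row : Set
    Row = O × O × List (O × ℕ)

    row : (a p : O) → List O → (c u : O) → Row
    row a p es c u = c , u , tagged (p ⊗ u)
      where
      tagged : O → List (O × ℕ)
      tagged k = map (tag k) (filterᵇ (canon c) (cross a k c es))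

    rows : (a p γ₄ : O) → (cs es : List O) → List Row
    rows a p γ₄ cs es = map (λ c → row a p es c (γ₄ ⊕ ⊖ (c ⊗ c))) (filterᵇ half cs)

    -- The data of v₄ that depend on v₂ and on the norm of v₃, but not on the products of v₃. They
    -- are prepared once in a branch and serve all Gram matrices of v₁, v₂, v₃ there.
    Prepared : Set
    Prepared = O × List Row × List O

    prepare : (α a p β γ : O) → Prepared
    prepare α a p β γ = γ , scaled (int (+ 4) ⊗ γ)
      where
      scaled : O → List Row × List O
      scaled γ₄ = rows a p γ₄ (bounded γ₄) (bounded (γ₄ ⊗ α)) , bounded (γ₄ ⊗ β)

    module _ (free : Bool) where

      -- True means that the configuration is impossible: either the determinant is nonzero, or the
      -- lattice is free, v₁, v₂, v₃ are forced to span it, and v₄ fails to have integral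
      -- coordinates.
      verdict : (X det d₂ d₃ : O) → Bool
      verdict X det d₂ d₃ = if isZero det then free ∧ not (divides X d₂ ∧ divides X d₃) ∧ primitive5 X else true

      -- With k = Xu − sr² and w = 2qr the second argument of verdict is symDet₃; for X ≠ 0 the
      -- third and fourth ones are X times the last two coordinates of a fourth vector.
      admissible : (p q s X r k w v : O) → Bool
      admissible p q s X r k w v = verdict X (k ⊕ ⊖ (v ⊗ (p ⊗ v ⊕ ⊖ w))) (s ⊗ r ⊕ ⊖ (q ⊗ v)) (p ⊗ v ⊕ ⊖ (q ⊗ r))

      module _ (p b s q X : O) where

        -- If the determinant vanishes, then (pv − qr)² = X(pu − r²).
        killedRow : O → List (O × ℕ) → List O → Bool
        killedRow u rs vs = all (λ (r , m) → not (squareTest (ℤ.∣ normO X ∣ ℕ.* m)) ∨ inner r (X ⊗ u ⊕ ⊖ (s ⊗ (r ⊗ r))) (q ⊗ r ⊕ q ⊗ r)) rs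
          where
          inner : (r k w : O) → Bool
          inner r k w = all (admissible p q s X r k w) vs

        killed : Prepared → Bool
        killed (γ , rws , fs) = totpos γ ∧ all (λ (c , u , rs) → killedRow u rs (cross b (s ⊗ u) c fs)) rws

        -- X ≠ 0 says that v₁, v₂, v₃ are independent. A certificate must choose β so that this
        -- holds for every possible Gram matrix.
        leaf : List Prepared → Bool
        leaf ps = totpos s ∧ not (isZero X) ∧ any killed ps

      branch : (α a : O) → O × List O → Bool
      branch α a (β , γs) = totpos β ∧ scaled (int (+ 4) ⊗ α ⊕ ⊖ (a ⊗ a)) (int (+ 4) ⊗ β)
        where
        leaves : (p : O) → List Prepared → List Row → Bool
        leaves p ps rws = all (λ (b , s , qs) → all (λ (q , _) → leaf p b s q (symDet₂ p q s) ps) qs) rws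
        scaled : (p β₄ : O) → Bool
        scaled p β₄ = totpos p ∧ leaves p (map (prepare α a p β) γs) (rows a p β₄ (bounded β₄) (bounded (β₄ ⊗ α)))

      check : Certificate → Bool
      check (α , bs) = totpos α ∧ zipAll (branch α) (filterᵇ half (bounded (int (+ 4) ⊗ α))) bs

    normO≡ : ∀ a b → normO (a , b) ≡ a ℤ.* a ℤ.+ t ℤ.* (a ℤ.* b) ℤ.- n ℤ.* (b ℤ.* b)
    normO≡ a b = cong₂ ℤ._-_
      (cong₂ ℤ._+_ (·≡* a a) (trans (·≡* t (a · b)) (cong (t ℤ.*_) (·≡* a b))))
      (trans (·≡* n (b · b)) (cong (n ℤ.*_) (·≡* b b)))

    normO-* : ∀ x y → normO (x ⊗ y) ≡ normO x ℤ.* normO y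
    normO-* (a , b) (c , d) = trans (cong normO (⊗-def a b c d)) (trans (normO≡ (a ℤ.* c ℤ.+ n ℤ.* (b ℤ.* d)) (a ℤ.* d ℤ.+ b ℤ.* c ℤ.+ t ℤ.* (b ℤ.* d)))
      (trans (I.solve 6 (λ t n a b c d →
          let e = a I.:* c I.:+ n I.:* (b I.:* d)
              f = a I.:* d I.:+ b I.:* c I.:+ t I.:* (b I.:* d)
              N = λ a b → a I.:* a I.:+ t I.:* (a I.:* b) I.:- n I.:* (b I.:* b)
          in N e f I.:= N a b I.:* N c d) refl t n a b c d)
        (sym (cong₂ ℤ._*_ (normO≡ a b) (normO≡ c d)))))

    ∣normO∣-* : ∀ x y → ℤ.∣ normO (x ⊗ y) ∣ ≡ ℤ.∣ normO x ∣ ℕ.* ℤ.∣ normO y ∣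
    ∣normO∣-* x y = trans (cong ℤ.∣_∣ (normO-* x y)) (ℤ.abs-* (normO x) (normO y))

  -- Totally nonnegative elements and bounds for square roots

  module Positivity (0<Δ : + 0 ℤ.< Δ) where

    module _ where
      open I using (_:+_; _:*_; :-_; _:-_; _:=_; con)

      private
        0≤Δ : + 0 ℤ.≤ Δ
        0≤Δ = ℤ.<⇒≤ 0<Δ

      conjO : O → O
      conjO (a , b) = a ℤ.+ t ℤ.* b , ℤ.- b

      norm : O → ℤ
      norm (a , b) = a ℤ.* a ℤ.+ t ℤ.* (a ℤ.* b) ℤ.- n ℤ.* (b ℤ.* b)

      conj*-cancel : ∀ x y → conjO x ⊗ (x ⊗ y) ≡ int (norm x) ⊗ y
      conj*-cancel (a , b) (c , d) = trans (trans (cong (conjO (a , b) ⊗_) (⊗-def a b c d))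
        (⊗-def (a ℤ.+ t ℤ.* b) (ℤ.- b) (a ℤ.* c ℤ.+ n ℤ.* (b ℤ.* d)) (a ℤ.* d ℤ.+ b ℤ.* c ℤ.+ t ℤ.* (b ℤ.* d))))
        (trans (cong₂ _,_
        (I.solve 6 (λ t n a b c d →
           (a :+ t :* b) :* (a :* c :+ n :* (b :* d)) :+ n :* ((:- b) :* (a :* d :+ b :* c :+ t :* (b :* d)))
           := (a :* a :+ t :* (a :* b) :- n :* (b :* b)) :* c :+ n :* (con (+ 0) :* d)) refl t n a b c d)
        (I.solve 6 (λ t n a b c d →
           (a :+ t :* b) :* (a :* d :+ b :* c :+ t :* (b :* d)) :+ (:- b) :* (a :* c :+ n :* (b :* d)) :+ t :* ((:- b) :* (a :* d :+ b :* c :+ t :* (b :* d)))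
           := (a :* a :+ t :* (a :* b) :- n :* (b :* b)) :* d :+ con (+ 0) :* c :+ t :* (con (+ 0) :* d)) refl t n a b c d))
        (sym (⊗-def (norm (a , b)) (+ 0) c d)))

      -- The trace satisfies 2τ(xy) = τ(x)τ(y) + Δbd, and the hypotheses give |Δbd| ≤ τ(x)τ(y). The
      -- second condition holds because τ² - Δb², four times the norm, is multiplicative up to the
      -- factor 4.
      Nonneg-⊗ : ∀ x y → Nonneg x → Nonneg y → Nonneg (x ⊗ y)
      Nonneg-⊗ x@(a , b) y@(c , d) (0≤τx , x≤) (0≤τy , y≤) = subst Nonneg (sym (⊗-def a b c d)) (
          0≤-cancel* {+ 2} (ℤ.+<+ ℕ.z<s) (subst (+ 0 ℤ.≤_) trace (sum-nonneg p q (0≤* 0≤τx 0≤τy) 0≤q²-p²))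
        , ℤ.0≤i-j⇒j≤i (0≤-cancel* {+ 4} (ℤ.+<+ ℕ.z<s) (subst (+ 0 ℤ.≤_) norms (0≤* (ℤ.i≤j⇒0≤j-i x≤) (ℤ.i≤j⇒0≤j-i y≤)))))
        where
        z : O
        z = a ℤ.* c ℤ.+ n ℤ.* (b ℤ.* d) , a ℤ.* d ℤ.+ b ℤ.* c ℤ.+ t ℤ.* (b ℤ.* d)
        p q : ℤ
        p = Δ ℤ.* (b ℤ.* d)
        q = τ x ℤ.* τ y
        trace : q ℤ.+ p ≡ + 2 ℤ.* τ z
        trace = I.solve 6 (λ t n a b c d →
           (con (+ 2) :* a :+ t :* b) :* (con (+ 2) :* c :+ t :* d) :+ (t :* t :+ con (+ 4) :* n) :* (b :* d)
           := con (+ 2) :* (con (+ 2) :* (a :* c :+ n :* (b :* d)) :+ t :* (a :* d :+ b :* c :+ t :* (b :* d)))) refl t n a b c d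
        norms : (τ x ℤ.* τ x ℤ.- Δ ℤ.* (b ℤ.* b)) ℤ.* (τ y ℤ.* τ y ℤ.- Δ ℤ.* (d ℤ.* d))
              ≡ + 4 ℤ.* (τ z ℤ.* τ z ℤ.- Δ ℤ.* (proj₂ z ℤ.* proj₂ z))
        norms = I.solve 6 (λ t n a b c d →
           let τx = con (+ 2) :* a :+ t :* b
               τy = con (+ 2) :* c :+ t :* d
               Δ  = t :* t :+ con (+ 4) :* n
               e  = a :* c :+ n :* (b :* d)
               f  = a :* d :+ b :* c :+ t :* (b :* d)
               τz = con (+ 2) :* e :+ t :* f
           in (τx :* τx :- Δ :* (b :* b)) :* (τy :* τy :- Δ :* (d :* d)) := con (+ 4) :* (τz :* τz :- Δ :* (f :* f))) refl t n a b c d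
        0≤q²-p² : + 0 ℤ.≤ q ℤ.* q ℤ.- p ℤ.* p
        0≤q²-p² = subst (+ 0 ℤ.≤_)
          (I.solve 5 (λ u v Δ b d → (u :* u :- Δ :* (b :* b)) :* (v :* v) :+ (Δ :* (b :* b)) :* (v :* v :- Δ :* (d :* d))
              := (u :* v) :* (u :* v) :- (Δ :* (b :* d)) :* (Δ :* (b :* d))) refl (τ x) (τ y) Δ b d)
          (ℤ.+-mono-≤ (0≤* (ℤ.i≤j⇒0≤j-i x≤) (square≥0 (τ y))) (0≤* (0≤* 0≤Δ (square≥0 b)) (ℤ.i≤j⇒0≤j-i y≤)))

      TotPos⇒0<norm : ∀ x → TotallyPositive x → + 0 ℤ.< norm x
      TotPos⇒0<norm x@(a , b) (_ , h) = ℤ.*-cancelˡ-<-nonNeg (+ 4) (subst (+ 0 ℤ.<_)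
        (I.solve 4 (λ t n a b → (con (+ 2) :* a :+ t :* b) :* (con (+ 2) :* a :+ t :* b) :- (t :* t :+ con (+ 4) :* n) :* (b :* b)
           := con (+ 4) :* (a :* a :+ t :* (a :* b) :- n :* (b :* b))) refl t n a b) (<⇒0< h))

      Nonneg-conj : ∀ x → Nonneg x → Nonneg (conjO x)
      Nonneg-conj (a , b) (p , q) = subst (+ 0 ℤ.≤_) e p , subst₂ ℤ._≤_ (cong (Δ ℤ.*_) (I.solve 1 (λ b → b :* b := (:- b) :* (:- b)) refl b)) (cong₂ ℤ._*_ e e) q
        where
        e : τ (a , b) ≡ τ (conjO (a , b))
        e = I.solve 3 (λ t a b → con (+ 2) :* a :+ t :* b := con (+ 2) :* (a :+ t :* b) :+ t :* (:- b)) refl t a b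

      TotPos⇒Nonneg : ∀ x → TotallyPositive x → Nonneg x
      TotPos⇒Nonneg x (p , q) = ℤ.<⇒≤ p , ℤ.<⇒≤ q

      Nonneg-cancel-int : ∀ m y → + 0 ℤ.< m → Nonneg (int m ⊗ y) → Nonneg y
      Nonneg-cancel-int m y@(c , d) 0<m hk with subst Nonneg (⊗-def m (+ 0) c d) hk
      ... | h , k =
          0≤-cancel* 0<m (subst (+ 0 ℤ.≤_)
            (I.solve 5 (λ t n m c d → con (+ 2) :* (m :* c :+ n :* (con (+ 0) :* d)) :+ t :* (m :* d :+ con (+ 0) :* c :+ t :* (con (+ 0) :* d))
              := m :* (con (+ 2) :* c :+ t :* d)) refl t n m c d) h)
        , ℤ.0≤i-j⇒j≤i (0≤-cancel* (0<* 0<m 0<m) (subst (+ 0 ℤ.≤_)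
            (I.solve 5 (λ t n m c d →
              let e = m :* c :+ n :* (con (+ 0) :* d)
                  f = m :* d :+ con (+ 0) :* c :+ t :* (con (+ 0) :* d)
                  τz = con (+ 2) :* e :+ t :* f
                  τy = con (+ 2) :* c :+ t :* d
                  Δ = t :* t :+ con (+ 4) :* n
              in τz :* τz :- Δ :* (f :* f) := m :* m :* (τy :* τy :- Δ :* (d :* d))) refl t n m c d) (ℤ.i≤j⇒0≤j-i k)))

      -- Multiplication by the conjugate of x, again totally nonnegative, turns the factor x into
      -- the positive integer N(x), which can be cancelled coordinatewise.
      Nonneg-cancel : ∀ x y → TotallyPositive x → Nonneg (x ⊗ y) → Nonneg y
      Nonneg-cancel x y x>0 h = Nonneg-cancel-int (norm x) y (TotPos⇒0<norm x x>0)
        (subst Nonneg (conj*-cancel x y) (Nonneg-⊗ (conjO x) (x ⊗ y) (Nonneg-conj x (TotPos⇒Nonneg x x>0)) h))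

      -- Since 2τ(b²) = τ(b)² + Δd², the inequality τ(b²) ≤ τ(P) bounds the ω-coordinate d of b.
      trace-bound : ∀ P b → Nonneg (P ⊕ ⊖ (b ⊗ b)) → Δ ℤ.* (proj₂ b ℤ.* proj₂ b) ℤ.≤ + 2 ℤ.* τ P
      trace-bound (u , v) b@(c , d) hk with subst (λ z → Nonneg ((u , v) ⊕ ⊖ z)) (⊗-def c d c d) hk
      ... | h , _ =
          ℤ.0≤i-j⇒j≤i (subst (+ 0 ℤ.≤_) (I.solve 3 (λ x y z → (z :- (x :+ y)) :+ x := z :- y) refl (τ b ℤ.* τ b) (Δ ℤ.* (d ℤ.* d)) (+ 2 ℤ.* τ (u , v)))
            (ℤ.+-mono-≤ base (square≥0 (τ b))))
        where
        base : + 0 ℤ.≤ + 2 ℤ.* τ (u , v) ℤ.- (τ b ℤ.* τ b ℤ.+ Δ ℤ.* (d ℤ.* d))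
        base = subst (+ 0 ℤ.≤_) (I.solve 6 (λ t n u v c d →
            let e = c :* c :+ n :* (d :* d)
                f = c :* d :+ d :* c :+ t :* (d :* d)
                τb = con (+ 2) :* c :+ t :* d
            in con (+ 2) :* (con (+ 2) :* (u :+ :- e) :+ t :* (v :+ :- f)) := con (+ 2) :* (con (+ 2) :* u :+ t :* v) :- (τb :* τb :+ (t :* t :+ con (+ 4) :* n) :* (d :* d)))
            refl t n u v c d) (0≤* {+ 2} (ℤ.+≤+ ℕ.z≤n) h)

      -- For σ = ±√Δ this would say that one conjugate of b has its square at most the same
      -- conjugate of P. An integer σ with σ² ≤ Δ approximates it: if P - b² has trace A and
      -- ω-coordinate B, then A ≥ |σB|, and the defect (Δ - σ²)d² has the right sign. When the
      -- conjugates of P differ greatly in size, this replaces a wide box by a thin one.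
      shear-bound : ∀ σ P b → σ ℤ.* σ ℤ.≤ Δ → Nonneg (P ⊕ ⊖ (b ⊗ b)) →
        (τ b ℤ.- σ ℤ.* proj₂ b) ℤ.* (τ b ℤ.- σ ℤ.* proj₂ b) ℤ.≤ + 2 ℤ.* (τ P ℤ.- σ ℤ.* proj₂ P)
      shear-bound σ (u , v) b@(c , d) σ²≤Δ hk with subst (λ z → Nonneg ((u , v) ⊕ ⊖ z)) (⊗-def c d c d) hk
      ... | h , k = ℤ.0≤i-j⇒j≤i (subst (+ 0 ℤ.≤_) (I.solve 7 (λ t n u v c d σ →
            let τb = con (+ 2) :* c :+ t :* d
                A  = con (+ 2) :* (u :+ :- (c :* c :+ n :* (d :* d))) :+ t :* (v :+ :- (c :* d :+ d :* c :+ t :* (d :* d)))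
                B  = v :+ :- (c :* d :+ d :* c :+ t :* (d :* d))
                Δ  = t :* t :+ con (+ 4) :* n
            in con (+ 2) :* (A :+ :- (σ :* B)) :+ (Δ :- σ :* σ) :* (d :* d)
                 := con (+ 2) :* (con (+ 2) :* u :+ t :* v :- σ :* v) :- (τb :- σ :* d) :* (τb :- σ :* d)) refl t n u v c d σ)
          (ℤ.+-mono-≤ (0≤* {+ 2} (ℤ.+≤+ ℕ.z≤n) (sum-nonneg (ℤ.- (σ ℤ.* B)) A h
            (subst (+ 0 ℤ.≤_) (I.solve 4 (λ A B σ Δ → (A :* A :- Δ :* (B :* B)) :+ (Δ :- σ :* σ) :* (B :* B)
                := A :* A :- (:- (σ :* B)) :* (:- (σ :* B))) refl A B σ Δ)
              (ℤ.+-mono-≤ (ℤ.i≤j⇒0≤j-i k) (0≤* (ℤ.i≤j⇒0≤j-i σ²≤Δ) (square≥0 B))))))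
            (0≤* (ℤ.i≤j⇒0≤j-i σ²≤Δ) (square≥0 d))))
        where
        A B : ℤ
        A = τ ((u , v) ⊕ ⊖ (c ℤ.* c ℤ.+ n ℤ.* (d ℤ.* d) , c ℤ.* d ℤ.+ d ℤ.* c ℤ.+ t ℤ.* (d ℤ.* d)))
        B = v ℤ.+ ℤ.- (c ℤ.* d ℤ.+ d ℤ.* c ℤ.+ t ℤ.* (d ℤ.* d))

    -- Cauchy-Schwarz and the projection orthogonal to v₁

    module Projection (Sp : Space) where
      open Space Sp

      module _ where
        open SO using (solve; con; _:+_; _:*_; :-_; _:=_)

        half-neg : ∀ x → T (half x) ⊎ T (half (⊖ x))
        half-neg (+ suc _  , _)        = inj₁ tt
        half-neg (+ zero   , + _)      = inj₁ tt
        half-neg (+ zero   , -[1+ _ ]) = inj₂ tt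
        half-neg (-[1+ _ ] , _)        = inj₂ tt

        canon-neg : ∀ c r → T (canon c r) ⊎ T (canon (⊖ c) (⊖ r))
        canon-neg (+ zero    , + zero)   r = half-neg r
        canon-neg (+ zero    , + suc _)  r = inj₁ tt
        canon-neg (+ zero    , -[1+ _ ]) r = inj₂ tt
        canon-neg (+ suc _   , _)        r = inj₁ tt
        canon-neg (-[1+ _ ]  , _)        r = inj₂ tt

        negate : X → X
        negate x = comb (int -[1+ 0 ]) x 0O x

        q-negate : ∀ x → q (negate x) ≡ q x
        q-negate x = trans (q-comb (int -[1+ 0 ]) x 0O x)
          (solve 2 (λ q b → con -[1+ 0 ] :* con -[1+ 0 ] :* q :+ (con -[1+ 0 ] :* con (+ 0) :* b :+ con (+ 0) :* con (+ 0) :* q) := q) refl (q x) (b x x))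

        b-negate : ∀ x y → b y (negate x) ≡ ⊖ b y x
        b-negate x y = trans (b-sym y (negate x)) (trans (b-comb (int -[1+ 0 ]) x 0O x y)
          (trans (solve 1 (λ b → con -[1+ 0 ] :* b :+ con (+ 0) :* b := :- b) refl (b x y)) (cong ⊖_ (b-sym x y))))

        -- The vector 2q(x)y - b(x,y)x has value q(x)(4q(x)q(y) - b(x,y)²), and the totally positive
        -- factor q(x) cancels.
        cauchy-schwarz : ∀ x y → TotallyPositive (q x) → Nonneg (int (+ 4) ⊗ q x ⊗ q y ⊕ ⊖ (b x y ⊗ b x y))
        cauchy-schwarz x y x>0 = Nonneg-cancel (q x) (int (+ 4) ⊗ q x ⊗ q y ⊕ ⊖ (b x y ⊗ b x y)) x>0 (subst Nonneg
          (trans (q-comb (int (+ 2) ⊗ q x) y (⊖ b x y) x) (trans (cong (λ z → int (+ 2) ⊗ q x ⊗ (int (+ 2) ⊗ q x) ⊗ q y ⊕ (int (+ 2) ⊗ q x ⊗ ⊖ b x y ⊗ z ⊕ ⊖ b x y ⊗ ⊖ b x y ⊗ q x)) (b-sym y x))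
            (solve 3 (λ q q′ b → con (+ 2) :* q :* (con (+ 2) :* q) :* q′ :+ (con (+ 2) :* q :* (:- b) :* b :+ (:- b) :* (:- b) :* q)
                      := q :* (con (+ 4) :* q :* q′ :+ :- (b :* b))) refl (q x) (q y) (b x y))))
          (nonneg (comb (int (+ 2) ⊗ q x) y (⊖ b x y) x)))

        module Base (v₁ : X) (q₁ : q v₁ ≡ 1O) where

          c₁ : X → O
          c₁ x = b v₁ x

          -- Half the polar form of the projections 2x − b(v₁,x)v₁ to the orthogonal complement of v₁.
          h : X → X → O
          h x y = int (+ 2) ⊗ b x y ⊕ ⊖ (c₁ x ⊗ c₁ y)

          -- The factor 2 is b(v₁,v₁); it keeps the multiple of the orthogonal projection inside the
          -- lattice.
          pr : X → X
          pr x = comb (int (+ 2)) x (⊖ c₁ x) v₁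

          b₁₁ : b v₁ v₁ ≡ int (+ 2)
          b₁₁ = trans (b-diag v₁) (cong₂ _⊕_ q₁ q₁)

          b-pr : ∀ x y → b (pr x) y ≡ int (+ 2) ⊗ b x y ⊕ ⊖ c₁ x ⊗ b v₁ y
          b-pr x y = b-comb (int (+ 2)) x (⊖ c₁ x) v₁ y

          b₁-pr : ∀ x → b v₁ (pr x) ≡ 0O
          b₁-pr x = trans (b-sym v₁ (pr x)) (trans (b-pr x v₁) (trans (cong₂ (λ u v → int (+ 2) ⊗ u ⊕ ⊖ c₁ x ⊗ v) (b-sym x v₁) b₁₁)
            (solve 1 (λ c → con (+ 2) :* c :+ (:- c) :* con (+ 2) := con (+ 0)) refl (c₁ x))))

          b-pr-pr : ∀ x y → b (pr x) (pr y) ≡ int (+ 2) ⊗ h x y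
          b-pr-pr x y = trans (b-pr x (pr y)) (trans (cong₂ (λ u v → int (+ 2) ⊗ u ⊕ ⊖ c₁ x ⊗ v)
              (trans (b-sym x (pr y)) (trans (b-pr y x) (cong (λ z → int (+ 2) ⊗ z ⊕ ⊖ c₁ y ⊗ b v₁ x) (b-sym y x)))) (b₁-pr y))
            (solve 3 (λ b c d → con (+ 2) :* (con (+ 2) :* b :+ (:- d) :* c) :+ (:- c) :* con (+ 0) := con (+ 2) :* (con (+ 2) :* b :+ :- (c :* d))) refl (b x y) (c₁ x) (c₁ y)))

          h-diag : ∀ x → h x x ≡ int (+ 4) ⊗ q x ⊕ ⊖ (c₁ x ⊗ c₁ x)
          h-diag x = trans (cong (λ z → int (+ 2) ⊗ z ⊕ ⊖ (c₁ x ⊗ c₁ x)) (b-diag x))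
            (solve 2 (λ q c → con (+ 2) :* (q :+ q) :+ :- (c :* c) := con (+ 4) :* q :+ :- (c :* c)) refl (q x) (c₁ x))

          h-sym : ∀ x y → h x y ≡ h y x
          h-sym x y = trans (cong (λ z → int (+ 2) ⊗ z ⊕ ⊖ (c₁ x ⊗ c₁ y)) (b-sym x y))
            (solve 3 (λ b c d → con (+ 2) :* b :+ :- (c :* d) := con (+ 2) :* b :+ :- (d :* c)) refl (b y x) (c₁ x) (c₁ y))

          q-pr : ∀ x → q (pr x) ≡ h x x
          q-pr x = trans (q-comb (int (+ 2)) x (⊖ c₁ x) v₁) (trans (cong₂ (λ u v → int (+ 2) ⊗ int (+ 2) ⊗ q x ⊕ (int (+ 2) ⊗ ⊖ c₁ x ⊗ u ⊕ ⊖ c₁ x ⊗ ⊖ c₁ x ⊗ v)) (b-sym x v₁) q₁)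
            (trans (solve 2 (λ q c → con (+ 2) :* con (+ 2) :* q :+ (con (+ 2) :* (:- c) :* c :+ (:- c) :* (:- c) :* con (+ 1)) := con (+ 4) :* q :+ :- (c :* c)) refl (q x) (c₁ x))
              (sym (h-diag x))))

          private
            4>0 : TotallyPositive (int (+ 4))
            4>0 = subst (+ 0 ℤ.<_) (sym τ4) (ℤ.+<+ ℕ.z<s)
                , subst₂ ℤ._<_ (sym (ℤ.*-zeroʳ Δ)) (sym (cong₂ ℤ._*_ τ4 τ4)) (ℤ.+<+ ℕ.z<s)
              where
              τ4 : τ (int (+ 4)) ≡ + 8
              τ4 = trans (cong (λ z → + 8 ℤ.+ z) (ℤ.*-zeroʳ t)) refl

          -- For projections q(pr x) = h(x,x) but b(pr x, pr y) = 2h(x,y), so the inequality carries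
          -- a factor 4, which cancels.
          h-cauchy-schwarz : ∀ x y → TotallyPositive (h x x) → Nonneg (h x x ⊗ h y y ⊕ ⊖ (h x y ⊗ h x y))
          h-cauchy-schwarz x y x>0 = Nonneg-cancel (int (+ 4)) (h x x ⊗ h y y ⊕ ⊖ (h x y ⊗ h x y)) 4>0 (subst Nonneg
            (trans (cong₂ (λ u v → int (+ 4) ⊗ u ⊗ v ⊕ ⊖ (b (pr x) (pr y) ⊗ b (pr x) (pr y))) (q-pr x) (q-pr y))
              (trans (cong (λ z → int (+ 4) ⊗ h x x ⊗ h y y ⊕ ⊖ (z ⊗ z)) (b-pr-pr x y))
                (solve 3 (λ p u r → con (+ 4) :* p :* u :+ :- (con (+ 2) :* r :* (con (+ 2) :* r)) := con (+ 4) :* (p :* u :+ :- (r :* r))) refl (h x x) (h y y) (h x y))))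
            (cauchy-schwarz (pr x) (pr y) (subst TotallyPositive (sym (q-pr x)) x>0)))

          private
            symDet₃-double : ∀ p q s r v u → symDet₃ (int (+ 2) ⊗ p) (int (+ 2) ⊗ q) (int (+ 2) ⊗ s) (int (+ 2) ⊗ r) (int (+ 2) ⊗ v) (int (+ 2) ⊗ u)
              ≡ int (+ 8) ⊗ symDet₃ p q s r v u
            symDet₃-double = solve 6 (λ p q s r v u →
                     let 2p = con (+ 2) :* p
                         2q = con (+ 2) :* q
                         2s = con (+ 2) :* s
                         2r = con (+ 2) :* r
                         2v = con (+ 2) :* v
                         2u = con (+ 2) :* u
                     in (2p :* 2s :+ :- (2q :* 2q)) :* 2u :+ :- (2s :* (2r :* 2r)) :+ :- (2v :* (2p :* 2v :+ :- (con (+ 2) :* (2q :* 2r))))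
                      := con (+ 8) :* ((p :* s :+ :- (q :* q)) :* u :+ :- (s :* (r :* r)) :+ :- (v :* (p :* v :+ :- (con (+ 2) :* (q :* r)))))) refl

            symDet₂-double : ∀ p q s → symDet₂ (int (+ 2) ⊗ p) (int (+ 2) ⊗ q) (int (+ 2) ⊗ s) ≡ int (+ 4) ⊗ symDet₂ p q s
            symDet₂-double = solve 3 (λ p q s → con (+ 2) :* p :* (con (+ 2) :* s) :+ :- (con (+ 2) :* q :* (con (+ 2) :* q)) := con (+ 4) :* (p :* s :+ :- (q :* q))) refl

            int-cancel : ∀ m x → ¬ (int m ≡ 0O) → int m ⊗ x ≡ 0O → x ≡ 0O
            int-cancel m x m≢0 e = domain (int m) x e m≢0
            4≢0 : ¬ (int (+ 4) ≡ 0O)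
            4≢0 ()
            8≢0 : ¬ (int (+ 8) ≡ 0O)
            8≢0 ()

          -- `rank` is applied to v₁ and the projections, which are orthogonal to it. Their products
          -- are 2h, so the two determinants appear with factors 4 and 8.
          h-rank : ∀ x y z → symDet₂ (h x x) (h x y) (h y y) ≡ 0O
            ⊎ symDet₃ (h x x) (h x y) (h y y) (h x z) (h y z) (h z z) ≡ 0O
          h-rank x y z = Sum.map
            (λ e → int-cancel (+ 4) (symDet₂ (h x x) (h x y) (h y y)) 4≢0 (trans (sym (trans
                (cong₃ (b-pr-pr x x) (b-pr-pr x y) (b-pr-pr y y))
                (symDet₂-double (h x x) (h x y) (h y y)))) e))
            (λ e → int-cancel (+ 8) (symDet₃ (h x x) (h x y) (h y y) (h x z) (h y z) (h z z)) 8≢0 (trans (sym (trans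
                (cong₆ (b-pr-pr x x) (b-pr-pr x y) (b-pr-pr y y) (b-pr-pr x z) (b-pr-pr y z) (b-pr-pr z z))
                (symDet₃-double (h x x) (h x y) (h y y) (h x z) (h y z) (h z z)))) e))
            (rank v₁ (pr x) (pr y) (pr z) q₁ (b₁-pr x) (b₁-pr y) (b₁-pr z))
            where
            cong₃ : ∀ {p q s p' q' s'} → p ≡ p' → q ≡ q' → s ≡ s' → symDet₂ p q s ≡ symDet₂ p' q' s'
            cong₃ refl refl refl = refl
            cong₆ : ∀ {p q s r v u p' q' s' r' v' u'} → p ≡ p' → q ≡ q' → s ≡ s' → r ≡ r' → v ≡ v' → u ≡ u' →
              symDet₃ p q s r v u ≡ symDet₃ p' q' s' r' v' u'
            cong₆ refl refl refl refl refl refl = refl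

          h-negate : ∀ x y → h x (negate y) ≡ ⊖ h x y
          h-negate x y = trans (cong₂ (λ u v → int (+ 2) ⊗ u ⊕ ⊖ (c₁ x ⊗ v)) (b-negate y x) (b-negate y v₁))
            (solve 3 (λ b c d → con (+ 2) :* (:- b) :+ :- (c :* (:- d)) := :- (con (+ 2) :* b :+ :- (c :* d))) refl (b x y) (c₁ x) (c₁ y))

          -- Replacing w by -w keeps its norm and changes the signs of b(v₁,w) and h(x,w) together,
          -- so one vector of each such pair is enough for the search.
          canonical : ∀ x α → TotallyPositive α → ∃[ w ] (q w ≡ α × T (canon (c₁ w) (h x w)))
          canonical x α α>0 with universal α α>0
          ... | w , refl with canon-neg (c₁ w) (h x w)
          ...   | inj₁ k = w , refl , k
          ...   | inj₂ k = negate w , q-negate w , subst₂ (λ c r → T (canon c r)) (sym (b-negate w v₁)) (sym (h-negate x w)) k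

      -- Soundness of the checker

      module Soundness (κ : ℤ) (σ²≤Δ : (+ 2 ℤ.* κ ℤ.+ t) ℤ.* (+ 2 ℤ.* κ ℤ.+ t) ℤ.≤ Δ) where
        open Check κ
        private
          tr≡τ : ∀ x → tr x ≡ τ x
          tr≡τ (a , b) = trans (cong (λ k → a ℤ.+ a ℤ.+ k) (·≡* t b))
            (I.solve 2 (λ a k → a I.:+ a I.:+ k I.:= I.con (+ 2) I.:* a I.:+ k) refl a (t ℤ.* b))

          4normO : ∀ x → + 4 ℤ.* normO x ≡ τ x ℤ.* τ x ℤ.- Δ ℤ.* (proj₂ x ℤ.* proj₂ x)
          4normO (a , b) = trans (cong (λ k → + 4 ℤ.* k) (normO≡ a b))
            (I.solve 4 (λ t n a b → I.con (+ 4) I.:* (a I.:* a I.:+ t I.:* (a I.:* b) I.:- n I.:* (b I.:* b))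
               I.:= (I.con (+ 2) I.:* a I.:+ t I.:* b) I.:* (I.con (+ 2) I.:* a I.:+ t I.:* b) I.:- (t I.:* t I.:+ I.con (+ 4) I.:* n) I.:* (b I.:* b)) refl t n a b)

        tnn-complete : ∀ x → Nonneg x → T (tnn x)
        tnn-complete x (τ≥0 , norm≥0) = ∧T (ℤ.≤⇒≤ᵇ (subst (+ 0 ℤ.≤_) (sym (tr≡τ x)) τ≥0))
          (ℤ.≤⇒≤ᵇ (0≤-cancel* {+ 4} (ℤ.+<+ ℕ.z<s) (subst (+ 0 ℤ.≤_) (sym (4normO x)) (ℤ.i≤j⇒0≤j-i norm≥0))))

        totpos-sound : ∀ x → T (totpos x) → TotallyPositive x
        totpos-sound x h =
            subst (+ 0 ℤ.<_) (tr≡τ x) (ℤ.<-≤-trans (ℤ.+<+ ℕ.z<s) (ℤ.≤ᵇ⇒≤ (proj₁ split)))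
          , 0<⇒< (subst (+ 0 ℤ.<_) (4normO x) (0<* {+ 4} (ℤ.+<+ ℕ.z<s) (ℤ.<-≤-trans (ℤ.+<+ ℕ.z<s) (ℤ.≤ᵇ⇒≤ (proj₂ split)))))
          where
          split : T (+ 1 ℤ.≤ᵇ tr x) × T (+ 1 ℤ.≤ᵇ normO x)
          split = T∧ h

        private
          abs-mono : ∀ {i j} → + 0 ℤ.≤ i → i ℤ.≤ j → ℤ.∣ i ∣ ℕ.≤ ℤ.∣ j ∣
          abs-mono {+ _} {+ _} _ (ℤ.+≤+ h) = h

          abs-square : ∀ i → ℤ.∣ i ℤ.* i ∣ ≡ ℤ.∣ i ∣ ℕ.* ℤ.∣ i ∣
          abs-square i = ℤ.abs-* i i

          Δ≢0 : ℕ.NonZero ℤ.∣ Δ ∣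
          Δ≢0 = nz 0<Δ
            where
            nz : ∀ {i} → + 0 ℤ.< i → ℕ.NonZero ℤ.∣ i ∣
            nz {+ suc _} _ = _
            nz {+ zero} (ℤ.+<+ ())

        -- The two slopes κ and -κ - t correspond to σ and -σ. For κ ≥ 0 the sign of the
        -- ω-coordinate of P selects the smaller right-hand side in `shear-bound`, which belongs to
        -- the smaller conjugate of P.
        slope-bound : ∀ v → let σ = + 2 ℤ.* slope v ℤ.+ t in σ ℤ.* σ ℤ.≤ Δ
        slope-bound v with + 0 ℤ.≤ᵇ v
        ... | true  = σ²≤Δ
        ... | false = subst (ℤ._≤ Δ) (I.solve 2 (λ t κ → (I.con (+ 2) I.:* κ I.:+ t) I.:* (I.con (+ 2) I.:* κ I.:+ t)
            I.:= (I.con (+ 2) I.:* (I.:- κ I.:- t) I.:+ t) I.:* (I.con (+ 2) I.:* (I.:- κ I.:- t) I.:+ t)) refl t κ) σ²≤Δ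

        -- The box has coordinates d and e = c - kd. The trace bounds d, and the sheared inequality
        -- bounds 2e = τ(b) - σd, which accounts for the halved root.
        bounded-complete : ∀ P b → Nonneg (P ⊕ ⊖ (b ⊗ b)) → b ∈ bounded P
        bounded-complete P b@(c , d) hb = ∈-filterᵇ (λ b → tnn (P ⊕ ⊖ (b ⊗ b)))
          (subst (_∈ map unshear box) (cong (_, d) (trans (cong (ℤ._+ e) (·≡* k d)) (I.solve 3 (λ k c d → k I.:* d I.:+ (c I.:- k I.:* d) I.:= c) refl k c d)))
            (∈-map⁺ unshear (∈-cartesianProduct⁺ (∈-ints e (root 1 ℤ.∣ W ∣ / 2) ∣e∣≤) (∈-ints d (root ℤ.∣ Δ ∣ ℤ.∣ M ∣) ∣d∣≤))))
          (tnn-complete (P ⊕ ⊖ (b ⊗ b)) hb)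
          where
          k σ M W e : ℤ
          k = slope (proj₂ P)
          σ = + 2 ℤ.* k ℤ.+ t
          M = tr P ℤ.+ tr P
          W = M ℤ.- (k ℤ.+ k ℤ.+ t) · (proj₂ P ℤ.+ proj₂ P)
          e = c ℤ.- k ℤ.* d
          unshear : O → O
          unshear (d , y) = k · y ℤ.+ d , y
          box : List O
          box = cartesianProduct (ints (root 1 ℤ.∣ W ∣ / 2)) (ints (root ℤ.∣ Δ ∣ ℤ.∣ M ∣))
          2τ≡M : + 2 ℤ.* τ P ≡ M
          2τ≡M = trans (I.solve 1 (λ k → I.con (+ 2) I.:* k I.:= k I.:+ k) refl (τ P)) (cong₂ ℤ._+_ (sym (tr≡τ P)) (sym (tr≡τ P)))
          W≡ : + 2 ℤ.* (τ P ℤ.- σ ℤ.* proj₂ P) ≡ W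
          W≡ = trans (I.solve 4 (λ T k t v → I.con (+ 2) I.:* (T I.:- (I.con (+ 2) I.:* k I.:+ t) I.:* v) I.:= I.con (+ 2) I.:* T I.:- (k I.:+ k I.:+ t) I.:* (v I.:+ v)) refl (τ P) k t (proj₂ P))
            (cong₂ ℤ._-_ 2τ≡M (sym (·≡* (k ℤ.+ k ℤ.+ t) (proj₂ P ℤ.+ proj₂ P))))
          ∣d∣≤ : ℤ.∣ d ∣ ℕ.≤ root ℤ.∣ Δ ∣ ℤ.∣ M ∣
          ∣d∣≤ = root-≥ ℤ.∣ Δ ∣ ℤ.∣ M ∣ ℤ.∣ d ∣ {{Δ≢0}} (subst (ℕ._≤ ℤ.∣ M ∣) (trans (ℤ.abs-* Δ (d ℤ.* d)) (cong (ℤ.∣ Δ ∣ ℕ.*_) (abs-square d)))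
            (abs-mono (0≤* (ℤ.<⇒≤ 0<Δ) (square≥0 d)) (subst (Δ ℤ.* (d ℤ.* d) ℤ.≤_) 2τ≡M (trace-bound P b hb))))
          2e≡ : τ b ℤ.- σ ℤ.* d ≡ e ℤ.* + 2
          2e≡ = I.solve 4 (λ t k c d → (I.con (+ 2) I.:* c I.:+ t I.:* d) I.:- (I.con (+ 2) I.:* k I.:+ t) I.:* d I.:= (c I.:- k I.:* d) I.:* I.con (+ 2)) refl t k c d
          2∣e∣≤ : ℤ.∣ e ∣ ℕ.* 2 ℕ.≤ root 1 ℤ.∣ W ∣
          2∣e∣≤ = subst (ℕ._≤ root 1 ℤ.∣ W ∣) (trans (cong ℤ.∣_∣ 2e≡) (ℤ.abs-* e (+ 2)))
            (root-≥ 1 ℤ.∣ W ∣ ℤ.∣ τ b ℤ.- σ ℤ.* d ∣ (subst (ℕ._≤ ℤ.∣ W ∣) (trans (abs-square (τ b ℤ.- σ ℤ.* d)) (sym (ℕ.*-identityˡ _)))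
              (abs-mono (square≥0 (τ b ℤ.- σ ℤ.* d)) (subst ((τ b ℤ.- σ ℤ.* d) ℤ.* (τ b ℤ.- σ ℤ.* d) ℤ.≤_) W≡ (shear-bound σ P b (slope-bound (proj₂ P)) hb)))))
          ∣e∣≤ : ℤ.∣ e ∣ ℕ.≤ root 1 ℤ.∣ W ∣ / 2
          ∣e∣≤ = subst (ℕ._≤ root 1 ℤ.∣ W ∣ / 2) (m*n/n≡m ℤ.∣ e ∣ 2) (/-monoˡ-≤ 2 2∣e∣≤)

        private
          int4-comm : ∀ x y z → Nonneg (int (+ 4) ⊗ x ⊗ y ⊕ z) → Nonneg (int (+ 4) ⊗ y ⊗ x ⊕ z)
          int4-comm x y z = subst Nonneg (SO.solve 3 (λ x y z → SO.con (+ 4) SO.:* x SO.:* y SO.:+ z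
            SO.:= SO.con (+ 4) SO.:* y SO.:* x SO.:+ z) refl x y z)

          int4*1 : ∀ x z → Nonneg (int (+ 4) ⊗ 1O ⊗ x ⊕ z) → Nonneg (int (+ 4) ⊗ x ⊕ z)
          int4*1 x z = subst Nonneg (SO.solve 2 (λ x z → SO.con (+ 4) SO.:* SO.con (+ 1) SO.:* x SO.:+ z
            SO.:= SO.con (+ 4) SO.:* x SO.:+ z) refl x z)

          1>0 : TotallyPositive 1O
          1>0 = subst (+ 0 ℤ.<_) (sym τ1) (ℤ.+<+ ℕ.z<s) , subst₂ ℤ._<_ (sym (ℤ.*-zeroʳ Δ)) (sym (cong₂ ℤ._*_ τ1 τ1)) (ℤ.+<+ ℕ.z<s)
            where
            τ1 : τ 1O ≡ + 2
            τ1 = trans (cong (λ z → + 2 ℤ.+ z) (ℤ.*-zeroʳ t)) refl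

        -- If v₁, x, y span the lattice, then h(x,z) and h(y,z) come from integral coordinates of z.
        BasisProperty : Set
        BasisProperty = ∀ v₁ (q₁ : q v₁ ≡ 1O) x y z → let open Base v₁ q₁ in
          ¬ (symDet₂ (h x x) (h x y) (h y y) ≡ 0O) →
          T (primitive5 (symDet₂ (h x x) (h x y) (h y y))) →
          T (divides (symDet₂ (h x x) (h x y) (h y y)) (h y y ⊗ h x z ⊕ ⊖ (h x y ⊗ h y z)))
          × T (divides (symDet₂ (h x x) (h x y) (h y y)) (h x x ⊗ h y z ⊕ ⊖ (h x y ⊗ h x z)))

        module _ (free : Bool) (basis : T free → BasisProperty) where

          verdict-sound : ∀ X det d₂ d₃ → det ≡ 0O → (T free → T (primitive5 X) → T (divides X d₂) × T (divides X d₃)) →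
            ¬ T (verdict free X det d₂ d₃)
          verdict-sound X _ d₂ d₃ refl div k = excluded free (primitive5 X) (divides X d₂) (divides X d₃) div k
            where
            excluded : ∀ f w x y → (T f → T w → T x × T y) → ¬ T (f ∧ not (x ∧ y) ∧ w)
            excluded true true true  true  _ ()
            excluded true true false _     g _ = proj₁ (g tt tt)
            excluded true true true  false g _ = proj₂ (g tt tt)
            excluded true false true  true  _ ()
            excluded true false true  false _ ()
            excluded true false false _     _ ()

          module _ (v₁ : X) (q₁ : q v₁ ≡ 1O) where
            open Base v₁ q₁

            c₁∈ : ∀ w α → q w ≡ α → c₁ w ∈ bounded (int (+ 4) ⊗ α)
            c₁∈ w α refl = bounded-complete (int (+ 4) ⊗ q w) (c₁ w) (int4*1 (q w) (⊖ (c₁ w ⊗ c₁ w))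
              (subst (λ o → Nonneg (int (+ 4) ⊗ o ⊗ q w ⊕ ⊖ (c₁ w ⊗ c₁ w))) q₁ (cauchy-schwarz v₁ w (subst TotallyPositive (sym q₁) 1>0))))

            b∈ : ∀ x w α γ → q x ≡ α → q w ≡ γ → TotallyPositive α → b x w ∈ bounded (int (+ 4) ⊗ γ ⊗ α)
            b∈ x w α γ refl refl α>0 = bounded-complete (int (+ 4) ⊗ q w ⊗ q x) (b x w) (int4-comm (q x) (q w) (⊖ (b x w ⊗ b x w)) (cauchy-schwarz x w α>0))

            h-value : ∀ w γ → q w ≡ γ → h w w ≡ int (+ 4) ⊗ γ ⊕ ⊖ (c₁ w ⊗ c₁ w)
            h-value w γ refl = h-diag w

            cross-complete : ∀ x w p u bs → h x x ≡ p → h w w ≡ u → TotallyPositive p → b x w ∈ bs → h x w ∈ cross (c₁ x) (p ⊗ u) (c₁ w) bs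
            cross-complete x w p u bs refl refl p>0 b∈bs = ∈-filterᵇ (λ r → tnn (h x x ⊗ h w w ⊕ ⊖ (r ⊗ r)))
              (subst (_∈ map (λ e → e ⊕ e ⊕ ⊖ (c₁ x ⊗ c₁ w)) bs) (double (b x w) (⊖ (c₁ x ⊗ c₁ w))) (∈-map⁺ (λ e → e ⊕ e ⊕ ⊖ (c₁ x ⊗ c₁ w)) b∈bs))
              (tnn-complete (h x x ⊗ h w w ⊕ ⊖ (h x w ⊗ h x w)) (h-cauchy-schwarz x w p>0))
              where
              double : ∀ e m → e ⊕ e ⊕ m ≡ int (+ 2) ⊗ e ⊕ m
              double = SO.solve 2 (λ e m → e SO.:+ e SO.:+ m SO.:= SO.con (+ 2) SO.:* e SO.:+ m) refl

            rows-complete : ∀ x w α a p γ → q x ≡ α → c₁ x ≡ a → h x x ≡ p → q w ≡ γ → TotallyPositive α → TotallyPositive p → T (canon (c₁ w) (h x w)) →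
              let γ₄ = int (+ 4) ⊗ γ in
              ∃[ rs ] ((c₁ w , h w w , rs) ∈ rows a p γ₄ (bounded γ₄) (bounded (γ₄ ⊗ α)) × tag (p ⊗ h w w) (h x w) ∈ rs)
            rows-complete x w α a p γ qx refl hx qw α>0 p>0 canon-w = rs
                , subst (λ u → (c₁ w , u , rs) ∈ rows (c₁ x) p γ₄ (bounded γ₄) es) (sym (h-value w γ qw))
                    (∈-map⁺ (λ c → row (c₁ x) p es c (γ₄ ⊕ ⊖ (c ⊗ c))) (∈-filterᵇ half (c₁∈ w γ qw) (proj₁ (T∧ {half (c₁ w)} canon-w))))
                , subst (λ u → tag (p ⊗ u) (h x w) ∈ rs) (sym (h-value w γ qw)) (∈-map⁺ (tag (p ⊗ u′))
                    (∈-filterᵇ (canon (c₁ w)) (cross-complete x w p u′ es hx (h-value w γ qw) p>0 (b∈ x w α γ qx qw α>0)) canon-w))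
              where
              γ₄ u′ : O
              γ₄ = int (+ 4) ⊗ γ
              u′ = γ₄ ⊕ ⊖ (c₁ w ⊗ c₁ w)
              es : List O
              es = bounded (γ₄ ⊗ α)
              rs : List (O × ℕ)
              rs = map (tag (p ⊗ u′)) (filterᵇ (canon (c₁ w)) (cross (c₁ x) (p ⊗ u′) (c₁ w) es))

            Gram : (x y z : X) (p q s r v u : O) → Set
            Gram x y z p q s r v u = h x x ≡ p × h x y ≡ q × h y y ≡ s × h x z ≡ r × h y z ≡ v × h z z ≡ u

            gram-rank : ∀ x y z p q s r v u → Gram x y z p q s r v u → symDet₂ p q s ≡ 0O ⊎ symDet₃ p q s r v u ≡ 0O
            gram-rank x y z _ _ _ _ _ _ (refl , refl , refl , refl , refl , refl) = h-rank x y z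

            gram-basis : ∀ x y z p q s r v u → Gram x y z p q s r v u → ¬ (symDet₂ p q s ≡ 0O) → T free → T (primitive5 (symDet₂ p q s)) →
              T (divides (symDet₂ p q s) (s ⊗ r ⊕ ⊖ (q ⊗ v))) × T (divides (symDet₂ p q s) (p ⊗ v ⊕ ⊖ (q ⊗ r)))
            gram-basis x y z _ _ _ _ _ _ (refl , refl , refl , refl , refl , refl) X≢0 f = basis f v₁ q₁ x y z X≢0

            admissible-sound : ∀ x y z p q s r v u → Gram x y z p q s r v u → ¬ (symDet₂ p q s ≡ 0O) →
              ¬ T (admissible free p q s (symDet₂ p q s) r (symDet₂ p q s ⊗ u ⊕ ⊖ (s ⊗ (r ⊗ r))) (q ⊗ r ⊕ q ⊗ r) v)
            admissible-sound x y z p q s r v u g X≢0 adm = [ X≢0 , (λ e →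
                verdict-sound (symDet₂ p q s) (k ⊕ ⊖ (v ⊗ (p ⊗ v ⊕ ⊖ (q ⊗ r ⊕ q ⊗ r)))) (s ⊗ r ⊕ ⊖ (q ⊗ v)) (p ⊗ v ⊕ ⊖ (q ⊗ r))
                  (trans (cong (λ w → k ⊕ ⊖ (v ⊗ (p ⊗ v ⊕ ⊖ w))) (double (q ⊗ r))) e)
                  (gram-basis x y z p q s r v u g X≢0) adm) ]′ (gram-rank x y z p q s r v u g)
              where
              k : O
              k = symDet₂ p q s ⊗ u ⊕ ⊖ (s ⊗ (r ⊗ r))
              double : ∀ e → e ⊕ e ≡ int (+ 2) ⊗ e
              double = SO.solve 1 (λ e → e SO.:+ e SO.:= SO.con (+ 2) SO.:* e) refl

            -- This is the Desnanot-Jacobi identity (pv - qr)² + p · det = X(pu - r²). If the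
            -- determinant vanishes, the right-hand side is a square in ℤ[ω], and the absolute value
            -- of its norm is a perfect square.
            discriminant-square : ∀ p q s r v u → symDet₃ p q s r v u ≡ 0O →
              T (squareTest (ℤ.∣ normO (symDet₂ p q s) ∣ ℕ.* ℤ.∣ normO (p ⊗ u ⊕ ⊖ (r ⊗ r)) ∣))
            discriminant-square p q s r v u det≡0 = subst (T ∘ squareTest)
              (trans (sym (∣normO∣-* z z)) (trans (cong (λ y → ℤ.∣ normO y ∣) z²) (∣normO∣-* (symDet₂ p q s) (p ⊗ u ⊕ ⊖ (r ⊗ r)))))
              (squareTest-complete ℤ.∣ normO z ∣)
              where
              z : O
              z = p ⊗ v ⊕ ⊖ (q ⊗ r)
              identity : ∀ p q s r v u → (p ⊗ v ⊕ ⊖ (q ⊗ r)) ⊗ (p ⊗ v ⊕ ⊖ (q ⊗ r)) ⊕ p ⊗ symDet₃ p q s r v u ≡ symDet₂ p q s ⊗ (p ⊗ u ⊕ ⊖ (r ⊗ r))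
              identity = SO.solve 6 (λ p q s r v u →
                (p :* v :+ :- (q :* r)) :* (p :* v :+ :- (q :* r)) :+ p :* ((p :* s :+ :- (q :* q)) :* u :+ :- (s :* (r :* r)) :+ :- (v :* (p :* v :+ :- (con (+ 2) :* (q :* r)))))
                := (p :* s :+ :- (q :* q)) :* (p :* u :+ :- (r :* r))) refl
                where open SO using (_:+_; _:*_; :-_; con; _:=_)
              z² : z ⊗ z ≡ symDet₂ p q s ⊗ (p ⊗ u ⊕ ⊖ (r ⊗ r))
              z² = trans (sym (trans (cong (λ d → z ⊗ z ⊕ p ⊗ d) det≡0) (+*0 (z ⊗ z) p))) (identity p q s r v u)
                where
                +*0 : ∀ x p → x ⊕ p ⊗ 0O ≡ x
                +*0 = SO.solve 2 (λ x p → x SO.:+ p SO.:* SO.con (+ 0) SO.:= x) refl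

            -- A vector w of norm γ, up to sign, has its data in some enumerated row. If its
            -- determinant with x and y vanishes, the square test succeeds, so `admissible` was
            -- evaluated at the actual value of h(y,w).
            killed-sound : ∀ x y α a p β b s q′ γ → q x ≡ α → c₁ x ≡ a → h x x ≡ p → q y ≡ β → c₁ y ≡ b → h y y ≡ s → h x y ≡ q′ →
              TotallyPositive α → TotallyPositive β → TotallyPositive p → TotallyPositive s → ¬ (symDet₂ p q′ s ≡ 0O) →
              ¬ T (killed free p b s q′ (symDet₂ p q′ s) (prepare α a p β γ))
            killed-sound x y α a p β b s q′ γ qx cx hx qy refl hy hxy α>0 β>0 p>0 s>0 X≢0 k =
              refute (canonical x γ (totpos-sound γ (proj₁ (T∧ {totpos γ} k))))
              where
              γ₄ X′ : O
              γ₄ = int (+ 4) ⊗ γ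
              X′ = symDet₂ p q′ s
              fs : List O
              fs = bounded (γ₄ ⊗ β)
              refute : ∃[ w ] (q w ≡ γ × T (canon (c₁ w) (h x w))) → ⊥
              refute (w , qw , canon-w) = continue (rows-complete x w α a p γ qx cx hx qw α>0 p>0 canon-w)
                where
                vs : List O
                vs = cross b (s ⊗ h w w) (c₁ w) fs
                test : O → O → Bool
                test r = admissible free p q′ s X′ r (X′ ⊗ h w w ⊕ ⊖ (s ⊗ (r ⊗ r))) (q′ ⊗ r ⊕ q′ ⊗ r)
                continue : ∃[ rs ] ((c₁ w , h w w , rs) ∈ rows a p γ₄ (bounded γ₄) (bounded (γ₄ ⊗ α)) × tag (p ⊗ h w w) (h x w) ∈ rs) → ⊥
                continue (rs , row∈ , r∈) = det-zero (gram-rank x y w p q′ s (h x w) (h y w) (h w w) g)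
                  where
                  r v u : O
                  r = h x w
                  v = h y w
                  u = h w w
                  g : Gram x y w p q′ s r v u
                  g = hx , hxy , hy , refl , refl , refl
                  passed : T (not (squareTest (ℤ.∣ normO X′ ∣ ℕ.* ℤ.∣ normO (p ⊗ u ⊕ ⊖ (r ⊗ r)) ∣)) ∨ all (test r) vs)
                  passed = all-sound (λ (r , m) → not (squareTest (ℤ.∣ normO X′ ∣ ℕ.* m)) ∨ all (test r) vs) rs
                    (all-sound (λ (c , u , rs) → killedRow free p b s q′ X′ u rs (cross b (s ⊗ u) c fs)) _ (proj₂ (T∧ {totpos γ} k)) row∈) r∈
                  det-zero : symDet₂ p q′ s ≡ 0O ⊎ symDet₃ p q′ s r v u ≡ 0O → ⊥
                  det-zero (inj₁ X≡0) = X≢0 X≡0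
                  det-zero (inj₂ det≡0) = admissible-sound x y w p q′ s r v u g X≢0
                    (all-sound (test r) vs (T-not∨ passed (discriminant-square p q′ s r v u det≡0))
                      (cross-complete y w s u fs hy refl s>0 (b∈ y w β γ qy qw β>0)))

            leaf-sound : ∀ x y α a p β b s q′ γs → q x ≡ α → c₁ x ≡ a → h x x ≡ p → q y ≡ β → c₁ y ≡ b → h y y ≡ s → h x y ≡ q′ →
              TotallyPositive α → TotallyPositive β → TotallyPositive p → ¬ T (leaf free p b s q′ (symDet₂ p q′ s) (map (prepare α a p β) γs))
            leaf-sound x y α a p β b s q′ γs qx cx hx qy cy hy hxy α>0 β>0 p>0 k =
              refute (satisfied (map⁻ (any⁻ (killed free p b s q′ X′) (map (prepare α a p β) γs) (proj₂ k′))))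
              where
              X′ : O
              X′ = symDet₂ p q′ s
              k′ : T (not (isZero X′)) × T (any (killed free p b s q′ X′) (map (prepare α a p β) γs))
              k′ = T∧ {not (isZero X′)} (proj₂ (T∧ {totpos s} k))
              refute : ∃[ γ ] T (killed free p b s q′ X′ (prepare α a p β γ)) → ⊥
              refute (γ , dead) = killed-sound x y α a p β b s q′ γ qx cx hx qy cy hy hxy α>0 β>0 p>0
                (totpos-sound s (proj₁ (T∧ {totpos s} k))) (λ e → T-not (proj₁ k′) (subst (T ∘ isZero) (sym e) tt)) dead

            branch-sound : ∀ x α a cert → q x ≡ α → c₁ x ≡ a → TotallyPositive α → ¬ T (branch free α a cert)
            branch-sound x α a (β , γs) qx cx α>0 k = refute (canonical x β β>0)
              where
              p β₄ : O
              p = int (+ 4) ⊗ α ⊕ ⊖ (a ⊗ a)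
              β₄ = int (+ 4) ⊗ β
              β>0 : TotallyPositive β
              β>0 = totpos-sound β (proj₁ (T∧ {totpos β} k))
              k′ : T (totpos p) × T (all (λ (b , s , qs) → all (λ (q , _) → leaf free p b s q (symDet₂ p q s) (map (prepare α a p β) γs)) qs)
                (rows a p β₄ (bounded β₄) (bounded (β₄ ⊗ α))))
              k′ = T∧ {totpos p} (proj₂ (T∧ {totpos β} k))
              p>0 : TotallyPositive p
              p>0 = totpos-sound p (proj₁ k′)
              hx : h x x ≡ p
              hx = trans (h-value x α qx) (cong (λ c → int (+ 4) ⊗ α ⊕ ⊖ (c ⊗ c)) cx)
              refute : ∃[ y ] (q y ≡ β × T (canon (c₁ y) (h x y))) → ⊥
              refute (y , qy , canon-y) = continue (rows-complete x y α a p β qx cx hx qy α>0 p>0 canon-y)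
                where
                continue : ∃[ rs ] ((c₁ y , h y y , rs) ∈ rows a p β₄ (bounded β₄) (bounded (β₄ ⊗ α)) × tag (p ⊗ h y y) (h x y) ∈ rs) → ⊥
                continue (qs , row∈ , q∈) = leaf-sound x y α a p β (c₁ y) (h y y) (h x y) γs qx cx hx qy refl refl refl α>0 β>0 p>0
                  (all-sound (λ (q , _) → leaf free p (c₁ y) (h y y) q (symDet₂ p q (h y y)) (map (prepare α a p β) γs)) qs
                    (all-sound (λ (b , s , qs) → all (λ (q , _) → leaf free p b s q (symDet₂ p q s) (map (prepare α a p β) γs)) qs)
                      (rows a p β₄ (bounded β₄) (bounded (β₄ ⊗ α))) (proj₂ k′) row∈) q∈)

          check-sound : ∀ cert → ¬ T (check free cert)
          check-sound (α , branches) k = refute (universal 1O 1>0)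
            where
            α>0 : TotallyPositive α
            α>0 = totpos-sound α (proj₁ (T∧ {totpos α} k))
            as : List O
            as = filterᵇ half (bounded (int (+ 4) ⊗ α))
            refute : ∃[ v₁ ] q v₁ ≡ 1O → ⊥
            -- With v₁ itself as the reference vector h(v₁,x) is 0, so the choice of sign concerns
            -- b(v₁,x) alone.
            refute (v₁ , q₁) = continue (Base.canonical v₁ q₁ v₁ α α>0)
              where
              continue : ∃[ x ] (q x ≡ α × T (canon (b v₁ x) (Base.h v₁ q₁ v₁ x))) → ⊥
              continue (x , qx , canon-x) = finish (zipAll-sound (branch free α) as branches (proj₂ (T∧ {totpos α} k))
                  (∈-filterᵇ half (c₁∈ v₁ q₁ x α qx) (proj₁ (T∧ {half (b v₁ x)} canon-x))))
                where
                finish : ∃[ cert ] T (branch free α (b v₁ x) cert) → ⊥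
                finish (cert , k′) = branch-sound v₁ q₁ x α (b v₁ x) cert qx refl α>0 k′

      -- Discriminants from 1849 on

      module LargeDiscriminant (t′ : ℕ) (t′≤1 : t′ ℕ.≤ 1) (t≡t′ : t ≡ + t′) (1849≤Δ : + 1849 ℤ.≤ Δ) where
        τ-int : ∀ i → τ (int i) ≡ + 2 ℤ.* i
        τ-int i = trans (cong (λ z → + 2 ℤ.* i ℤ.+ z) (ℤ.*-zeroʳ t)) (ℤ.+-identityʳ (+ 2 ℤ.* i))

        int-totpos : ∀ m → .{{ℕ.NonZero m}} → TotallyPositive (int (+ m))
        int-totpos m@(suc _) = subst (+ 0 ℤ.<_) (sym (τ-int (+ m))) (0<* {+ 2} {+ m} (ℤ.+<+ ℕ.z<s) (ℤ.+<+ ℕ.z<s))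
          , subst₂ ℤ._<_ (sym (ℤ.*-zeroʳ Δ)) (sym (cong₂ ℤ._*_ (τ-int (+ m)) (τ-int (+ m))))
              (0<* {+ 2 ℤ.* + m} {+ 2 ℤ.* + m} (0<* {+ 2} {+ m} (ℤ.+<+ ℕ.z<s) (ℤ.+<+ ℕ.z<s)) (0<* {+ 2} {+ m} (ℤ.+<+ ℕ.z<s) (ℤ.+<+ ℕ.z<s)))

        small⇒zero : ∀ d k → Δ ℤ.* (d ℤ.* d) ℤ.≤ k → k ℤ.< Δ → d ≡ + 0
        small⇒zero d k h k<Δ = zero-square d (λ 1≤d² → ℤ.<-irrefl refl (ℤ.<-≤-trans k<Δ (ℤ.≤-trans
            (subst (ℤ._≤ Δ ℤ.* (d ℤ.* d)) (ℤ.*-identityʳ Δ) (ℤ.*-monoˡ-≤-nonNeg Δ {{ℤ.nonNegative (ℤ.<⇒≤ 0<Δ)}} 1≤d²)) h)))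
          where
          zero-square : ∀ d → ¬ (+ 1 ℤ.≤ d ℤ.* d) → d ≡ + 0
          zero-square (+ zero)  _ = refl
          zero-square (+ suc _) h = ⊥-elim (h (ℤ.+≤+ (ℕ.s≤s ℕ.z≤n)))
          zero-square -[1+ _ ]  h = ⊥-elim (h (ℤ.+≤+ (ℕ.s≤s ℕ.z≤n)))

        Integral : O → Set
        Integral x = proj₂ x ≡ + 0

        integral⇒int : ∀ x → Integral x → x ≡ int (proj₁ x)
        integral⇒int (a , _) refl = refl

        -- The trace bound for 4mα - b(x,y)² gives Δd² ≤ 8mτ(α) < Δ for the ω-coordinate d of the
        -- product.
        b-integral : ∀ x y m α → .{{ℕ.NonZero m}} → q x ≡ int (+ m) → q y ≡ α → + 8 ℤ.* (+ m ℤ.* τ α) ℤ.< Δ → Integral (b x y)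
        b-integral x y m α qx refl h = small⇒zero (proj₂ (b x y)) (+ 8 ℤ.* (+ m ℤ.* τ (q y)))
          (subst (Δ ℤ.* (proj₂ (b x y) ℤ.* proj₂ (b x y)) ℤ.≤_) (2τ (q y))
            (trace-bound (int (+ 4) ⊗ int (+ m) ⊗ q y) (b x y)
              (subst (λ z → Nonneg (int (+ 4) ⊗ z ⊗ q y ⊕ ⊖ (b x y ⊗ b x y))) qx (cauchy-schwarz x y (subst TotallyPositive (sym qx) (int-totpos m)))))) h
          where
          2τ : ∀ α → + 2 ℤ.* τ (int (+ 4) ⊗ int (+ m) ⊗ α) ≡ + 8 ℤ.* (+ m ℤ.* τ α)
          2τ (c , d) = trans (cong (λ z → + 2 ℤ.* τ z) (trans (cong (_⊗ (c , d)) (sym (int-* (+ 4) (+ m)))) (⊗-def (+ 4 ℤ.* + m) (+ 0) c d)))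
            (I.solve 5 (λ t n m c d → I.con (+ 2) I.:* (I.con (+ 2) I.:* (I.con (+ 4) I.:* m I.:* c I.:+ n I.:* (I.con (+ 0) I.:* d))
                I.:+ t I.:* (I.con (+ 4) I.:* m I.:* d I.:+ I.con (+ 0) I.:* c I.:+ t I.:* (I.con (+ 0) I.:* d)))
              I.:= I.con (+ 8) I.:* (m I.:* (I.con (+ 2) I.:* c I.:+ t I.:* d))) refl t n (+ m) c d)

        -- The shear bound with σ = 0 compares traces only and yields i² ≤ 4mk. The values 8, 12,
        -- 24, 20, 40 of 4mk for the pairs of norms (1,2), (1,3), (2,3), (1,5), (2,5) give the
        -- ranges 2, 3, 4, 4, 6 in `noPlane`.
        b-bound : ∀ x y m k i → .{{ℕ.NonZero m}} → q x ≡ int (+ m) → q y ≡ int (+ k) → b x y ≡ int i →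
          ℤ.∣ i ∣ ℕ.≤ root 1 (4 ℕ.* (m ℕ.* k))
        b-bound x y m k i qx qy bxy = root-≥ 1 (4 ℕ.* (m ℕ.* k)) ℤ.∣ i ∣ (ℕ.*-cancelˡ-≤ 4 (subst (ℕ._≤ 4 ℕ.* (4 ℕ.* (m ℕ.* k))) lhs (ℤ.drop‿+≤+ bound′)))
          where
          bound : (τ (int i) ℤ.- + 0 ℤ.* + 0) ℤ.* (τ (int i) ℤ.- + 0 ℤ.* + 0) ℤ.≤ + 2 ℤ.* (τ (int (+ 4) ⊗ int (+ m) ⊗ int (+ k)) ℤ.- + 0 ℤ.* proj₂ (int (+ 4) ⊗ int (+ m) ⊗ int (+ k)))
          bound = shear-bound (+ 0) (int (+ 4) ⊗ int (+ m) ⊗ int (+ k)) (int i) (ℤ.<⇒≤ 0<Δ)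
            (subst₂ (λ z w → Nonneg (int (+ 4) ⊗ int (+ m) ⊗ z ⊕ ⊖ (w ⊗ w))) qy bxy
              (subst (λ z → Nonneg (int (+ 4) ⊗ z ⊗ q y ⊕ ⊖ (b x y ⊗ b x y))) qx (cauchy-schwarz x y (subst TotallyPositive (sym qx) (int-totpos m)))))
          i² : (τ (int i) ℤ.- + 0 ℤ.* + 0) ℤ.* (τ (int i) ℤ.- + 0 ℤ.* + 0) ≡ + (4 ℕ.* (ℤ.∣ i ∣ ℕ.* ℤ.∣ i ∣))
          i² = trans (cong (λ z → (z ℤ.- + 0 ℤ.* + 0) ℤ.* (z ℤ.- + 0 ℤ.* + 0)) (τ-int i))
            (trans (I.solve 1 (λ i → (I.con (+ 2) I.:* i I.:- I.con (+ 0) I.:* I.con (+ 0)) I.:* (I.con (+ 2) I.:* i I.:- I.con (+ 0) I.:* I.con (+ 0)) I.:= I.con (+ 4) I.:* (i I.:* i)) refl i)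
              (trans (cong (λ z → + 4 ℤ.* z) (trans (sym (ℤ.0≤i⇒+∣i∣≡i (square≥0 i))) (cong +_ (ℤ.abs-* i i)))) (sym (ℤ.pos-* 4 (ℤ.∣ i ∣ ℕ.* ℤ.∣ i ∣)))))
          P≡ : int (+ 4) ⊗ int (+ m) ⊗ int (+ k) ≡ int (+ (4 ℕ.* (m ℕ.* k)))
          P≡ = trans (cong (_⊗ int (+ k)) (sym (int-* (+ 4) (+ m)))) (trans (sym (int-* (+ 4 ℤ.* + m) (+ k)))
            (cong int (trans (ℤ.*-assoc (+ 4) (+ m) (+ k)) (trans (cong (λ z → + 4 ℤ.* z) (sym (ℤ.pos-* m k))) (sym (ℤ.pos-* 4 (m ℕ.* k)))))))
          bound′ : + (4 ℕ.* (ℤ.∣ i ∣ ℕ.* ℤ.∣ i ∣)) ℤ.≤ + (4 ℕ.* (4 ℕ.* (m ℕ.* k)))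
          bound′ = subst₂ ℤ._≤_ i² (trans (cong (λ z → + 2 ℤ.* (τ z ℤ.- + 0 ℤ.* proj₂ z)) P≡)
            (trans (cong (λ z → + 2 ℤ.* (z ℤ.- + 0 ℤ.* + 0)) (τ-int (+ (4 ℕ.* (m ℕ.* k)))))
              (trans (I.solve 1 (λ j → I.con (+ 2) I.:* (I.con (+ 2) I.:* j I.:- I.con (+ 0) I.:* I.con (+ 0)) I.:= I.con (+ 4) I.:* j) refl (+ (4 ℕ.* (m ℕ.* k))))
                (sym (ℤ.pos-* 4 (4 ℕ.* (m ℕ.* k))))))) bound
          lhs : 4 ℕ.* (ℤ.∣ i ∣ ℕ.* ℤ.∣ i ∣) ≡ 4 ℕ.* (1 ℕ.* (ℤ.∣ i ∣ ℕ.* ℤ.∣ i ∣))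
          lhs = cong (4 ℕ.*_) (sym (ℕ.*-identityˡ (ℤ.∣ i ∣ ℕ.* ℤ.∣ i ∣)))

        -- In symDet₃ the ω-component is 4 (ps − q²) when u = 4α − c² with α = a + ω and everything else is integral.
        ω-component : ∀ p q s r v c a → symDet₃ (int p) (int q) (int s) (int r) (int v) (int (+ 4) ⊗ (a , + 1) ⊕ ⊖ (int c ⊗ int c)) ≡ 0O →
          symDet₂ (int p) (int q) (int s) ≡ 0O
        ω-component p q s r v c a e = trans (symDet₂-int p q s) (cong int (zero4 (p ℤ.* s ℤ.- q ℤ.* q) (trans (sym second) (cong proj₂ e))))
          where
          symDet₂-int : ∀ p q s → symDet₂ (int p) (int q) (int s) ≡ int (p ℤ.* s ℤ.- q ℤ.* q)
          symDet₂-int p q s = cong₂ (λ x y → x ⊕ ⊖ y) (sym (int-* p s)) (sym (int-* q q))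
          u : O
          u = int (+ 4) ⊗ (a , + 1) ⊕ ⊖ (int c ⊗ int c)
          u≡ : u ≡ (+ 4 ℤ.* a ℤ.- c ℤ.* c , + 4)
          u≡ = trans (cong₂ (λ x y → x ⊕ ⊖ y) (⊗-def (+ 4) (+ 0) a (+ 1)) (sym (int-* c c))) (cong₂ _,_
            (I.solve 3 (λ n a c → I.con (+ 4) I.:* a I.:+ n I.:* (I.con (+ 0) I.:* I.con (+ 1)) I.:+ I.:- (c I.:* c) I.:= I.con (+ 4) I.:* a I.:- c I.:* c) refl n a c)
            (I.solve 2 (λ t a → I.con (+ 4) I.:* I.con (+ 1) I.:+ I.con (+ 0) I.:* a I.:+ t I.:* (I.con (+ 0) I.:* I.con (+ 1)) I.:+ I.:- I.con (+ 0) I.:= I.con (+ 4)) refl t a))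
          det≡ : symDet₃ (int p) (int q) (int s) (int r) (int v) u
            ≡ int (p ℤ.* s ℤ.- q ℤ.* q) ⊗ (+ 4 ℤ.* a ℤ.- c ℤ.* c , + 4) ⊕ ⊖ int (s ℤ.* (r ℤ.* r)) ⊕ ⊖ int (v ℤ.* (p ℤ.* v ℤ.- + 2 ℤ.* (q ℤ.* r)))
          det≡ = cong₂ _⊕_ (cong₂ (λ x y → x ⊕ ⊖ y) (cong₂ _⊗_ (symDet₂-int p q s) u≡)
              (trans (cong (int s ⊗_) (sym (int-* r r))) (sym (int-* s (r ℤ.* r)))))
            (cong ⊖_ (trans (cong (int v ⊗_) (cong₂ (λ x y → x ⊕ ⊖ y) (sym (int-* p v))
              (trans (cong (int (+ 2) ⊗_) (sym (int-* q r))) (sym (int-* (+ 2) (q ℤ.* r)))))) (sym (int-* v (p ℤ.* v ℤ.- + 2 ℤ.* (q ℤ.* r))))))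
          second : proj₂ (symDet₃ (int p) (int q) (int s) (int r) (int v) u) ≡ + 4 ℤ.* (p ℤ.* s ℤ.- q ℤ.* q)
          second = trans (cong proj₂ (trans det≡ (cong (λ z → z ⊕ ⊖ int (s ℤ.* (r ℤ.* r)) ⊕ ⊖ int (v ℤ.* (p ℤ.* v ℤ.- + 2 ℤ.* (q ℤ.* r)))) (⊗-def (p ℤ.* s ℤ.- q ℤ.* q) (+ 0) (+ 4 ℤ.* a ℤ.- c ℤ.* c) (+ 4)))))
            (I.solve 3 (λ t m w → m I.:* I.con (+ 4) I.:+ I.con (+ 0) I.:* w I.:+ t I.:* (I.con (+ 0) I.:* I.con (+ 4)) I.:+ I.:- I.con (+ 0) I.:+ I.:- I.con (+ 0) I.:= I.con (+ 4) I.:* m)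
              refl t (p ℤ.* s ℤ.- q ℤ.* q) (+ 4 ℤ.* a ℤ.- c ℤ.* c))
          zero4 : ∀ m → + 4 ℤ.* m ≡ + 0 → m ≡ + 0
          zero4 m h = [ (λ ()) , (λ z → z) ]′ (ℤ.i*j≡0⇒i≡0∨j≡0 (+ 4) h)

        impossible : ⊥
        impossible = finish (minimalTrace ℤ.∣ Δ ∣ t′ t′≤1 (ℤ.drop‿+≤+ (subst (+ 1849 ℤ.≤_) (sym ∣Δ∣≡) 1849≤Δ)))
            (universal 1O (int-totpos 1)) (universal (int (+ 2)) (int-totpos 2)) (universal (int (+ 3)) (int-totpos 3)) (universal (int (+ 5)) (int-totpos 5))
          where
          ∣Δ∣≡ : + ℤ.∣ Δ ∣ ≡ Δ
          ∣Δ∣≡ = ℤ.0≤i⇒+∣i∣≡i (ℤ.<⇒≤ 0<Δ)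
          finish : ∃[ a ] (let s = 2 ℕ.* a ℕ.+ t′ in ℤ.∣ Δ ∣ ℕ.< s ℕ.* s × 40 ℕ.* s ℕ.< ℤ.∣ Δ ∣) →
            ∃[ x ] q x ≡ 1O → ∃[ x ] q x ≡ int (+ 2) → ∃[ x ] q x ≡ int (+ 3) → ∃[ x ] q x ≡ int (+ 5) → ⊥
          finish (a , Δ<s² , 40s<Δ) (x₁ , q₁) (x₂ , q₂) (x₃ , q₃) (x₅ , q₅) = final (universal α α>0)
            where
            open Base x₁ q₁
            s : ℕ
            s = 2 ℕ.* a ℕ.+ t′
            α : O
            α = + a , + 1
            τα : τ α ≡ + s
            τα = trans (cong₂ ℤ._+_ (sym (ℤ.pos-* 2 a)) (trans (ℤ.*-identityʳ t) t≡t′)) (sym (ℤ.pos-+ (2 ℕ.* a) t′))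
            0<s : 0 ℕ.< s
            0<s = ℕ.n≢0⇒n>0 (λ s≡0 → ℕ.n≮0 (subst (λ s → ℤ.∣ Δ ∣ ℕ.< s ℕ.* s) s≡0 Δ<s²))
            α>0 : TotallyPositive α
            α>0 = subst (+ 0 ℤ.<_) (sym τα) (ℤ.+<+ 0<s)
                , subst₂ ℤ._<_ (trans ∣Δ∣≡ (sym (ℤ.*-identityʳ Δ))) (trans (ℤ.pos-* s s) (sym (cong₂ ℤ._*_ τα τα))) (ℤ.+<+ Δ<s²)
            40s : + 40 ℤ.* + s ℤ.< Δ
            40s = subst₂ ℤ._<_ (ℤ.pos-* 40 s) ∣Δ∣≡ (ℤ.+<+ 40s<Δ)
            -- For integral norms the bound 8mτ(k) is 16mk, at most 160 in the uses below.
            small : ∀ m k → 16 ℕ.* (m ℕ.* k) ℕ.< 1849 → + 8 ℤ.* (+ m ℤ.* τ (int (+ k))) ℤ.< Δ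
            small m k h = subst (ℤ._< Δ) (sym (trans (cong (λ z → + 8 ℤ.* (+ m ℤ.* z)) (τ-int (+ k)))
                (trans (I.solve 2 (λ m k → I.con (+ 8) I.:* (m I.:* (I.con (+ 2) I.:* k)) I.:= I.con (+ 16) I.:* (m I.:* k)) refl (+ m) (+ k))
                  (trans (cong (λ z → + 16 ℤ.* z) (sym (ℤ.pos-* m k))) (sym (ℤ.pos-* 16 (m ℕ.* k)))))))
              (ℤ.<-≤-trans (ℤ.+<+ h) 1849≤Δ)
            b₂ b₃ b₅ b₂₃ b₂₅ : ℤ
            b₂ = proj₁ (b x₁ x₂)
            b₃ = proj₁ (b x₁ x₃)
            b₅ = proj₁ (b x₁ x₅)
            b₂₃ = proj₁ (b x₂ x₃)
            b₂₅ = proj₁ (b x₂ x₅)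
            e₂ : b x₁ x₂ ≡ int b₂
            e₂ = integral⇒int _ (b-integral x₁ x₂ 1 (int (+ 2)) q₁ q₂ (small 1 2 (ℕ.≤ᵇ⇒≤ _ _ tt)))
            e₃ : b x₁ x₃ ≡ int b₃
            e₃ = integral⇒int _ (b-integral x₁ x₃ 1 (int (+ 3)) q₁ q₃ (small 1 3 (ℕ.≤ᵇ⇒≤ _ _ tt)))
            e₅ : b x₁ x₅ ≡ int b₅
            e₅ = integral⇒int _ (b-integral x₁ x₅ 1 (int (+ 5)) q₁ q₅ (small 1 5 (ℕ.≤ᵇ⇒≤ _ _ tt)))
            e₂₃ : b x₂ x₃ ≡ int b₂₃
            e₂₃ = integral⇒int _ (b-integral x₂ x₃ 2 (int (+ 3)) q₂ q₃ (small 2 3 (ℕ.≤ᵇ⇒≤ _ _ tt)))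
            e₂₅ : b x₂ x₅ ≡ int b₂₅
            e₂₅ = integral⇒int _ (b-integral x₂ x₅ 2 (int (+ 5)) q₂ q₅ (small 2 5 (ℕ.≤ᵇ⇒≤ _ _ tt)))
            h-int : ∀ x y i j k → b x y ≡ int k → b x₁ x ≡ int i → b x₁ y ≡ int j → h x y ≡ int (+ 2 ℤ.* k ℤ.- i ℤ.* j)
            h-int x y i j k bxy bx by = trans (cong₂ (λ u w → int (+ 2) ⊗ u ⊕ ⊖ w) bxy (cong₂ _⊗_ bx by))
              (cong₂ (λ u w → u ⊕ ⊖ w) (sym (int-* (+ 2) k)) (sym (int-* i j)))
            h-diag-int : ∀ x i m → q x ≡ int m → b x₁ x ≡ int i → h x x ≡ int (+ 4 ℤ.* m ℤ.- i ℤ.* i)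
            h-diag-int x i m qx bx = trans (h-diag x) (trans (cong₂ (λ u w → int (+ 4) ⊗ u ⊕ ⊖ (w ⊗ w)) qx bx)
              (cong₂ (λ u w → u ⊕ ⊖ w) (sym (int-* (+ 4) m)) (sym (int-* i i))))
            final : ∃[ y ] q y ≡ α → ⊥
            final (y , qy) = T-not (T-not∨ {degenerate (+ 12) b₃ b₂₃ b₂} level₁ (deg (+ 3) b₃ b₂₃ (plane x₃ 3 b₃ b₂₃ q₃ e₃ e₂₃ (small-y 3 (ℕ.≤ᵇ⇒≤ _ _ tt)))))
                (deg (+ 5) b₅ b₂₅ (plane x₅ 5 b₅ b₂₅ q₅ e₅ e₂₅ (small-y 5 (ℕ.≤ᵇ⇒≤ _ _ tt))))
              where
              -- The case m = 5 is the bound 40s; smaller norms only improve it.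
              small-y : ∀ m → m ℕ.≤ 5 → + 8 ℤ.* (+ m ℤ.* τ α) ℤ.< Δ
              small-y m m≤5 = ℤ.≤-<-trans (subst₂ ℤ._≤_
                  (trans (ℤ.pos-* 8 (m ℕ.* s)) (cong (λ z → + 8 ℤ.* z) (trans (ℤ.pos-* m s) (cong (+ m ℤ.*_) (sym τα)))))
                  (trans (cong +_ (sym (ℕ.*-assoc 8 5 s))) (ℤ.pos-* 40 s))
                  (ℤ.+≤+ (ℕ.*-monoʳ-≤ 8 (ℕ.*-monoˡ-≤ s m≤5)))) 40s
              c r₂ : ℤ
              c = proj₁ (b x₁ y)
              r₂ = proj₁ (b x₂ y)
              ec : b x₁ y ≡ int c
              ec = integral⇒int _ (b-integral x₁ y 1 α q₁ qy (small-y 1 (ℕ.≤ᵇ⇒≤ _ _ tt)))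
              er₂ : b x₂ y ≡ int r₂
              er₂ = integral⇒int _ (b-integral x₂ y 2 α q₂ qy (small-y 2 (ℕ.≤ᵇ⇒≤ _ _ tt)))
              hy : h y y ≡ int (+ 4) ⊗ α ⊕ ⊖ (int c ⊗ int c)
              hy = trans (h-diag y) (cong₂ (λ u w → int (+ 4) ⊗ u ⊕ ⊖ (w ⊗ w)) qy ec)
              -- Both alternatives of `h-rank` lead to the same equation, so x lies in the plane of
              -- `x₁` and `x₂`. For norms 3 and 5 together this contradicts `noPlane`.
              plane : ∀ x m i j → .{{ℕ.NonZero m}} → q x ≡ int (+ m) → b x₁ x ≡ int i → b x₂ x ≡ int j → + 8 ℤ.* (+ m ℤ.* τ α) ℤ.< Δ →
                symDet₂ (int (+ 8 ℤ.- b₂ ℤ.* b₂)) (int (+ 2 ℤ.* j ℤ.- b₂ ℤ.* i)) (int (+ 4 ℤ.* + m ℤ.- i ℤ.* i)) ≡ 0O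
              plane x m i j qx bx b₂x sm = [ (λ e → trans (sym (cong₃ p q′ s′)) e)
                  , (λ e → ω-component (+ 8 ℤ.- b₂ ℤ.* b₂) (+ 2 ℤ.* j ℤ.- b₂ ℤ.* i) (+ 4 ℤ.* + m ℤ.- i ℤ.* i)
                      (+ 2 ℤ.* r₂ ℤ.- b₂ ℤ.* c) (+ 2 ℤ.* k ℤ.- i ℤ.* c) c (+ a) (trans (sym (cong₆ p q′ s′ (h-int x₂ y b₂ c r₂ er₂ e₂ ec) (h-int x y i c k ek bx ec) hy)) e)) ]′ (h-rank x₂ x y)
                where
                k : ℤ
                k = proj₁ (b x y)
                ek : b x y ≡ int k
                ek = integral⇒int _ (b-integral x y m α qx qy sm)
                p : h x₂ x₂ ≡ int (+ 8 ℤ.- b₂ ℤ.* b₂)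
                p = h-diag-int x₂ b₂ (+ 2) q₂ e₂
                q′ : h x₂ x ≡ int (+ 2 ℤ.* j ℤ.- b₂ ℤ.* i)
                q′ = h-int x₂ x b₂ i j b₂x e₂ bx
                s′ : h x x ≡ int (+ 4 ℤ.* + m ℤ.- i ℤ.* i)
                s′ = h-diag-int x i (+ m) qx bx
                cong₃ : ∀ {p q s p' q' s'} → p ≡ p' → q ≡ q' → s ≡ s' → symDet₂ p q s ≡ symDet₂ p' q' s'
                cong₃ refl refl refl = refl
                cong₆ : ∀ {p q s r v u p' q' s' r' v' u'} → p ≡ p' → q ≡ q' → s ≡ s' → r ≡ r' → v ≡ v' → u ≡ u' →
                  symDet₃ p q s r v u ≡ symDet₃ p' q' s' r' v' u'
                cong₆ refl refl refl refl refl refl = refl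
              deg : ∀ m i j → symDet₂ (int (+ 8 ℤ.- b₂ ℤ.* b₂)) (int (+ 2 ℤ.* j ℤ.- b₂ ℤ.* i)) (int (+ 4 ℤ.* m ℤ.- i ℤ.* i)) ≡ 0O →
                T (degenerate (+ 4 ℤ.* m) i j b₂)
              deg m i j e = does-≟ ((+ 8 ℤ.- b₂ ℤ.* b₂) ℤ.* (+ 4 ℤ.* m ℤ.- i ℤ.* i)) ((+ 2 ℤ.* j ℤ.- b₂ ℤ.* i) ℤ.* (+ 2 ℤ.* j ℤ.- b₂ ℤ.* i)) (trans (cong proj₁ (cong₂ (λ x y → x ⊕ ⊖ y)
                  (int-* (+ 8 ℤ.- b₂ ℤ.* b₂) (+ 4 ℤ.* m ℤ.- i ℤ.* i)) (int-* (+ 2 ℤ.* j ℤ.- b₂ ℤ.* i) (+ 2 ℤ.* j ℤ.- b₂ ℤ.* i)))) (cong proj₁ e))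
                where
                does-≟ : ∀ x y → x ℤ.- y ≡ + 0 → T (does (x ℤ.≟ y))
                does-≟ x y h = subst T (sym (dec-true (x ℤ.≟ y) (ℤ.i-j≡0⇒i≡j x y h))) tt
              level₁ : T (not (degenerate (+ 12) b₃ b₂₃ b₂) ∨ not (degenerate (+ 20) b₅ b₂₅ b₂))
              level₁ = combine {degenerate (+ 12) b₃ b₂₃ b₂} outer
                where
                inner : ℤ → ℤ → ℤ → Bool
                inner a c e = not (degenerate (+ 20) c e a)
                outer : T (not (degenerate (+ 12) b₃ b₂₃ b₂) ∨ all (λ c → all (inner b₂ c) (ints 6)) (ints 4))
                outer = all-sound (λ g → not (degenerate (+ 12) b₃ g b₂) ∨ all (λ c → all (inner b₂ c) (ints 6)) (ints 4)) (ints 4)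
                  (all-sound (λ b → all (λ g → not (degenerate (+ 12) b g b₂) ∨ all (λ c → all (inner b₂ c) (ints 6)) (ints 4)) (ints 4)) (ints 3)
                    (all-sound (λ a → all (λ b → all (λ g → not (degenerate (+ 12) b g a) ∨ all (λ c → all (inner a c) (ints 6)) (ints 4)) (ints 4)) (ints 3)) (ints 2) noPlane
                      (∈-ints b₂ 2 (b-bound x₁ x₂ 1 2 b₂ q₁ q₂ e₂)))
                    (∈-ints b₃ 3 (b-bound x₁ x₃ 1 3 b₃ q₁ q₃ e₃)))
                  (∈-ints b₂₃ 4 (b-bound x₂ x₃ 2 3 b₂₃ q₂ q₃ e₂₃))
                combine : ∀ {d} → T (not d ∨ all (λ c → all (inner b₂ c) (ints 6)) (ints 4)) → T (not d ∨ not (degenerate (+ 20) b₅ b₂₅ b₂))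
                combine {false} _ = tt
                combine {true}  k = all-sound (inner b₂ b₅) (ints 6) (all-sound (λ c → all (inner b₂ c) (ints 6)) (ints 4) k
                  (∈-ints b₅ 4 (b-bound x₁ x₅ 1 5 b₅ q₁ q₅ e₅))) (∈-ints b₂₅ 6 (b-bound x₂ x₅ 2 5 b₂₅ q₂ q₅ e₂₅))

      -- Free lattices when 5 divides the discriminant

      module FreeBasis (κ δ : ℤ) (Δ≡5δ : Δ ≡ + 5 ℤ.* δ) where
        open Check κ using (normO; normO≡; ∣normO∣-*; primitive5; divides)
        open SO using (detR; :det; detR-*; solve; con; _:+_; _:*_; :-_; _:=_)

        -- As 4N(x) = τ² - Δb² and 5 divides Δ, the norm is -τ² modulo 5 and its square is τ⁴.
        norm-mod5 : ∀ x → ¬ T ((ℤ.∣ normO x ∣ % 5 ℕ.≡ᵇ 2) ∨ (ℤ.∣ normO x ∣ % 5 ℕ.≡ᵇ 3))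
        norm-mod5 x@(a , b) = fourthPower-mod5 ℤ.∣ normO x ∣ ℤ.∣ τ x ∣ (w ℤ.* (+ 5 ℤ.* w ℤ.- + 2 ℤ.* (τ x ℤ.* τ x)))
          (trans (square-abs (normO x)) (trans (cong (λ z → z ℤ.* z) normO≡w) (trans
            (I.solve 2 (λ w s → (I.con (+ 5) I.:* w I.:- s) I.:* (I.con (+ 5) I.:* w I.:- s) I.:= s I.:* s I.:+ I.con (+ 5) I.:* (w I.:* (I.con (+ 5) I.:* w I.:- I.con (+ 2) I.:* s))) refl w (τ x ℤ.* τ x))
            (cong (λ s → s ℤ.* s ℤ.+ + 5 ℤ.* (w ℤ.* (+ 5 ℤ.* w ℤ.- + 2 ℤ.* (τ x ℤ.* τ x)))) (sym (square-abs (τ x)))))))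
          where
          square-abs : ∀ i → + ℤ.∣ i ∣ ℤ.* + ℤ.∣ i ∣ ≡ i ℤ.* i
          square-abs i = trans (sym (ℤ.pos-* ℤ.∣ i ∣ ℤ.∣ i ∣)) (trans (cong +_ (sym (ℤ.abs-* i i))) (ℤ.0≤i⇒+∣i∣≡i (square≥0 i)))
          -- The quotient in N = 5w - τ², obtained from N = 5N - 4N = 5N + Δb² - τ² with Δ = 5δ.
          w : ℤ
          w = norm x ℤ.+ δ ℤ.* (b ℤ.* b)
          normO≡w : normO x ≡ + 5 ℤ.* w ℤ.- τ x ℤ.* τ x
          normO≡w = trans (normO≡ a b) (trans
            (I.solve 5 (λ t n a b Δ → let N = a I.:* a I.:+ t I.:* (a I.:* b) I.:- n I.:* (b I.:* b) ; τ = I.con (+ 2) I.:* a I.:+ t I.:* b in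
                N I.:= I.con (+ 5) I.:* N I.:+ (t I.:* t I.:+ I.con (+ 4) I.:* n) I.:* (b I.:* b) I.:- τ I.:* τ) refl t n a b Δ)
            (trans (cong (λ D → + 5 ℤ.* norm x ℤ.+ D ℤ.* (b ℤ.* b) ℤ.- τ x ℤ.* τ x) Δ≡5δ)
              (I.solve 4 (λ N δ b s → I.con (+ 5) I.:* N I.:+ I.con (+ 5) I.:* δ I.:* (b I.:* b) I.:- s I.:= I.con (+ 5) I.:* (N I.:+ δ I.:* (b I.:* b)) I.:- s) refl (norm x) δ b (τ x ℤ.* τ x))))

        norm-zero⇒zero : ∀ x → normO x ≡ + 0 → x ≡ 0O
        norm-zero⇒zero x@(a , b) e with x ≟O 0O
          where
          _≟O_ : (x y : O) → Dec (x ≡ y)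
          (a , b) ≟O (c , d) with a ℤ.≟ c | b ℤ.≟ d
          ... | yes refl | yes refl = yes refl
          ... | no a≢c   | _        = no (λ { refl → a≢c refl })
          ... | yes _    | no b≢d   = no (λ { refl → b≢d refl })
        ... | yes x≡0 = x≡0
        ... | no x≢0 = ⊥-elim (x≢0 (conj-zero (domain x (conjO x) x*conj x≢0)))
          where
          x*conj : x ⊗ conjO x ≡ 0O
          x*conj = trans (⊗-def a b (a ℤ.+ t ℤ.* b) (ℤ.- b)) (cong₂ _,_
            (trans (I.solve 4 (λ t n a b → a I.:* (a I.:+ t I.:* b) I.:+ n I.:* (b I.:* I.:- b) I.:= a I.:* a I.:+ t I.:* (a I.:* b) I.:- n I.:* (b I.:* b)) refl t n a b) (trans (sym (normO≡ a b)) e))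
            (I.solve 3 (λ t a b → a I.:* I.:- b I.:+ b I.:* (a I.:+ t I.:* b) I.:+ t I.:* (b I.:* I.:- b) I.:= I.con (+ 0)) refl t a b))
          conj-zero : conjO x ≡ 0O → x ≡ 0O
          conj-zero h = cong₂ _,_ (trans (I.solve 3 (λ t a b → a I.:= (a I.:+ t I.:* b) I.:+ t I.:* (I.:- b)) refl t a b) (trans (cong₂ (λ u v → u ℤ.+ t ℤ.* v) (cong proj₁ h) (cong proj₂ h)) (trans (ℤ.+-identityˡ (t ℤ.* + 0)) (ℤ.*-zeroʳ t))))
            (trans (sym (ℤ.neg-involutive b)) (cong ℤ.-_ (cong proj₂ h)))

        divides-complete : ∀ x w y → x ⊗ w ≡ y → T (divides x y)
        divides-complete x@(a , b) w@(c , d) _ refl = ∧T (dvd c (cong proj₁ conj*)) (dvd d (cong proj₂ conj*))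
          where
          conj* : conjO x ⊗ (x ⊗ w) ≡ (normO x ℤ.* c , normO x ℤ.* d)
          conj* = trans (conj*-cancel x w) (trans (cong (λ N → int N ⊗ w) (sym (normO≡ a b))) (trans (⊗-def (normO x) (+ 0) c d) (cong₂ _,_
            (I.solve 4 (λ n N c d → N I.:* c I.:+ n I.:* (I.con (+ 0) I.:* d) I.:= N I.:* c) refl n (normO x) c d)
            (I.solve 4 (λ t N c d → N I.:* d I.:+ I.con (+ 0) I.:* c I.:+ t I.:* (I.con (+ 0) I.:* d) I.:= N I.:* d) refl t (normO x) c d))))
          dvd : ∀ c {z} → z ≡ normO x ℤ.* c → T (does (ℤ.∣ normO x ∣ ℕ.∣? ℤ.∣ z ∣))
          dvd c refl = subst T (sym (dec-true (ℤ.∣ normO x ∣ ℕ.∣? ℤ.∣ normO x ℤ.* c ∣)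
            (ℕ.divides ℤ.∣ c ∣ (trans (ℤ.abs-* (normO x) c) (ℕ.*-comm ℤ.∣ normO x ∣ ℤ.∣ c ∣))))) tt

        -- Since N(4) = 16, the quotient |N(x)|/16 is N(c)²|N(g)|, so m = |N(c)| is among the
        -- numbers that `primitive5` inspects. Being a norm up to sign, m is not ±2 modulo 5, which
        -- leaves m < 2; and m ≠ 0 as x ≠ 0.
        primitive5-unit : ∀ x c g → x ≡ int (+ 4) ⊗ ((c ⊗ c) ⊗ g) → ¬ (x ≡ 0O) → T (primitive5 x) → ℤ.∣ normO c ∣ ≡ 1
        primitive5-unit x c g refl x≢0 h = one m m≢0 m<2
          where
          m l k : ℕ
          m = ℤ.∣ normO c ∣
          l = ℤ.∣ normO g ∣
          k = ℤ.∣ normO x ∣ / 16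
          norm4 : ℤ.∣ normO (int (+ 4)) ∣ ≡ 16
          norm4 = cong ℤ.∣_∣ (trans (normO≡ (+ 4) (+ 0)) (I.solve 2 (λ t n → I.con (+ 4) I.:* I.con (+ 4) I.:+ t I.:* (I.con (+ 4) I.:* I.con (+ 0)) I.:- n I.:* (I.con (+ 0) I.:* I.con (+ 0)) I.:= I.con (+ 16)) refl t n))
          N≡ : ℤ.∣ normO x ∣ ≡ (l ℕ.* (m ℕ.* m)) ℕ.* 16
          N≡ = trans (∣normO∣-* (int (+ 4)) ((c ⊗ c) ⊗ g)) (trans (cong₂ ℕ._*_ norm4 (trans (∣normO∣-* (c ⊗ c) g) (trans (cong (ℕ._* l) (∣normO∣-* c c)) (ℕ.*-comm (m ℕ.* m) l))))
            (ℕ.*-comm 16 (l ℕ.* (m ℕ.* m))))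
          k≡ : k ≡ l ℕ.* (m ℕ.* m)
          k≡ = trans (cong (_/ 16) N≡) (m*n/n≡m (l ℕ.* (m ℕ.* m)) 16)
          k≢0 : ¬ (k ≡ 0)
          k≢0 e = x≢0 (norm-zero⇒zero x (ℤ.∣i∣≡0⇒i≡0 (trans N≡ (cong (ℕ._* 16) (trans (sym k≡) e)))))
          m≢0 : ¬ (m ≡ 0)
          m≢0 e = k≢0 (trans k≡ (trans (cong (λ m → l ℕ.* (m ℕ.* m)) e) (ℕ.*-zeroʳ l)))
          l≢0 : ¬ (l ≡ 0)
          l≢0 e = k≢0 (trans k≡ (cong (ℕ._* (m ℕ.* m)) e))
          m≤√k : m ℕ.≤ root 1 k
          m≤√k = root-≥ 1 k m (ℕ.≤-trans (ℕ.≤-reflexive (ℕ.*-identityˡ (m ℕ.* m)))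
            (ℕ.≤-trans (ℕ.m≤n*m (m ℕ.* m) l {{ℕ.≢-nonZero l≢0}}) (ℕ.≤-reflexive (sym k≡))))
          m<2 : T (m ℕ.<ᵇ 2)
          m<2 = elim (m ℕ.<ᵇ 2) (m % 5 ℕ.≡ᵇ 2) (m % 5 ℕ.≡ᵇ 3) (does (m ℕ.* m ℕ.∣? k))
            (all-sound (λ m → (m ℕ.<ᵇ 2) ∨ (m % 5 ℕ.≡ᵇ 2) ∨ (m % 5 ℕ.≡ᵇ 3) ∨ not (does (m ℕ.* m ℕ.∣? k))) (downFrom (suc (root 1 k))) h (∈-downFrom⁺ (ℕ.s≤s m≤√k)))
            (norm-mod5 c) (subst T (sym (dec-true (m ℕ.* m ℕ.∣? k) (ℕ.divides l k≡))) tt)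
            where
            elim : ∀ a b c d → T (a ∨ b ∨ c ∨ not d) → ¬ T (b ∨ c) → T d → T a
            elim true  _     _     _     _ _ _ = tt
            elim false true  _     _     _ f _ = ⊥-elim (f tt)
            elim false false true  _     _ f _ = ⊥-elim (f tt)
            elim false false false true  () _ _
          one : ∀ m → ¬ (m ≡ 0) → T (m ℕ.<ᵇ 2) → m ≡ 1
          one zero          m≢0 _ = ⊥-elim (m≢0 refl)
          one (suc zero)    _   _ = refl
          one (suc (suc _)) _   ()

        module _ (e₀ e₁ e₂ : X)
          (coordinates : ∀ x → ∃[ c ] ∃[ d ] ∃[ e ] (∀ y → b x y ≡ c ⊗ b e₀ y ⊕ (d ⊗ b e₁ y ⊕ e ⊗ b e₂ y))) where

          -- The Gram determinant of a basis is twice the determinant of an integral form.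
          gram-even : ∃[ g ] detR (b e₀ e₀) (b e₀ e₁) (b e₀ e₂) (b e₁ e₀) (b e₁ e₁) (b e₁ e₂) (b e₂ e₀) (b e₂ e₁) (b e₂ e₂) ≡ int (+ 2) ⊗ g
          gram-even = int (+ 4) ⊗ (q e₀ ⊗ (q e₁ ⊗ q e₂)) ⊕ b e₀ e₁ ⊗ (b e₀ e₂ ⊗ b e₁ e₂)
                ⊕ ⊖ (q e₀ ⊗ (b e₁ e₂ ⊗ b e₁ e₂) ⊕ q e₁ ⊗ (b e₀ e₂ ⊗ b e₀ e₂) ⊕ q e₂ ⊗ (b e₀ e₁ ⊗ b e₀ e₁)) , trans (detR-cong (b e₀ e₁) (b e₀ e₂) (b e₁ e₂) (b-diag e₀) (b-diag e₁) (b-diag e₂) (b-sym e₁ e₀) (b-sym e₂ e₀) (b-sym e₂ e₁))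
              (even (q e₀) (q e₁) (q e₂) (b e₀ e₁) (b e₀ e₂) (b e₁ e₂))
            where
            detR-cong : ∀ b c f {a d e g h i a' e' i' d' g' h'} → a ≡ a' → e ≡ e' → i ≡ i' → d ≡ d' → g ≡ g' → h ≡ h' →
              detR a b c d e f g h i ≡ detR a' b c d' e' f g' h' i'
            detR-cong b c f refl refl refl refl refl refl = refl
            even : ∀ a b c x y z → detR (a ⊕ a) x y x (b ⊕ b) z y z (c ⊕ c)
              ≡ int (+ 2) ⊗ (int (+ 4) ⊗ (a ⊗ (b ⊗ c)) ⊕ x ⊗ (y ⊗ z) ⊕ ⊖ (a ⊗ (z ⊗ z) ⊕ b ⊗ (y ⊗ y) ⊕ c ⊗ (x ⊗ x)))
            even = solve 6 (λ a b c x y z → :det (a :+ a) x y x (b :+ b) z y z (c :+ c)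
              := con (+ 2) :* (con (+ 4) :* (a :* (b :* c)) :+ x :* (y :* z) :+ :- (a :* (z :* z) :+ b :* (y :* y) :+ c :* (x :* x)))) refl

          module _ (v₁ : X) (q₁ : q v₁ ≡ 1O) (x y z : X) where
            open Base v₁ q₁

            private
              X₂ : O
              X₂ = symDet₂ (h x x) (h x y) (h y y)

            -- With C the coordinate matrix and G the Gram matrix of the basis, the Gram matrix of
            -- v₁, x, y is C G Cᵗ; the product formula is used on the rows and, after transposition,
            -- on the columns. Pivoting on b(v₁,v₁) = 2 shows that `X₂` is twice its determinant,
            -- and `gram-even` supplies the other factor 2.
            gram-change : ∀ {c₁₀ c₁₁ c₁₂ c₂₀ c₂₁ c₂₂ c₃₀ c₃₁ c₃₂} →
              (∀ y → b v₁ y ≡ c₁₀ ⊗ b e₀ y ⊕ (c₁₁ ⊗ b e₁ y ⊕ c₁₂ ⊗ b e₂ y)) →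
              (∀ u → b x u ≡ c₂₀ ⊗ b e₀ u ⊕ (c₂₁ ⊗ b e₁ u ⊕ c₂₂ ⊗ b e₂ u)) →
              (∀ u → b y u ≡ c₃₀ ⊗ b e₀ u ⊕ (c₃₁ ⊗ b e₁ u ⊕ c₃₂ ⊗ b e₂ u)) →
              let c = detR c₁₀ c₁₁ c₁₂ c₂₀ c₂₁ c₂₂ c₃₀ c₃₁ c₃₂ in
              X₂ ≡ int (+ 4) ⊗ ((c ⊗ c) ⊗ proj₁ gram-even)
            gram-change {c₁₀} {c₁₁} {c₁₂} {c₂₀} {c₂₁} {c₂₂} {c₃₀} {c₃₁} {c₃₂} h₁ h₂ h₃ =
              trans (sym half-det) (trans (cong (int (+ 2) ⊗_) (trans (detR-cong₉ (h₁ v₁) (h₁ x) (h₁ y) (h₂ v₁) (h₂ x) (h₂ y) (h₃ v₁) (h₃ x) (h₃ y))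
                (trans (detR-* c₁₀ c₁₁ c₁₂ c₂₀ c₂₁ c₂₂ c₃₀ c₃₁ c₃₂ (b e₀ v₁) (b e₀ x) (b e₀ y) (b e₁ v₁) (b e₁ x) (b e₁ y) (b e₂ v₁) (b e₂ x) (b e₂ y))
                  (cong (c ⊗_) second))))
                (collect c (proj₁ gram-even)))
              where
              c : O
              c = detR c₁₀ c₁₁ c₁₂ c₂₀ c₂₁ c₂₂ c₃₀ c₃₁ c₃₂
              detR-cong₉ : ∀ {a b c d e f g h i a' b' c' d' e' f' g' h' i'} → a ≡ a' → b ≡ b' → c ≡ c' → d ≡ d' → e ≡ e' → f ≡ f' → g ≡ g' → h ≡ h' → i ≡ i' →
                detR a b c d e f g h i ≡ detR a' b' c' d' e' f' g' h' i'
              detR-cong₉ refl refl refl refl refl refl refl refl refl = refl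
              transpose : ∀ a b c d e f g h i → detR a b c d e f g h i ≡ detR a d g b e h c f i
              transpose = solve 9 (λ a b c d e f g h i → :det a b c d e f g h i := :det a d g b e h c f i) refl
              second : detR (b e₀ v₁) (b e₀ x) (b e₀ y) (b e₁ v₁) (b e₁ x) (b e₁ y) (b e₂ v₁) (b e₂ x) (b e₂ y) ≡ c ⊗ (int (+ 2) ⊗ proj₁ gram-even)
              second = trans (transpose (b e₀ v₁) (b e₀ x) (b e₀ y) (b e₁ v₁) (b e₁ x) (b e₁ y) (b e₂ v₁) (b e₂ x) (b e₂ y))
                (trans (detR-cong₉ (flip v₁ {c₁₀} {c₁₁} {c₁₂} h₁ e₀) (flip v₁ {c₁₀} {c₁₁} {c₁₂} h₁ e₁) (flip v₁ {c₁₀} {c₁₁} {c₁₂} h₁ e₂) (flip x {c₂₀} {c₂₁} {c₂₂} h₂ e₀) (flip x {c₂₀} {c₂₁} {c₂₂} h₂ e₁) (flip x {c₂₀} {c₂₁} {c₂₂} h₂ e₂) (flip y {c₃₀} {c₃₁} {c₃₂} h₃ e₀) (flip y {c₃₀} {c₃₁} {c₃₂} h₃ e₁) (flip y {c₃₀} {c₃₁} {c₃₂} h₃ e₂))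
                  (trans (detR-* c₁₀ c₁₁ c₁₂ c₂₀ c₂₁ c₂₂ c₃₀ c₃₁ c₃₂ (b e₀ e₀) (b e₀ e₁) (b e₀ e₂) (b e₁ e₀) (b e₁ e₁) (b e₁ e₂) (b e₂ e₀) (b e₂ e₁) (b e₂ e₂))
                    (cong (c ⊗_) (proj₂ gram-even))))
                where
                flip : ∀ x {c d e} → (∀ y → b x y ≡ c ⊗ b e₀ y ⊕ (d ⊗ b e₁ y ⊕ e ⊗ b e₂ y)) → ∀ u → b u x ≡ c ⊗ b e₀ u ⊕ (d ⊗ b e₁ u ⊕ e ⊗ b e₂ u)
                flip x h u = trans (b-sym u x) (h u)
              collect : ∀ c g → int (+ 2) ⊗ (c ⊗ (c ⊗ (int (+ 2) ⊗ g))) ≡ int (+ 4) ⊗ ((c ⊗ c) ⊗ g)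
              collect = solve 2 (λ c g → con (+ 2) :* (c :* (c :* (con (+ 2) :* g))) := con (+ 4) :* ((c :* c) :* g)) refl
              half-det : int (+ 2) ⊗ detR (b v₁ v₁) (b v₁ x) (b v₁ y) (b x v₁) (b x x) (b x y) (b y v₁) (b y x) (b y y) ≡ X₂
              half-det = trans (cong (int (+ 2) ⊗_) (detR-cong₉ b₁₁ (refl {x = b v₁ x}) (refl {x = b v₁ y}) (b-sym x v₁) (refl {x = b x x}) (refl {x = b x y}) (b-sym y v₁) (b-sym y x) (refl {x = b y y})))
                (expand (b v₁ x) (b v₁ y) (b x x) (b x y) (b y y))
                where
                expand : ∀ a c d e f → int (+ 2) ⊗ detR (int (+ 2)) a c a d e c e f
                  ≡ symDet₂ (int (+ 2) ⊗ d ⊕ ⊖ (a ⊗ a)) (int (+ 2) ⊗ e ⊕ ⊖ (a ⊗ c)) (int (+ 2) ⊗ f ⊕ ⊖ (c ⊗ c))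
                expand = solve 5 (λ a c d e f → con (+ 2) :* :det (con (+ 2)) a c a d e c e f
                  := (con (+ 2) :* d :+ :- (a :* a)) :* (con (+ 2) :* f :+ :- (c :* c)) :+ :- ((con (+ 2) :* e :+ :- (a :* c)) :* (con (+ 2) :* e :+ :- (a :* c)))) refl

            -- If c is a unit, v₁, x, y span the lattice, so z is an integral combination of them (Cramer).
            span : ∀ {c₁₀ c₁₁ c₁₂ c₂₀ c₂₁ c₂₂ c₃₀ c₃₁ c₃₂ k₀ k₁ k₂} →
              (∀ u → b v₁ u ≡ c₁₀ ⊗ b e₀ u ⊕ (c₁₁ ⊗ b e₁ u ⊕ c₁₂ ⊗ b e₂ u)) →
              (∀ u → b x u ≡ c₂₀ ⊗ b e₀ u ⊕ (c₂₁ ⊗ b e₁ u ⊕ c₂₂ ⊗ b e₂ u)) →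
              (∀ u → b y u ≡ c₃₀ ⊗ b e₀ u ⊕ (c₃₁ ⊗ b e₁ u ⊕ c₃₂ ⊗ b e₂ u)) →
              (∀ u → b z u ≡ k₀ ⊗ b e₀ u ⊕ (k₁ ⊗ b e₁ u ⊕ k₂ ⊗ b e₂ u)) →
              ℤ.∣ normO (detR c₁₀ c₁₁ c₁₂ c₂₀ c₂₁ c₂₂ c₃₀ c₃₁ c₃₂) ∣ ≡ 1 →
              ∃[ w₁ ] ∃[ w₂ ] ∃[ w₃ ] (∀ u → b z u ≡ w₁ ⊗ b v₁ u ⊕ (w₂ ⊗ b x u ⊕ w₃ ⊗ b y u))
            span {c₁₀} {c₁₁} {c₁₂} {c₂₀} {c₂₁} {c₂₂} {c₃₀} {c₃₁} {c₃₂} {k₀} {k₁} {k₂} h₁ h₂ h₃ hz unit =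
                c⁻¹ ⊗ d₁ , c⁻¹ ⊗ d₂ , c⁻¹ ⊗ d₃ , λ u → begin
                  b z u                                                  ≡⟨ one* (b z u) ⟨
                  1O ⊗ b z u                                             ≡⟨ cong (_⊗ b z u) inverse ⟨
                  (c⁻¹ ⊗ c) ⊗ b z u                                      ≡⟨ cong ((c⁻¹ ⊗ c) ⊗_) (hz u) ⟩
                  (c⁻¹ ⊗ c) ⊗ (k₀ ⊗ b e₀ u ⊕ (k₁ ⊗ b e₁ u ⊕ k₂ ⊗ b e₂ u)) ≡⟨ assoc c⁻¹ c (k₀ ⊗ b e₀ u ⊕ (k₁ ⊗ b e₁ u ⊕ k₂ ⊗ b e₂ u)) ⟩
                  c⁻¹ ⊗ (c ⊗ (k₀ ⊗ b e₀ u ⊕ (k₁ ⊗ b e₁ u ⊕ k₂ ⊗ b e₂ u))) ≡⟨ cong (c⁻¹ ⊗_) (cramer c₁₀ c₁₁ c₁₂ c₂₀ c₂₁ c₂₂ c₃₀ c₃₁ c₃₂ k₀ k₁ k₂ (b e₀ u) (b e₁ u) (b e₂ u)) ⟩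
                  c⁻¹ ⊗ (d₁ ⊗ (c₁₀ ⊗ b e₀ u ⊕ (c₁₁ ⊗ b e₁ u ⊕ c₁₂ ⊗ b e₂ u)) ⊕ (d₂ ⊗ (c₂₀ ⊗ b e₀ u ⊕ (c₂₁ ⊗ b e₁ u ⊕ c₂₂ ⊗ b e₂ u)) ⊕ d₃ ⊗ (c₃₀ ⊗ b e₀ u ⊕ (c₃₁ ⊗ b e₁ u ⊕ c₃₂ ⊗ b e₂ u))))
                    ≡⟨ cong₃ (sym (h₁ u)) (sym (h₂ u)) (sym (h₃ u)) ⟩
                  c⁻¹ ⊗ (d₁ ⊗ b v₁ u ⊕ (d₂ ⊗ b x u ⊕ d₃ ⊗ b y u))        ≡⟨ distribute c⁻¹ d₁ d₂ d₃ (b v₁ u) (b x u) (b y u) ⟩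
                  c⁻¹ ⊗ d₁ ⊗ b v₁ u ⊕ (c⁻¹ ⊗ d₂ ⊗ b x u ⊕ c⁻¹ ⊗ d₃ ⊗ b y u) ∎
              where
              open ≡-Reasoning
              c d₁ d₂ d₃ c⁻¹ : O
              c = detR c₁₀ c₁₁ c₁₂ c₂₀ c₂₁ c₂₂ c₃₀ c₃₁ c₃₂
              d₁ = detR k₀ k₁ k₂ c₂₀ c₂₁ c₂₂ c₃₀ c₃₁ c₃₂
              d₂ = detR c₁₀ c₁₁ c₁₂ k₀ k₁ k₂ c₃₀ c₃₁ c₃₂
              d₃ = detR c₁₀ c₁₁ c₁₂ c₂₀ c₂₁ c₂₂ k₀ k₁ k₂
              -- The norm of c is 1 or -1, hence its own inverse.
              c⁻¹ = int (normO c) ⊗ conjO c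
              one* : ∀ x → 1O ⊗ x ≡ x
              one* = solve 1 (λ x → con (+ 1) :* x := x) refl
              assoc : ∀ x y z → (x ⊗ y) ⊗ z ≡ x ⊗ (y ⊗ z)
              assoc = solve 3 (λ x y z → (x :* y) :* z := x :* (y :* z)) refl
              distribute : ∀ i a b c x y z → i ⊗ (a ⊗ x ⊕ (b ⊗ y ⊕ c ⊗ z)) ≡ i ⊗ a ⊗ x ⊕ (i ⊗ b ⊗ y ⊕ i ⊗ c ⊗ z)
              distribute = solve 7 (λ i a b c x y z → i :* (a :* x :+ (b :* y :+ c :* z)) := i :* a :* x :+ (i :* b :* y :+ i :* c :* z)) refl
              cong₃ : ∀ {a b c a' b' c'} → a ≡ a' → b ≡ b' → c ≡ c' → c⁻¹ ⊗ (d₁ ⊗ a ⊕ (d₂ ⊗ b ⊕ d₃ ⊗ c)) ≡ c⁻¹ ⊗ (d₁ ⊗ a' ⊕ (d₂ ⊗ b' ⊕ d₃ ⊗ c'))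
              cong₃ refl refl refl = refl
              cramer : ∀ a b c d e f g h i k l m x y z → detR a b c d e f g h i ⊗ (k ⊗ x ⊕ (l ⊗ y ⊕ m ⊗ z))
                ≡ detR k l m d e f g h i ⊗ (a ⊗ x ⊕ (b ⊗ y ⊕ c ⊗ z)) ⊕ (detR a b c k l m g h i ⊗ (d ⊗ x ⊕ (e ⊗ y ⊕ f ⊗ z)) ⊕ detR a b c d e f k l m ⊗ (g ⊗ x ⊕ (h ⊗ y ⊕ i ⊗ z)))
              cramer = solve 15 (λ a b c d e f g h i k l m x y z → :det a b c d e f g h i :* (k :* x :+ (l :* y :+ m :* z))
                := :det k l m d e f g h i :* (a :* x :+ (b :* y :+ c :* z)) :+ (:det a b c k l m g h i :* (d :* x :+ (e :* y :+ f :* z)) :+ :det a b c d e f k l m :* (g :* x :+ (h :* y :+ i :* z)))) refl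
              unit² : ∀ i → ℤ.∣ i ∣ ≡ 1 → i ℤ.* i ≡ + 1
              unit² (+ 1)    refl = refl
              unit² -[1+ 0 ] refl = refl
              inverse : c⁻¹ ⊗ c ≡ 1O
              inverse = trans (assoc (int (normO c)) (conjO c) c) (trans (cong (λ w → int (normO c) ⊗ (conjO c ⊗ w)) (sym (c*1 c)))
                (trans (cong (int (normO c) ⊗_) (trans (conj*-cancel c 1O) (cong (λ N → int N ⊗ 1O) (sym (normO≡ (proj₁ c) (proj₂ c))))))
                  (trans (cong (int (normO c) ⊗_) (c*1 (int (normO c)))) (trans (sym (int-* (normO c) (normO c))) (cong int (unit² (normO c) unit))))))
                where
                c*1 : ∀ x → x ⊗ 1O ≡ x
                c*1 = solve 1 (λ x → x :* con (+ 1) := x) refl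

            private
              Coordinates : X → Set
              Coordinates x = ∃[ c ] ∃[ d ] ∃[ e ] (∀ y → b x y ≡ c ⊗ b e₀ y ⊕ (d ⊗ b e₁ y ⊕ e ⊗ b e₂ y))

              Goal : Set
              Goal = T (divides X₂ (h y y ⊗ h x z ⊕ ⊖ (h x y ⊗ h y z))) × T (divides X₂ (h x x ⊗ h y z ⊕ ⊖ (h x y ⊗ h x z)))

              -- The coefficient of v₁ disappears from h(u,z), because h vanishes against v₁. What
              -- remains is a 2 × 2 system for w₂ and w₃ with determinant `X₂`, so they are the
              -- required quotients.
              combination : ∃[ w₁ ] ∃[ w₂ ] ∃[ w₃ ] (∀ u → b z u ≡ w₁ ⊗ b v₁ u ⊕ (w₂ ⊗ b x u ⊕ w₃ ⊗ b y u)) → Goal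
              combination (w₁ , w₂ , w₃ , hz) =
                  divides-complete X₂ w₂ _ (trans (first (h x x) (h x y) (h y y) w₂ w₃) (sym (cong₂ (λ r v → h y y ⊗ r ⊕ ⊖ (h x y ⊗ v)) (hx x) (trans (hx y) (cong (λ e → w₂ ⊗ e ⊕ w₃ ⊗ h y y) (h-sym y x))))))
                , divides-complete X₂ w₃ _ (trans (second (h x x) (h x y) (h y y) w₂ w₃) (sym (cong₂ (λ v r → h x x ⊗ v ⊕ ⊖ (h x y ⊗ r)) (trans (hx y) (cong (λ e → w₂ ⊗ e ⊕ w₃ ⊗ h y y) (h-sym y x))) (hx x))))
                where
                first : ∀ p q s w₂ w₃ → symDet₂ p q s ⊗ w₂ ≡ s ⊗ (w₂ ⊗ p ⊕ w₃ ⊗ q) ⊕ ⊖ (q ⊗ (w₂ ⊗ q ⊕ w₃ ⊗ s))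
                first = solve 5 (λ p q s u w → (p :* s :+ :- (q :* q)) :* u := s :* (u :* p :+ w :* q) :+ :- (q :* (u :* q :+ w :* s))) refl
                second : ∀ p q s w₂ w₃ → symDet₂ p q s ⊗ w₃ ≡ p ⊗ (w₂ ⊗ q ⊕ w₃ ⊗ s) ⊕ ⊖ (q ⊗ (w₂ ⊗ p ⊕ w₃ ⊗ q))
                second = solve 5 (λ p q s u w → (p :* s :+ :- (q :* q)) :* w := p :* (u :* q :+ w :* s) :+ :- (q :* (u :* p :+ w :* q))) refl
                hx : ∀ u → h u z ≡ w₂ ⊗ h u x ⊕ w₃ ⊗ h u y
                hx u = trans (cong₂ (λ r s → int (+ 2) ⊗ r ⊕ ⊖ (c₁ u ⊗ s)) (trans (b-sym u z) (hz u)) (trans (b-sym v₁ z) (hz v₁)))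
                  (trans (cong₆ (b-sym v₁ u) (b-sym x u) (b-sym y u) b₁₁ (b-sym x v₁) (b-sym y v₁))
                    (eliminate w₁ w₂ w₃ (c₁ u) (b u v₁) (b u x) (b u y) (c₁ x) (c₁ y) (b-sym u v₁)))
                  where
                  cong₆ : ∀ {a b c d e f a' b' c' d' e' f'} → a ≡ a' → b ≡ b' → c ≡ c' → d ≡ d' → e ≡ e' → f ≡ f' →
                    int (+ 2) ⊗ (w₁ ⊗ a ⊕ (w₂ ⊗ b ⊕ w₃ ⊗ c)) ⊕ ⊖ (c₁ u ⊗ (w₁ ⊗ d ⊕ (w₂ ⊗ e ⊕ w₃ ⊗ f)))
                      ≡ int (+ 2) ⊗ (w₁ ⊗ a' ⊕ (w₂ ⊗ b' ⊕ w₃ ⊗ c')) ⊕ ⊖ (c₁ u ⊗ (w₁ ⊗ d' ⊕ (w₂ ⊗ e' ⊕ w₃ ⊗ f')))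
                  cong₆ refl refl refl refl refl refl = refl
                  eliminate : ∀ w₁ w₂ w₃ c a x y cx cy → a ≡ c →
                    int (+ 2) ⊗ (w₁ ⊗ a ⊕ (w₂ ⊗ x ⊕ w₃ ⊗ y)) ⊕ ⊖ (c ⊗ (w₁ ⊗ int (+ 2) ⊕ (w₂ ⊗ cx ⊕ w₃ ⊗ cy)))
                      ≡ w₂ ⊗ (int (+ 2) ⊗ x ⊕ ⊖ (c ⊗ cx)) ⊕ w₃ ⊗ (int (+ 2) ⊗ y ⊕ ⊖ (c ⊗ cy))
                  eliminate w₁ w₂ w₃ c _ x y cx cy refl = solve 8 (λ w₁ w₂ w₃ c x y cx cy →
                    con (+ 2) :* (w₁ :* c :+ (w₂ :* x :+ w₃ :* y)) :+ :- (c :* (w₁ :* con (+ 2) :+ (w₂ :* cx :+ w₃ :* cy)))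
                      := w₂ :* (con (+ 2) :* x :+ :- (c :* cx)) :+ w₃ :* (con (+ 2) :* y :+ :- (c :* cy))) refl w₁ w₂ w₃ c x y cx cy

              assemble : Coordinates v₁ → Coordinates x → Coordinates y → Coordinates z → ¬ (X₂ ≡ 0O) → T (primitive5 X₂) → Goal
              assemble (c₁₀ , c₁₁ , c₁₂ , h₁) (c₂₀ , c₂₁ , c₂₂ , h₂) (c₃₀ , c₃₁ , c₃₂ , h₃) (k₀ , k₁ , k₂ , hz) X≢0 prim =
                combination (span {c₁₀} {c₁₁} {c₁₂} {c₂₀} {c₂₁} {c₂₂} {c₃₀} {c₃₁} {c₃₂} {k₀} {k₁} {k₂} h₁ h₂ h₃ hz
                  (primitive5-unit X₂ (detR c₁₀ c₁₁ c₁₂ c₂₀ c₂₁ c₂₂ c₃₀ c₃₁ c₃₂) (proj₁ gram-even)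
                    (gram-change {c₁₀} {c₁₁} {c₁₂} {c₂₀} {c₂₁} {c₂₂} {c₃₀} {c₃₁} {c₃₂} h₁ h₂ h₃) X≢0 prim))

            basis : ¬ (X₂ ≡ 0O) → T (primitive5 X₂) → Goal
            basis = assemble (coordinates v₁) (coordinates x) (coordinates y) (coordinates z)

-- The discriminant and the parameters of the checker for a given D

mod4 : ℕ → Bool
mod4 D = D % 4 ℕ.≡ᵇ 1

disc : ℕ → ℕ
disc D = if mod4 D then D else 4 ℕ.* D

Δ≡disc : ∀ D → Order.Δ (ωTrace (mod4 D) D) (ωNorm (mod4 D) D) ≡ + disc D
Δ≡disc D = cases (mod4 D) refl
  where
  cases : ∀ b → mod4 D ≡ b → Order.Δ (ωTrace b D) (ωNorm b D) ≡ + (if b then D else 4 ℕ.* D)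
  cases true  e = trans (ℤ.+-comm (+ 1) (+ 4 ℤ.* + (D / 4))) (sym (D≡4n+1 D e))
  cases false e = trans (ℤ.+-identityˡ (+ 4 ℤ.* + D)) (sym (ℤ.pos-* 4 D))

D≤disc : ∀ D → D ℕ.≤ disc D
D≤disc D = cases (mod4 D)
  where
  cases : ∀ b → D ℕ.≤ (if b then D else 4 ℕ.* D)
  cases true  = ℕ.≤-refl
  cases false = ℕ.m≤n*m D 4

disc-positive : ∀ D → 1 < D → + 0 ℤ.< Order.Δ (ωTrace (mod4 D) D) (ωNorm (mod4 D) D)
disc-positive D 1<D = subst (+ 0 ℤ.<_) (sym (Δ≡disc D)) (ℤ.+<+ (ℕ.<-≤-trans (ℕ.<-trans ℕ.z<s 1<D) (D≤disc D)))

-- For D ≥ 1, the largest κ with (2κ + t)² ≤ Δ, so that the slope approximates √Δ from below as well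
-- as its parity allows.
kappa : ℕ → ℕ
kappa D = if mod4 D then (root 1 D ℕ.∸ 1) / 2 else root 1 D

slopeTest : (t n κ : ℤ) → Bool
slopeTest t n κ = (+ 2 ℤ.* κ ℤ.+ t) ℤ.* (+ 2 ℤ.* κ ℤ.+ t) ℤ.≤ᵇ Order.Δ t n

refutes : Bool → ℕ → Certificate → Bool
refutes free D = at (ωTrace (mod4 D) D) (ωNorm (mod4 D) D) (+ kappa D)
  module Refutes where
  at : ℤ → ℤ → ℤ → Certificate → Bool
  at t n κ c = slopeTest t n κ ∧ Quadratic.Check.check t n κ free c

refutes-split : ∀ free D c → let t = ωTrace (mod4 D) D ; n = ωNorm (mod4 D) D ; κ = + kappa D in
  T (refutes free D c) → (+ 2 ℤ.* κ ℤ.+ t) ℤ.* (+ 2 ℤ.* κ ℤ.+ t) ℤ.≤ Order.Δ t n × T (Quadratic.Check.check t n κ free c)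
refutes-split free D c h = splitAt (ωTrace (mod4 D) D) (ωNorm (mod4 D) D) (+ kappa D) h
  where
  splitAt : ∀ t n κ → T (Refutes.at free D t n κ c) →
    (+ 2 ℤ.* κ ℤ.+ t) ℤ.* (+ 2 ℤ.* κ ℤ.+ t) ℤ.≤ Order.Δ t n × T (Quadratic.Check.check t n κ free c)
  splitAt t n κ h = ℤ.≤ᵇ⇒≤ (proj₁ (T∧ {slopeTest t n κ} h)) , proj₂ (T∧ {slopeTest t n κ} h)

-- Consequences for universal lattices over a given field

module _ (D : ℕ) (1<D : 1 < D) (sf : Squarefree D) (L : Field.QLattice D)
  (quadratic : Field.IsQuadraticLattice D L) (univ : Field.Universal D L) where

  private
    space : Forms.Space (ωTrace (mod4 D) D) (ωNorm (mod4 D) D)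
    space = FieldTheory.LatticeSpace.space D 1<D sf L quadratic univ

  refutes-sound : ∀ c → ¬ T (refutes false D c)
  refutes-sound c h = Quadratic.Positivity.Projection.Soundness.check-sound (ωTrace (mod4 D) D) (ωNorm (mod4 D) D) (disc-positive D 1<D) space (+ kappa D)
    (proj₁ (refutes-split false D c h)) false (λ ()) c (proj₂ (refutes-split false D c h))

  disc<1849 : disc D < 1849
  disc<1849 = ℕ.≰⇒> (λ 1849≤disc → cases (mod4 D) space (subst (+ 1849 ℤ.≤_) (sym (Δ≡disc D)) (ℤ.+≤+ 1849≤disc)))
    where
    -- Generalising the Boolean makes t the numeral 1 or 0, which `LargeDiscriminant` takes as the
    -- natural number t′.
    cases : ∀ b → Forms.Space (ωTrace b D) (ωNorm b D) → + 1849 ℤ.≤ Order.Δ (ωTrace b D) (ωNorm b D) → ⊥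
    cases true  sp h = Quadratic.Positivity.Projection.LargeDiscriminant.impossible (+ 1) (+ (D / 4)) (ℤ.<-≤-trans (ℤ.+<+ ℕ.z<s) h) sp 1 (ℕ.s≤s ℕ.z≤n) refl h
    cases false sp h = Quadratic.Positivity.Projection.LargeDiscriminant.impossible (+ 0) (+ D) (ℤ.<-≤-trans (ℤ.+<+ ℕ.z<s) h) sp 0 ℕ.z≤n refl h

  refutes-free-sound : 5 ℕ.∣ D → Field.Free D L → ∀ c → ¬ T (refutes true D c)
  refutes-free-sound (ℕ.divides d D≡) (e , e∈ , spans , _) c h =
    Quadratic.Positivity.Projection.Soundness.check-sound (ωTrace (mod4 D) D) (ωNorm (mod4 D) D) (disc-positive D 1<D) space (+ kappa D) (proj₁ (refutes-split true D c h)) true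
      (λ _ v₁ q₁ x y z → Quadratic.Positivity.Projection.FreeBasis.basis (ωTrace (mod4 D) D) (ωNorm (mod4 D) D) (disc-positive D 1<D) space (+ kappa D) (proj₁ fivefold) (proj₂ fivefold)
        (e₀′ e e∈ spans) (e₁′ e e∈ spans) (e₂′ e e∈ spans) (coordinates e e∈ spans) v₁ q₁ x y z)
      c (proj₂ (refutes-split true D c h))
    where
    open FieldTheory.FreeLattice D 1<D sf L quadratic univ using (e₀′; e₁′; e₂′; coordinates)
    fivefold : ∃[ δ ] Order.Δ (ωTrace (mod4 D) D) (ωNorm (mod4 D) D) ≡ + 5 ℤ.* δ
    fivefold = cases (mod4 D) (Δ≡disc D)
      where
      cases : ∀ b {i} → i ≡ + (if b then D else 4 ℕ.* D) → ∃[ δ ] i ≡ + 5 ℤ.* δ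
      cases true  e = + d , trans e (trans (cong +_ (trans D≡ (ℕ.*-comm d 5))) (ℤ.pos-* 5 d))
      cases false e = + (4 ℕ.* d) , trans e (trans (cong +_ (trans (cong (4 ℕ.*_) D≡) (trans (sym (ℕ.*-assoc 4 d 5)) (ℕ.*-comm (4 ℕ.* d) 5)))) (ℤ.pos-* 5 (4 ℕ.* d)))

-- x ⊞ y and x ⊟ y stand for x + yω and x − yω.
infix 9 _⊞_ _⊟_
_⊞_ _⊟_ : ℕ → ℕ → O
x ⊞ y = + x , + y
x ⊟ y = + x , ℤ.- (+ y)

-- Certificates

Table : Set
Table = List (ℕ × Certificate)

refutesEntry : Bool → ℕ × Certificate → Bool
refutesEntry free (D , c) = refutes free D c

-- An entry verified for a numeral k is transported along k = D, so the checker itself is evaluated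
-- on closed terms only.
entryAt : ∀ free D {entries} → All (T ∘ refutesEntry free) entries → Any (λ (k , _) → T (k ℕ.≡ᵇ D)) entries →
  ∃[ c ] T (refutes free D c)
entryAt free D (r All.∷ _)  (here {x = k , c} k≡D) = c , subst (λ k → T (refutes free k c)) (ℕ.≡ᵇ⇒≡ k D k≡D) r
entryAt free D (_ All.∷ rs) (there i)              = entryAt free D rs i

-- An entry gives D, then α, then one pair (β, γs) for each possible b(v₁,v₂). In the entries with α
-- = 2 these values are 2, 1, 0 in this order: there Δ > 32, and the trace bound Δd² ≤ 32 excludes a
-- nonzero ω-coordinate.
table₁ : Table
table₁ =
  (11 , 10 ⊟ 3 , (4 ⊟ 1 , 7 ⊞ 2 ∷ 5 ⊞ 1 ∷ 17 ⊞ 5 ∷ []) ∷ (5 ⊟ 1 , 4 ⊞ 1 ∷ 17 ⊞ 5 ∷ 5 ⊞ 1 ∷ []) ∷ []) ∷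
  (14 , 4 ⊞ 1 , (7 ⊞ 1 , 5 ⊞ 0 ∷ 21 ⊟ 5 ∷ 35 ⊟ 9 ∷ []) ∷ (15 ⊟ 4 , 3 ⊞ 0 ∷ 5 ⊞ 0 ∷ 21 ⊞ 5 ∷ []) ∷ []) ∷
  (15 , 2 ⊞ 0 , (3 ⊞ 0 , 4 ⊟ 1 ∷ 8 ⊟ 2 ∷ []) ∷ (4 ⊟ 1 , 8 ⊟ 2 ∷ []) ∷ (4 ⊟ 1 , 8 ⊟ 2 ∷ 12 ⊟ 3 ∷ []) ∷ []) ∷
  (19 , 2 ⊞ 0 , (5 ⊟ 1 , 5 ⊞ 1 ∷ []) ∷ (9 ⊟ 2 , 5 ⊞ 1 ∷ 5 ⊞ 0 ∷ []) ∷ (9 ⊟ 2 , 5 ⊞ 1 ∷ 9 ⊞ 2 ∷ []) ∷ []) ∷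
  (22 , 197 ⊟ 42 , (5 ⊟ 1 , 5 ⊞ 1 ∷ []) ∷ (6 ⊟ 1 , 5 ⊟ 1 ∷ 6 ⊞ 1 ∷ 24 ⊟ 5 ∷ []) ∷ []) ∷
  (23 , 24 ⊟ 5 , (5 ⊞ 1 , 3 ⊞ 0 ∷ []) ∷ (5 ⊞ 1 , 10 ⊞ 2 ∷ []) ∷ []) ∷
  (26 , 2 ⊞ 0 , (6 ⊟ 1 , 3 ⊞ 0 ∷ []) ∷ (6 ⊟ 1 , 3 ⊞ 0 ∷ 10 ⊟ 1 ∷ []) ∷ (6 ⊟ 1 , 6 ⊞ 1 ∷ 7 ⊟ 1 ∷ 10 ⊟ 1 ∷ 11 ⊟ 2 ∷ []) ∷ []) ∷
  (29 , 3 ⊞ 1 , (4 ⊟ 1 , 2 ⊞ 0 ∷ 5 ⊞ 2 ∷ []) ∷ (2 ⊞ 0 , 4 ⊟ 1 ∷ 7 ⊟ 2 ∷ []) ∷ (4 ⊟ 1 , 2 ⊞ 0 ∷ 12 ⊞ 5 ∷ []) ∷ []) ∷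
  []

refuted-table₁ : All (T ∘ refutesEntry false) table₁
refuted-table₁ = all⁺ (refutesEntry false) table₁ tt

table₂ : Table
table₂ =
  (30 , 6 ⊟ 1 , (11 ⊟ 2 , 6 ⊞ 1 ∷ 7 ⊞ 1 ∷ []) ∷ (11 ⊟ 2 , 6 ⊞ 1 ∷ 17 ⊞ 3 ∷ []) ∷ []) ∷
  (31 , 39 ⊟ 7 , (2 ⊞ 0 , 6 ⊞ 1 ∷ 28 ⊞ 5 ∷ []) ∷ []) ∷
  (34 , 6 ⊟ 1 , (6 ⊞ 1 , 2 ⊞ 0 ∷ []) ∷ []) ∷
  (35 , 2 ⊞ 0 , (12 ⊟ 2 , 6 ⊟ 1 ∷ []) ∷ (6 ⊟ 1 , 3 ⊞ 0 ∷ []) ∷ (6 ⊟ 1 , 18 ⊟ 3 ∷ []) ∷ []) ∷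
  (37 , 3 ⊞ 1 , (4 ⊟ 1 , 2 ⊞ 0 ∷ []) ∷ (4 ⊟ 1 , 2 ⊞ 0 ∷ 3 ⊞ 0 ∷ []) ∷ []) ∷
  (38 , 37 ⊟ 6 , (8 ⊟ 1 , 7 ⊟ 1 ∷ 68 ⊟ 11 ∷ 7 ⊞ 1 ∷ 8 ⊞ 1 ∷ []) ∷ (7 ⊟ 1 , 3 ⊞ 0 ∷ []) ∷ []) ∷
  (39 , 13 ⊞ 2 , (25 ⊟ 4 , 2 ⊞ 0 ∷ []) ∷ (25 ⊟ 4 , 2 ⊞ 0 ∷ []) ∷ []) ∷
  (42 , 13 ⊟ 2 , (7 ⊟ 1 , 7 ⊞ 1 ∷ []) ∷ []) ∷
  (43 , 2 ⊞ 0 , (7 ⊟ 1 , 7 ⊞ 1 ∷ []) ∷ (7 ⊟ 1 , 7 ⊞ 1 ∷ []) ∷ (7 ⊟ 1 , 7 ⊞ 1 ∷ []) ∷ []) ∷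
  (46 , 2 ⊞ 0 , (7 ⊟ 1 , 7 ⊞ 1 ∷ []) ∷ (7 ⊟ 1 , 7 ⊞ 1 ∷ []) ∷ (7 ⊟ 1 , 7 ⊞ 1 ∷ 41 ⊞ 6 ∷ []) ∷ []) ∷
  (47 , 7 ⊟ 1 , (7 ⊞ 1 , 2 ⊞ 0 ∷ 3 ⊞ 0 ∷ []) ∷ []) ∷
  (51 , 50 ⊟ 7 , (8 ⊞ 1 , 15 ⊞ 2 ∷ []) ∷ (8 ⊞ 1 , 3 ⊞ 0 ∷ []) ∷ []) ∷
  []

refuted-table₂ : All (T ∘ refutesEntry false) table₂
refuted-table₂ = all⁺ (refutesEntry false) table₂ tt

table₃ : Table
table₃ =
  (53 , 2 ⊞ 0 , (4 ⊞ 1 , 5 ⊟ 1 ∷ []) ∷ (4 ⊞ 1 , 5 ⊟ 1 ∷ 9 ⊟ 2 ∷ []) ∷ (4 ⊞ 1 , 5 ⊟ 1 ∷ 9 ⊟ 2 ∷ 7 ⊞ 2 ∷ []) ∷ []) ∷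
  (55 , 2 ⊞ 0 , (15 ⊟ 2 , 8 ⊞ 1 ∷ []) ∷ (15 ⊟ 2 , 8 ⊞ 1 ∷ []) ∷ (15 ⊟ 2 , 8 ⊞ 1 ∷ 23 ⊞ 3 ∷ []) ∷ []) ∷
  (57 , 5 ⊟ 1 , (13 ⊟ 3 , 2 ⊞ 0 ∷ 10 ⊞ 3 ∷ 131 ⊞ 40 ∷ []) ∷ (13 ⊟ 3 , 2 ⊞ 0 ∷ 7 ⊞ 2 ∷ []) ∷ []) ∷
  (58 , 2 ⊞ 0 , (23 ⊟ 3 , 8 ⊞ 1 ∷ []) ∷ (8 ⊟ 1 , 8 ⊞ 1 ∷ []) ∷ (23 ⊟ 3 , 8 ⊞ 1 ∷ []) ∷ []) ∷
  (59 , 2 ⊞ 0 , (8 ⊟ 1 , 8 ⊞ 1 ∷ []) ∷ (8 ⊟ 1 , 8 ⊞ 1 ∷ 3 ⊞ 0 ∷ []) ∷ (8 ⊟ 1 , 8 ⊞ 1 ∷ []) ∷ []) ∷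
  (61 , 7 ⊞ 2 , (9 ⊟ 2 , 2 ⊞ 0 ∷ 133 ⊞ 39 ∷ []) ∷ (9 ⊟ 2 , 2 ⊞ 0 ∷ 4 ⊞ 1 ∷ []) ∷ []) ∷
  (62 , 8 ⊞ 1 , (2 ⊞ 0 , 8 ⊟ 1 ∷ 63 ⊟ 8 ∷ []) ∷ []) ∷
  (66 , 17 ⊞ 2 , (65 ⊟ 8 , 9 ⊞ 1 ∷ []) ∷ (65 ⊟ 8 , 9 ⊞ 1 ∷ 10 ⊞ 1 ∷ 41 ⊞ 5 ∷ []) ∷ []) ∷
  (67 , 41 ⊟ 5 , (2 ⊞ 0 , 9 ⊞ 1 ∷ 25 ⊞ 3 ∷ []) ∷ (17 ⊞ 2 , 2 ⊞ 0 ∷ []) ∷ []) ∷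
  (69 , 5 ⊟ 1 , (11 ⊞ 3 , 2 ⊞ 0 ∷ []) ∷ (11 ⊞ 3 , 2 ⊞ 0 ∷ []) ∷ []) ∷
  (70 , 2 ⊞ 0 , (17 ⊟ 2 , 9 ⊞ 1 ∷ []) ∷ (9 ⊟ 1 , 9 ⊞ 1 ∷ []) ∷ (9 ⊟ 1 , 9 ⊞ 1 ∷ 17 ⊞ 2 ∷ []) ∷ []) ∷
  (71 , 59 ⊟ 7 , (2 ⊞ 0 , 17 ⊞ 2 ∷ []) ∷ []) ∷
  (73 , 4 ⊞ 1 , (5 ⊟ 1 , 2 ⊞ 0 ∷ 24 ⊟ 5 ∷ []) ∷ []) ∷
  (74 , 2 ⊞ 0 , (26 ⊟ 3 , 9 ⊞ 1 ∷ []) ∷ (9 ⊟ 1 , 9 ⊞ 1 ∷ []) ∷ (26 ⊟ 3 , 9 ⊞ 1 ∷ []) ∷ []) ∷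
  (78 , 9 ⊞ 1 , (53 ⊟ 6 , 2 ⊞ 0 ∷ []) ∷ []) ∷
  (79 , 9 ⊟ 1 , (9 ⊞ 1 , 2 ⊞ 0 ∷ []) ∷ []) ∷
  (82 , 2 ⊞ 0 , (10 ⊟ 1 , 10 ⊞ 1 ∷ []) ∷ (10 ⊟ 1 , 10 ⊞ 1 ∷ []) ∷ (10 ⊟ 1 , 10 ⊞ 1 ∷ []) ∷ []) ∷
  (83 , 2 ⊞ 0 , (10 ⊟ 1 , 10 ⊞ 1 ∷ []) ∷ (19 ⊟ 2 , 10 ⊞ 1 ∷ []) ∷ (10 ⊟ 1 , 10 ⊞ 1 ∷ []) ∷ []) ∷
  (85 , 2 ⊞ 0 , (5 ⊞ 1 , 6 ⊟ 1 ∷ 3 ⊞ 0 ∷ []) ∷ (6 ⊟ 1 , 5 ⊞ 1 ∷ 3 ⊞ 0 ∷ 17 ⊞ 4 ∷ 38 ⊞ 9 ∷ []) ∷ (5 ⊞ 1 , 6 ⊟ 1 ∷ 16 ⊟ 3 ∷ []) ∷ []) ∷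
  (86 , 10 ⊟ 1 , (28 ⊞ 3 , 2 ⊞ 0 ∷ []) ∷ (28 ⊞ 3 , 2 ⊞ 0 ∷ []) ∷ []) ∷
  (87 , 28 ⊟ 3 , (2 ⊞ 0 , 10 ⊞ 1 ∷ []) ∷ []) ∷
  (89 , 17 ⊞ 4 , (2 ⊞ 0 , 21 ⊟ 4 ∷ 3 ⊞ 0 ∷ []) ∷ (21 ⊟ 4 , 2 ⊞ 0 ∷ []) ∷ []) ∷
  (91 , 2 ⊞ 0 , (29 ⊟ 3 , 10 ⊞ 1 ∷ []) ∷ (10 ⊟ 1 , 10 ⊞ 1 ∷ 3 ⊞ 0 ∷ []) ∷ (10 ⊟ 1 , 10 ⊞ 1 ∷ 48 ⊞ 5 ∷ []) ∷ []) ∷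
  (93 , 6 ⊟ 1 , (13 ⊞ 3 , 2 ⊞ 0 ∷ []) ∷ (13 ⊞ 3 , 2 ⊞ 0 ∷ []) ∷ []) ∷
  (94 , 10 ⊟ 1 , (2 ⊞ 0 , 10 ⊞ 1 ∷ []) ∷ (2 ⊞ 0 , 10 ⊞ 1 ∷ 49 ⊞ 5 ∷ []) ∷ []) ∷
  (95 , 39 ⊟ 4 , (2 ⊞ 0 , 10 ⊞ 1 ∷ 20 ⊞ 2 ∷ []) ∷ []) ∷
  (97 , 31 ⊞ 7 , (11 ⊟ 2 , 2 ⊞ 0 ∷ []) ∷ []) ∷
  (101 , 2 ⊞ 0 , (5 ⊞ 1 , 6 ⊟ 1 ∷ []) ∷ (5 ⊞ 1 , 6 ⊟ 1 ∷ 3 ⊞ 0 ∷ []) ∷ (5 ⊞ 1 , 6 ⊟ 1 ∷ []) ∷ []) ∷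
  (102 , 11 ⊟ 1 , (2 ⊞ 0 , 11 ⊞ 1 ∷ 21 ⊞ 2 ∷ []) ∷ (2 ⊞ 0 , 11 ⊞ 1 ∷ []) ∷ []) ∷
  (103 , 11 ⊟ 1 , (61 ⊞ 6 , 2 ⊞ 0 ∷ []) ∷ (2 ⊞ 0 , 21 ⊞ 2 ∷ []) ∷ []) ∷
  (105 , 37 ⊞ 8 , (2 ⊞ 0 , 6 ⊟ 1 ∷ 23 ⊟ 4 ∷ []) ∷ []) ∷
  (106 , 31 ⊟ 3 , (2 ⊞ 0 , 11 ⊞ 1 ∷ []) ∷ []) ∷
  (107 , 2 ⊞ 0 , (21 ⊟ 2 , 11 ⊞ 1 ∷ []) ∷ (21 ⊟ 2 , 11 ⊞ 1 ∷ []) ∷ (21 ⊟ 2 , 11 ⊞ 1 ∷ []) ∷ []) ∷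
  (109 , 2 ⊞ 0 , (5 ⊞ 1 , 6 ⊟ 1 ∷ []) ∷ (5 ⊞ 1 , 6 ⊟ 1 ∷ []) ∷ (5 ⊞ 1 , 6 ⊟ 1 ∷ []) ∷ []) ∷
  (110 , 21 ⊟ 2 , (2 ⊞ 0 , 11 ⊞ 1 ∷ []) ∷ []) ∷
  (111 , 2 ⊞ 0 , (11 ⊟ 1 , 11 ⊞ 1 ∷ []) ∷ (11 ⊟ 1 , 11 ⊞ 1 ∷ []) ∷ (11 ⊟ 1 , 11 ⊞ 1 ∷ 22 ⊞ 2 ∷ []) ∷ []) ∷
  (113 , 5 ⊞ 1 , (6 ⊟ 1 , 2 ⊞ 0 ∷ []) ∷ []) ∷
  (114 , 11 ⊟ 1 , (3 ⊞ 0 , 2 ⊞ 0 ∷ 12 ⊞ 1 ∷ []) ∷ (2 ⊞ 0 , 11 ⊞ 1 ∷ 3 ⊞ 0 ∷ []) ∷ []) ∷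
  (115 , 11 ⊟ 1 , (2 ⊞ 0 , 22 ⊞ 2 ∷ []) ∷ (43 ⊞ 4 , 2 ⊞ 0 ∷ 3 ⊞ 0 ∷ []) ∷ []) ∷
  (118 , 11 ⊟ 1 , (2 ⊞ 0 , 11 ⊞ 1 ∷ []) ∷ []) ∷
  []

refuted-table₃ : All (T ∘ refutesEntry false) table₃
refuted-table₃ = all⁺ (refutesEntry false) table₃ tt

table₄ : Table
table₄ =
  (119 , 11 ⊟ 1 , (11 ⊞ 1 , 2 ⊞ 0 ∷ []) ∷ []) ∷
  (122 , 12 ⊟ 1 , (2 ⊞ 0 , 12 ⊞ 1 ∷ 23 ⊞ 2 ∷ []) ∷ (2 ⊞ 0 , 12 ⊞ 1 ∷ []) ∷ []) ∷
  (123 , 23 ⊟ 2 , (2 ⊞ 0 , 12 ⊞ 1 ∷ []) ∷ (2 ⊞ 0 , 12 ⊞ 1 ∷ []) ∷ []) ∷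
  (127 , 2 ⊞ 0 , (34 ⊟ 3 , 12 ⊞ 1 ∷ []) ∷ (34 ⊟ 3 , 12 ⊞ 1 ∷ []) ∷ (34 ⊟ 3 , 12 ⊞ 1 ∷ []) ∷ []) ∷
  (129 , 2 ⊞ 0 , (26 ⊞ 5 , 13 ⊟ 2 ∷ []) ∷ (26 ⊞ 5 , 7 ⊟ 1 ∷ 25 ⊟ 4 ∷ []) ∷ (6 ⊞ 1 , 7 ⊟ 1 ∷ []) ∷ []) ∷
  (130 , 23 ⊟ 2 , (2 ⊞ 0 , 12 ⊞ 1 ∷ []) ∷ []) ∷
  (131 , 23 ⊟ 2 , (2 ⊞ 0 , 23 ⊞ 2 ∷ []) ∷ []) ∷
  (133 , 79 ⊞ 15 , (3 ⊞ 0 , 19 ⊟ 3 ∷ 32 ⊟ 5 ∷ []) ∷ []) ∷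
  (134 , 58 ⊟ 5 , (2 ⊞ 0 , 12 ⊞ 1 ∷ []) ∷ []) ∷
  (137 , 2 ⊞ 0 , (11 ⊞ 2 , 7 ⊟ 1 ∷ []) ∷ (6 ⊞ 1 , 7 ⊟ 1 ∷ []) ∷ (6 ⊞ 1 , 7 ⊟ 1 ∷ []) ∷ []) ∷
  (138 , 47 ⊟ 4 , (2 ⊞ 0 , 12 ⊞ 1 ∷ 24 ⊞ 2 ∷ []) ∷ []) ∷
  (139 , 12 ⊟ 1 , (12 ⊞ 1 , 2 ⊞ 0 ∷ []) ∷ []) ∷
  (141 , 11 ⊞ 2 , (6 ⊞ 1 , 13 ⊟ 2 ∷ []) ∷ []) ∷
  (142 , 12 ⊟ 1 , (12 ⊞ 1 , 2 ⊞ 0 ∷ []) ∷ []) ∷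
  (143 , 24 ⊟ 2 , (2 ⊞ 0 , 13 ⊞ 1 ∷ []) ∷ []) ∷
  (145 , 6 ⊞ 1 , (2 ⊞ 0 , 7 ⊟ 1 ∷ 20 ⊟ 3 ∷ []) ∷ (2 ⊞ 0 , 7 ⊟ 1 ∷ []) ∷ []) ∷
  (146 , 13 ⊟ 1 , (2 ⊞ 0 , 13 ⊞ 1 ∷ []) ∷ (2 ⊞ 0 , 13 ⊞ 1 ∷ []) ∷ []) ∷
  (149 , 2 ⊞ 0 , (6 ⊞ 1 , 7 ⊟ 1 ∷ []) ∷ (6 ⊞ 1 , 7 ⊟ 1 ∷ []) ∷ (6 ⊞ 1 , 7 ⊟ 1 ∷ []) ∷ []) ∷
  (151 , 37 ⊟ 3 , (2 ⊞ 0 , 13 ⊞ 1 ∷ []) ∷ []) ∷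
  (154 , 25 ⊟ 2 , (2 ⊞ 0 , 13 ⊞ 1 ∷ []) ∷ []) ∷
  (155 , 25 ⊟ 2 , (2 ⊞ 0 , 25 ⊞ 2 ∷ []) ∷ []) ∷
  (157 , 6 ⊞ 1 , (7 ⊟ 1 , 2 ⊞ 0 ∷ []) ∷ []) ∷
  (158 , 13 ⊟ 1 , (2 ⊞ 0 , 13 ⊞ 1 ∷ []) ∷ (63 ⊞ 5 , 2 ⊞ 0 ∷ []) ∷ []) ∷
  (159 , 38 ⊟ 3 , (2 ⊞ 0 , 13 ⊞ 1 ∷ []) ∷ []) ∷
  (161 , 7 ⊟ 1 , (2 ⊞ 0 , 6 ⊞ 1 ∷ 47 ⊞ 8 ∷ []) ∷ []) ∷
  (163 , 13 ⊟ 1 , (13 ⊞ 1 , 2 ⊞ 0 ∷ []) ∷ []) ∷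
  (165 , 6 ⊞ 1 , (12 ⊞ 2 , 2 ⊞ 0 ∷ []) ∷ []) ∷
  (166 , 13 ⊟ 1 , (2 ⊞ 0 , 13 ⊞ 1 ∷ []) ∷ []) ∷
  (167 , 13 ⊟ 1 , (13 ⊞ 1 , 2 ⊞ 0 ∷ []) ∷ []) ∷
  (170 , 2 ⊞ 0 , (27 ⊟ 2 , 14 ⊞ 1 ∷ []) ∷ (14 ⊟ 1 , 14 ⊞ 1 ∷ []) ∷ (27 ⊟ 2 , 14 ⊞ 1 ∷ []) ∷ []) ∷
  (173 , 2 ⊞ 0 , (7 ⊞ 1 , 8 ⊟ 1 ∷ []) ∷ (7 ⊞ 1 , 8 ⊟ 1 ∷ []) ∷ (7 ⊞ 1 , 8 ⊟ 1 ∷ []) ∷ []) ∷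
  (174 , 66 ⊟ 5 , (2 ⊞ 0 , 14 ⊞ 1 ∷ []) ∷ []) ∷
  (177 , 2 ⊞ 0 , (7 ⊞ 1 , 8 ⊟ 1 ∷ []) ∷ (37 ⊞ 6 , 8 ⊟ 1 ∷ 36 ⊟ 5 ∷ []) ∷ (37 ⊞ 6 , 43 ⊟ 6 ∷ []) ∷ []) ∷
  (178 , 27 ⊟ 2 , (2 ⊞ 0 , 14 ⊞ 1 ∷ []) ∷ (2 ⊞ 0 , 14 ⊞ 1 ∷ []) ∷ []) ∷
  (179 , 27 ⊟ 2 , (2 ⊞ 0 , 27 ⊞ 2 ∷ []) ∷ []) ∷
  (181 , 25 ⊞ 4 , (15 ⊟ 2 , 2 ⊞ 0 ∷ []) ∷ (2 ⊞ 0 , 8 ⊟ 1 ∷ 22 ⊟ 3 ∷ []) ∷ []) ∷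
  (182 , 27 ⊟ 2 , (2 ⊞ 0 , 14 ⊞ 1 ∷ []) ∷ []) ∷
  (183 , 14 ⊟ 1 , (2 ⊞ 0 , 14 ⊞ 1 ∷ 41 ⊞ 3 ∷ []) ∷ (2 ⊞ 0 , 14 ⊞ 1 ∷ []) ∷ []) ∷
  (185 , 7 ⊞ 1 , (22 ⊟ 3 , 2 ⊞ 0 ∷ []) ∷ (22 ⊟ 3 , 2 ⊞ 0 ∷ []) ∷ []) ∷
  (186 , 41 ⊟ 3 , (2 ⊞ 0 , 14 ⊞ 1 ∷ []) ∷ []) ∷
  (187 , 2 ⊞ 0 , (55 ⊟ 4 , 14 ⊞ 1 ∷ []) ∷ (14 ⊟ 1 , 14 ⊞ 1 ∷ 3 ⊞ 0 ∷ []) ∷ (14 ⊟ 1 , 14 ⊞ 1 ∷ 28 ⊞ 2 ∷ []) ∷ []) ∷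
  (190 , 14 ⊟ 1 , (14 ⊞ 1 , 2 ⊞ 0 ∷ []) ∷ []) ∷
  (191 , 14 ⊟ 1 , (14 ⊞ 1 , 2 ⊞ 0 ∷ []) ∷ []) ∷
  (193 , 13 ⊞ 2 , (15 ⊟ 2 , 2 ⊞ 0 ∷ []) ∷ []) ∷
  (194 , 14 ⊟ 1 , (14 ⊞ 1 , 2 ⊞ 0 ∷ []) ∷ []) ∷
  (195 , 14 ⊟ 1 , (2 ⊞ 0 , 3 ⊞ 0 ∷ 29 ⊞ 2 ∷ []) ∷ []) ∷
  (197 , 2 ⊞ 0 , (7 ⊞ 1 , 8 ⊟ 1 ∷ []) ∷ (7 ⊞ 1 , 8 ⊟ 1 ∷ []) ∷ (7 ⊞ 1 , 8 ⊟ 1 ∷ []) ∷ []) ∷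
  (199 , 43 ⊟ 3 , (2 ⊞ 0 , 15 ⊞ 1 ∷ []) ∷ (2 ⊞ 0 , 15 ⊞ 1 ∷ []) ∷ []) ∷
  (201 , 7 ⊞ 1 , (38 ⊟ 5 , 2 ⊞ 0 ∷ []) ∷ (38 ⊟ 5 , 2 ⊞ 0 ∷ []) ∷ []) ∷
  (202 , 57 ⊟ 4 , (2 ⊞ 0 , 15 ⊞ 1 ∷ []) ∷ []) ∷
  (203 , 43 ⊞ 3 , (2 ⊞ 0 , 15 ⊟ 1 ∷ []) ∷ (57 ⊟ 4 , 3 ⊞ 0 ∷ []) ∷ []) ∷
  (205 , 20 ⊞ 3 , (2 ⊞ 0 , 8 ⊟ 1 ∷ []) ∷ []) ∷
  (206 , 2 ⊞ 0 , (72 ⊟ 5 , 15 ⊞ 1 ∷ []) ∷ (29 ⊟ 2 , 15 ⊞ 1 ∷ []) ∷ (29 ⊟ 2 , 15 ⊞ 1 ∷ []) ∷ []) ∷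
  (209 , 2 ⊞ 0 , (7 ⊞ 1 , 8 ⊟ 1 ∷ 16 ⊟ 2 ∷ []) ∷ (27 ⊞ 4 , 8 ⊟ 1 ∷ []) ∷ (7 ⊞ 1 , 8 ⊟ 1 ∷ 16 ⊟ 2 ∷ []) ∷ []) ∷
  (210 , 29 ⊟ 2 , (2 ⊞ 0 , 15 ⊞ 1 ∷ []) ∷ []) ∷
  (211 , 15 ⊟ 1 , (2 ⊞ 0 , 15 ⊞ 1 ∷ []) ∷ (2 ⊞ 0 , 15 ⊞ 1 ∷ []) ∷ []) ∷
  (213 , 8 ⊟ 1 , (34 ⊞ 5 , 2 ⊞ 0 ∷ []) ∷ []) ∷
  (214 , 44 ⊟ 3 , (2 ⊞ 0 , 15 ⊞ 1 ∷ []) ∷ []) ∷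
  (215 , 44 ⊟ 3 , (2 ⊞ 0 , 15 ⊞ 1 ∷ []) ∷ []) ∷
  (217 , 7 ⊞ 1 , (2 ⊞ 0 , 8 ⊟ 1 ∷ 24 ⊟ 3 ∷ []) ∷ []) ∷
  (218 , 15 ⊟ 1 , (15 ⊞ 1 , 2 ⊞ 0 ∷ []) ∷ []) ∷
  (219 , 15 ⊞ 1 , (74 ⊟ 5 , 2 ⊞ 0 ∷ []) ∷ []) ∷
  (221 , 7 ⊞ 1 , (2 ⊞ 0 , 3 ⊞ 0 ∷ 17 ⊟ 2 ∷ []) ∷ []) ∷
  (222 , 15 ⊟ 1 , (2 ⊞ 0 , 15 ⊞ 1 ∷ []) ∷ []) ∷
  (223 , 15 ⊟ 1 , (15 ⊞ 1 , 2 ⊞ 0 ∷ []) ∷ []) ∷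
  (226 , 2 ⊞ 0 , (16 ⊟ 1 , 16 ⊞ 1 ∷ []) ∷ (16 ⊟ 1 , 16 ⊞ 1 ∷ []) ∷ (16 ⊟ 1 , 16 ⊞ 1 ∷ []) ∷ []) ∷
  (227 , 2 ⊞ 0 , (16 ⊟ 1 , 16 ⊞ 1 ∷ []) ∷ (16 ⊟ 1 , 16 ⊞ 1 ∷ []) ∷ (16 ⊟ 1 , 16 ⊞ 1 ∷ []) ∷ []) ∷
  (229 , 2 ⊞ 0 , (8 ⊞ 1 , 9 ⊟ 1 ∷ []) ∷ (8 ⊞ 1 , 9 ⊟ 1 ∷ []) ∷ (8 ⊞ 1 , 9 ⊟ 1 ∷ []) ∷ []) ∷
  (230 , 46 ⊟ 3 , (2 ⊞ 0 , 16 ⊞ 1 ∷ []) ∷ (2 ⊞ 0 , 16 ⊞ 1 ∷ []) ∷ []) ∷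
  (231 , 46 ⊟ 3 , (2 ⊞ 0 , 16 ⊞ 1 ∷ []) ∷ (2 ⊞ 0 , 16 ⊞ 1 ∷ []) ∷ []) ∷
  (233 , 50 ⊞ 7 , (2 ⊞ 0 , 17 ⊟ 2 ∷ []) ∷ (2 ⊞ 0 , 9 ⊟ 1 ∷ 17 ⊟ 2 ∷ []) ∷ []) ∷
  (235 , 46 ⊟ 3 , (2 ⊞ 0 , 16 ⊞ 1 ∷ []) ∷ []) ∷
  (237 , 9 ⊟ 1 , (36 ⊞ 5 , 2 ⊞ 0 ∷ []) ∷ (36 ⊞ 5 , 2 ⊞ 0 ∷ []) ∷ []) ∷
  (238 , 31 ⊟ 2 , (2 ⊞ 0 , 16 ⊞ 1 ∷ 31 ⊞ 2 ∷ []) ∷ []) ∷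
  (239 , 31 ⊟ 2 , (2 ⊞ 0 , 16 ⊞ 1 ∷ []) ∷ []) ∷
  (241 , 8 ⊞ 1 , (25 ⊟ 3 , 2 ⊞ 0 ∷ []) ∷ (25 ⊟ 3 , 2 ⊞ 0 ∷ []) ∷ []) ∷
  (246 , 2 ⊞ 0 , (16 ⊟ 1 , 16 ⊞ 1 ∷ []) ∷ (63 ⊟ 4 , 16 ⊞ 1 ∷ []) ∷ (16 ⊟ 1 , 16 ⊞ 1 ∷ []) ∷ []) ∷
  (247 , 2 ⊞ 0 , (63 ⊟ 4 , 16 ⊞ 1 ∷ []) ∷ (63 ⊟ 4 , 16 ⊞ 1 ∷ []) ∷ (16 ⊟ 1 , 16 ⊞ 1 ∷ 32 ⊞ 2 ∷ []) ∷ []) ∷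
  (249 , 15 ⊞ 2 , (17 ⊟ 2 , 2 ⊞ 0 ∷ []) ∷ []) ∷
  (251 , 16 ⊟ 1 , (16 ⊞ 1 , 2 ⊞ 0 ∷ []) ∷ []) ∷
  []

refuted-table₄ : All (T ∘ refutesEntry false) table₄
refuted-table₄ = all⁺ (refutesEntry false) table₄ tt

table₅ : Table
table₅ =
  (253 , 15 ⊞ 2 , (2 ⊞ 0 , 9 ⊟ 1 ∷ 43 ⊟ 5 ∷ []) ∷ []) ∷
  (254 , 16 ⊟ 1 , (16 ⊞ 1 , 2 ⊞ 0 ∷ []) ∷ []) ∷
  (255 , 16 ⊟ 1 , (2 ⊞ 0 , 3 ⊞ 0 ∷ 33 ⊞ 2 ∷ []) ∷ []) ∷
  (257 , 2 ⊞ 0 , (8 ⊞ 1 , 9 ⊟ 1 ∷ []) ∷ (8 ⊞ 1 , 9 ⊟ 1 ∷ []) ∷ (8 ⊞ 1 , 9 ⊟ 1 ∷ []) ∷ []) ∷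
  (258 , 2 ⊞ 0 , (33 ⊟ 2 , 17 ⊞ 1 ∷ []) ∷ (17 ⊟ 1 , 17 ⊞ 1 ∷ []) ∷ (33 ⊟ 2 , 17 ⊞ 1 ∷ []) ∷ []) ∷
  (259 , 2 ⊞ 0 , (17 ⊟ 1 , 17 ⊞ 1 ∷ []) ∷ (17 ⊟ 1 , 17 ⊞ 1 ∷ []) ∷ (49 ⊟ 3 , 17 ⊞ 1 ∷ []) ∷ []) ∷
  (262 , 49 ⊟ 3 , (2 ⊞ 0 , 17 ⊞ 1 ∷ []) ∷ (2 ⊞ 0 , 17 ⊞ 1 ∷ []) ∷ []) ∷
  (263 , 65 ⊟ 4 , (2 ⊞ 0 , 17 ⊞ 1 ∷ []) ∷ []) ∷
  (265 , 2 ⊞ 0 , (23 ⊞ 3 , 9 ⊟ 1 ∷ []) ∷ (23 ⊞ 3 , 9 ⊟ 1 ∷ []) ∷ (8 ⊞ 1 , 9 ⊟ 1 ∷ []) ∷ []) ∷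
  (266 , 49 ⊟ 3 , (2 ⊞ 0 , 17 ⊞ 1 ∷ []) ∷ []) ∷
  (267 , 2 ⊞ 0 , (33 ⊟ 2 , 17 ⊞ 1 ∷ []) ∷ (33 ⊟ 2 , 17 ⊞ 1 ∷ []) ∷ (33 ⊟ 2 , 33 ⊞ 2 ∷ []) ∷ []) ∷
  (269 , 8 ⊞ 1 , (2 ⊞ 0 , 9 ⊟ 1 ∷ []) ∷ (2 ⊞ 0 , 9 ⊟ 1 ∷ []) ∷ []) ∷
  (271 , 33 ⊟ 2 , (2 ⊞ 0 , 33 ⊞ 2 ∷ []) ∷ []) ∷
  (273 , 2 ⊞ 0 , (8 ⊞ 1 , 18 ⊟ 2 ∷ []) ∷ (8 ⊞ 1 , 9 ⊟ 1 ∷ 3 ⊞ 0 ∷ []) ∷ (8 ⊞ 1 , 18 ⊟ 2 ∷ 53 ⊟ 6 ∷ []) ∷ []) ∷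
  (274 , 2 ⊞ 0 , (17 ⊟ 1 , 17 ⊞ 1 ∷ []) ∷ (17 ⊟ 1 , 17 ⊞ 1 ∷ []) ∷ (50 ⊟ 3 , 17 ⊞ 1 ∷ []) ∷ []) ∷
  (277 , 8 ⊞ 1 , (9 ⊟ 1 , 2 ⊞ 0 ∷ []) ∷ []) ∷
  (278 , 2 ⊞ 0 , (17 ⊟ 1 , 17 ⊞ 1 ∷ []) ∷ (17 ⊟ 1 , 17 ⊞ 1 ∷ []) ∷ (17 ⊟ 1 , 17 ⊞ 1 ∷ []) ∷ []) ∷
  (281 , 8 ⊞ 1 , (9 ⊟ 1 , 2 ⊞ 0 ∷ []) ∷ []) ∷
  (282 , 2 ⊞ 0 , (17 ⊟ 1 , 17 ⊞ 1 ∷ []) ∷ (17 ⊟ 1 , 17 ⊞ 1 ∷ []) ∷ (17 ⊟ 1 , 17 ⊞ 1 ∷ []) ∷ []) ∷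
  (283 , 17 ⊟ 1 , (17 ⊞ 1 , 2 ⊞ 0 ∷ []) ∷ []) ∷
  (285 , 8 ⊞ 1 , (2 ⊞ 0 , 3 ⊞ 0 ∷ 19 ⊟ 2 ∷ []) ∷ []) ∷
  (286 , 17 ⊟ 1 , (2 ⊞ 0 , 17 ⊞ 1 ∷ []) ∷ []) ∷
  (287 , 17 ⊟ 1 , (17 ⊞ 1 , 2 ⊞ 0 ∷ []) ∷ []) ∷
  (290 , 18 ⊟ 1 , (2 ⊞ 0 , 3 ⊞ 0 ∷ 35 ⊞ 2 ∷ []) ∷ (2 ⊞ 0 , 18 ⊞ 1 ∷ []) ∷ []) ∷
  (291 , 2 ⊞ 0 , (18 ⊟ 1 , 18 ⊞ 1 ∷ []) ∷ (18 ⊟ 1 , 3 ⊞ 0 ∷ []) ∷ (18 ⊟ 1 , 18 ⊞ 1 ∷ []) ∷ []) ∷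
  (293 , 2 ⊞ 0 , (9 ⊞ 1 , 10 ⊟ 1 ∷ []) ∷ (9 ⊞ 1 , 10 ⊟ 1 ∷ []) ∷ (9 ⊞ 1 , 10 ⊟ 1 ∷ []) ∷ []) ∷
  (295 , 69 ⊟ 4 , (2 ⊞ 0 , 18 ⊞ 1 ∷ []) ∷ (2 ⊞ 0 , 18 ⊞ 1 ∷ []) ∷ []) ∷
  (298 , 2 ⊞ 0 , (52 ⊟ 3 , 18 ⊞ 1 ∷ []) ∷ (52 ⊟ 3 , 35 ⊞ 2 ∷ []) ∷ (52 ⊟ 3 , 18 ⊞ 1 ∷ []) ∷ []) ∷
  (299 , 52 ⊟ 3 , (2 ⊞ 0 , 18 ⊞ 1 ∷ []) ∷ []) ∷
  (301 , 9 ⊞ 1 , (46 ⊟ 5 , 2 ⊞ 0 ∷ []) ∷ (37 ⊟ 4 , 2 ⊞ 0 ∷ []) ∷ []) ∷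
  (302 , 35 ⊟ 2 , (2 ⊞ 0 , 35 ⊞ 2 ∷ 18 ⊞ 1 ∷ []) ∷ []) ∷
  (303 , 35 ⊟ 2 , (2 ⊞ 0 , 35 ⊞ 2 ∷ []) ∷ []) ∷
  (305 , 33 ⊞ 4 , (2 ⊞ 0 , 10 ⊟ 1 ∷ []) ∷ []) ∷
  (307 , 2 ⊞ 0 , (18 ⊟ 1 , 18 ⊞ 1 ∷ []) ∷ (18 ⊟ 1 , 18 ⊞ 1 ∷ []) ∷ (18 ⊟ 1 , 18 ⊞ 1 ∷ []) ∷ []) ∷
  (309 , 2 ⊞ 0 , (25 ⊞ 3 , 10 ⊟ 1 ∷ []) ∷ (25 ⊞ 3 , 10 ⊟ 1 ∷ []) ∷ (25 ⊞ 3 , 10 ⊟ 1 ∷ []) ∷ []) ∷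
  (310 , 53 ⊟ 3 , (2 ⊞ 0 , 18 ⊞ 1 ∷ []) ∷ []) ∷
  (311 , 53 ⊟ 3 , (2 ⊞ 0 , 18 ⊞ 1 ∷ []) ∷ []) ∷
  (313 , 2 ⊞ 0 , (17 ⊞ 2 , 10 ⊟ 1 ∷ []) ∷ (17 ⊞ 2 , 19 ⊟ 2 ∷ []) ∷ (17 ⊞ 2 , 10 ⊟ 1 ∷ []) ∷ []) ∷
  (314 , 71 ⊟ 4 , (2 ⊞ 0 , 18 ⊞ 1 ∷ []) ∷ []) ∷
  (317 , 17 ⊞ 2 , (2 ⊞ 0 , 10 ⊟ 1 ∷ []) ∷ []) ∷
  (318 , 18 ⊟ 1 , (18 ⊞ 1 , 2 ⊞ 0 ∷ []) ∷ []) ∷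
  (319 , 18 ⊟ 1 , (2 ⊞ 0 , 18 ⊞ 1 ∷ []) ∷ []) ∷
  (321 , 17 ⊞ 2 , (2 ⊞ 0 , 10 ⊟ 1 ∷ []) ∷ []) ∷
  (322 , 18 ⊟ 1 , (18 ⊞ 1 , 2 ⊞ 0 ∷ []) ∷ []) ∷
  (323 , 18 ⊟ 1 , (2 ⊞ 0 , 3 ⊞ 0 ∷ 37 ⊞ 2 ∷ []) ∷ []) ∷
  (326 , 19 ⊟ 1 , (2 ⊞ 0 , 19 ⊞ 1 ∷ []) ∷ (2 ⊞ 0 , 19 ⊞ 1 ∷ []) ∷ []) ∷
  (327 , 73 ⊟ 4 , (2 ⊞ 0 , 19 ⊞ 1 ∷ []) ∷ (2 ⊞ 0 , 19 ⊞ 1 ∷ []) ∷ []) ∷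
  (329 , 60 ⊞ 7 , (2 ⊞ 0 , 10 ⊟ 1 ∷ []) ∷ []) ∷
  (330 , 73 ⊟ 4 , (2 ⊞ 0 , 19 ⊞ 1 ∷ []) ∷ (2 ⊞ 0 , 19 ⊞ 1 ∷ 37 ⊞ 2 ∷ []) ∷ []) ∷
  (331 , 73 ⊟ 4 , (2 ⊞ 0 , 19 ⊞ 1 ∷ []) ∷ []) ∷
  (334 , 2 ⊞ 0 , (55 ⊟ 3 , 19 ⊞ 1 ∷ []) ∷ (55 ⊟ 3 , 19 ⊞ 1 ∷ []) ∷ (55 ⊟ 3 , 19 ⊞ 1 ∷ []) ∷ []) ∷
  (335 , 55 ⊟ 3 , (2 ⊞ 0 , 19 ⊞ 1 ∷ []) ∷ []) ∷
  (337 , 9 ⊞ 1 , (2 ⊞ 0 , 10 ⊟ 1 ∷ []) ∷ (10 ⊟ 1 , 2 ⊞ 0 ∷ []) ∷ []) ∷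
  (339 , 37 ⊟ 2 , (2 ⊞ 0 , 37 ⊞ 2 ∷ []) ∷ []) ∷
  (341 , 35 ⊞ 4 , (2 ⊞ 0 , 10 ⊟ 1 ∷ 49 ⊟ 5 ∷ []) ∷ []) ∷
  (345 , 9 ⊞ 1 , (2 ⊞ 0 , 20 ⊟ 2 ∷ []) ∷ []) ∷
  (346 , 2 ⊞ 0 , (56 ⊟ 3 , 19 ⊞ 1 ∷ []) ∷ (56 ⊟ 3 , 19 ⊞ 1 ∷ []) ∷ (56 ⊟ 3 , 19 ⊞ 1 ∷ []) ∷ []) ∷
  (347 , 56 ⊟ 3 , (2 ⊞ 0 , 19 ⊞ 1 ∷ []) ∷ []) ∷
  (349 , 9 ⊞ 1 , (10 ⊟ 1 , 2 ⊞ 0 ∷ []) ∷ []) ∷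
  (353 , 9 ⊞ 1 , (10 ⊟ 1 , 2 ⊞ 0 ∷ []) ∷ []) ∷
  (354 , 2 ⊞ 0 , (19 ⊟ 1 , 19 ⊞ 1 ∷ []) ∷ (19 ⊟ 1 , 19 ⊞ 1 ∷ []) ∷ (19 ⊟ 1 , 19 ⊞ 1 ∷ []) ∷ []) ∷
  (355 , 2 ⊞ 0 , (19 ⊟ 1 , 19 ⊞ 1 ∷ []) ∷ (19 ⊟ 1 , 19 ⊞ 1 ∷ []) ∷ (19 ⊟ 1 , 38 ⊞ 2 ∷ []) ∷ []) ∷
  (357 , 18 ⊞ 2 , (2 ⊞ 0 , 11 ⊟ 1 ∷ []) ∷ []) ∷
  (358 , 19 ⊟ 1 , (2 ⊞ 0 , 19 ⊞ 1 ∷ []) ∷ []) ∷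
  (359 , 19 ⊟ 1 , (19 ⊞ 1 , 2 ⊞ 0 ∷ []) ∷ []) ∷
  (362 , 2 ⊞ 0 , (20 ⊟ 1 , 3 ⊞ 0 ∷ []) ∷ (20 ⊟ 1 , 3 ⊞ 0 ∷ []) ∷ (20 ⊟ 1 , 20 ⊞ 1 ∷ []) ∷ []) ∷
  (365 , 10 ⊞ 1 , (2 ⊞ 0 , 11 ⊟ 1 ∷ []) ∷ (2 ⊞ 0 , 11 ⊟ 1 ∷ []) ∷ []) ∷
  (366 , 2 ⊞ 0 , (39 ⊟ 2 , 20 ⊞ 1 ∷ []) ∷ (58 ⊟ 3 , 20 ⊞ 1 ∷ []) ∷ (58 ⊟ 3 , 20 ⊞ 1 ∷ []) ∷ []) ∷
  (367 , 2 ⊞ 0 , (39 ⊟ 2 , 20 ⊞ 1 ∷ []) ∷ (58 ⊟ 3 , 20 ⊞ 1 ∷ []) ∷ (58 ⊟ 3 , 20 ⊞ 1 ∷ []) ∷ []) ∷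
  (370 , 2 ⊞ 0 , (58 ⊟ 3 , 20 ⊞ 1 ∷ []) ∷ (58 ⊟ 3 , 20 ⊞ 1 ∷ []) ∷ (58 ⊟ 3 , 20 ⊞ 1 ∷ []) ∷ []) ∷
  (371 , 2 ⊞ 0 , (58 ⊟ 3 , 20 ⊞ 1 ∷ []) ∷ (58 ⊟ 3 , 20 ⊞ 1 ∷ []) ∷ (58 ⊟ 3 , 20 ⊞ 1 ∷ []) ∷ []) ∷
  (373 , 19 ⊞ 2 , (61 ⊟ 6 , 2 ⊞ 0 ∷ []) ∷ (61 ⊟ 6 , 2 ⊞ 0 ∷ []) ∷ []) ∷
  (374 , 2 ⊞ 0 , (39 ⊟ 2 , 20 ⊞ 1 ∷ []) ∷ (39 ⊟ 2 , 20 ⊞ 1 ∷ []) ∷ (39 ⊟ 2 , 20 ⊞ 1 ∷ []) ∷ []) ∷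
  (377 , 10 ⊞ 1 , (41 ⊟ 4 , 2 ⊞ 0 ∷ []) ∷ (41 ⊟ 4 , 2 ⊞ 0 ∷ []) ∷ []) ∷
  (379 , 39 ⊟ 2 , (2 ⊞ 0 , 39 ⊞ 2 ∷ []) ∷ []) ∷
  (381 , 2 ⊞ 0 , (28 ⊞ 3 , 11 ⊟ 1 ∷ []) ∷ (19 ⊞ 2 , 11 ⊟ 1 ∷ []) ∷ (19 ⊞ 2 , 11 ⊟ 1 ∷ []) ∷ []) ∷
  (382 , 2 ⊞ 0 , (20 ⊟ 1 , 20 ⊞ 1 ∷ []) ∷ (20 ⊟ 1 , 20 ⊞ 1 ∷ []) ∷ (59 ⊟ 3 , 20 ⊞ 1 ∷ []) ∷ []) ∷
  (383 , 2 ⊞ 0 , (20 ⊟ 1 , 20 ⊞ 1 ∷ []) ∷ (20 ⊟ 1 , 20 ⊞ 1 ∷ []) ∷ (59 ⊟ 3 , 20 ⊞ 1 ∷ []) ∷ []) ∷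
  (385 , 2 ⊞ 0 , (28 ⊞ 3 , 11 ⊟ 1 ∷ []) ∷ (19 ⊞ 2 , 11 ⊟ 1 ∷ []) ∷ (28 ⊞ 3 , 21 ⊟ 2 ∷ []) ∷ []) ∷
  (386 , 59 ⊟ 3 , (2 ⊞ 0 , 20 ⊞ 1 ∷ []) ∷ []) ∷
  []

refuted-table₅ : All (T ∘ refutesEntry false) table₅
refuted-table₅ = all⁺ (refutesEntry false) table₅ tt

table₆ : Table
table₆ =
  (389 , 19 ⊞ 2 , (2 ⊞ 0 , 11 ⊟ 1 ∷ []) ∷ (2 ⊞ 0 , 11 ⊟ 1 ∷ []) ∷ []) ∷
  (390 , 2 ⊞ 0 , (20 ⊟ 1 , 3 ⊞ 0 ∷ []) ∷ (20 ⊟ 1 , 20 ⊞ 1 ∷ []) ∷ (20 ⊟ 1 , 20 ⊞ 1 ∷ 40 ⊞ 2 ∷ []) ∷ []) ∷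
  (391 , 2 ⊞ 0 , (20 ⊟ 1 , 40 ⊞ 2 ∷ []) ∷ (20 ⊟ 1 , 20 ⊞ 1 ∷ 40 ⊞ 2 ∷ []) ∷ (20 ⊟ 1 , 20 ⊞ 1 ∷ 40 ⊞ 2 ∷ []) ∷ []) ∷
  (393 , 19 ⊞ 2 , (2 ⊞ 0 , 11 ⊟ 1 ∷ []) ∷ []) ∷
  (394 , 20 ⊟ 1 , (20 ⊞ 1 , 2 ⊞ 0 ∷ []) ∷ []) ∷
  (395 , 20 ⊟ 1 , (2 ⊞ 0 , 20 ⊞ 1 ∷ 40 ⊞ 2 ∷ []) ∷ []) ∷
  (397 , 19 ⊞ 2 , (2 ⊞ 0 , 11 ⊟ 1 ∷ []) ∷ []) ∷
  (398 , 20 ⊟ 1 , (20 ⊞ 1 , 2 ⊞ 0 ∷ []) ∷ []) ∷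
  (399 , 20 ⊟ 1 , (2 ⊞ 0 , 3 ⊞ 0 ∷ 41 ⊞ 2 ∷ []) ∷ []) ∷
  (401 , 2 ⊞ 0 , (10 ⊞ 1 , 11 ⊟ 1 ∷ []) ∷ (10 ⊞ 1 , 11 ⊟ 1 ∷ []) ∷ (10 ⊞ 1 , 11 ⊟ 1 ∷ []) ∷ []) ∷
  (402 , 2 ⊞ 0 , (21 ⊟ 1 , 3 ⊞ 0 ∷ []) ∷ (21 ⊟ 1 , 3 ⊞ 0 ∷ []) ∷ (21 ⊟ 1 , 21 ⊞ 1 ∷ []) ∷ []) ∷
  (403 , 2 ⊞ 0 , (21 ⊟ 1 , 3 ⊞ 0 ∷ []) ∷ (21 ⊟ 1 , 3 ⊞ 0 ∷ []) ∷ (41 ⊟ 2 , 21 ⊞ 1 ∷ []) ∷ []) ∷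
  (406 , 2 ⊞ 0 , (61 ⊟ 3 , 21 ⊞ 1 ∷ []) ∷ (61 ⊟ 3 , 21 ⊞ 1 ∷ []) ∷ (61 ⊟ 3 , 21 ⊞ 1 ∷ []) ∷ []) ∷
  (407 , 2 ⊞ 0 , (61 ⊟ 3 , 21 ⊞ 1 ∷ []) ∷ (61 ⊟ 3 , 21 ⊞ 1 ∷ []) ∷ (61 ⊟ 3 , 21 ⊞ 1 ∷ []) ∷ []) ∷
  (409 , 10 ⊞ 1 , (2 ⊞ 0 , 11 ⊟ 1 ∷ []) ∷ (32 ⊟ 3 , 2 ⊞ 0 ∷ []) ∷ []) ∷
  (410 , 2 ⊞ 0 , (61 ⊟ 3 , 21 ⊞ 1 ∷ []) ∷ (61 ⊟ 3 , 21 ⊞ 1 ∷ []) ∷ (61 ⊟ 3 , 21 ⊞ 1 ∷ []) ∷ []) ∷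
  (411 , 2 ⊞ 0 , (61 ⊟ 3 , 21 ⊞ 1 ∷ []) ∷ (61 ⊟ 3 , 21 ⊞ 1 ∷ []) ∷ (61 ⊟ 3 , 21 ⊞ 1 ∷ []) ∷ []) ∷
  (413 , 11 ⊟ 1 , (29 ⊞ 3 , 2 ⊞ 0 ∷ []) ∷ (29 ⊞ 3 , 3 ⊞ 0 ∷ []) ∷ []) ∷
  (415 , 2 ⊞ 0 , (41 ⊟ 2 , 21 ⊞ 1 ∷ []) ∷ (41 ⊟ 2 , 41 ⊞ 2 ∷ []) ∷ (41 ⊟ 2 , 21 ⊞ 1 ∷ []) ∷ []) ∷
  (417 , 10 ⊞ 1 , (3 ⊞ 0 , 11 ⊟ 1 ∷ []) ∷ (11 ⊟ 1 , 2 ⊞ 0 ∷ []) ∷ []) ∷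
  (418 , 41 ⊟ 2 , (2 ⊞ 0 , 21 ⊞ 1 ∷ []) ∷ []) ∷
  (419 , 41 ⊟ 2 , (2 ⊞ 0 , 41 ⊞ 2 ∷ []) ∷ []) ∷
  (421 , 10 ⊞ 1 , (11 ⊟ 1 , 2 ⊞ 0 ∷ []) ∷ []) ∷
  (422 , 2 ⊞ 0 , (21 ⊟ 1 , 21 ⊞ 1 ∷ []) ∷ (21 ⊟ 1 , 21 ⊞ 1 ∷ []) ∷ (62 ⊟ 3 , 21 ⊞ 1 ∷ []) ∷ []) ∷
  (426 , 62 ⊟ 3 , (2 ⊞ 0 , 21 ⊞ 1 ∷ []) ∷ []) ∷
  (427 , 62 ⊟ 3 , (2 ⊞ 0 , 21 ⊞ 1 ∷ []) ∷ []) ∷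
  (429 , 11 ⊟ 1 , (69 ⊞ 7 , 2 ⊞ 0 ∷ []) ∷ []) ∷
  (430 , 2 ⊞ 0 , (21 ⊟ 1 , 3 ⊞ 0 ∷ []) ∷ (21 ⊟ 1 , 21 ⊞ 1 ∷ []) ∷ (21 ⊟ 1 , 21 ⊞ 1 ∷ 42 ⊞ 2 ∷ []) ∷ []) ∷
  (431 , 2 ⊞ 0 , (21 ⊟ 1 , 21 ⊞ 1 ∷ []) ∷ (21 ⊟ 1 , 21 ⊞ 1 ∷ []) ∷ (21 ⊟ 1 , 21 ⊞ 1 ∷ []) ∷ []) ∷
  (433 , 10 ⊞ 1 , (11 ⊟ 1 , 2 ⊞ 0 ∷ []) ∷ []) ∷
  (434 , 21 ⊟ 1 , (21 ⊞ 1 , 2 ⊞ 0 ∷ []) ∷ []) ∷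
  (435 , 21 ⊟ 1 , (21 ⊞ 1 , 2 ⊞ 0 ∷ 5 ⊞ 0 ∷ []) ∷ []) ∷
  (437 , 20 ⊞ 2 , (2 ⊞ 0 , 12 ⊟ 1 ∷ []) ∷ []) ∷
  (438 , 21 ⊟ 1 , (2 ⊞ 0 , 21 ⊞ 1 ∷ []) ∷ []) ∷
  (439 , 21 ⊟ 1 , (21 ⊞ 1 , 2 ⊞ 0 ∷ []) ∷ []) ∷
  (442 , 2 ⊞ 0 , (22 ⊟ 1 , 3 ⊞ 0 ∷ []) ∷ (22 ⊟ 1 , 3 ⊞ 0 ∷ []) ∷ (43 ⊟ 2 , 22 ⊞ 1 ∷ []) ∷ []) ∷
  (443 , 2 ⊞ 0 , (22 ⊟ 1 , 3 ⊞ 0 ∷ []) ∷ (22 ⊟ 1 , 3 ⊞ 0 ∷ []) ∷ (22 ⊟ 1 , 22 ⊞ 1 ∷ []) ∷ []) ∷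
  (445 , 11 ⊞ 1 , (2 ⊞ 0 , 12 ⊟ 1 ∷ []) ∷ (2 ⊞ 0 , 12 ⊟ 1 ∷ []) ∷ []) ∷
  (446 , 2 ⊞ 0 , (22 ⊟ 1 , 3 ⊞ 0 ∷ []) ∷ (22 ⊟ 1 , 3 ⊞ 0 ∷ []) ∷ (64 ⊟ 3 , 22 ⊞ 1 ∷ []) ∷ []) ∷
  (447 , 2 ⊞ 0 , (64 ⊟ 3 , 22 ⊞ 1 ∷ []) ∷ (64 ⊟ 3 , 22 ⊞ 1 ∷ []) ∷ (64 ⊟ 3 , 22 ⊞ 1 ∷ []) ∷ []) ∷
  (449 , 11 ⊞ 1 , (2 ⊞ 0 , 12 ⊟ 1 ∷ []) ∷ (2 ⊞ 0 , 12 ⊟ 1 ∷ []) ∷ []) ∷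
  (451 , 2 ⊞ 0 , (64 ⊟ 3 , 22 ⊞ 1 ∷ []) ∷ (64 ⊟ 3 , 22 ⊞ 1 ∷ []) ∷ (64 ⊟ 3 , 22 ⊞ 1 ∷ []) ∷ []) ∷
  (453 , 12 ⊟ 1 , (71 ⊞ 7 , 2 ⊞ 0 ∷ []) ∷ (71 ⊞ 7 , 2 ⊞ 0 ∷ []) ∷ []) ∷
  (454 , 64 ⊟ 3 , (2 ⊞ 0 , 22 ⊞ 1 ∷ []) ∷ []) ∷
  (455 , 64 ⊟ 3 , (2 ⊞ 0 , 22 ⊞ 1 ∷ []) ∷ []) ∷
  (457 , 51 ⊞ 5 , (2 ⊞ 0 , 12 ⊟ 1 ∷ []) ∷ []) ∷
  (458 , 2 ⊞ 0 , (43 ⊟ 2 , 43 ⊞ 2 ∷ []) ∷ (43 ⊟ 2 , 43 ⊞ 2 ∷ []) ∷ (43 ⊟ 2 , 43 ⊞ 2 ∷ []) ∷ []) ∷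
  (461 , 41 ⊞ 4 , (2 ⊞ 0 , 12 ⊟ 1 ∷ []) ∷ []) ∷
  (462 , 43 ⊟ 2 , (2 ⊞ 0 , 22 ⊞ 1 ∷ []) ∷ []) ∷
  (465 , 31 ⊞ 3 , (2 ⊞ 0 , 12 ⊟ 1 ∷ 23 ⊟ 2 ∷ []) ∷ []) ∷
  (469 , 12 ⊟ 1 , (31 ⊞ 3 , 2 ⊞ 0 ∷ []) ∷ (31 ⊞ 3 , 3 ⊞ 0 ∷ []) ∷ []) ∷
  (473 , 2 ⊞ 0 , (21 ⊞ 2 , 12 ⊟ 1 ∷ []) ∷ (21 ⊞ 2 , 12 ⊟ 1 ∷ []) ∷ (21 ⊞ 2 , 12 ⊟ 1 ∷ []) ∷ []) ∷
  (481 , 21 ⊞ 2 , (2 ⊞ 0 , 12 ⊟ 1 ∷ []) ∷ []) ∷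
  (485 , 11 ⊞ 1 , (2 ⊞ 0 , 12 ⊟ 1 ∷ []) ∷ (2 ⊞ 0 , 12 ⊟ 1 ∷ []) ∷ []) ∷
  (489 , 11 ⊞ 1 , (2 ⊞ 0 , 12 ⊟ 1 ∷ []) ∷ (58 ⊟ 5 , 2 ⊞ 0 ∷ []) ∷ []) ∷
  (493 , 32 ⊞ 3 , (2 ⊞ 0 , 12 ⊟ 1 ∷ []) ∷ []) ∷
  (497 , 11 ⊞ 1 , (35 ⊟ 3 , 2 ⊞ 0 ∷ []) ∷ (2 ⊞ 0 , 12 ⊟ 1 ∷ []) ∷ []) ∷
  (501 , 2 ⊞ 0 , (43 ⊞ 4 , 12 ⊟ 1 ∷ []) ∷ (11 ⊞ 1 , 12 ⊟ 1 ∷ 3 ⊞ 0 ∷ []) ∷ (11 ⊞ 1 , 12 ⊟ 1 ∷ []) ∷ []) ∷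
  (505 , 43 ⊞ 4 , (2 ⊞ 0 , 12 ⊟ 1 ∷ []) ∷ []) ∷
  (509 , 11 ⊞ 1 , (12 ⊟ 1 , 2 ⊞ 0 ∷ []) ∷ []) ∷
  (517 , 11 ⊞ 1 , (2 ⊞ 0 , 12 ⊟ 1 ∷ 24 ⊟ 2 ∷ []) ∷ []) ∷
  (521 , 11 ⊞ 1 , (12 ⊟ 1 , 2 ⊞ 0 ∷ []) ∷ []) ∷
  (533 , 2 ⊞ 0 , (12 ⊞ 1 , 13 ⊟ 1 ∷ []) ∷ (12 ⊞ 1 , 13 ⊟ 1 ∷ []) ∷ (12 ⊞ 1 , 13 ⊟ 1 ∷ []) ∷ []) ∷
  (537 , 2 ⊞ 0 , (12 ⊞ 1 , 13 ⊟ 1 ∷ []) ∷ (12 ⊞ 1 , 13 ⊟ 1 ∷ []) ∷ (12 ⊞ 1 , 13 ⊟ 1 ∷ []) ∷ []) ∷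
  (541 , 23 ⊞ 2 , (2 ⊞ 0 , 13 ⊟ 1 ∷ []) ∷ (2 ⊞ 0 , 13 ⊟ 1 ∷ []) ∷ []) ∷
  (545 , 23 ⊞ 2 , (2 ⊞ 0 , 13 ⊟ 1 ∷ []) ∷ (2 ⊞ 0 , 13 ⊟ 1 ∷ []) ∷ []) ∷
  (553 , 12 ⊞ 1 , (37 ⊟ 3 , 2 ⊞ 0 ∷ []) ∷ (37 ⊟ 3 , 2 ⊞ 0 ∷ 3 ⊞ 0 ∷ []) ∷ []) ∷
  (557 , 34 ⊞ 3 , (2 ⊞ 0 , 13 ⊟ 1 ∷ []) ∷ []) ∷
  (561 , 2 ⊞ 0 , (23 ⊞ 2 , 13 ⊟ 1 ∷ []) ∷ (23 ⊞ 2 , 13 ⊟ 1 ∷ []) ∷ (23 ⊞ 2 , 13 ⊟ 1 ∷ []) ∷ []) ∷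
  (565 , 2 ⊞ 0 , (23 ⊞ 2 , 25 ⊟ 2 ∷ []) ∷ (23 ⊞ 2 , 25 ⊟ 2 ∷ []) ∷ (23 ⊞ 2 , 13 ⊟ 1 ∷ []) ∷ []) ∷
  (569 , 2 ⊞ 0 , (23 ⊞ 2 , 13 ⊟ 1 ∷ []) ∷ (23 ⊞ 2 , 25 ⊟ 2 ∷ []) ∷ (23 ⊞ 2 , 13 ⊟ 1 ∷ []) ∷ []) ∷
  (573 , 23 ⊞ 2 , (2 ⊞ 0 , 13 ⊟ 1 ∷ []) ∷ []) ∷
  (577 , 12 ⊞ 1 , (2 ⊞ 0 , 13 ⊟ 1 ∷ []) ∷ (2 ⊞ 0 , 13 ⊟ 1 ∷ []) ∷ []) ∷
  (581 , 12 ⊞ 1 , (2 ⊞ 0 , 13 ⊟ 1 ∷ []) ∷ (63 ⊟ 5 , 2 ⊞ 0 ∷ []) ∷ []) ∷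
  (589 , 35 ⊞ 3 , (2 ⊞ 0 , 13 ⊟ 1 ∷ []) ∷ []) ∷
  (593 , 2 ⊞ 0 , (12 ⊞ 1 , 13 ⊟ 1 ∷ []) ∷ (12 ⊞ 1 , 13 ⊟ 1 ∷ []) ∷ (12 ⊞ 1 , 13 ⊟ 1 ∷ []) ∷ []) ∷
  (597 , 2 ⊞ 0 , (47 ⊞ 4 , 13 ⊟ 1 ∷ []) ∷ (12 ⊞ 1 , 13 ⊟ 1 ∷ 26 ⊟ 2 ∷ []) ∷ (12 ⊞ 1 , 13 ⊟ 1 ∷ []) ∷ []) ∷
  (601 , 12 ⊞ 1 , (13 ⊟ 1 , 2 ⊞ 0 ∷ []) ∷ []) ∷
  (609 , 2 ⊞ 0 , (12 ⊞ 1 , 26 ⊟ 2 ∷ []) ∷ (12 ⊞ 1 , 13 ⊟ 1 ∷ 26 ⊟ 2 ∷ []) ∷ (12 ⊞ 1 , 13 ⊟ 1 ∷ 26 ⊟ 2 ∷ []) ∷ []) ∷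
  (613 , 12 ⊞ 1 , (2 ⊞ 0 , 13 ⊟ 1 ∷ []) ∷ []) ∷
  []

refuted-table₆ : All (T ∘ refutesEntry false) table₆
refuted-table₆ = all⁺ (refutesEntry false) table₆ tt

table₇ : Table
table₇ =
  (617 , 12 ⊞ 1 , (13 ⊟ 1 , 2 ⊞ 0 ∷ []) ∷ []) ∷
  (629 , 2 ⊞ 0 , (25 ⊞ 2 , 14 ⊟ 1 ∷ []) ∷ (25 ⊞ 2 , 14 ⊟ 1 ∷ []) ∷ (25 ⊞ 2 , 14 ⊟ 1 ∷ []) ∷ []) ∷
  (633 , 2 ⊞ 0 , (13 ⊞ 1 , 14 ⊟ 1 ∷ []) ∷ (13 ⊞ 1 , 14 ⊟ 1 ∷ []) ∷ (13 ⊞ 1 , 14 ⊟ 1 ∷ []) ∷ []) ∷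
  (641 , 37 ⊞ 3 , (2 ⊞ 0 , 14 ⊟ 1 ∷ []) ∷ (2 ⊞ 0 , 14 ⊟ 1 ∷ []) ∷ []) ∷
  (645 , 61 ⊞ 5 , (14 ⊟ 1 , 2 ⊞ 0 ∷ []) ∷ []) ∷
  (649 , 49 ⊞ 4 , (53 ⊟ 4 , 2 ⊞ 0 ∷ []) ∷ []) ∷
  (653 , 37 ⊞ 3 , (2 ⊞ 0 , 14 ⊟ 1 ∷ []) ∷ []) ∷
  (661 , 2 ⊞ 0 , (25 ⊞ 2 , 14 ⊟ 1 ∷ []) ∷ (25 ⊞ 2 , 14 ⊟ 1 ∷ []) ∷ (25 ⊞ 2 , 14 ⊟ 1 ∷ []) ∷ []) ∷
  (665 , 25 ⊞ 2 , (67 ⊟ 5 , 2 ⊞ 0 ∷ []) ∷ []) ∷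
  (669 , 25 ⊞ 2 , (2 ⊞ 0 , 14 ⊟ 1 ∷ []) ∷ []) ∷
  (673 , 25 ⊞ 2 , (2 ⊞ 0 , 14 ⊟ 1 ∷ []) ∷ []) ∷
  (677 , 13 ⊞ 1 , (2 ⊞ 0 , 14 ⊟ 1 ∷ []) ∷ (2 ⊞ 0 , 14 ⊟ 1 ∷ []) ∷ []) ∷
  (681 , 38 ⊞ 3 , (2 ⊞ 0 , 14 ⊟ 1 ∷ []) ∷ (2 ⊞ 0 , 14 ⊟ 1 ∷ []) ∷ []) ∷
  (685 , 38 ⊞ 3 , (2 ⊞ 0 , 14 ⊟ 1 ∷ []) ∷ []) ∷
  (689 , 38 ⊞ 3 , (2 ⊞ 0 , 14 ⊟ 1 ∷ []) ∷ []) ∷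
  (697 , 2 ⊞ 0 , (51 ⊞ 4 , 14 ⊟ 1 ∷ []) ∷ (13 ⊞ 1 , 14 ⊟ 1 ∷ []) ∷ (13 ⊞ 1 , 14 ⊟ 1 ∷ []) ∷ []) ∷
  (701 , 13 ⊞ 1 , (2 ⊞ 0 , 14 ⊟ 1 ∷ []) ∷ (55 ⊟ 4 , 3 ⊞ 0 ∷ []) ∷ []) ∷
  (705 , 2 ⊞ 0 , (13 ⊞ 1 , 14 ⊟ 1 ∷ []) ∷ (13 ⊞ 1 , 14 ⊟ 1 ∷ []) ∷ (13 ⊞ 1 , 14 ⊟ 1 ∷ 28 ⊟ 2 ∷ []) ∷ []) ∷
  (709 , 13 ⊞ 1 , (14 ⊟ 1 , 2 ⊞ 0 ∷ []) ∷ []) ∷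
  (713 , 2 ⊞ 0 , (13 ⊞ 1 , 28 ⊟ 2 ∷ []) ∷ (13 ⊞ 1 , 14 ⊟ 1 ∷ 28 ⊟ 2 ∷ []) ∷ (13 ⊞ 1 , 14 ⊟ 1 ∷ 28 ⊟ 2 ∷ []) ∷ []) ∷
  (717 , 13 ⊞ 1 , (2 ⊞ 0 , 14 ⊟ 1 ∷ []) ∷ []) ∷
  (721 , 13 ⊞ 1 , (14 ⊟ 1 , 2 ⊞ 0 ∷ []) ∷ []) ∷
  (733 , 2 ⊞ 0 , (14 ⊞ 1 , 15 ⊟ 1 ∷ []) ∷ (14 ⊞ 1 , 15 ⊟ 1 ∷ []) ∷ (14 ⊞ 1 , 15 ⊟ 1 ∷ []) ∷ []) ∷
  (737 , 2 ⊞ 0 , (14 ⊞ 1 , 15 ⊟ 1 ∷ []) ∷ (14 ⊞ 1 , 15 ⊟ 1 ∷ []) ∷ (14 ⊞ 1 , 15 ⊟ 1 ∷ []) ∷ []) ∷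
  (741 , 2 ⊞ 0 , (27 ⊞ 2 , 15 ⊟ 1 ∷ []) ∷ (27 ⊞ 2 , 15 ⊟ 1 ∷ []) ∷ (27 ⊞ 2 , 15 ⊟ 1 ∷ []) ∷ []) ∷
  (745 , 40 ⊞ 3 , (2 ⊞ 0 , 15 ⊟ 1 ∷ []) ∷ (2 ⊞ 0 , 15 ⊟ 1 ∷ []) ∷ []) ∷
  (749 , 14 ⊞ 1 , (71 ⊟ 5 , 2 ⊞ 0 ∷ []) ∷ (71 ⊟ 5 , 2 ⊞ 0 ∷ []) ∷ []) ∷
  (753 , 53 ⊞ 4 , (2 ⊞ 0 , 15 ⊟ 1 ∷ []) ∷ []) ∷
  (757 , 40 ⊞ 3 , (2 ⊞ 0 , 15 ⊟ 1 ∷ []) ∷ []) ∷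
  (761 , 40 ⊞ 3 , (2 ⊞ 0 , 15 ⊟ 1 ∷ []) ∷ []) ∷
  (769 , 2 ⊞ 0 , (27 ⊞ 2 , 15 ⊟ 1 ∷ []) ∷ (27 ⊞ 2 , 15 ⊟ 1 ∷ []) ∷ (27 ⊞ 2 , 15 ⊟ 1 ∷ []) ∷ []) ∷
  (773 , 2 ⊞ 0 , (27 ⊞ 2 , 15 ⊟ 1 ∷ []) ∷ (27 ⊞ 2 , 15 ⊟ 1 ∷ []) ∷ (27 ⊞ 2 , 15 ⊟ 1 ∷ []) ∷ []) ∷
  (777 , 27 ⊞ 2 , (2 ⊞ 0 , 15 ⊟ 1 ∷ []) ∷ []) ∷
  (781 , 27 ⊞ 2 , (2 ⊞ 0 , 15 ⊟ 1 ∷ []) ∷ []) ∷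
  (785 , 2 ⊞ 0 , (14 ⊞ 1 , 15 ⊟ 1 ∷ []) ∷ (41 ⊞ 3 , 15 ⊟ 1 ∷ []) ∷ (14 ⊞ 1 , 15 ⊟ 1 ∷ []) ∷ []) ∷
  (789 , 41 ⊞ 3 , (2 ⊞ 0 , 15 ⊟ 1 ∷ []) ∷ (2 ⊞ 0 , 15 ⊟ 1 ∷ []) ∷ []) ∷
  (793 , 14 ⊞ 1 , (73 ⊟ 5 , 2 ⊞ 0 ∷ []) ∷ (73 ⊟ 5 , 2 ⊞ 0 ∷ []) ∷ []) ∷
  (797 , 41 ⊞ 3 , (2 ⊞ 0 , 15 ⊟ 1 ∷ []) ∷ []) ∷
  (805 , 2 ⊞ 0 , (14 ⊞ 1 , 3 ⊞ 0 ∷ []) ∷ (14 ⊞ 1 , 15 ⊟ 1 ∷ 3 ⊞ 0 ∷ []) ∷ (14 ⊞ 1 , 15 ⊟ 1 ∷ 30 ⊟ 2 ∷ []) ∷ []) ∷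
  (809 , 55 ⊞ 4 , (2 ⊞ 0 , 15 ⊟ 1 ∷ []) ∷ []) ∷
  (813 , 2 ⊞ 0 , (14 ⊞ 1 , 15 ⊟ 1 ∷ []) ∷ (14 ⊞ 1 , 15 ⊟ 1 ∷ []) ∷ (14 ⊞ 1 , 15 ⊟ 1 ∷ []) ∷ []) ∷
  (817 , 14 ⊞ 1 , (15 ⊟ 1 , 2 ⊞ 0 ∷ []) ∷ []) ∷
  (821 , 14 ⊞ 1 , (15 ⊟ 1 , 2 ⊞ 0 ∷ []) ∷ []) ∷
  (829 , 14 ⊞ 1 , (2 ⊞ 0 , 15 ⊟ 1 ∷ []) ∷ []) ∷
  (849 , 2 ⊞ 0 , (15 ⊞ 1 , 16 ⊟ 1 ∷ []) ∷ (29 ⊞ 2 , 16 ⊟ 1 ∷ []) ∷ (15 ⊞ 1 , 16 ⊟ 1 ∷ []) ∷ []) ∷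
  (853 , 2 ⊞ 0 , (15 ⊞ 1 , 16 ⊟ 1 ∷ []) ∷ (15 ⊞ 1 , 16 ⊟ 1 ∷ []) ∷ (43 ⊞ 3 , 16 ⊟ 1 ∷ []) ∷ []) ∷
  (857 , 2 ⊞ 0 , (15 ⊞ 1 , 16 ⊟ 1 ∷ []) ∷ (29 ⊞ 2 , 16 ⊟ 1 ∷ []) ∷ (29 ⊞ 2 , 16 ⊟ 1 ∷ []) ∷ []) ∷
  (861 , 43 ⊞ 3 , (2 ⊞ 0 , 16 ⊟ 1 ∷ []) ∷ (2 ⊞ 0 , 16 ⊟ 1 ∷ []) ∷ []) ∷
  (865 , 15 ⊞ 1 , (61 ⊟ 4 , 2 ⊞ 0 ∷ []) ∷ (61 ⊟ 4 , 2 ⊞ 0 ∷ []) ∷ []) ∷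
  (869 , 57 ⊞ 4 , (2 ⊞ 0 , 16 ⊟ 1 ∷ 46 ⊟ 3 ∷ []) ∷ []) ∷
  (877 , 43 ⊞ 3 , (2 ⊞ 0 , 16 ⊟ 1 ∷ []) ∷ []) ∷
  (881 , 2 ⊞ 0 , (29 ⊞ 2 , 16 ⊟ 1 ∷ []) ∷ (29 ⊞ 2 , 31 ⊟ 2 ∷ []) ∷ (29 ⊞ 2 , 16 ⊟ 1 ∷ []) ∷ []) ∷
  (885 , 2 ⊞ 0 , (29 ⊞ 2 , 16 ⊟ 1 ∷ []) ∷ (29 ⊞ 2 , 16 ⊟ 1 ∷ []) ∷ (29 ⊞ 2 , 16 ⊟ 1 ∷ []) ∷ []) ∷
  (889 , 2 ⊞ 0 , (29 ⊞ 2 , 16 ⊟ 1 ∷ []) ∷ (29 ⊞ 2 , 31 ⊟ 2 ∷ []) ∷ (29 ⊞ 2 , 16 ⊟ 1 ∷ []) ∷ []) ∷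
  (893 , 29 ⊞ 2 , (2 ⊞ 0 , 16 ⊟ 1 ∷ []) ∷ []) ∷
  (897 , 29 ⊞ 2 , (2 ⊞ 0 , 16 ⊟ 1 ∷ []) ∷ []) ∷
  (901 , 2 ⊞ 0 , (15 ⊞ 1 , 16 ⊟ 1 ∷ []) ∷ (15 ⊞ 1 , 16 ⊟ 1 ∷ []) ∷ (44 ⊞ 3 , 16 ⊟ 1 ∷ []) ∷ []) ∷
  (905 , 44 ⊞ 3 , (2 ⊞ 0 , 16 ⊟ 1 ∷ []) ∷ (2 ⊞ 0 , 16 ⊟ 1 ∷ []) ∷ []) ∷
  (913 , 44 ⊞ 3 , (2 ⊞ 0 , 16 ⊟ 1 ∷ []) ∷ []) ∷
  (917 , 44 ⊞ 3 , (2 ⊞ 0 , 16 ⊟ 1 ∷ []) ∷ []) ∷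
  (921 , 2 ⊞ 0 , (15 ⊞ 1 , 16 ⊟ 1 ∷ []) ∷ (15 ⊞ 1 , 16 ⊟ 1 ∷ []) ∷ (15 ⊞ 1 , 16 ⊟ 1 ∷ []) ∷ []) ∷
  (929 , 59 ⊞ 4 , (2 ⊞ 0 , 16 ⊟ 1 ∷ 32 ⊟ 2 ∷ []) ∷ []) ∷
  (933 , 2 ⊞ 0 , (15 ⊞ 1 , 16 ⊟ 1 ∷ []) ∷ (15 ⊞ 1 , 16 ⊟ 1 ∷ []) ∷ (15 ⊞ 1 , 16 ⊟ 1 ∷ []) ∷ []) ∷
  (937 , 15 ⊞ 1 , (16 ⊟ 1 , 2 ⊞ 0 ∷ []) ∷ []) ∷
  (941 , 15 ⊞ 1 , (16 ⊟ 1 , 2 ⊞ 0 ∷ []) ∷ []) ∷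
  (949 , 15 ⊞ 1 , (2 ⊞ 0 , 16 ⊟ 1 ∷ []) ∷ []) ∷
  (953 , 15 ⊞ 1 , (16 ⊟ 1 , 2 ⊞ 0 ∷ []) ∷ []) ∷
  (957 , 15 ⊞ 1 , (2 ⊞ 0 , 3 ⊞ 0 ∷ 33 ⊟ 2 ∷ []) ∷ []) ∷
  (965 , 2 ⊞ 0 , (16 ⊞ 1 , 17 ⊟ 1 ∷ []) ∷ (16 ⊞ 1 , 17 ⊟ 1 ∷ []) ∷ (16 ⊞ 1 , 17 ⊟ 1 ∷ []) ∷ []) ∷
  (969 , 2 ⊞ 0 , (16 ⊞ 1 , 17 ⊟ 1 ∷ []) ∷ (16 ⊞ 1 , 17 ⊟ 1 ∷ []) ∷ (16 ⊞ 1 , 17 ⊟ 1 ∷ []) ∷ []) ∷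
  (973 , 2 ⊞ 0 , (16 ⊞ 1 , 17 ⊟ 1 ∷ []) ∷ (16 ⊞ 1 , 17 ⊟ 1 ∷ []) ∷ (46 ⊞ 3 , 17 ⊟ 1 ∷ []) ∷ []) ∷
  (977 , 2 ⊞ 0 , (16 ⊞ 1 , 17 ⊟ 1 ∷ []) ∷ (16 ⊞ 1 , 17 ⊟ 1 ∷ []) ∷ (31 ⊞ 2 , 17 ⊟ 1 ∷ []) ∷ []) ∷
  (985 , 16 ⊞ 1 , (81 ⊟ 5 , 2 ⊞ 0 ∷ []) ∷ (81 ⊟ 5 , 3 ⊞ 0 ∷ []) ∷ []) ∷
  (989 , 16 ⊞ 1 , (65 ⊟ 4 , 2 ⊞ 0 ∷ []) ∷ (65 ⊟ 4 , 2 ⊞ 0 ∷ []) ∷ []) ∷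
  (993 , 46 ⊞ 3 , (2 ⊞ 0 , 17 ⊟ 1 ∷ []) ∷ []) ∷
  (997 , 46 ⊞ 3 , (2 ⊞ 0 , 17 ⊟ 1 ∷ []) ∷ []) ∷
  (1001 , 46 ⊞ 3 , (2 ⊞ 0 , 17 ⊟ 1 ∷ []) ∷ []) ∷
  (1005 , 2 ⊞ 0 , (31 ⊞ 2 , 17 ⊟ 1 ∷ []) ∷ (31 ⊞ 2 , 17 ⊟ 1 ∷ []) ∷ (31 ⊞ 2 , 17 ⊟ 1 ∷ []) ∷ []) ∷
  (1009 , 2 ⊞ 0 , (31 ⊞ 2 , 17 ⊟ 1 ∷ []) ∷ (31 ⊞ 2 , 33 ⊟ 2 ∷ []) ∷ (31 ⊞ 2 , 17 ⊟ 1 ∷ []) ∷ []) ∷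
  (1013 , 2 ⊞ 0 , (31 ⊞ 2 , 17 ⊟ 1 ∷ []) ∷ (31 ⊞ 2 , 17 ⊟ 1 ∷ []) ∷ (31 ⊞ 2 , 17 ⊟ 1 ∷ []) ∷ []) ∷
  []

refuted-table₇ : All (T ∘ refutesEntry false) table₇
refuted-table₇ = all⁺ (refutesEntry false) table₇ tt

table₈ : Table
table₈ =
  (1021 , 31 ⊞ 2 , (2 ⊞ 0 , 17 ⊟ 1 ∷ []) ∷ []) ∷
  (1033 , 47 ⊞ 3 , (2 ⊞ 0 , 17 ⊟ 1 ∷ []) ∷ (2 ⊞ 0 , 17 ⊟ 1 ∷ []) ∷ []) ∷
  (1037 , 47 ⊞ 3 , (2 ⊞ 0 , 17 ⊟ 1 ∷ []) ∷ []) ∷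
  (1041 , 47 ⊞ 3 , (2 ⊞ 0 , 17 ⊟ 1 ∷ []) ∷ []) ∷
  (1045 , 47 ⊞ 3 , (2 ⊞ 0 , 17 ⊟ 1 ∷ []) ∷ []) ∷
  (1049 , 2 ⊞ 0 , (63 ⊞ 4 , 17 ⊟ 1 ∷ []) ∷ (63 ⊞ 4 , 17 ⊟ 1 ∷ []) ∷ (16 ⊞ 1 , 17 ⊟ 1 ∷ []) ∷ []) ∷
  (1057 , 2 ⊞ 0 , (16 ⊞ 1 , 17 ⊟ 1 ∷ []) ∷ (16 ⊞ 1 , 17 ⊟ 1 ∷ []) ∷ (16 ⊞ 1 , 17 ⊟ 1 ∷ []) ∷ []) ∷
  (1061 , 2 ⊞ 0 , (16 ⊞ 1 , 17 ⊟ 1 ∷ []) ∷ (16 ⊞ 1 , 17 ⊟ 1 ∷ []) ∷ (16 ⊞ 1 , 17 ⊟ 1 ∷ []) ∷ []) ∷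
  (1065 , 2 ⊞ 0 , (16 ⊞ 1 , 17 ⊟ 1 ∷ []) ∷ (16 ⊞ 1 , 34 ⊟ 2 ∷ []) ∷ (16 ⊞ 1 , 34 ⊟ 2 ∷ []) ∷ []) ∷
  (1069 , 16 ⊞ 1 , (17 ⊟ 1 , 2 ⊞ 0 ∷ []) ∷ []) ∷
  (1073 , 16 ⊞ 1 , (2 ⊞ 0 , 34 ⊟ 2 ∷ []) ∷ []) ∷
  (1077 , 16 ⊞ 1 , (2 ⊞ 0 , 17 ⊟ 1 ∷ []) ∷ []) ∷
  (1081 , 16 ⊞ 1 , (17 ⊟ 1 , 2 ⊞ 0 ∷ []) ∷ []) ∷
  (1085 , 32 ⊞ 2 , (2 ⊞ 0 , 18 ⊟ 1 ∷ []) ∷ []) ∷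
  (1093 , 2 ⊞ 0 , (17 ⊞ 1 , 18 ⊟ 1 ∷ []) ∷ (17 ⊞ 1 , 18 ⊟ 1 ∷ []) ∷ (17 ⊞ 1 , 18 ⊟ 1 ∷ []) ∷ []) ∷
  (1097 , 2 ⊞ 0 , (33 ⊞ 2 , 18 ⊟ 1 ∷ []) ∷ (33 ⊞ 2 , 18 ⊟ 1 ∷ []) ∷ (33 ⊞ 2 , 18 ⊟ 1 ∷ []) ∷ []) ∷
  (1101 , 2 ⊞ 0 , (33 ⊞ 2 , 18 ⊟ 1 ∷ []) ∷ (33 ⊞ 2 , 18 ⊟ 1 ∷ []) ∷ (33 ⊞ 2 , 18 ⊟ 1 ∷ []) ∷ []) ∷
  (1105 , 2 ⊞ 0 , (17 ⊞ 1 , 18 ⊟ 1 ∷ []) ∷ (17 ⊞ 1 , 18 ⊟ 1 ∷ []) ∷ (33 ⊞ 2 , 18 ⊟ 1 ∷ []) ∷ []) ∷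
  (1109 , 49 ⊞ 3 , (2 ⊞ 0 , 18 ⊟ 1 ∷ []) ∷ (2 ⊞ 0 , 18 ⊟ 1 ∷ []) ∷ []) ∷
  (1113 , 2 ⊞ 0 , (33 ⊞ 2 , 18 ⊟ 1 ∷ []) ∷ (65 ⊞ 4 , 18 ⊟ 1 ∷ []) ∷ (33 ⊞ 2 , 18 ⊟ 1 ∷ []) ∷ []) ∷
  (1117 , 17 ⊞ 1 , (69 ⊟ 4 , 2 ⊞ 0 ∷ []) ∷ (69 ⊟ 4 , 2 ⊞ 0 ∷ []) ∷ []) ∷
  (1121 , 17 ⊞ 1 , (69 ⊟ 4 , 2 ⊞ 0 ∷ []) ∷ (69 ⊟ 4 , 2 ⊞ 0 ∷ []) ∷ []) ∷
  (1129 , 49 ⊞ 3 , (2 ⊞ 0 , 18 ⊟ 1 ∷ []) ∷ []) ∷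
  (1133 , 49 ⊞ 3 , (2 ⊞ 0 , 18 ⊟ 1 ∷ []) ∷ []) ∷
  (1137 , 2 ⊞ 0 , (33 ⊞ 2 , 35 ⊟ 2 ∷ []) ∷ (33 ⊞ 2 , 35 ⊟ 2 ∷ []) ∷ (33 ⊞ 2 , 35 ⊟ 2 ∷ []) ∷ []) ∷
  (1141 , 2 ⊞ 0 , (33 ⊞ 2 , 35 ⊟ 2 ∷ []) ∷ (33 ⊞ 2 , 35 ⊟ 2 ∷ []) ∷ (33 ⊞ 2 , 35 ⊟ 2 ∷ []) ∷ []) ∷
  (1145 , 2 ⊞ 0 , (33 ⊞ 2 , 35 ⊟ 2 ∷ []) ∷ (33 ⊞ 2 , 18 ⊟ 1 ∷ []) ∷ (33 ⊞ 2 , 35 ⊟ 2 ∷ []) ∷ []) ∷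
  (1149 , 33 ⊞ 2 , (2 ⊞ 0 , 35 ⊟ 2 ∷ []) ∷ []) ∷
  (1153 , 33 ⊞ 2 , (2 ⊞ 0 , 35 ⊟ 2 ∷ []) ∷ []) ∷
  (1157 , 2 ⊞ 0 , (17 ⊞ 1 , 18 ⊟ 1 ∷ []) ∷ (17 ⊞ 1 , 18 ⊟ 1 ∷ []) ∷ (17 ⊞ 1 , 18 ⊟ 1 ∷ []) ∷ []) ∷
  (1165 , 50 ⊞ 3 , (2 ⊞ 0 , 18 ⊟ 1 ∷ []) ∷ (2 ⊞ 0 , 18 ⊟ 1 ∷ []) ∷ []) ∷
  (1169 , 18 ⊟ 1 , (83 ⊞ 5 , 2 ⊞ 0 ∷ []) ∷ (83 ⊞ 5 , 3 ⊞ 0 ∷ []) ∷ []) ∷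
  (1173 , 50 ⊞ 3 , (2 ⊞ 0 , 18 ⊟ 1 ∷ []) ∷ []) ∷
  (1177 , 50 ⊞ 3 , (2 ⊞ 0 , 18 ⊟ 1 ∷ []) ∷ []) ∷
  (1181 , 2 ⊞ 0 , (17 ⊞ 1 , 18 ⊟ 1 ∷ []) ∷ (67 ⊞ 4 , 18 ⊟ 1 ∷ []) ∷ (17 ⊞ 1 , 18 ⊟ 1 ∷ []) ∷ []) ∷
  (1185 , 2 ⊞ 0 , (67 ⊞ 4 , 18 ⊟ 1 ∷ []) ∷ (67 ⊞ 4 , 36 ⊟ 2 ∷ []) ∷ (67 ⊞ 4 , 18 ⊟ 1 ∷ []) ∷ []) ∷
  (1189 , 67 ⊞ 4 , (2 ⊞ 0 , 18 ⊟ 1 ∷ []) ∷ []) ∷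
  (1193 , 2 ⊞ 0 , (17 ⊞ 1 , 18 ⊟ 1 ∷ []) ∷ (17 ⊞ 1 , 18 ⊟ 1 ∷ []) ∷ (17 ⊞ 1 , 18 ⊟ 1 ∷ []) ∷ []) ∷
  (1201 , 17 ⊞ 1 , (18 ⊟ 1 , 2 ⊞ 0 ∷ []) ∷ []) ∷
  (1205 , 17 ⊞ 1 , (18 ⊟ 1 , 3 ⊞ 0 ∷ []) ∷ []) ∷
  (1209 , 17 ⊞ 1 , (2 ⊞ 0 , 36 ⊟ 2 ∷ []) ∷ []) ∷
  (1213 , 17 ⊞ 1 , (2 ⊞ 0 , 18 ⊟ 1 ∷ []) ∷ []) ∷
  (1217 , 17 ⊞ 1 , (18 ⊟ 1 , 2 ⊞ 0 ∷ []) ∷ []) ∷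
  (1221 , 34 ⊞ 2 , (2 ⊞ 0 , 19 ⊟ 1 ∷ []) ∷ []) ∷
  (1229 , 2 ⊞ 0 , (18 ⊞ 1 , 19 ⊟ 1 ∷ []) ∷ (18 ⊞ 1 , 3 ⊞ 0 ∷ []) ∷ (18 ⊞ 1 , 19 ⊟ 1 ∷ []) ∷ []) ∷
  (1237 , 2 ⊞ 0 , (35 ⊞ 2 , 19 ⊟ 1 ∷ []) ∷ (35 ⊞ 2 , 19 ⊟ 1 ∷ []) ∷ (35 ⊞ 2 , 19 ⊟ 1 ∷ []) ∷ []) ∷
  (1241 , 2 ⊞ 0 , (35 ⊞ 2 , 19 ⊟ 1 ∷ []) ∷ (35 ⊞ 2 , 19 ⊟ 1 ∷ []) ∷ (35 ⊞ 2 , 19 ⊟ 1 ∷ []) ∷ []) ∷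
  (1245 , 2 ⊞ 0 , (35 ⊞ 2 , 19 ⊟ 1 ∷ []) ∷ (35 ⊞ 2 , 19 ⊟ 1 ∷ []) ∷ (35 ⊞ 2 , 19 ⊟ 1 ∷ []) ∷ []) ∷
  (1249 , 52 ⊞ 3 , (2 ⊞ 0 , 19 ⊟ 1 ∷ []) ∷ (2 ⊞ 0 , 19 ⊟ 1 ∷ []) ∷ []) ∷
  (1253 , 19 ⊟ 1 , (86 ⊞ 5 , 2 ⊞ 0 ∷ []) ∷ (86 ⊞ 5 , 3 ⊞ 0 ∷ []) ∷ []) ∷
  (1257 , 18 ⊞ 1 , (73 ⊟ 4 , 2 ⊞ 0 ∷ []) ∷ (73 ⊟ 4 , 2 ⊞ 0 ∷ []) ∷ []) ∷
  (1261 , 52 ⊞ 3 , (2 ⊞ 0 , 19 ⊟ 1 ∷ []) ∷ []) ∷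
  (1265 , 52 ⊞ 3 , (2 ⊞ 0 , 19 ⊟ 1 ∷ []) ∷ []) ∷
  (1273 , 2 ⊞ 0 , (35 ⊞ 2 , 19 ⊟ 1 ∷ []) ∷ (35 ⊞ 2 , 19 ⊟ 1 ∷ []) ∷ (35 ⊞ 2 , 19 ⊟ 1 ∷ []) ∷ []) ∷
  (1277 , 2 ⊞ 0 , (35 ⊞ 2 , 19 ⊟ 1 ∷ []) ∷ (35 ⊞ 2 , 37 ⊟ 2 ∷ []) ∷ (35 ⊞ 2 , 37 ⊟ 2 ∷ []) ∷ []) ∷
  (1281 , 2 ⊞ 0 , (35 ⊞ 2 , 37 ⊟ 2 ∷ []) ∷ (35 ⊞ 2 , 37 ⊟ 2 ∷ []) ∷ (35 ⊞ 2 , 37 ⊟ 2 ∷ []) ∷ []) ∷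
  (1285 , 2 ⊞ 0 , (35 ⊞ 2 , 37 ⊟ 2 ∷ []) ∷ (35 ⊞ 2 , 19 ⊟ 1 ∷ []) ∷ (35 ⊞ 2 , 37 ⊟ 2 ∷ []) ∷ []) ∷
  (1289 , 35 ⊞ 2 , (2 ⊞ 0 , 37 ⊟ 2 ∷ []) ∷ []) ∷
  (1293 , 35 ⊞ 2 , (2 ⊞ 0 , 37 ⊟ 2 ∷ []) ∷ []) ∷
  (1297 , 2 ⊞ 0 , (18 ⊞ 1 , 19 ⊟ 1 ∷ []) ∷ (18 ⊞ 1 , 19 ⊟ 1 ∷ []) ∷ (18 ⊞ 1 , 19 ⊟ 1 ∷ []) ∷ []) ∷
  (1301 , 2 ⊞ 0 , (18 ⊞ 1 , 19 ⊟ 1 ∷ []) ∷ (18 ⊞ 1 , 19 ⊟ 1 ∷ []) ∷ (18 ⊞ 1 , 19 ⊟ 1 ∷ []) ∷ []) ∷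
  (1309 , 53 ⊞ 3 , (2 ⊞ 0 , 19 ⊟ 1 ∷ []) ∷ []) ∷
  (1313 , 53 ⊞ 3 , (2 ⊞ 0 , 19 ⊟ 1 ∷ []) ∷ []) ∷
  (1317 , 53 ⊞ 3 , (2 ⊞ 0 , 19 ⊟ 1 ∷ []) ∷ []) ∷
  (1321 , 2 ⊞ 0 , (18 ⊞ 1 , 19 ⊟ 1 ∷ []) ∷ (18 ⊞ 1 , 19 ⊟ 1 ∷ []) ∷ (18 ⊞ 1 , 19 ⊟ 1 ∷ []) ∷ []) ∷
  (1329 , 71 ⊞ 4 , (2 ⊞ 0 , 19 ⊟ 1 ∷ []) ∷ []) ∷
  (1333 , 2 ⊞ 0 , (18 ⊞ 1 , 38 ⊟ 2 ∷ []) ∷ (18 ⊞ 1 , 38 ⊟ 2 ∷ []) ∷ (18 ⊞ 1 , 19 ⊟ 1 ∷ 38 ⊟ 2 ∷ []) ∷ []) ∷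
  (1337 , 2 ⊞ 0 , (18 ⊞ 1 , 19 ⊟ 1 ∷ []) ∷ (18 ⊞ 1 , 19 ⊟ 1 ∷ []) ∷ (18 ⊞ 1 , 19 ⊟ 1 ∷ []) ∷ []) ∷
  (1345 , 18 ⊞ 1 , (19 ⊟ 1 , 3 ⊞ 0 ∷ []) ∷ []) ∷
  (1349 , 18 ⊞ 1 , (2 ⊞ 0 , 19 ⊟ 1 ∷ 38 ⊟ 2 ∷ []) ∷ []) ∷
  (1353 , 18 ⊞ 1 , (2 ⊞ 0 , 38 ⊟ 2 ∷ []) ∷ []) ∷
  (1357 , 18 ⊞ 1 , (2 ⊞ 0 , 19 ⊟ 1 ∷ []) ∷ []) ∷
  (1361 , 18 ⊞ 1 , (19 ⊟ 1 , 2 ⊞ 0 ∷ []) ∷ []) ∷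
  (1365 , 18 ⊞ 1 , (2 ⊞ 0 , 3 ⊞ 0 ∷ 39 ⊟ 2 ∷ []) ∷ []) ∷
  (1373 , 2 ⊞ 0 , (19 ⊞ 1 , 3 ⊞ 0 ∷ []) ∷ (19 ⊞ 1 , 3 ⊞ 0 ∷ []) ∷ (19 ⊞ 1 , 20 ⊟ 1 ∷ []) ∷ []) ∷
  (1381 , 2 ⊞ 0 , (19 ⊞ 1 , 20 ⊟ 1 ∷ []) ∷ (19 ⊞ 1 , 3 ⊞ 0 ∷ []) ∷ (19 ⊞ 1 , 20 ⊟ 1 ∷ []) ∷ []) ∷
  (1385 , 2 ⊞ 0 , (37 ⊞ 2 , 20 ⊟ 1 ∷ []) ∷ (37 ⊞ 2 , 20 ⊟ 1 ∷ []) ∷ (37 ⊞ 2 , 20 ⊟ 1 ∷ []) ∷ []) ∷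
  (1389 , 2 ⊞ 0 , (37 ⊞ 2 , 20 ⊟ 1 ∷ []) ∷ (37 ⊞ 2 , 20 ⊟ 1 ∷ []) ∷ (37 ⊞ 2 , 20 ⊟ 1 ∷ []) ∷ []) ∷
  (1393 , 2 ⊞ 0 , (37 ⊞ 2 , 20 ⊟ 1 ∷ []) ∷ (37 ⊞ 2 , 20 ⊟ 1 ∷ []) ∷ (37 ⊞ 2 , 20 ⊟ 1 ∷ []) ∷ []) ∷
  (1397 , 19 ⊞ 1 , (96 ⊟ 5 , 2 ⊞ 0 ∷ []) ∷ (96 ⊟ 5 , 2 ⊞ 0 ∷ []) ∷ []) ∷
  []

refuted-table₈ : All (T ∘ refutesEntry false) table₈
refuted-table₈ = all⁺ (refutesEntry false) table₈ tt

table₉ : Table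
table₉ =
  (1401 , 2 ⊞ 0 , (73 ⊞ 4 , 20 ⊟ 1 ∷ []) ∷ (73 ⊞ 4 , 20 ⊟ 1 ∷ []) ∷ (73 ⊞ 4 , 20 ⊟ 1 ∷ []) ∷ []) ∷
  (1405 , 73 ⊞ 4 , (2 ⊞ 0 , 20 ⊟ 1 ∷ []) ∷ []) ∷
  (1409 , 55 ⊞ 3 , (2 ⊞ 0 , 20 ⊟ 1 ∷ []) ∷ []) ∷
  (1417 , 55 ⊞ 3 , (2 ⊞ 0 , 20 ⊟ 1 ∷ []) ∷ []) ∷
  (1429 , 2 ⊞ 0 , (37 ⊞ 2 , 39 ⊟ 2 ∷ []) ∷ (37 ⊞ 2 , 39 ⊟ 2 ∷ []) ∷ (37 ⊞ 2 , 39 ⊟ 2 ∷ []) ∷ []) ∷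
  (1433 , 2 ⊞ 0 , (37 ⊞ 2 , 39 ⊟ 2 ∷ []) ∷ (37 ⊞ 2 , 39 ⊟ 2 ∷ []) ∷ (37 ⊞ 2 , 39 ⊟ 2 ∷ []) ∷ []) ∷
  (1437 , 37 ⊞ 2 , (2 ⊞ 0 , 39 ⊟ 2 ∷ []) ∷ []) ∷
  (1441 , 37 ⊞ 2 , (2 ⊞ 0 , 39 ⊟ 2 ∷ []) ∷ []) ∷
  (1453 , 2 ⊞ 0 , (19 ⊞ 1 , 20 ⊟ 1 ∷ []) ∷ (19 ⊞ 1 , 20 ⊟ 1 ∷ []) ∷ (56 ⊞ 3 , 20 ⊟ 1 ∷ []) ∷ []) ∷
  (1457 , 2 ⊞ 0 , (56 ⊞ 3 , 20 ⊟ 1 ∷ []) ∷ (56 ⊞ 3 , 20 ⊟ 1 ∷ []) ∷ (56 ⊞ 3 , 20 ⊟ 1 ∷ []) ∷ []) ∷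
  (1461 , 2 ⊞ 0 , (56 ⊞ 3 , 20 ⊟ 1 ∷ []) ∷ (56 ⊞ 3 , 20 ⊟ 1 ∷ []) ∷ (56 ⊞ 3 , 20 ⊟ 1 ∷ []) ∷ []) ∷
  (1465 , 56 ⊞ 3 , (2 ⊞ 0 , 20 ⊟ 1 ∷ []) ∷ []) ∷
  (1469 , 56 ⊞ 3 , (2 ⊞ 0 , 20 ⊟ 1 ∷ []) ∷ []) ∷
  (1473 , 2 ⊞ 0 , (75 ⊞ 4 , 20 ⊟ 1 ∷ []) ∷ (75 ⊞ 4 , 20 ⊟ 1 ∷ []) ∷ (75 ⊞ 4 , 20 ⊟ 1 ∷ []) ∷ []) ∷
  (1477 , 2 ⊞ 0 , (75 ⊞ 4 , 20 ⊟ 1 ∷ []) ∷ (19 ⊞ 1 , 20 ⊟ 1 ∷ []) ∷ (75 ⊞ 4 , 20 ⊟ 1 ∷ []) ∷ []) ∷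
  (1481 , 75 ⊞ 4 , (2 ⊞ 0 , 20 ⊟ 1 ∷ []) ∷ []) ∷
  (1489 , 2 ⊞ 0 , (19 ⊞ 1 , 20 ⊟ 1 ∷ []) ∷ (19 ⊞ 1 , 20 ⊟ 1 ∷ []) ∷ (19 ⊞ 1 , 20 ⊟ 1 ∷ []) ∷ []) ∷
  (1493 , 2 ⊞ 0 , (19 ⊞ 1 , 20 ⊟ 1 ∷ []) ∷ (19 ⊞ 1 , 20 ⊟ 1 ∷ []) ∷ (19 ⊞ 1 , 20 ⊟ 1 ∷ []) ∷ []) ∷
  (1497 , 19 ⊞ 1 , (20 ⊟ 1 , 2 ⊞ 0 ∷ []) ∷ []) ∷
  (1501 , 19 ⊞ 1 , (2 ⊞ 0 , 20 ⊟ 1 ∷ 40 ⊟ 2 ∷ []) ∷ []) ∷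
  (1505 , 19 ⊞ 1 , (2 ⊞ 0 , 40 ⊟ 2 ∷ []) ∷ []) ∷
  (1509 , 19 ⊞ 1 , (2 ⊞ 0 , 20 ⊟ 1 ∷ []) ∷ []) ∷
  (1513 , 19 ⊞ 1 , (20 ⊟ 1 , 2 ⊞ 0 ∷ []) ∷ []) ∷
  (1517 , 19 ⊞ 1 , (2 ⊞ 0 , 3 ⊞ 0 ∷ 41 ⊟ 2 ∷ []) ∷ []) ∷
  (1529 , 2 ⊞ 0 , (20 ⊞ 1 , 3 ⊞ 0 ∷ []) ∷ (20 ⊞ 1 , 3 ⊞ 0 ∷ []) ∷ (39 ⊞ 2 , 21 ⊟ 1 ∷ []) ∷ []) ∷
  (1533 , 2 ⊞ 0 , (20 ⊞ 1 , 3 ⊞ 0 ∷ []) ∷ (20 ⊞ 1 , 3 ⊞ 0 ∷ []) ∷ (39 ⊞ 2 , 21 ⊟ 1 ∷ []) ∷ []) ∷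
  (1537 , 2 ⊞ 0 , (20 ⊞ 1 , 3 ⊞ 0 ∷ []) ∷ (20 ⊞ 1 , 3 ⊞ 0 ∷ []) ∷ (39 ⊞ 2 , 21 ⊟ 1 ∷ []) ∷ []) ∷
  (1541 , 2 ⊞ 0 , (39 ⊞ 2 , 21 ⊟ 1 ∷ []) ∷ (39 ⊞ 2 , 21 ⊟ 1 ∷ []) ∷ (39 ⊞ 2 , 21 ⊟ 1 ∷ []) ∷ []) ∷
  (1545 , 2 ⊞ 0 , (39 ⊞ 2 , 21 ⊟ 1 ∷ []) ∷ (39 ⊞ 2 , 21 ⊟ 1 ∷ []) ∷ (39 ⊞ 2 , 21 ⊟ 1 ∷ []) ∷ []) ∷
  (1549 , 2 ⊞ 0 , (39 ⊞ 2 , 21 ⊟ 1 ∷ []) ∷ (20 ⊞ 1 , 81 ⊟ 4 ∷ []) ∷ (39 ⊞ 2 , 21 ⊟ 1 ∷ []) ∷ []) ∷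
  (1553 , 2 ⊞ 0 , (77 ⊞ 4 , 21 ⊟ 1 ∷ []) ∷ (77 ⊞ 4 , 21 ⊟ 1 ∷ []) ∷ (77 ⊞ 4 , 21 ⊟ 1 ∷ []) ∷ []) ∷
  (1561 , 58 ⊞ 3 , (2 ⊞ 0 , 21 ⊟ 1 ∷ []) ∷ []) ∷
  (1565 , 58 ⊞ 3 , (2 ⊞ 0 , 21 ⊟ 1 ∷ []) ∷ []) ∷
  (1569 , 58 ⊞ 3 , (2 ⊞ 0 , 21 ⊟ 1 ∷ []) ∷ []) ∷
  (1577 , 2 ⊞ 0 , (39 ⊞ 2 , 21 ⊟ 1 ∷ []) ∷ (39 ⊞ 2 , 21 ⊟ 1 ∷ []) ∷ (39 ⊞ 2 , 21 ⊟ 1 ∷ []) ∷ []) ∷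
  (1581 , 2 ⊞ 0 , (39 ⊞ 2 , 41 ⊟ 2 ∷ []) ∷ (39 ⊞ 2 , 41 ⊟ 2 ∷ []) ∷ (39 ⊞ 2 , 41 ⊟ 2 ∷ []) ∷ []) ∷
  (1585 , 2 ⊞ 0 , (39 ⊞ 2 , 41 ⊟ 2 ∷ []) ∷ (39 ⊞ 2 , 41 ⊟ 2 ∷ []) ∷ (39 ⊞ 2 , 41 ⊟ 2 ∷ []) ∷ []) ∷
  (1589 , 39 ⊞ 2 , (2 ⊞ 0 , 41 ⊟ 2 ∷ []) ∷ []) ∷
  (1597 , 39 ⊞ 2 , (2 ⊞ 0 , 41 ⊟ 2 ∷ []) ∷ []) ∷
  (1601 , 2 ⊞ 0 , (20 ⊞ 1 , 21 ⊟ 1 ∷ []) ∷ (20 ⊞ 1 , 21 ⊟ 1 ∷ []) ∷ (20 ⊞ 1 , 21 ⊟ 1 ∷ []) ∷ []) ∷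
  (1605 , 2 ⊞ 0 , (20 ⊞ 1 , 21 ⊟ 1 ∷ []) ∷ (20 ⊞ 1 , 3 ⊞ 0 ∷ []) ∷ (20 ⊞ 1 , 21 ⊟ 1 ∷ []) ∷ []) ∷
  (1609 , 2 ⊞ 0 , (20 ⊞ 1 , 21 ⊟ 1 ∷ []) ∷ (20 ⊞ 1 , 21 ⊟ 1 ∷ []) ∷ (59 ⊞ 3 , 21 ⊟ 1 ∷ []) ∷ []) ∷
  (1613 , 2 ⊞ 0 , (20 ⊞ 1 , 21 ⊟ 1 ∷ []) ∷ (59 ⊞ 3 , 21 ⊟ 1 ∷ []) ∷ (59 ⊞ 3 , 21 ⊟ 1 ∷ []) ∷ []) ∷
  (1621 , 59 ⊞ 3 , (2 ⊞ 0 , 21 ⊟ 1 ∷ []) ∷ []) ∷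
  (1633 , 2 ⊞ 0 , (79 ⊞ 4 , 21 ⊟ 1 ∷ []) ∷ (79 ⊞ 4 , 21 ⊟ 1 ∷ []) ∷ (79 ⊞ 4 , 21 ⊟ 1 ∷ []) ∷ []) ∷
  (1637 , 79 ⊞ 4 , (2 ⊞ 0 , 21 ⊟ 1 ∷ []) ∷ []) ∷
  (1641 , 2 ⊞ 0 , (20 ⊞ 1 , 21 ⊟ 1 ∷ []) ∷ (20 ⊞ 1 , 21 ⊟ 1 ∷ []) ∷ (20 ⊞ 1 , 21 ⊟ 1 ∷ []) ∷ []) ∷
  (1645 , 21 ⊟ 1 , (99 ⊞ 5 , 2 ⊞ 0 ∷ []) ∷ []) ∷
  (1649 , 20 ⊞ 1 , (21 ⊟ 1 , 2 ⊞ 0 ∷ []) ∷ []) ∷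
  (1653 , 2 ⊞ 0 , (20 ⊞ 1 , 21 ⊟ 1 ∷ []) ∷ (20 ⊞ 1 , 21 ⊟ 1 ∷ []) ∷ (20 ⊞ 1 , 42 ⊟ 2 ∷ []) ∷ []) ∷
  (1657 , 20 ⊞ 1 , (21 ⊟ 1 , 2 ⊞ 0 ∷ []) ∷ []) ∷
  (1661 , 20 ⊞ 1 , (2 ⊞ 0 , 21 ⊟ 1 ∷ []) ∷ []) ∷
  (1669 , 20 ⊞ 1 , (2 ⊞ 0 , 21 ⊟ 1 ∷ []) ∷ []) ∷
  (1673 , 20 ⊞ 1 , (21 ⊟ 1 , 2 ⊞ 0 ∷ []) ∷ []) ∷
  (1677 , 20 ⊞ 1 , (2 ⊞ 0 , 3 ⊞ 0 ∷ 43 ⊟ 2 ∷ []) ∷ []) ∷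
  (1685 , 2 ⊞ 0 , (21 ⊞ 1 , 3 ⊞ 0 ∷ []) ∷ (21 ⊞ 1 , 3 ⊞ 0 ∷ []) ∷ (21 ⊞ 1 , 22 ⊟ 1 ∷ []) ∷ []) ∷
  (1689 , 2 ⊞ 0 , (21 ⊞ 1 , 3 ⊞ 0 ∷ []) ∷ (21 ⊞ 1 , 3 ⊞ 0 ∷ []) ∷ (21 ⊞ 1 , 22 ⊟ 1 ∷ []) ∷ []) ∷
  (1693 , 2 ⊞ 0 , (21 ⊞ 1 , 3 ⊞ 0 ∷ []) ∷ (21 ⊞ 1 , 3 ⊞ 0 ∷ []) ∷ (41 ⊞ 2 , 22 ⊟ 1 ∷ []) ∷ []) ∷
  (1697 , 2 ⊞ 0 , (21 ⊞ 1 , 3 ⊞ 0 ∷ []) ∷ (21 ⊞ 1 , 3 ⊞ 0 ∷ []) ∷ (41 ⊞ 2 , 22 ⊟ 1 ∷ []) ∷ []) ∷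
  (1705 , 2 ⊞ 0 , (41 ⊞ 2 , 22 ⊟ 1 ∷ []) ∷ (41 ⊞ 2 , 22 ⊟ 1 ∷ []) ∷ (41 ⊞ 2 , 22 ⊟ 1 ∷ []) ∷ []) ∷
  (1709 , 2 ⊞ 0 , (41 ⊞ 2 , 22 ⊟ 1 ∷ []) ∷ (21 ⊞ 1 , 106 ⊟ 5 ∷ []) ∷ (41 ⊞ 2 , 106 ⊟ 5 ∷ []) ∷ []) ∷
  (1713 , 21 ⊞ 1 , (106 ⊟ 5 , 2 ⊞ 0 ∷ []) ∷ (106 ⊟ 5 , 2 ⊞ 0 ∷ []) ∷ []) ∷
  (1717 , 2 ⊞ 0 , (81 ⊞ 4 , 22 ⊟ 1 ∷ []) ∷ (81 ⊞ 4 , 22 ⊟ 1 ∷ []) ∷ (81 ⊞ 4 , 22 ⊟ 1 ∷ []) ∷ []) ∷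
  (1721 , 81 ⊞ 4 , (2 ⊞ 0 , 22 ⊟ 1 ∷ []) ∷ []) ∷
  (1729 , 61 ⊞ 3 , (2 ⊞ 0 , 22 ⊟ 1 ∷ []) ∷ []) ∷
  (1733 , 61 ⊞ 3 , (2 ⊞ 0 , 22 ⊟ 1 ∷ []) ∷ []) ∷
  (1741 , 2 ⊞ 0 , (41 ⊞ 2 , 22 ⊟ 1 ∷ []) ∷ (41 ⊞ 2 , 43 ⊟ 2 ∷ []) ∷ (41 ⊞ 2 , 43 ⊟ 2 ∷ []) ∷ []) ∷
  (1745 , 2 ⊞ 0 , (41 ⊞ 2 , 43 ⊟ 2 ∷ []) ∷ (102 ⊞ 5 , 43 ⊟ 2 ∷ []) ∷ (41 ⊞ 2 , 43 ⊟ 2 ∷ []) ∷ []) ∷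
  (1749 , 2 ⊞ 0 , (41 ⊞ 2 , 43 ⊟ 2 ∷ []) ∷ (41 ⊞ 2 , 43 ⊟ 2 ∷ []) ∷ (41 ⊞ 2 , 22 ⊟ 1 ∷ []) ∷ []) ∷
  (1753 , 41 ⊞ 2 , (2 ⊞ 0 , 43 ⊟ 2 ∷ []) ∷ []) ∷
  (1757 , 41 ⊞ 2 , (2 ⊞ 0 , 43 ⊟ 2 ∷ []) ∷ []) ∷
  (1761 , 41 ⊞ 2 , (2 ⊞ 0 , 43 ⊟ 2 ∷ []) ∷ []) ∷
  (1765 , 2 ⊞ 0 , (21 ⊞ 1 , 22 ⊟ 1 ∷ []) ∷ (21 ⊞ 1 , 3 ⊞ 0 ∷ []) ∷ (21 ⊞ 1 , 22 ⊟ 1 ∷ []) ∷ []) ∷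
  (1769 , 2 ⊞ 0 , (21 ⊞ 1 , 22 ⊟ 1 ∷ []) ∷ (21 ⊞ 1 , 22 ⊟ 1 ∷ []) ∷ (21 ⊞ 1 , 22 ⊟ 1 ∷ []) ∷ []) ∷
  (1777 , 2 ⊞ 0 , (21 ⊞ 1 , 22 ⊟ 1 ∷ []) ∷ (62 ⊞ 3 , 22 ⊟ 1 ∷ []) ∷ (62 ⊞ 3 , 22 ⊟ 1 ∷ []) ∷ []) ∷
  (1781 , 2 ⊞ 0 , (62 ⊞ 3 , 22 ⊟ 1 ∷ []) ∷ (62 ⊞ 3 , 22 ⊟ 1 ∷ []) ∷ (62 ⊞ 3 , 22 ⊟ 1 ∷ []) ∷ []) ∷
  (1785 , 62 ⊞ 3 , (2 ⊞ 0 , 22 ⊟ 1 ∷ []) ∷ []) ∷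
  (1789 , 62 ⊞ 3 , (2 ⊞ 0 , 22 ⊟ 1 ∷ []) ∷ []) ∷
  (1793 , 2 ⊞ 0 , (21 ⊞ 1 , 22 ⊟ 1 ∷ []) ∷ (21 ⊞ 1 , 22 ⊟ 1 ∷ []) ∷ (21 ⊞ 1 , 22 ⊟ 1 ∷ []) ∷ []) ∷
  (1797 , 2 ⊞ 0 , (83 ⊞ 4 , 22 ⊟ 1 ∷ []) ∷ (83 ⊞ 4 , 22 ⊟ 1 ∷ []) ∷ (83 ⊞ 4 , 22 ⊟ 1 ∷ []) ∷ []) ∷
  (1801 , 2 ⊞ 0 , (83 ⊞ 4 , 22 ⊟ 1 ∷ []) ∷ (21 ⊞ 1 , 22 ⊟ 1 ∷ []) ∷ (83 ⊞ 4 , 22 ⊟ 1 ∷ []) ∷ []) ∷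
  (1817 , 21 ⊞ 1 , (22 ⊟ 1 , 2 ⊞ 0 ∷ 5 ⊞ 0 ∷ []) ∷ []) ∷
  (1821 , 2 ⊞ 0 , (21 ⊞ 1 , 22 ⊟ 1 ∷ []) ∷ (21 ⊞ 1 , 22 ⊟ 1 ∷ []) ∷ (21 ⊞ 1 , 22 ⊟ 1 ∷ []) ∷ []) ∷
  (1829 , 21 ⊞ 1 , (2 ⊞ 0 , 22 ⊟ 1 ∷ []) ∷ []) ∷
  (1833 , 21 ⊞ 1 , (2 ⊞ 0 , 44 ⊟ 2 ∷ []) ∷ []) ∷
  (1837 , 21 ⊞ 1 , (2 ⊞ 0 , 22 ⊟ 1 ∷ []) ∷ []) ∷
  (1841 , 21 ⊞ 1 , (22 ⊟ 1 , 2 ⊞ 0 ∷ []) ∷ []) ∷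
  []

refuted-table₉ : All (T ∘ refutesEntry false) table₉
refuted-table₉ = all⁺ (refutesEntry false) table₉ tt

table : Table
table = table₁ ++ table₂ ++ table₃ ++ table₄ ++ table₅ ++ table₆ ++ table₇ ++ table₈ ++ table₉

refuted : All (T ∘ refutesEntry false) table
refuted = refuted-table₁ ++ᴬ refuted-table₂ ++ᴬ refuted-table₃ ++ᴬ refuted-table₄ ++ᴬ refuted-table₅ ++ᴬ refuted-table₆ ++ᴬ refuted-table₇ ++ᴬ refuted-table₈ ++ᴬ refuted-table₉

-- These entries are checked with `free` true, so a vanishing determinant can also be refuted: v₁,
-- v₂, v₃ are forced to span the lattice and v₄ has a coordinate outside ℤ[ω].
freeTable : Table
freeTable =
  (10 , 10 ⊟ 3 , (4 ⊟ 1 , 2 ⊞ 0 ∷ 4 ⊟ 1 ∷ 4 ⊞ 1 ∷ 5 ⊟ 1 ∷ 5 ⊞ 1 ∷ []) ∷ (11 ⊟ 3 , 2 ⊞ 0 ∷ 4 ⊟ 1 ∷ 4 ⊞ 1 ∷ 5 ⊟ 1 ∷ 5 ⊞ 1 ∷ []) ∷ (4 ⊟ 1 , 2 ⊞ 0 ∷ 4 ⊟ 1 ∷ 4 ⊞ 1 ∷ 5 ⊟ 1 ∷ 5 ⊞ 1 ∷ []) ∷ (4 ⊞ 1 , 2 ⊞ 0 ∷ 4 ⊟ 1 ∷ 4 ⊞ 1 ∷ 5 ⊟ 1 ∷ 5 ⊞ 1 ∷ []) ∷ (11 ⊞ 3 , 2 ⊞ 0 ∷ 4 ⊟ 1 ∷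 4 ⊞ 1 ∷ 5 ⊟ 1 ∷ 5 ⊞ 1 ∷ []) ∷ []) ∷
  (65 , 4 ⊞ 1 , (2 ⊞ 0 , 5 ⊟ 1 ∷ 11 ⊞ 3 ∷ 8 ⊞ 2 ∷ 3 ⊞ 0 ∷ 18 ⊞ 5 ∷ []) ∷ (2 ⊞ 0 , 5 ⊟ 1 ∷ 11 ⊞ 3 ∷ 8 ⊞ 2 ∷ 3 ⊞ 0 ∷ 18 ⊞ 5 ∷ []) ∷ []) ∷
  []

refuted-freeTable : All (T ∘ refutesEntry true) freeTable
refuted-freeTable = all⁺ (refutesEntry true) freeTable tt

-- The fields with discriminant below 1849, and the theorem

candidates primes : List ℕ
candidates = 2 ∷ 3 ∷ 5 ∷ 6 ∷ 7 ∷ 10 ∷ 13 ∷ 17 ∷ 21 ∷ 33 ∷ 41 ∷ 65 ∷ 77 ∷ []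
primes = 2 ∷ 3 ∷ 5 ∷ 7 ∷ 11 ∷ 13 ∷ 17 ∷ 19 ∷ 23 ∷ 29 ∷ 31 ∷ 37 ∷ 41 ∷ 43 ∷ []

primes-prime : All Prime primes
primes-prime = toWitness {a? = All.all? prime? primes} tt

-- As D ≤ `disc D`, a bound on the discriminant bounds D, and finitely many D remain. The
-- alternative with a large discriminant concerns D ≢ 1 modulo 4, where it is 4D. A square prime
-- divisor p² of some D < 1849 has p < 43, so the list of primes reaches far enough.
covered : ℕ → Bool
covered D = (D ℕ.<ᵇ 2) ∨ (1849 ℕ.≤ᵇ disc D) ∨ any (D ℕ.≡ᵇ_) candidates
  ∨ any (λ p → isYes (p ℕ.* p ℕ.∣? D)) primes ∨ any (λ (k , _) → k ℕ.≡ᵇ D) table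

all-covered : All (T ∘ covered) (downFrom 1849)
all-covered = all⁺ covered (downFrom 1849) tt

universalTernary⇒candidate : ∀ D → 1 < D → Squarefree D → ∃[ L ] Field.UniversalTernaryLattice D L → D ∈ candidates
universalTernary⇒candidate D 1<D sf (L , quadratic , _ , univ) =
  [ (λ D<2 → ⊥-elim (ℕ.<⇒≱ 1<D (ℕ.s≤s⁻¹ (ℕ.<ᵇ⇒< D 2 D<2))))
  , [ (λ large → ⊥-elim (ℕ.<⇒≱ small (ℕ.≤ᵇ⇒≤ 1849 (disc D) large)))
    , [ (λ h → Any.map (ℕ.≡ᵇ⇒≡ D _) (any⁻ (D ℕ.≡ᵇ_) candidates h))
      , [ (λ h → ⊥-elim (square (any⁻ (λ p → isYes (p ℕ.* p ℕ.∣? D)) primes h)))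
        , (λ h → ⊥-elim (listed (any⁻ (λ (k , _) → k ℕ.≡ᵇ D) table h))) ]′ ∘ split ]′ ∘ split ]′ ∘ split ]′
  (split (lookup all-covered (∈-downFrom⁺ (ℕ.≤-<-trans (D≤disc D) small))))
  where
  split : ∀ {a b} → T (a ∨ b) → T a ⊎ T b
  split = Equivalence.to T-∨
  small : disc D < 1849
  small = disc<1849 D 1<D sf L quadratic univ
  square : Any (λ p → T (isYes (p ℕ.* p ℕ.∣? D))) primes → ⊥
  square h = sf (Any.lookup h) (proj₁ found) (toWitness (proj₂ found))
    where
    found = lookupAny primes-prime h
  listed : Any (λ (k , _) → T (k ℕ.≡ᵇ D)) table → ⊥
  listed h = refutes-sound D 1<D sf L quadratic univ (proj₁ found) (proj₂ found)
    where
    found : ∃[ c ] T (refutes false D c)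
    found = entryAt false D refuted h

noFreeUniversalTernary : ∀ D → 1 < D → Squarefree D → 5 ℕ.∣ D → Any (λ (k , _) → T (k ℕ.≡ᵇ D)) freeTable →
  ¬ (∃[ L ] (Field.UniversalTernaryLattice D L × Field.Free D L))
noFreeUniversalTernary D 1<D sf 5∣D h (L , (quadratic , _ , univ) , free) =
  refutes-free-sound D 1<D sf L quadratic univ 5∣D free (proj₁ found) (proj₂ found)
  where
  found : ∃[ c ] T (refutes true D c)
  found = entryAt true D refuted-freeTable h

theorem7p1 : (D : ℕ) → 1 < D → Squarefree D →
    ((∃[ L ] Field.UniversalTernaryLattice D L) →
    D ∈ (2 ∷ 3 ∷ 5 ∷ 6 ∷ 7 ∷ 10 ∷ 13 ∷ 17 ∷ 21 ∷ 33 ∷ 41 ∷ 65 ∷ 77 ∷ []))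
    × ((D ≡ 10 ⊎ D ≡ 65) →
    ¬ (∃[ L ] (Field.UniversalTernaryLattice D L × Field.Free D L)))
theorem7p1 D 1<D sf = universalTernary⇒candidate D 1<D sf ,
  [ (λ e → noFreeUniversalTernary D 1<D sf (subst (5 ℕ.∣_) (sym e) (ℕ.divides 2 refl)) (here (ℕ.≡⇒≡ᵇ 10 D (sym e))))
  , (λ e → noFreeUniversalTernary D 1<D sf (subst (5 ℕ.∣_) (sym e) (ℕ.divides 13 refl)) (there (here (ℕ.≡⇒≡ᵇ 65 D (sym e))))) ]′
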